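{- Let $d\ge 1$, let $\mathbf{w}=(w_1,\dots,w_d)$ be a weight in $\mathbb{R}^d$, and let $\boldsymbol\theta:\mathbb{R}^d\to\mathbb{R}^d$ be of the form $\boldsymbol\theta(\mathbf{x})=(\theta_1(x_1),\dots,\theta_d(x_d))$, where each $\theta_i:\mathbb{R}\to\mathbb{R}$ is a Lipschitz function. Then $\mathbf{Bad}_{\boldsymbol\theta}(\mathbf{w})\subset\mathbb{R}^d$ is hyperplane absolute winning; in particular, it is winning in the sense of Schmidt's game.
   Context: A weight in $\mathbb{R}^d$ is a vector $\mathbf{w}=(w_1,\dots,w_d)$ with $w_i\ge 0$ for all $i$ and $\sum_{i=1}^d w_i=1$. For $x\in\mathbb{R}$, $|x|_{\mathbb{Z}}$ is the distance from $x$ to the nearest integer. For $\boldsymbol\theta(\mathbf{x})=(\theta_i(x_i))_{i=1}^d$, $$\mathbf{Bad}_{\boldsymbol\theta}(\mathbf{w}):=\Big\{\mathbf{x}\in\mathbb{R}^d:\ \liminf_{q\in\mathbb{Z}\setminus\{0\},\,|q|\to\infty}\ \max_{1\le i\le d}|qx_i-\theta_i(x_i)|_{\mathbb{Z}}^{1/w_i}\,|q|>0\Big\},$$ with the convention $|x|_{\mathbb{Z}}^{1/w_i}:=0$ if $w_i=0$. Hyperplane absolute game on $\mathbb{R}^d$: Bob fixes $0<\beta<1/3$ and chooses a closed ball $B_0$ of radius $r_0>0$. At stage $n\ge 0$, given the ball $B_n$ of radius $r_n$, Alice chooses an affine hyperplane $H_n$ and $0<\varepsilon_n\le\beta r_n$,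 and then Bob chooses a closed ball $B_{n+1}\subset B_n$ of radius $r_{n+1}\ge\beta r_n$ disjoint from the $\varepsilon_n$-neighbourhood of $H_n$. A set $S\subset\mathbb{R}^d$ is hyperplane absolute winning if for every $0<\beta<1/3$ Alice has a strategy guaranteeing $\bigcap_n B_n\cap S\neq\emptyset$. Schmidt's $(\alpha,\beta)$-game ($0<\alpha,\beta<1$): Bob chooses a closed ball $B_0$, then the players alternate choosing closed balls $B_0\supset A_0\supset B_1\supset A_1\supset\cdots$ ($A_n$ chosen by Alice, $B_n$ by Bob) such that $A_n$ has radius $\alpha$ times that of $B_n$ and $B_{n+1}$ has radius $\beta$ times that of $A_n$. $S$ is winning if there is $\alpha\in(0,1)$ such that for every $\beta\in(0,1)$ Alice has a strategy guaranteeing that the point of $\bigcap_n B_n$ lies in $S$. -}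

module Defs where

open import Algebra.Bundles using (CommutativeRing)
open import Axiom.ExcludedMiddle using (ExcludedMiddle)
open import Data.Fin.Base using (Fin)
open import Data.Integer.Base using (ℤ; +_; -[1+_]; 0ℤ; ∣_∣)
open import Data.List.Base using (List; []; _∷_)
open import Data.Nat.Base as ℕ using (ℕ; zero; suc)
open import Data.Product.Base using (Σ; Σ-syntax; ∃; ∃-syntax; _×_; _,_; proj₁)
open import Data.Sum.Base using (_⊎_)
open import Data.Vec.Functional using (Vector; foldr)
open import Level using (0ℓ) renaming (suc to lsuc)
open import Relation.Binary.Bundles using (TotalOrder)
open import Relation.Binary.Core using (Rel)
open import Relation.Binary.PropositionalEquality.Core using (_≢_)
open import Relation.Binary.Structures using (IsTotalOrder)
open import Relation.Nullary using (¬_; yes; no)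
open import Relation.Unary using (Pred; _∈_; _∩_; _⊆_; _⊥_; Satisfiable; ⋂)
import Algebra.Construct.NaturalChoice.Max as Max
import Algebra.Properties.CommutativeMonoid.Sum as Sum
import Algebra.Properties.Monoid.Mult as Mult
import Algebra.Properties.Semiring.Exp as Exp
import Relation.Binary.Construct.NonStrictToStrict as Strict

-- The real numbers, characterised up to unique isomorphism as a
-- Dedekind-complete ordered field. Equality is the setoid equality _≈_.
-- The value of 0# ⁻¹ is unspecified.
record Reals : Set (lsuc 0ℓ) where
  infix  4 _≤_
  infix  8 _⁻¹

  field
    commutativeRing : CommutativeRing 0ℓ 0ℓ

  open CommutativeRing commutativeRing public

  field
    0≉1          : ¬ (0# ≈ 1#)
    _⁻¹          : Carrier → Carrier
    ⁻¹-inverseʳ  : ∀ x → ¬ (x ≈ 0#) → x * x ⁻¹ ≈ 1#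
    _≤_          : Rel Carrier 0ℓ
    isTotalOrder : IsTotalOrder _≈_ _≤_
    +-monoˡ-≤    : ∀ z {x y} → x ≤ y → x + z ≤ y + z
    *-nonNeg     : ∀ {x y} → 0# ≤ x → 0# ≤ y → 0# ≤ x * y

  UpperBound : Pred Carrier 0ℓ → Pred Carrier 0ℓ
  UpperBound P b = ∀ y → y ∈ P → y ≤ b

  field
    complete : (P : Pred Carrier 0ℓ) → Satisfiable P → Satisfiable (UpperBound P) →
               ∃[ s ] (s ∈ UpperBound P × (∀ b → b ∈ UpperBound P → s ≤ b))

  totalOrder : TotalOrder 0ℓ 0ℓ 0ℓ
  totalOrder = record { isTotalOrder = isTotalOrder }

  open Strict _≈_ _≤_ public using (_<_)
  open Max totalOrder public using (_⊔_)
  open Sum +-commutativeMonoid public using (sum)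
  open Exp semiring public using (_^_)
  open Mult +-monoid public using () renaming (_×_ to _×ℕ_)

  fromℕ : ℕ → Carrier
  fromℕ n = n ×ℕ 1#

  fromℤ : ℤ → Carrier
  fromℤ (+ n)    = fromℕ n
  fromℤ -[1+ n ] = - fromℕ (suc n)

  ∣_∣ᴿ : Carrier → Carrier
  ∣ x ∣ᴿ = x ⊔ (- x)

-- The mathematics is classical. Since Dec P contains a witness of P when there
-- is one, excluded middle also supplies the choices needed to turn "Alice always
-- has a good move" into a strategy.
module Classical (em : ExcludedMiddle 0ℓ) (ℝ : Reals) where

  open Reals ℝ public

  -- Equal to 0# for sets that are empty or not bounded above.
  sup : Pred Carrier 0ℓ → Carrier
  sup P with em {Satisfiable P × Satisfiable (UpperBound P)}
  ... | yes (nonempty , bounded) = proj₁ (complete P nonempty bounded)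
  ... | no  _                    = 0#

  inf : Pred Carrier 0ℓ → Carrier
  inf P = - sup (λ y → (- y) ∈ P)

  √ : Carrier → Carrier
  √ x = sup (λ y → y * y ≤ x)

  -- Real powers a ^ s for 0 ≤ a and 0 < s, as the supremum of the y ≥ 0 with
  -- y ≤ a ^ (m / n) for some rational exponent m / n on the side of s on which
  -- a ^ (m / n) ≤ a ^ s.
  infixr 8 _^ᴿ_
  _^ᴿ_ : Carrier → Carrier → Carrier
  a ^ᴿ s = sup λ y → 0# ≤ y × ∃[ m ] ∃[ n ]
    ( n ≢ 0
    × (a ≤ 1# × fromℕ n * s ≤ fromℕ m ⊎ 1# ≤ a × fromℕ m ≤ fromℕ n * s)
    × y ^ n ≤ a ^ m)

  -- Distance to the nearest integer.
  ∣_∣ℤ : Carrier → Carrier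
  ∣ x ∣ℤ = inf λ y → ∃[ n ] y ≈ ∣ x - fromℤ n ∣ᴿ

  -- c < liminf f(q) as q ranges over ℤ ∖ {0} and |q| → ∞, where the lower limit
  -- is sup_N inf_{|q| ≥ N} f(q) in the extended reals (it can be +∞).
  _<liminf_ : Carrier → (ℤ → Carrier) → Set
  c <liminf f = ∃[ c′ ] ∃[ N ]
    (c < c′ × (∀ q → q ≢ 0ℤ → N ℕ.≤ ∣ q ∣ → c′ ≤ f q))

  -- For a family of nonnegative reals, as in Bad below, this is the maximum.
  max : ∀ {d} → Vector Carrier d → Carrier
  max = foldr _⊔_ 0#

  Lipschitz : (Carrier → Carrier) → Set
  Lipschitz f = ∃[ L ] ∀ x y → ∣ f x - f y ∣ᴿ ≤ L * ∣ x - y ∣ᴿ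

  IsWeight : ∀ {d} → Vector Carrier d → Set
  IsWeight w = (∀ i → 0# ≤ w i) × sum w ≈ 1#

  -- ∣ x ∣ℤ to the power 1 / w, with value 0# when w is zero.
  ∣_∣ℤ^1/_ : Carrier → Carrier → Carrier
  ∣ x ∣ℤ^1/ w with em {w ≈ 0#}
  ... | yes _ = 0#
  ... | no  _ = ∣ x ∣ℤ ^ᴿ (w ⁻¹)

  Bad : ∀ {d} → (Fin d → Carrier → Carrier) → Vector Carrier d →
        Pred (Vector Carrier d) 0ℓ
  Bad θ w x =
    0# <liminf λ q →
      max (λ i → ∣ fromℤ q * x i - θ i (x i) ∣ℤ^1/ w i) * fromℤ (+ ∣ q ∣)

module Games (em : ExcludedMiddle 0ℓ) (ℝ : Reals) (d : ℕ) where

  open Classical em ℝ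

  Point : Set
  Point = Vector Carrier d

  dist : Point → Point → Carrier
  dist x y = √ (sum λ i → (x i - y i) * (x i - y i))

  record Ball : Set where
    field
      centre   : Point
      radius   : Carrier
      0<radius : 0# < radius

  open Ball public

  ⟦_⟧ : Ball → Pred Point 0ℓ
  ⟦ B ⟧ x = dist (centre B) x ≤ radius B

  record Hyperplane : Set where
    field
      normal   : Point
      offset   : Carrier
      normal≉0 : ∃[ i ] ¬ (normal i ≈ 0#)

  open Hyperplane public

  onHyperplane : Hyperplane → Pred Point 0ℓ
  onHyperplane H x = sum (λ i → normal H i * x i) ≈ offset H

  Neighbourhood : Carrier → Pred Point 0ℓ → Pred Point 0ℓ
  Neighbourhood ε P x = ∃[ y ] (y ∈ P × dist x y < ε)

  -- The balls B (n - 1), …, B 0, most recent first.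
  past : (ℕ → Ball) → ℕ → List Ball
  past B zero    = []
  past B (suc n) = B n ∷ past B n

  -- In both games Alice's strategy sees all of Bob's balls so far, the current
  -- one last, and returns a move that is legal by its type.
  Strategy : (Ball → Set) → Set
  Strategy Move = List Ball → (B : Ball) → Move B

  response : ∀ {Move} → Strategy Move → (B : ℕ → Ball) → ∀ n → Move (B n)
  response σ B n = σ (past B n) (B n)

  record HyperplaneMove (β : Carrier) (B : Ball) : Set where
    field
      hyperplane : Hyperplane
      ε          : Carrier
      0<ε        : 0# < ε
      ε≤βr       : ε ≤ β * radius B

  HyperplanePlay : ∀ {β} → Strategy (HyperplaneMove β) → Pred (ℕ → Ball) 0ℓ
  HyperplanePlay {β} σ B = ∀ n →
    let open HyperplaneMove (response σ B n) in
      ⟦ B (suc n) ⟧ ⊆ ⟦ B n ⟧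
    × β * radius (B n) ≤ radius (B (suc n))
    × ⟦ B (suc n) ⟧ ⊥ Neighbourhood ε (onHyperplane hyperplane)

  HyperplaneAbsoluteWinning : Pred Point 0ℓ → Set
  HyperplaneAbsoluteWinning S =
    ∀ β → 0# < β → β < fromℕ 3 ⁻¹ →
    Σ[ σ ∈ Strategy (HyperplaneMove β) ]
      ∀ B → HyperplanePlay σ B → Satisfiable (⋂ ℕ (λ n → ⟦ B n ⟧) ∩ S)

  record SchmidtMove (α : Carrier) (B : Ball) : Set where
    field
      ball     : Ball
      radius≈  : radius ball ≈ α * radius B
      ball⊆B   : ⟦ ball ⟧ ⊆ ⟦ B ⟧

  SchmidtPlay : ∀ {α} → Carrier → Strategy (SchmidtMove α) → Pred (ℕ → Ball) 0ℓ
  SchmidtPlay β σ B = ∀ n →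
    let open SchmidtMove (response σ B n) renaming (ball to A) in
      radius (B (suc n)) ≈ β * radius A
    × ⟦ B (suc n) ⟧ ⊆ ⟦ A ⟧

  -- The radii tend to 0, so ⋂ₙ Bₙ has at most one point.
  SchmidtWinning : Pred Point 0ℓ → Set
  SchmidtWinning S =
    ∃[ α ] (0# < α × α < 1# ×
      (∀ β → 0# < β → β < 1# →
       Σ[ σ ∈ Strategy (SchmidtMove α) ]
         ∀ B → SchmidtPlay β σ B → Satisfiable (⋂ ℕ (λ n → ⟦ B n ⟧) ∩ S)))

{-# OPTIONS --safe #-}

-- The e-th epoch of a play is its first ball of radius at most b^(-e). At each epoch Alice is given
-- affine functions ("tasks") T with deadlines, and she wants |T| to be at least of the order of the
-- radius on the epoch ball at the deadline. She can serve all tasks of small total weight, where a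
-- task has weight u^(remaining time) with u slightly less than 1: if d + 1 centres in general
-- position were all bad, some task of gradient 1 would be small at all of them.
--
-- With λ_i = b^(w_i), the main estimate A(t, s) says that from the epoch t + V + s on no nonzero
-- integer affine function has linear coefficients |a_i| < min (b^s, λ_i^t) and absolute value below
-- b^(-t-V). It is proved by induction on t, then on s. The violating functions at d + 2 earlier epochs
-- are spanned by systems in echelon form; if Alice avoids the zero set of one suitable basis function
-- at each of these epochs, the dimension drops every time, because otherwise the pigeonhole principle
-- gives an integer combination of violating functions that contradicts the estimate for a smaller t.
--
-- A pigeonhole argument modulo Q transfers A(t, s) to simultaneous approximation: points Q y are far
-- from ℤ^d in the weighted sense. Hence for b^(t-2) < |q| ≤ b^(t-1) at most one q and p can be close
-- solutions of the inhomogeneous problem near an epoch ball, and one more task removes them.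
module Submission where

open import Defs
open import Axiom.ExcludedMiddle using (ExcludedMiddle)
open import Data.Bool.Base using (Bool; true; false)
open import Data.Empty using (⊥; ⊥-elim)
open import Data.Fin.Base as Fin using (Fin; zero; suc; punchIn; toℕ; fromℕ<; finToFun; funToFin)
open import Data.Integer.Base as ℤ using (ℤ; +_; -[1+_]; 0ℤ)
open import Data.Integer.DivMod using () renaming (_/_ to _/ℤ_; _%_ to _%ℤ_; a≡a%n+[a/n]*n to division; n%d<d to remainder<)
open import Data.List.Base using (List; []; _∷_; _++_; length)
open import Data.List.Membership.Propositional using () renaming (_∈_ to _∈ˡ_)
open import Data.List.Membership.Propositional.Properties using (∈-++⁺ˡ; ∈-++⁺ʳ; ∈-++⁻)
open import Data.List.Relation.Unary.Any using (here; there)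
open import Data.Maybe.Base using (Maybe; just; nothing)
open import Data.Nat.Base as ℕ using (ℕ; zero; suc; z≤n; s≤s)
open import Data.Nat.DivMod using (_/_; m/n*n≤m; m≥n⇒m/n>0; _%_; m≡m%n+[m/n]*n; m%n<n; m*n/n≡m; /-monoˡ-≤)
open import Data.Nat.Solver using (module +-*-Solver)
open import Data.Product.Base using (Σ-syntax; ∃; ∃-syntax; _×_; _,_; proj₁; proj₂)
open import Data.Sum.Base using (_⊎_; inj₁; inj₂; [_,_]′)
open import Data.Vec.Functional as Vector using (Vector)
open import Function.Base using (_∘_; id)
open import Function.Definitions using (Injective)
open import Level using (0ℓ)
open import Relation.Binary.Bundles using (TotalOrder)
open import Relation.Binary.Definitions using (Tri; tri<; tri≈; tri>)
open import Relation.Binary.PropositionalEquality.Core as ≡ using (_≡_; _≢_)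
open import Relation.Binary.Structures using (IsTotalOrder)
open import Relation.Nullary using (¬_; yes; no; Dec)
open import Relation.Unary using (Pred; _∈_; Satisfiable; _⊆_; _∩_; ⋂) renaming (_⊥_ to _∥_)
import Algebra.Construct.NaturalChoice.Max as Max
import Algebra.Construct.NaturalChoice.MaxOp as MaxOp
import Algebra.Construct.NaturalChoice.Min as Min
import Algebra.Construct.NaturalChoice.MinOp as MinOp
import Algebra.Properties.CommutativeMonoid.Sum as CMSum
import Algebra.Properties.CommutativeSemiring.Exp as CSExp
import Algebra.Properties.Monoid.Mult as Mult
import Algebra.Properties.Ring as RingProperties
import Algebra.Properties.Semiring.Exp as SExp
import Algebra.Properties.Semiring.Mult as SMult
import Algebra.Properties.Semiring.Sum as SSum
import Algebra.Solver.Ring as RingSolver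
import Algebra.Solver.Ring.AlmostCommutativeRing as ACR
import Data.Fin.Properties as Fin
import Data.Integer.Properties as ℤ
import Data.Nat.Properties as ℕ
import Relation.Binary.Reasoning.PartialOrder as POR
import Relation.Binary.Reasoning.Setoid as SetoidReasoning

module N = +-*-Solver

-- Serving one task for every integer function would require a bound on their number. Instead a task
-- is given to a single basis function of a system, one for each pair (t, s) and level i of the
-- descent. Its deadline n is a fixed fraction of v = M t - s + V, the exponent by which the box of
-- coefficients and values falls short of volume 1. At a given epoch, the numbers n, i and the
-- residue of v modulo `period` determine (t, s). So at most period (d + 1) of these tasks share a
-- deadline, whatever the epoch, and no deadline is shorter than V₁: their weight is the tail of a
-- geometric series. The gaps between the epochs of the descent grow by the factor G², because
-- omitting a pivot must gain more than b^k, which is lost between the solution and the centre of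
-- the earlier ball. Order of choice: b from β, d, the weights and the Lipschitz constants; then g
-- and `period` from b; then V₁, which also depends on e₀ and thus on Bob's first ball.

module Proof (em : ExcludedMiddle 0ℓ) (ℝ : Reals) where

  -- Ordered field arithmetic: absolute values, powers, embedded integers.

  module OrderedField where

    open Classical em ℝ hiding (zero) public

    open RingProperties ring public using (-‿distribˡ-*; -‿distribʳ-*; -0#≈0#; -‿involutive; -‿+-comm)
    open CSExp commutativeSemiring public using (^-distrib-*)
    open SExp semiring public using (^-homo-*; ^-assocʳ; ^-congˡ)
    open Mult +-monoid using (×-homo-+)
    open SMult semiring using (×1-homo-*)
    open IsTotalOrder isTotalOrder public using ()
      renaming (refl to ≤-refl; reflexive to ≈⇒≤; trans to ≤-trans; antisym to ≤-antisym; total to ≤-total;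
                ≤-respˡ-≈ to ≤-respˡ; ≤-respʳ-≈ to ≤-respʳ)

    module ≤R = POR (TotalOrder.poset totalOrder)
    module ≈R = SetoidReasoning setoid

    fromℕ-+ : ∀ m n → fromℕ (m ℕ.+ n) ≈ fromℕ m + fromℕ n
    fromℕ-+ = ×-homo-+ 1#

    fromℕ-* : ∀ m n → fromℕ (m ℕ.* n) ≈ fromℕ m * fromℕ n
    fromℕ-* = ×1-homo-*

    fromℤ-⊖ : ∀ m n → fromℤ (m ℤ.⊖ n) ≈ fromℕ m - fromℕ n
    fromℤ-⊖ m zero = sym (trans (+-congˡ -0#≈0#) (+-identityʳ _))
    fromℤ-⊖ zero (suc n) = sym (+-identityˡ _)
    fromℤ-⊖ (suc m) (suc n) = begin
      fromℤ (suc m ℤ.⊖ suc n)              ≡⟨ ≡.cong fromℤ (ℤ.[1+m]⊖[1+n]≡m⊖n m n) ⟩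
      fromℤ (m ℤ.⊖ n)                      ≈⟨ fromℤ-⊖ m n ⟩
      fromℕ m - fromℕ n                    ≈⟨ +-identityˡ _ ⟨
      0# + (fromℕ m - fromℕ n)             ≈⟨ +-congʳ (-‿inverseʳ 1#) ⟨
      (1# - 1#) + (fromℕ m - fromℕ n)      ≈⟨ +-assoc _ _ _ ⟩
      1# + (- 1# + (fromℕ m - fromℕ n))    ≈⟨ +-congˡ (+-assoc _ _ _) ⟨
      1# + ((- 1# + fromℕ m) - fromℕ n)    ≈⟨ +-congˡ (+-congʳ (+-comm _ _)) ⟩
      1# + ((fromℕ m - 1#) - fromℕ n)      ≈⟨ +-congˡ (+-assoc _ _ _) ⟩
      1# + (fromℕ m + (- 1# - fromℕ n))    ≈⟨ +-assoc _ _ _ ⟨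
      (1# + fromℕ m) + (- 1# - fromℕ n)    ≈⟨ +-congˡ (-‿+-comm _ _) ⟩
      (1# + fromℕ m) - (1# + fromℕ n)      ∎
      where open ≈R

    fromℤ-neg : ∀ i → fromℤ (ℤ.- i) ≈ - fromℤ i
    fromℤ-neg (+ zero)   = sym -0#≈0#
    fromℤ-neg (+ suc n)  = refl
    fromℤ-neg -[1+ n ]   = sym (-‿involutive _)

    fromℤ-+ : ∀ i j → fromℤ (i ℤ.+ j) ≈ fromℤ i + fromℤ j
    fromℤ-+ (+ m) (+ n) = fromℕ-+ m n
    fromℤ-+ (+ m) -[1+ n ] = fromℤ-⊖ m (suc n)
    fromℤ-+ -[1+ m ] (+ n) = trans (fromℤ-⊖ n (suc m)) (+-comm _ _)
    fromℤ-+ -[1+ m ] -[1+ n ] = begin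
      - (1# + (1# + fromℕ (m ℕ.+ n)))          ≈⟨ -‿cong (+-congˡ (+-congˡ (fromℕ-+ m n))) ⟩
      - (1# + (1# + (fromℕ m + fromℕ n)))      ≈⟨ -‿cong (+-congˡ (+-assoc _ _ _)) ⟨
      - (1# + ((1# + fromℕ m) + fromℕ n))      ≈⟨ -‿cong (+-congˡ (+-comm _ _)) ⟩
      - (1# + (fromℕ n + (1# + fromℕ m)))      ≈⟨ -‿cong (+-assoc _ _ _) ⟨
      - ((1# + fromℕ n) + (1# + fromℕ m))      ≈⟨ -‿cong (+-comm _ _) ⟩
      - ((1# + fromℕ m) + (1# + fromℕ n))      ≈⟨ -‿+-comm _ _ ⟨
      - (1# + fromℕ m) - (1# + fromℕ n)        ∎
      where open ≈R

    fromℤ-* : ∀ i j → fromℤ (i ℤ.* j) ≈ fromℤ i * fromℤ j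
    fromℤ-* (+ m) (+ n) = trans (reflexive (≡.cong fromℤ (≡.sym (ℤ.pos-* m n)))) (fromℕ-* m n)
    fromℤ-* (+ m) -[1+ n ] = begin
      fromℤ (+ m ℤ.* -[1+ n ])         ≡⟨ ≡.cong fromℤ (ℤ.neg-distribʳ-* (+ m) (+ suc n)) ⟨
      fromℤ (ℤ.- (+ m ℤ.* + suc n))    ≈⟨ fromℤ-neg (+ m ℤ.* + suc n) ⟩
      - fromℤ (+ m ℤ.* + suc n)        ≈⟨ -‿cong (fromℤ-* (+ m) (+ suc n)) ⟩
      - (fromℕ m * fromℕ (suc n))      ≈⟨ -‿distribʳ-* _ _ ⟩
      fromℕ m * - fromℕ (suc n)        ∎
      where open ≈R
    fromℤ-* -[1+ m ] (+ n) = begin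
      fromℤ (-[1+ m ] ℤ.* + n)         ≡⟨ ≡.cong fromℤ (ℤ.neg-distribˡ-* (+ suc m) (+ n)) ⟨
      fromℤ (ℤ.- (+ suc m ℤ.* + n))    ≈⟨ fromℤ-neg (+ suc m ℤ.* + n) ⟩
      - fromℤ (+ suc m ℤ.* + n)        ≈⟨ -‿cong (fromℤ-* (+ suc m) (+ n)) ⟩
      - (fromℕ (suc m) * fromℕ n)      ≈⟨ -‿distribˡ-* _ _ ⟩
      - fromℕ (suc m) * fromℕ n        ∎
      where open ≈R
    fromℤ-* -[1+ m ] -[1+ n ] = begin
      fromℕ (suc m ℕ.* suc n)                    ≈⟨ fromℕ-* (suc m) (suc n) ⟩
      fromℕ (suc m) * fromℕ (suc n)              ≈⟨ -‿involutive _ ⟨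
      - - (fromℕ (suc m) * fromℕ (suc n))        ≈⟨ -‿cong (-‿distribʳ-* _ _) ⟩
      - (fromℕ (suc m) * - fromℕ (suc n))        ≈⟨ -‿distribˡ-* _ _ ⟩
      - fromℕ (suc m) * - fromℕ (suc n)          ∎
      where open ≈R

    private
      acr : ACR.AlmostCommutativeRing 0ℓ 0ℓ
      acr = ACR.fromCommutativeRing commutativeRing

      -- The solver then reads the constants 0 and 1 as 0# and 1# on the nose.
      ⟦_⟧ᶜ : ℤ → Carrier
      ⟦ + 1 ⟧ᶜ = 1#
      ⟦ i ⟧ᶜ   = fromℤ i

      ⟦⟧ᶜ≈ : ∀ i → ⟦ i ⟧ᶜ ≈ fromℤ i
      ⟦⟧ᶜ≈ (+ 0) = refl
      ⟦⟧ᶜ≈ (+ 1) = sym (+-identityʳ 1#)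
      ⟦⟧ᶜ≈ (+ suc (suc n)) = refl
      ⟦⟧ᶜ≈ -[1+ n ] = refl

      ℤ⟶ℝ : ℤ.+-*-rawRing ACR.-Raw-AlmostCommutative⟶ acr
      ℤ⟶ℝ = record
        { ⟦_⟧    = ⟦_⟧ᶜ
        ; +-homo = λ i j → trans (⟦⟧ᶜ≈ (i ℤ.+ j)) (trans (fromℤ-+ i j) (sym (+-cong (⟦⟧ᶜ≈ i) (⟦⟧ᶜ≈ j))))
        ; *-homo = λ i j → trans (⟦⟧ᶜ≈ (i ℤ.* j)) (trans (fromℤ-* i j) (sym (*-cong (⟦⟧ᶜ≈ i) (⟦⟧ᶜ≈ j))))
        ; -‿homo = λ i → trans (⟦⟧ᶜ≈ (ℤ.- i)) (trans (fromℤ-neg i) (sym (-‿cong (⟦⟧ᶜ≈ i))))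
        ; 0-homo = refl ; 1-homo = refl }

      coeff≟ : ∀ i j → Maybe (⟦ i ⟧ᶜ ≈ ⟦ j ⟧ᶜ)
      coeff≟ i j with i ℤ.≟ j
      ... | yes ≡.refl = just refl
      ... | no _       = nothing

    module Solve = RingSolver ℤ.+-*-rawRing acr ℤ⟶ℝ coeff≟
    open Solve public using (solve; con; _:+_; _:*_; _:-_; :-_; _:=_; _:^_)

    infix 4 _≤?_
    _≤?_ : ∀ x y → Dec (x ≤ y)
    x ≤? y = em

    classically : ∀ (Q : Set) {X : Set} → (Q → X) → (¬ Q → X) → X
    classically Q {X} f g = go em
      where
      go : Dec Q → X
      go (yes q) = f q
      go (no ¬q) = g ¬q

    <⇒≤ : ∀ {x y} → x < y → x ≤ y
    <⇒≤ = proj₁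

    <⇒≱ : ∀ {x y} → x < y → ¬ (y ≤ x)
    <⇒≱ (x≤y , x≉y) y≤x = x≉y (≤-antisym x≤y y≤x)

    ≰⇒> : ∀ {x y} → ¬ (y ≤ x) → x < y
    ≰⇒> {x} {y} y≰x with ≤-total x y
    ... | inj₁ x≤y = x≤y , λ x≈y → y≰x (≈⇒≤ (sym x≈y))
    ... | inj₂ y≤x = ⊥-elim (y≰x y≤x)

    ≮⇒≥ : ∀ {x y} → ¬ (x < y) → y ≤ x
    ≮⇒≥ {x} {y} x≮y with y ≤? x
    ... | yes p = p
    ... | no ¬p = ⊥-elim (x≮y (≰⇒> ¬p))

    <-or-≥ : ∀ x y → x < y ⊎ y ≤ x
    <-or-≥ x y with y ≤? x
    ... | yes p = inj₂ p
    ... | no ¬p = inj₁ (≰⇒> ¬p)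

    ≤-<-trans : ∀ {x y z} → x ≤ y → y < z → x < z
    ≤-<-trans x≤y y<z = ≰⇒> λ z≤x → <⇒≱ y<z (≤-trans z≤x x≤y)

    <-≤-trans : ∀ {x y z} → x < y → y ≤ z → x < z
    <-≤-trans x<y y≤z = ≰⇒> λ z≤x → <⇒≱ x<y (≤-trans y≤z z≤x)

    <-resp : ∀ {x x′ y y′} → x ≈ x′ → y ≈ y′ → x < y → x′ < y′
    <-resp p q x<y = ≤-<-trans (≈⇒≤ (sym p)) (<-≤-trans x<y (≈⇒≤ q))

    ≤-resp : ∀ {x x′ y y′} → x ≈ x′ → y ≈ y′ → x ≤ y → x′ ≤ y′
    ≤-resp p q x≤y = ≤-trans (≈⇒≤ (sym p)) (≤-trans x≤y (≈⇒≤ q))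

    +-mono-≤ : ∀ {x y u v} → x ≤ y → u ≤ v → x + u ≤ y + v
    +-mono-≤ {x} {y} {u} {v} p q =
      ≤-trans (+-monoˡ-≤ u p) (≤-resp (+-comm u y) (+-comm v y) (+-monoˡ-≤ y q))

    -- Linear arithmetic: a goal x ≤ y follows from s ≤ t once t - s and y - x agree.
    lin : ∀ {x y s t} → s ≤ t → y + s ≈ x + t → x ≤ y
    lin {x} {y} {s} {t} s≤t e = ≤-resp p q (+-monoˡ-≤ (- t + - s + x + t) s≤t)
      where
      p : s + (- t + - s + x + t) ≈ x
      p = solve 3 (λ s t x → s :+ (:- t :+ :- s :+ x :+ t) := x) refl s t x
      q : t + (- t + - s + x + t) ≈ y
      q = begin
        t + (- t + - s + x + t) ≈⟨ solve 3 (λ s t x → t :+ (:- t :+ :- s :+ x :+ t) := (x :+ t) :- s) refl s t x ⟩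
        (x + t) - s             ≈⟨ +-congʳ (sym e) ⟩
        (y + s) - s             ≈⟨ solve 2 (λ s y → (y :+ s) :- s := y) refl s y ⟩
        y                       ∎
        where open ≈R

    x≤y⇒0≤y-x : ∀ {x y} → x ≤ y → 0# ≤ y - x
    x≤y⇒0≤y-x {x} {y} p = lin p (solve 2 (λ x y → (y :- x) :+ x := con 0ℤ :+ y) refl x y)

    neg-mono-≤ : ∀ {x y} → x ≤ y → - y ≤ - x
    neg-mono-≤ {x} {y} p = lin p (solve 2 (λ x y → :- x :+ x := :- y :+ y) refl x y)

    *-monoˡ-≤ : ∀ {z x y} → 0# ≤ z → x ≤ y → z * x ≤ z * y
    *-monoˡ-≤ {z} {x} {y} 0≤z x≤y = lin (*-nonNeg 0≤z (x≤y⇒0≤y-x x≤y))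
      (solve 3 (λ z x y → z :* y :+ con 0ℤ := z :* x :+ z :* (y :- x)) refl z x y)

    *-monoʳ-≤ : ∀ {z x y} → 0# ≤ z → x ≤ y → x * z ≤ y * z
    *-monoʳ-≤ 0≤z x≤y = ≤-resp (*-comm _ _) (*-comm _ _) (*-monoˡ-≤ 0≤z x≤y)

    *-mono-≤ : ∀ {x y u v} → 0# ≤ u → 0# ≤ y → x ≤ y → u ≤ v → x * u ≤ y * v
    *-mono-≤ 0≤u 0≤y x≤y u≤v = ≤-trans (*-monoʳ-≤ 0≤u x≤y) (*-monoˡ-≤ 0≤y u≤v)

    sq-nonNeg : ∀ x → 0# ≤ x * x
    sq-nonNeg x with ≤-total 0# x
    ... | inj₁ p = *-nonNeg p p
    ... | inj₂ p = ≤-respʳ (solve 1 (λ x → :- x :* :- x := x :* x) refl x) (*-nonNeg q q)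
      where q = ≤-respˡ -0#≈0# (neg-mono-≤ p)

    0≤1 : 0# ≤ 1#
    0≤1 = ≤-respʳ (*-identityʳ 1#) (sq-nonNeg 1#)

    0<1 : 0# < 1#
    0<1 = 0≤1 , 0≉1

    0<⇒≉ : ∀ {x} → 0# < x → ¬ (x ≈ 0#)
    0<⇒≉ (_ , p) e = p (sym e)

    +-nonNeg : ∀ {x y} → 0# ≤ x → 0# ≤ y → 0# ≤ x + y
    +-nonNeg p q = ≤-respˡ (+-identityʳ 0#) (+-mono-≤ p q)

    +-pos-nonNeg : ∀ {x y} → 0# < x → 0# ≤ y → 0# < x + y
    +-pos-nonNeg {x} {y} p q = <-≤-trans p (lin q (solve 2 (λ x y → (x :+ y) :+ con 0ℤ := x :+ y) refl x y))

    ⁻¹-inverseˡ : ∀ {x} → ¬ (x ≈ 0#) → x ⁻¹ * x ≈ 1#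
    ⁻¹-inverseˡ p = trans (*-comm _ _) (⁻¹-inverseʳ _ p)

    *-cancelˡ-≈0 : ∀ {x y} → ¬ (x ≈ 0#) → x * y ≈ 0# → y ≈ 0#
    *-cancelˡ-≈0 {x} {y} p e = begin
      y              ≈⟨ *-identityˡ y ⟨
      1# * y         ≈⟨ *-congʳ (⁻¹-inverseˡ p) ⟨
      x ⁻¹ * x * y   ≈⟨ *-assoc _ _ _ ⟩
      x ⁻¹ * (x * y) ≈⟨ *-congˡ e ⟩
      x ⁻¹ * 0#      ≈⟨ zeroʳ _ ⟩
      0#             ∎
      where open ≈R

    *-pos : ∀ {x y} → 0# < x → 0# < y → 0# < x * y
    *-pos p q = *-nonNeg (<⇒≤ p) (<⇒≤ q) , λ e → 0<⇒≉ q (*-cancelˡ-≈0 (0<⇒≉ p) (sym e))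

    *-cancelˡ-≤ : ∀ {z x y} → 0# < z → z * x ≤ z * y → x ≤ y
    *-cancelˡ-≤ {z} {x} {y} 0<z p = ≮⇒≥ λ y<x → <⇒≱ (0<d y<x) (lin p
      (solve 3 (λ z x y → con 0ℤ :+ z :* x := z :* (x :- y) :+ z :* y) refl z x y))
      where
      0<d : y < x → 0# < z * (x - y)
      0<d (y≤x , y≉x) = *-pos 0<z (x≤y⇒0≤y-x y≤x , λ e → y≉x (begin
        y           ≈⟨ +-identityʳ y ⟨
        y + 0#      ≈⟨ +-congˡ e ⟩
        y + (x - y) ≈⟨ solve 2 (λ x y → y :+ (x :- y) := x) refl x y ⟩
        x           ∎))
        where open ≈R

    *-cancelʳ-≤ : ∀ {z x y} → 0# < z → x * z ≤ y * z → x ≤ y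
    *-cancelʳ-≤ 0<z p = *-cancelˡ-≤ 0<z (≤-resp (*-comm _ _) (*-comm _ _) p)

    *-monoˡ-< : ∀ {z x y} → 0# < z → x < y → z * x < z * y
    *-monoˡ-< 0<z x<y = ≰⇒> λ q → <⇒≱ x<y (*-cancelˡ-≤ 0<z q)

    *-monoʳ-< : ∀ {z x y} → 0# < z → x < y → x * z < y * z
    *-monoʳ-< 0<z x<y = <-resp (*-comm _ _) (*-comm _ _) (*-monoˡ-< 0<z x<y)

    ⁻¹-pos : ∀ {x} → 0# < x → 0# < x ⁻¹
    ⁻¹-pos {x} 0<x = ≰⇒> λ p → <⇒≱ 0<1 (≤-resp (⁻¹-inverseʳ x (0<⇒≉ 0<x)) (zeroʳ x) (*-monoˡ-≤ (<⇒≤ 0<x) p))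

    0≤-fromℕ : ∀ n → 0# ≤ fromℕ n
    0≤-fromℕ zero    = ≤-refl
    0≤-fromℕ (suc n) = +-nonNeg 0≤1 (0≤-fromℕ n)

    0<-fromℕ : ∀ n → 0# < fromℕ (suc n)
    0<-fromℕ n = +-pos-nonNeg 0<1 (0≤-fromℕ n)

    fromℕ-mono-≤ : ∀ {m n} → m ℕ.≤ n → fromℕ m ≤ fromℕ n
    fromℕ-mono-≤ {_} {n} z≤n = 0≤-fromℕ n
    fromℕ-mono-≤ (s≤s p) = +-mono-≤ ≤-refl (fromℕ-mono-≤ p)

    fromℕ-1 : fromℕ 1 ≈ 1#
    fromℕ-1 = +-identityʳ 1#

    1≤-fromℕ : ∀ n → 1# ≤ fromℕ (suc n)
    1≤-fromℕ n = lin (0≤-fromℕ n) (solve 1 (λ x → (con (+ 1) :+ x) :+ con 0ℤ := con (+ 1) :+ x) refl (fromℕ n))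

    open MaxOp (Max.maxOperator totalOrder) public using (x≤x⊔y; x≤y⊔x; ⊔-cong; ⊔-lub)

    x≤∣x∣ : ∀ x → x ≤ ∣ x ∣ᴿ
    x≤∣x∣ x = x≤x⊔y x (- x)

    -x≤∣x∣ : ∀ x → - x ≤ ∣ x ∣ᴿ
    -x≤∣x∣ x = x≤y⊔x x (- x)

    abs-lub : ∀ {x a} → x ≤ a → - x ≤ a → ∣ x ∣ᴿ ≤ a
    abs-lub = ⊔-lub

    abs-cong : ∀ {x y} → x ≈ y → ∣ x ∣ᴿ ≈ ∣ y ∣ᴿ
    abs-cong e = ⊔-cong e (-‿cong e)

    abs-neg : ∀ x → ∣ - x ∣ᴿ ≈ ∣ x ∣ᴿ
    abs-neg x = ≤-antisym
      (abs-lub (-x≤∣x∣ x) (≤-respˡ (sym (-‿involutive x)) (x≤∣x∣ x)))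
      (abs-lub (≤-respˡ (-‿involutive x) (-x≤∣x∣ (- x))) (x≤∣x∣ (- x)))

    abs-nonNeg : ∀ x → 0# ≤ ∣ x ∣ᴿ
    abs-nonNeg x with ≤-total 0# x
    ... | inj₁ p = ≤-trans p (x≤∣x∣ x)
    ... | inj₂ p = ≤-trans (≤-respˡ -0#≈0# (neg-mono-≤ p)) (-x≤∣x∣ x)

    abs-of-nonNeg : ∀ {x} → 0# ≤ x → ∣ x ∣ᴿ ≈ x
    abs-of-nonNeg {x} p = ≤-antisym (abs-lub ≤-refl (≤-trans (≤-respʳ -0#≈0# (neg-mono-≤ p)) p)) (x≤∣x∣ x)

    abs-0 : ∀ {x} → x ≈ 0# → ∣ x ∣ᴿ ≈ 0#
    abs-0 {x} e = trans (abs-cong e) (abs-of-nonNeg ≤-refl)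

    abs-sign : ∀ x → ∣ x ∣ᴿ ≈ x ⊎ ∣ x ∣ᴿ ≈ - x
    abs-sign x with ≤-total 0# x
    ... | inj₁ p = inj₁ (abs-of-nonNeg p)
    ... | inj₂ p = inj₂ (trans (sym (abs-neg x)) (abs-of-nonNeg (≤-respˡ -0#≈0# (neg-mono-≤ p))))

    abs-+ : ∀ x y → ∣ x + y ∣ᴿ ≤ ∣ x ∣ᴿ + ∣ y ∣ᴿ
    abs-+ x y = abs-lub (+-mono-≤ (x≤∣x∣ x) (x≤∣x∣ y))
      (≤-respˡ (-‿+-comm x y) (+-mono-≤ (-x≤∣x∣ x) (-x≤∣x∣ y)))

    abs-* : ∀ x y → ∣ x * y ∣ᴿ ≈ ∣ x ∣ᴿ * ∣ y ∣ᴿ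
    abs-* x y with ≤-total 0# x | ≤-total 0# y
    ... | inj₁ p | inj₁ q = trans (abs-of-nonNeg (*-nonNeg p q)) (sym (*-cong (abs-of-nonNeg p) (abs-of-nonNeg q)))
    ... | inj₁ p | inj₂ q = begin
      ∣ x * y ∣ᴿ          ≈⟨ abs-neg _ ⟨
      ∣ - (x * y) ∣ᴿ      ≈⟨ abs-cong (-‿distribʳ-* x y) ⟩
      ∣ x * - y ∣ᴿ        ≈⟨ abs-of-nonNeg (*-nonNeg p q′) ⟩
      x * - y             ≈⟨ *-cong (abs-of-nonNeg p) (trans (sym (abs-neg y)) (abs-of-nonNeg q′)) ⟨
      ∣ x ∣ᴿ * ∣ y ∣ᴿ     ∎
      where
      open ≈R
      q′ = ≤-respˡ -0#≈0# (neg-mono-≤ q)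
    ... | inj₂ p | inj₁ q = begin
      ∣ x * y ∣ᴿ          ≈⟨ abs-neg _ ⟨
      ∣ - (x * y) ∣ᴿ      ≈⟨ abs-cong (-‿distribˡ-* x y) ⟩
      ∣ - x * y ∣ᴿ        ≈⟨ abs-of-nonNeg (*-nonNeg p′ q) ⟩
      - x * y             ≈⟨ *-cong (trans (sym (abs-neg x)) (abs-of-nonNeg p′)) (abs-of-nonNeg q) ⟨
      ∣ x ∣ᴿ * ∣ y ∣ᴿ     ∎
      where
      open ≈R
      p′ = ≤-respˡ -0#≈0# (neg-mono-≤ p)
    ... | inj₂ p | inj₂ q = begin
      ∣ x * y ∣ᴿ          ≈⟨ abs-cong (solve 2 (λ x y → x :* y := :- x :* :- y) refl x y) ⟩
      ∣ - x * - y ∣ᴿ      ≈⟨ abs-of-nonNeg (*-nonNeg p′ q′) ⟩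
      - x * - y           ≈⟨ *-cong (trans (sym (abs-neg x)) (abs-of-nonNeg p′)) (trans (sym (abs-neg y)) (abs-of-nonNeg q′)) ⟨
      ∣ x ∣ᴿ * ∣ y ∣ᴿ     ∎
      where
      open ≈R
      p′ = ≤-respˡ -0#≈0# (neg-mono-≤ p)
      q′ = ≤-respˡ -0#≈0# (neg-mono-≤ q)

    abs-sub : ∀ x y → ∣ x - y ∣ᴿ ≈ ∣ y - x ∣ᴿ
    abs-sub x y = trans (abs-cong (solve 2 (λ x y → x :- y := :- (y :- x)) refl x y)) (abs-neg (y - x))

    abs-triangle : ∀ x y z → ∣ x - z ∣ᴿ ≤ ∣ x - y ∣ᴿ + ∣ y - z ∣ᴿ
    abs-triangle x y z = ≤-respˡ (abs-cong (solve 3 (λ x y z → (x :- y) :+ (y :- z) := x :- z) refl x y z))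
      (abs-+ (x - y) (y - z))

    abs-sq : ∀ x → ∣ x ∣ᴿ * ∣ x ∣ᴿ ≈ x * x
    abs-sq x = trans (sym (abs-* x x)) (abs-of-nonNeg (sq-nonNeg x))

    sq-cancel-≤ : ∀ {x y} → 0# ≤ y → x * x ≤ y * y → x ≤ y
    sq-cancel-≤ {x} {y} 0≤y p = ≮⇒≥ λ y<x → <⇒≱ (≤-<-trans (*-monoˡ-≤ 0≤y (<⇒≤ y<x)) (*-monoʳ-< (≤-<-trans 0≤y y<x) y<x)) p

    abs-≤0⇒≈0 : ∀ {x} → ∣ x ∣ᴿ ≤ 0# → x ≈ 0#
    abs-≤0⇒≈0 {x} p = ≤-antisym (≤-trans (x≤∣x∣ x) p)
      (≤-resp -0#≈0# (-‿involutive x) (neg-mono-≤ (≤-trans (-x≤∣x∣ x) p)))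

    abs-pos : ∀ {x} → ¬ (x ≈ 0#) → 0# < ∣ x ∣ᴿ
    abs-pos p = ≰⇒> λ q → p (abs-≤0⇒≈0 q)

    abs-fromℤ : ∀ i → ∣ fromℤ i ∣ᴿ ≈ fromℕ ℤ.∣ i ∣
    abs-fromℤ (+ n)    = abs-of-nonNeg (0≤-fromℕ n)
    abs-fromℤ -[1+ n ] = trans (abs-neg _) (abs-of-nonNeg (0≤-fromℕ (suc n)))

    fromℤ-<1⇒≡0 : ∀ i → ∣ fromℤ i ∣ᴿ < 1# → i ≡ 0ℤ
    fromℤ-<1⇒≡0 (+ zero) _ = ≡.refl
    fromℤ-<1⇒≡0 (+ suc n) p = ⊥-elim (<⇒≱ p (≤-respʳ (sym (abs-fromℤ (+ suc n))) (1≤-fromℕ n)))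
    fromℤ-<1⇒≡0 -[1+ n ] p = ⊥-elim (<⇒≱ p (≤-respʳ (sym (abs-fromℤ -[1+ n ])) (1≤-fromℕ n)))

    ^-nonNeg : ∀ {x} n → 0# ≤ x → 0# ≤ x ^ n
    ^-nonNeg zero    p = 0≤1
    ^-nonNeg (suc n) p = *-nonNeg p (^-nonNeg n p)

    ^-pos : ∀ {x} n → 0# < x → 0# < x ^ n
    ^-pos zero    p = 0<1
    ^-pos (suc n) p = *-pos p (^-pos n p)

    ^-monoˡ-≤ : ∀ {x y} n → 0# ≤ x → x ≤ y → x ^ n ≤ y ^ n
    ^-monoˡ-≤ zero    p q = ≤-refl
    ^-monoˡ-≤ (suc n) p q = *-mono-≤ (^-nonNeg n p) (≤-trans p q) q (^-monoˡ-≤ n p q)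

    1^n : ∀ n → 1# ^ n ≈ 1#
    1^n zero    = refl
    1^n (suc n) = trans (*-identityˡ _) (1^n n)

    1≤^ : ∀ {x} n → 1# ≤ x → 1# ≤ x ^ n
    1≤^ n p = ≤-respˡ (1^n n) (^-monoˡ-≤ n 0≤1 p)

    ^≤1 : ∀ {x} n → 0# ≤ x → x ≤ 1# → x ^ n ≤ 1#
    ^≤1 n p q = ≤-respʳ (1^n n) (^-monoˡ-≤ n p q)

    x≤x*y : ∀ {x y} → 0# ≤ x → 1# ≤ y → x ≤ x * y
    x≤x*y p q = ≤-respˡ (*-identityʳ _) (*-monoˡ-≤ p q)

    ^-monoʳ-≤ : ∀ {x m n} → 1# ≤ x → m ℕ.≤ n → x ^ m ≤ x ^ n
    ^-monoʳ-≤ {n = n} p z≤n = 1≤^ n p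
    ^-monoʳ-≤ p (s≤s q) = *-monoˡ-≤ (≤-trans 0≤1 p) (^-monoʳ-≤ p q)

    ^-antiʳ-≤ : ∀ {x m n} → 0# ≤ x → x ≤ 1# → m ℕ.≤ n → x ^ n ≤ x ^ m
    ^-antiʳ-≤ {n = n} p q z≤n = ^≤1 n p q
    ^-antiʳ-≤ p q (s≤s r) = *-monoˡ-≤ p (^-antiʳ-≤ p q r)

    ^-cancel-≤ : ∀ {x y} n → 0# ≤ y → x ^ suc n ≤ y ^ suc n → x ≤ y
    ^-cancel-≤ {x} {y} n 0≤y p = ≮⇒≥ λ y<x → <⇒≱
      (≤-<-trans (*-monoˡ-≤ 0≤y (^-monoˡ-≤ n 0≤y (<⇒≤ y<x))) (*-monoʳ-< (^-pos n (≤-<-trans 0≤y y<x)) y<x)) p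

    fromℕ-^ : ∀ m n → fromℕ (m ℕ.^ n) ≈ fromℕ m ^ n
    fromℕ-^ m zero    = +-identityʳ 1#
    fromℕ-^ m (suc n) = trans (fromℕ-* m (m ℕ.^ n)) (*-congˡ (fromℕ-^ m n))

    bernoulli : ∀ {x} n → 0# ≤ x → 1# + fromℕ n * x ≤ (1# + x) ^ n
    bernoulli {x} zero p = ≈⇒≤ (trans (+-congˡ (zeroˡ x)) (+-identityʳ 1#))
    bernoulli {x} (suc n) p = ≤-trans
      (lin (*-nonNeg (*-nonNeg (0≤-fromℕ n) p) p)
        (solve 2 (λ x n → (con (+ 1) :+ x) :* (con (+ 1) :+ n :* x) :+ con 0ℤ :=
                          (con (+ 1) :+ (con (+ 1) :+ n) :* x) :+ (n :* x) :* x)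
          refl x (fromℕ n)))
      (*-monoˡ-≤ (+-nonNeg 0≤1 p) (bernoulli n p))

  -- Suprema, the Archimedean property, finite sums and products.

  module FiniteSums where
    open OrderedField

    open CMSum +-commutativeMonoid public using (sum-cong-≋; sum-remove; ∑-distrib-+)
    open SSum semiring public using (*-distribˡ-sum; *-distribʳ-sum)
    open CMSum *-commutativeMonoid public using ()
      renaming (sum to prod; sum-remove to prod-remove; sum-cong-≋ to prod-cong; ∑-distrib-+ to prod-*)
    open Min totalOrder public using (_⊓_)
    open MinOp (Min.minOperator totalOrder) public using (x⊓y≤x; x⊓y≤y; ⊓-glb; ⊓-sel)

    sup-ub : ∀ {P : Pred Carrier 0ℓ} {y} → Satisfiable (UpperBound P) → P y → y ≤ sup P
    sup-ub {P} {y} bdd py with em {Satisfiable P × Satisfiable (UpperBound P)}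
    ... | yes (ne , bd) = proj₁ (proj₂ (complete P ne bd)) y py
    ... | no ¬p = ⊥-elim (¬p ((y , py) , bdd))

    sup-lub : ∀ {P : Pred Carrier 0ℓ} {b} → Satisfiable P → UpperBound P b → sup P ≤ b
    sup-lub {P} {b} ne ub with em {Satisfiable P × Satisfiable (UpperBound P)}
    ... | yes (ne′ , bd) = proj₂ (proj₂ (complete P ne′ bd)) b ub
    ... | no ¬p = ⊥-elim (¬p (ne , (b , ub)))

    x-1≱x : ∀ {x} → ¬ (x ≤ x - 1#)
    x-1≱x {x} p = <⇒≱ 0<1 (lin p (solve 1 (λ x → con 0ℤ :+ x := con (+ 1) :+ (x :- con (+ 1))) refl x))

    -- Completeness enters here: if the naturals were bounded, their supremum minus 1 would still be
    -- an upper bound.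
    archimedean : ∀ x → ∃[ n ] x ≤ fromℕ n
    archimedean x with em {∃[ n ] x ≤ fromℕ n}
    ... | yes p = p
    ... | no ¬p = ⊥-elim (x-1≱x (least (s - 1#) λ { y (n , y≈n) → lin (isUb (fromℕ (suc n)) (suc n , refl))
            (trans (+-congˡ refl) (trans (solve 2 (λ s n → (s :- con (+ 1)) :+ (con (+ 1) :+ n) := n :+ s) refl s (fromℕ n)) (+-congʳ (sym y≈n)))) }))
      where
      P : Pred Carrier 0ℓ
      P y = ∃[ n ] y ≈ fromℕ n
      S = complete P (0# , 0 , refl) (x , λ { y (n , y≈n) → ≤-respˡ (sym y≈n) (<⇒≤ (≰⇒> (λ q → ¬p (n , q)))) })
      s = proj₁ S
      isUb = proj₁ (proj₂ S)
      least = proj₂ (proj₂ S)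

    archimedean-* : ∀ {ε} x → 0# < ε → ∃[ n ] x ≤ fromℕ n * ε
    archimedean-* {ε} x 0<ε with archimedean (x * ε ⁻¹)
    ... | n , p = n , ≤-respˡ e (*-monoʳ-≤ (<⇒≤ 0<ε) p)
      where
      e : x * ε ⁻¹ * ε ≈ x
      e = trans (*-assoc _ _ _) (trans (*-congˡ (⁻¹-inverseˡ (0<⇒≉ 0<ε))) (*-identityʳ x))

    archimedean-^ : ∀ {x} y → 1# < x → ∃[ n ] y ≤ x ^ n
    archimedean-^ {x} y (1≤x , 1≉x) = n , ≤-trans p (≤-trans z≤1+z (≤-respʳ (^-congˡ n 1+[x-1]) (bernoulli n (x≤y⇒0≤y-x 1≤x))))
      where
      1+[x-1] : 1# + (x - 1#) ≈ x
      1+[x-1] = solve 1 (λ x → con (+ 1) :+ (x :- con (+ 1)) := x) refl x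
      0<x-1 : 0# < x - 1#
      0<x-1 = x≤y⇒0≤y-x 1≤x , λ e → 1≉x (trans (sym (+-identityʳ 1#)) (trans (+-congˡ e) 1+[x-1]))
      a = archimedean-* y 0<x-1
      n = proj₁ a
      p = proj₂ a
      z≤1+z : fromℕ n * (x - 1#) ≤ 1# + fromℕ n * (x - 1#)
      z≤1+z = ≤-respˡ (+-identityˡ _) (+-mono-≤ 0≤1 ≤-refl)

    leastWith : (P : ℕ → Set) → ∃ P → ∃[ m ] (P m × (∀ k → k ℕ.< m → ¬ P k))
    leastWith P (n , pn) = go n zero (λ _ ()) (≡.subst P (≡.sym (ℕ.+-identityʳ n)) pn)
      where
      go : ∀ n m → (∀ k → k ℕ.< m → ¬ P k) → P (n ℕ.+ m) → ∃[ m ] (P m × (∀ k → k ℕ.< m → ¬ P k))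
      go zero m below p = m , p , below
      go (suc n) m below p with em {P m}
      ... | yes q = m , q , below
      ... | no ¬q = go n (suc m) below′ (≡.subst P (≡.sym (ℕ.+-suc n m)) p)
        where
        below′ : ∀ k → k ℕ.< suc m → ¬ P k
        below′ k (s≤s k≤m) with ℕ.m≤n⇒m<n∨m≡n k≤m
        ... | inj₁ k<m = below k k<m
        ... | inj₂ ≡.refl = ¬q

    x<1+x : ∀ x → x < 1# + x
    x<1+x x = ≰⇒> λ q → <⇒≱ 0<1 (lin q (+-identityˡ (1# + x)))

    floorℕ : ∀ {x} → 0# ≤ x → ∃[ n ] (fromℕ n ≤ x × x < fromℕ (suc n))
    floorℕ {x} 0≤x = fromLeast (leastWith (λ n → x < fromℕ n) (above (archimedean x)))
      where
      above : ∃[ k ] x ≤ fromℕ k → ∃[ n ] x < fromℕ n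
      above (k , x≤k) = suc k , ≤-<-trans x≤k (x<1+x (fromℕ k))
      fromLeast : ∃[ m ] (x < fromℕ m × (∀ k → k ℕ.< m → ¬ (x < fromℕ k))) → ∃[ n ] (fromℕ n ≤ x × x < fromℕ (suc n))
      fromLeast (zero , p , _) = ⊥-elim (<⇒≱ p 0≤x)
      fromLeast (suc n , p , least) = n , ≮⇒≥ (least n ℕ.≤-refl) , p

    -- ι, ζ, ∑ and ∏ are opaque copies of fromℕ, fromℤ, sum and prod.
    abstract
      ι : ℕ → Carrier
      ι = fromℕ

      ζ : ℤ → Carrier
      ζ = fromℤ

      ∑ : ∀ {n} → Vector Carrier n → Carrier
      ∑ = sum

      ∏ : ∀ {n} → Vector Carrier n → Carrier
      ∏ = prod

      ι-def : ∀ n → ι n ≈ fromℕ n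
      ι-def n = refl

      ζ-def : ∀ i → ζ i ≈ fromℤ i
      ζ-def i = refl

      ∑-def : ∀ {n} (f : Vector Carrier n) → ∑ f ≈ sum f
      ∑-def f = refl

      ι-0 : ι 0 ≈ 0#
      ι-0 = refl

      ι-1 : ι 1 ≈ 1#
      ι-1 = fromℕ-1

      ι-suc : ∀ n → ι (suc n) ≈ 1# + ι n
      ι-suc n = refl

      ι-+ : ∀ m n → ι (m ℕ.+ n) ≈ ι m + ι n
      ι-+ = fromℕ-+

      ι-* : ∀ m n → ι (m ℕ.* n) ≈ ι m * ι n
      ι-* = fromℕ-*

      ι-^ : ∀ m n → ι (m ℕ.^ n) ≈ ι m ^ n
      ι-^ = fromℕ-^

      0≤ι : ∀ n → 0# ≤ ι n
      0≤ι = 0≤-fromℕ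

      0<ι : ∀ n → 0# < ι (suc n)
      0<ι = 0<-fromℕ

      1≤ι : ∀ n → 1# ≤ ι (suc n)
      1≤ι = 1≤-fromℕ

      ι-mono-≤ : ∀ {m n} → m ℕ.≤ n → ι m ≤ ι n
      ι-mono-≤ = fromℕ-mono-≤

      ι-cancel-< : ∀ {m n} → ι m < ι n → m ℕ.< n
      ι-cancel-< {m} {n} p = ℕ.≰⇒> λ n≤m → <⇒≱ p (fromℕ-mono-≤ n≤m)

      ι<ι-suc : ∀ n → ι n < ι (suc n)
      ι<ι-suc n = x<1+x (fromℕ n)

      archimedean-ι : ∀ x → ∃[ n ] x ≤ ι n
      archimedean-ι = archimedean

      archimedean-ι* : ∀ {ε} x → 0# < ε → ∃[ n ] x ≤ ι n * ε
      archimedean-ι* = archimedean-*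

      floor-ι : ∀ {x} → 0# ≤ x → ∃[ n ] (ι n ≤ x × x < ι (suc n))
      floor-ι = floorℕ

      ζ-0 : ζ 0ℤ ≈ 0#
      ζ-0 = refl

      ζ-pos : ∀ n → ζ (+ n) ≈ ι n
      ζ-pos n = refl

      ζ-+ : ∀ i j → ζ (i ℤ.+ j) ≈ ζ i + ζ j
      ζ-+ = fromℤ-+

      ζ-sub : ∀ i j → ζ (i ℤ.- j) ≈ ζ i - ζ j
      ζ-sub i j = trans (fromℤ-+ i (ℤ.- j)) (+-congˡ (fromℤ-neg j))

      ζ-* : ∀ i j → ζ (i ℤ.* j) ≈ ζ i * ζ j
      ζ-* = fromℤ-*

      ζ-⊖ : ∀ m n → ζ (m ℤ.⊖ n) ≈ ι m - ι n
      ζ-⊖ = fromℤ-⊖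

      abs-ζ : ∀ i → ∣ ζ i ∣ᴿ ≈ ι ℤ.∣ i ∣
      abs-ζ = abs-fromℤ

      ζ-<1⇒≡0 : ∀ i → ∣ ζ i ∣ᴿ < 1# → i ≡ 0ℤ
      ζ-<1⇒≡0 = fromℤ-<1⇒≡0

      ∑-zero : (f : Vector Carrier 0) → ∑ f ≈ 0#
      ∑-zero f = refl

      ∑-suc : ∀ {n} (f : Vector Carrier (suc n)) → ∑ f ≈ f zero + ∑ (f ∘ suc)
      ∑-suc f = refl

      ∑-cong : ∀ {n} {f g : Vector Carrier n} → (∀ i → f i ≈ g i) → ∑ f ≈ ∑ g
      ∑-cong = sum-cong-≋

      ∑-remove : ∀ {n} i (f : Vector Carrier (suc n)) → ∑ f ≈ f i + ∑ (f ∘ punchIn i)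
      ∑-remove i f = sum-remove {i = i} f

      ∑-+ : ∀ {n} (f g : Vector Carrier n) → ∑ (λ i → f i + g i) ≈ ∑ f + ∑ g
      ∑-+ = ∑-distrib-+

      ∑-*ˡ : ∀ {n} x (f : Vector Carrier n) → x * ∑ f ≈ ∑ (λ i → x * f i)
      ∑-*ˡ = *-distribˡ-sum

      ∑-*ʳ : ∀ {n} (f : Vector Carrier n) x → ∑ f * x ≈ ∑ (λ i → f i * x)
      ∑-*ʳ f x = *-distribʳ-sum x f

      ∑-swap : ∀ {m n} (f : Fin m → Fin n → Carrier) → ∑ (λ i → ∑ (f i)) ≈ ∑ (λ j → ∑ λ i → f i j)
      ∑-swap f = CMSum.∑-comm +-commutativeMonoid f

      ∏-zero : (f : Vector Carrier 0) → ∏ f ≈ 1#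
      ∏-zero f = refl

      ∏-suc : ∀ {n} (f : Vector Carrier (suc n)) → ∏ f ≈ f zero * ∏ (f ∘ suc)
      ∏-suc f = refl

      ∏-cong : ∀ {n} {f g : Vector Carrier n} → (∀ i → f i ≈ g i) → ∏ f ≈ ∏ g
      ∏-cong = prod-cong

      ∏-remove : ∀ {n} i (f : Vector Carrier (suc n)) → ∏ f ≈ f i * ∏ (f ∘ punchIn i)
      ∏-remove i f = prod-remove {i = i} f

      ∏-* : ∀ {n} (f g : Vector Carrier n) → ∏ (λ i → f i * g i) ≈ ∏ f * ∏ g
      ∏-* = prod-*

      ∑-mono-≤ : ∀ {n} {f g : Vector Carrier n} → (∀ i → f i ≤ g i) → ∑ f ≤ ∑ g
      ∑-mono-≤ {zero}  p = ≤-refl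
      ∑-mono-≤ {suc n} p = +-mono-≤ (p zero) (∑-mono-≤ (p ∘ suc))

      ∑-nonNeg : ∀ {n} {f : Vector Carrier n} → (∀ i → 0# ≤ f i) → 0# ≤ ∑ f
      ∑-nonNeg {zero}  p = ≤-refl
      ∑-nonNeg {suc n} p = +-nonNeg (p zero) (∑-nonNeg (p ∘ suc))

      ∑-const : ∀ n x → ∑ {n} (λ _ → x) ≈ ι n * x
      ∑-const zero x = sym (zeroˡ x)
      ∑-const (suc n) x = trans (+-congˡ (∑-const n x)) (solve 2 (λ n x → x :+ n :* x := (con (+ 1) :+ n) :* x) refl (ι n) x)

      ∑-≤-const : ∀ {n} {f : Vector Carrier n} {x} → (∀ i → f i ≤ x) → ∑ f ≤ ι n * x
      ∑-≤-const {n} p = ≤-respʳ (∑-const n _) (∑-mono-≤ p)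

      term≤∑ : ∀ {n} {f : Vector Carrier n} → (∀ i → 0# ≤ f i) → ∀ i → f i ≤ ∑ f
      term≤∑ {suc n} {f} p i = ≤-respʳ (sym (∑-remove i f))
        (lin (∑-nonNeg (p ∘ punchIn i)) (solve 2 (λ x y → (x :+ y) :+ con 0ℤ := x :+ y) refl (f i) (∑ (f ∘ punchIn i))))

      abs-∑ : ∀ {n} (f : Vector Carrier n) → ∣ ∑ f ∣ᴿ ≤ ∑ (λ i → ∣ f i ∣ᴿ)
      abs-∑ {zero} f = ≈⇒≤ (abs-0 refl)
      abs-∑ {suc n} f = ≤-trans (abs-+ _ _) (+-mono-≤ ≤-refl (abs-∑ (f ∘ suc)))

      ∑-0 : ∀ {n} {f : Vector Carrier n} → (∀ i → f i ≈ 0#) → ∑ f ≈ 0#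
      ∑-0 {n} {f} p = trans (∑-cong p) (trans (∑-const n 0#) (zeroʳ _))

      ∑-neg : ∀ {n} (f : Vector Carrier n) → ∑ (λ i → - f i) ≈ - ∑ f
      ∑-neg {zero} f = sym -0#≈0#
      ∑-neg {suc n} f = trans (+-congˡ (∑-neg (f ∘ suc))) (-‿+-comm _ _)

      ∑-sub : ∀ {n} (f g : Vector Carrier n) → ∑ (λ i → f i - g i) ≈ ∑ f - ∑ g
      ∑-sub f g = trans (∑-+ f (λ i → - g i)) (+-congˡ (∑-neg g))

      ∑-single : ∀ {n} (f : Vector Carrier n) i → (∀ j → j ≢ i → f j ≈ 0#) → ∑ f ≈ f i
      ∑-single {suc n} f i p = trans (∑-remove i f) (trans (+-congˡ (∑-0 λ k → p (punchIn i k) (Fin.punchInᵢ≢i i k))) (+-identityʳ _))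

      ∏-nonNeg : ∀ {n} {f : Vector Carrier n} → (∀ i → 0# ≤ f i) → 0# ≤ ∏ f
      ∏-nonNeg {zero}  p = 0≤1
      ∏-nonNeg {suc n} p = *-nonNeg (p zero) (∏-nonNeg (p ∘ suc))

      ∏-pos : ∀ {n} {f : Vector Carrier n} → (∀ i → 0# < f i) → 0# < ∏ f
      ∏-pos {zero}  p = 0<1
      ∏-pos {suc n} p = *-pos (p zero) (∏-pos (p ∘ suc))

      ∏-mono-≤ : ∀ {n} {f g : Vector Carrier n} → (∀ i → 0# ≤ f i) → (∀ i → f i ≤ g i) → ∏ f ≤ ∏ g
      ∏-mono-≤ {zero}  p q = ≤-refl
      ∏-mono-≤ {suc n} p q = *-mono-≤ (∏-nonNeg (p ∘ suc)) (≤-trans (p zero) (q zero)) (q zero) (∏-mono-≤ (p ∘ suc) (q ∘ suc))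

      ∏-const : ∀ n x → ∏ {n} (λ _ → x) ≈ x ^ n
      ∏-const zero x = refl
      ∏-const (suc n) x = *-congˡ (∏-const n x)

      ∏-^ : ∀ {n} (f : Vector Carrier n) k → ∏ (λ i → f i ^ k) ≈ ∏ f ^ k
      ∏-^ {zero} f k = sym (1^n k)
      ∏-^ {suc n} f k = trans (*-congˡ (∏-^ (f ∘ suc) k)) (sym (^-distrib-* _ _ k))

    -- Factors outside the image of `J` are at least 1 and can be left out. In the induction the
    -- factor at `J zero` is set to 1 rather than removed, so the index type stays the same and
    -- `J ∘ suc` needs no reindexing.
    ∏-inj-≤ : ∀ {m d} {x : Vector Carrier d} (J : Fin m → Fin d) → Injective _≡_ _≡_ J →
                 (∀ i → 1# ≤ x i) → ∏ (x ∘ J) ≤ ∏ x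
    ∏-inj-≤ {zero} {d} {x} J inj 1≤x = ≤-respˡ (trans (prod-1 d) (sym (∏-zero (x ∘ J)))) (∏-mono-≤ (λ _ → 0≤1) 1≤x)
      where
      prod-1 : ∀ n → ∏ {n} (λ _ → 1#) ≈ 1#
      prod-1 n = trans (∏-const n 1#) (1^n n)
    ∏-inj-≤ {suc m} {zero} J = ⊥-elim (Fin.¬Fin0 (J zero))
    ∏-inj-≤ {suc m} {suc d} {x} J inj 1≤x = ≤-resp (sym (∏-suc (x ∘ J))) (sym split)
      (*-monoˡ-≤ (≤-trans 0≤1 (1≤x i)) (≤-respˡ (∏-cong (λ k → x′-other (J (suc k)) (λ e → Fin.0≢1+n (≡.sym (inj e)))))
        (∏-inj-≤ {x = x′} (J ∘ suc) (λ e → Fin.suc-injective (inj e)) 1≤x′)))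
      where
      i = J zero
      x′ : Vector Carrier (suc d)
      x′ k with k Fin.≟ i
      ... | yes _ = 1#
      ... | no _ = x k
      x′-other : ∀ k → k ≢ i → x′ k ≈ x k
      x′-other k k≢i with k Fin.≟ i
      ... | yes e = ⊥-elim (k≢i e)
      ... | no _ = refl
      x′-i : x′ i ≈ 1#
      x′-i with i Fin.≟ i
      ... | yes _ = refl
      ... | no ¬e = ⊥-elim (¬e ≡.refl)
      1≤x′ : ∀ k → 1# ≤ x′ k
      1≤x′ k with k Fin.≟ i
      ... | yes _ = ≤-refl
      ... | no _ = 1≤x k
      split : ∏ x ≈ x i * ∏ x′
      split = trans (∏-remove i x) (*-congˡ (sym (trans (∏-remove i x′) (trans (*-congʳ x′-i)
        (trans (*-identityˡ _) (∏-cong λ k → x′-other (punchIn i k) (Fin.punchInᵢ≢i i k)))))))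

    ∏-inj-≤-∉ : ∀ {m d} {x : Vector Carrier d} (J : Fin m → Fin d) → Injective _≡_ _≡_ J →
                   (∀ i → 1# ≤ x i) → ∀ l → (∀ k → J k ≢ l) → x l * ∏ (x ∘ J) ≤ ∏ x
    ∏-inj-≤-∉ {m} {d} {x} J inj 1≤x l l∉ = ≤-respˡ (∏-suc (x ∘ J⁺)) (∏-inj-≤ J⁺ inj⁺ 1≤x)
      where
      J⁺ : Fin (suc m) → Fin d
      J⁺ zero = l
      J⁺ (suc k) = J k
      inj⁺ : Injective _≡_ _≡_ J⁺
      inj⁺ {zero} {zero} _ = ≡.refl
      inj⁺ {zero} {suc k} e = ⊥-elim (l∉ k (≡.sym e))
      inj⁺ {suc k} {zero} e = ⊥-elim (l∉ k e)
      inj⁺ {suc k} {suc k′} e = ≡.cong suc (inj e)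

    ⊓-pos : ∀ {x y} → 0# < x → 0# < y → 0# < x ⊓ y
    ⊓-pos {x} {y} p q = ≰⇒> λ r → [ (λ e → <⇒≱ p (≤-respˡ e r)) , (λ e → <⇒≱ q (≤-respˡ e r)) ]′ (⊓-sel x y)

    element : ∀ {n} → 1 ℕ.≤ n → Fin n
    element {suc n} _ = zero

    argmax : ∀ {n} (f : Fin (suc n) → Carrier) → ∃[ i ] ∀ j → f j ≤ f i
    argmax {zero} f = zero , λ { zero → ≤-refl }
    argmax {suc n} f with argmax (f ∘ suc)
    ... | i , p with ≤-total (f zero) (f (suc i))
    ... | inj₁ q = suc i , λ { zero → q ; (suc j) → p j }
    ... | inj₂ q = zero , λ { zero → ≤-refl ; (suc j) → ≤-trans (p j) q }

    commonBound : ∀ {n} (P : Fin n → ℕ → Set) → (∀ i {k l} → k ℕ.≤ l → P i k → P i l) → (∀ i → ∃ (P i)) → ∃[ N ] ∀ i → P i N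
    commonBound {zero} P mono h = 0 , λ ()
    commonBound {suc n} P mono h with h zero | commonBound (P ∘ suc) (mono ∘ suc) (h ∘ suc)
    ... | k , p | N , q = k ℕ.⊔ N , λ { zero → mono zero (ℕ.m≤m⊔n k N) p ; (suc i) → mono (suc i) (ℕ.m≤n⊔m k N) (q i) }

  -- A pigeonhole theorem for systems of linear forms.

  module LinearFormsPigeonhole where
    open OrderedField
    open FiniteSums

    prodℕ : ∀ {m} → (Fin m → ℕ) → ℕ
    prodℕ {zero}  N = 1
    prodℕ {suc m} N = N zero ℕ.* prodℕ (N ∘ suc)

    ι-∏ : ∀ {m} (N : Fin m → ℕ) → ι (prodℕ N) ≈ ∏ (ι ∘ N)
    ι-∏ {zero}  N = trans ι-1 (sym (∏-zero _))
    ι-∏ {suc m} N = trans (ι-* (N zero) _) (trans (*-congˡ (ι-∏ (N ∘ suc))) (sym (∏-suc (ι ∘ N))))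

    encode : ∀ {m} (N : Fin m → ℕ) → (∀ i → Fin (N i)) → Fin (prodℕ N)
    encode {zero}  N c = zero
    encode {suc m} N c = Fin.combine (c zero) (encode (N ∘ suc) (c ∘ suc))

    encode-injective : ∀ {m} (N : Fin m → ℕ) (c c′ : ∀ i → Fin (N i)) → encode N c ≡ encode N c′ → ∀ i → c i ≡ c′ i
    encode-injective {suc m} N c c′ e i with Fin.combine-injective (c zero) _ (c′ zero) _ e
    encode-injective N c c′ e zero    | p , q = p
    encode-injective N c c′ e (suc i) | p , q = encode-injective (N ∘ suc) (c ∘ suc) (c′ ∘ suc) q i

    pigeonholeBox : ∀ {c m} n (N : Fin m → ℕ) → prodℕ N ℕ.< n ℕ.^ c →
                    (cell : (Fin c → Fin n) → ∀ i → Fin (N i)) →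
                    ∃[ a ] ∃[ a′ ] ((∃[ k ] a k ≢ a′ k) × (∀ i → cell a i ≡ cell a′ i))
    pigeonholeBox {c} {m} n N small cell = finish (Fin.pigeonhole small (encode N ∘ cell ∘ finToFun))
      where
      differ : ∀ (i j : Fin (n ℕ.^ c)) → i ≢ j → ∃[ k ] finToFun {n} {c} i k ≢ finToFun j k
      differ i j i≢j = classically (∃[ k ] finToFun {n} {c} i k ≢ finToFun j k) id λ ¬p →
          ⊥-elim (i≢j (≡.trans (≡.sym (Fin.funToFin-finToFin {c} {n} i)) (≡.trans (funToFin-cong (same ¬p)) (Fin.funToFin-finToFin {c} {n} j))))
        where
        same : ¬ (∃[ k ] finToFun {n} {c} i k ≢ finToFun j k) → ∀ k → finToFun {n} {c} i k ≡ finToFun j k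
        same ¬p k with finToFun {n} {c} i k Fin.≟ finToFun j k
        ... | yes e = e
        ... | no ¬e = ⊥-elim (¬p (k , ¬e))
        funToFin-cong : ∀ {c} {f g : Fin c → Fin n} → (∀ k → f k ≡ g k) → funToFin f ≡ funToFin g
        funToFin-cong {zero} p = ≡.refl
        funToFin-cong {suc c} p = ≡.cong₂ Fin.combine (p zero) (funToFin-cong (p ∘ suc))
      finish : ∃[ i ] ∃[ j ] (i Fin.< j × encode N (cell (finToFun i)) ≡ encode N (cell (finToFun j))) → _
      finish (i , j , i<j , e) = finToFun i , finToFun j , differ i j (Fin.<⇒≢ i<j) ,
        encode-injective N (cell (finToFun i)) (cell (finToFun j)) e

    module UnitCells (R : Carrier) (0≤R : 0# ≤ R) where
      private
        0≤2R : 0# ≤ R + R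
        0≤2R = +-nonNeg 0≤R 0≤R
        count′ : ∃[ n ] (ι n ≤ R + R × R + R < ι (suc n))
        count′ = floor-ι 0≤2R

      count : ℕ
      count = suc (proj₁ count′)

      count-≤ : ι count ≤ 1# + (R + R)
      count-≤ = ≤-respˡ (sym (ι-suc _)) (+-mono-≤ ≤-refl (proj₁ (proj₂ count′)))

      module _ (S : Carrier) (∣S∣≤R : ∣ S ∣ᴿ ≤ R) where
        private
          0≤S+R : 0# ≤ S + R
          0≤S+R = lin (≤-trans (-x≤∣x∣ S) ∣S∣≤R) (solve 2 (λ S R → (S :+ R) :+ (:- S) := con 0ℤ :+ R) refl S R)
          idx : ∃[ n ] (ι n ≤ S + R × S + R < ι (suc n))
          idx = floor-ι 0≤S+R
          idx< : proj₁ idx ℕ.< count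
          idx< = ι-cancel-< (≤-<-trans (proj₁ (proj₂ idx)) (≤-<-trans (+-mono-≤ (≤-trans (x≤∣x∣ S) ∣S∣≤R) ≤-refl) (proj₂ (proj₂ count′))))

        index : Fin count
        index = fromℕ< idx<

        base : Carrier
        base = ι (toℕ index) - R

        base≤ : base ≤ S
        base≤ = lin (≤-respˡ (reflexive (≡.cong ι (≡.sym (Fin.toℕ-fromℕ< idx<)))) (proj₁ (proj₂ idx)))
          (solve 3 (λ S R i → S :+ i := (i :- R) :+ (S :+ R)) refl S R (ι (toℕ index)))

        ≤base+1 : S ≤ base + 1#
        ≤base+1 = lin (≤-respʳ (+-congˡ (reflexive (≡.cong ι (≡.sym (Fin.toℕ-fromℕ< idx<))))) (≤-respʳ (ι-suc _) (<⇒≤ (proj₂ (proj₂ idx)))))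
          (solve 3 (λ S R i → ((i :- R) :+ con (+ 1)) :+ (S :+ R) := S :+ (con (+ 1) :+ i)) refl S R (ι (toℕ index)))

    within-1 : ∀ {b x y} → b ≤ x → x ≤ b + 1# → b ≤ y → y ≤ b + 1# → ∣ x - y ∣ᴿ ≤ 1#
    within-1 {b} {x} {y} p q r s = abs-lub (half q r)
      (≤-respˡ (solve 2 (λ x y → y :- x := :- (x :- y)) refl x y) (half s p))
      where
      half : ∀ {x y} → x ≤ b + 1# → b ≤ y → x - y ≤ 1#
      half {x} {y} q r = lin (+-mono-≤ q r) (solve 3 (λ b x y → con (+ 1) :+ (x :+ b) := (x :- y) :+ ((b :+ con (+ 1)) :+ y)) refl b x y)

    module PigeonholeForms {m : ℕ} (ℓ : Fin m → Fin (suc m) → Carrier) (φ : Fin (suc m) → Carrier)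
      (β : Fin m → Carrier) (Q : Fin m → Carrier) (ε : Carrier)
      (1≤Q : ∀ i → 1# ≤ Q i) (ℓ≤Q : ∀ i k → ∣ ℓ i k ∣ᴿ ≤ Q i) (0<ε : 0# < ε) (φ≤ε : ∀ k → ∣ φ k ∣ᴿ ≤ ε) where

      private
        c : ℕ
        c = suc m
        B : Carrier
        B = ∑ (λ i → ∣ β i ∣ᴿ)
        -- `X * ε` has to reach 1 + 2B, so that `3X * ε` cells suffice for the last form although
        -- `ε` may be tiny.
        T′ : ∃[ k ] (1# + (B + B) ≤ ι k * ε)
        T′ = archimedean-ι* (1# + (B + B)) 0<ε
        T : ℕ
        T = suc (proj₁ T′)
        t X : Carrier
        t = ι T
        X = ι c * t

        0≤X : 0# ≤ X
        0≤X = *-nonNeg (0≤ι c) (0≤ι T)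

        1≤X : 1# ≤ X
        1≤X = ≤-trans (1≤ι m) (x≤x*y (0≤ι c) (1≤ι (proj₁ T′)))

        large : 1# + (B + B) ≤ X * ε
        large = ≤-trans (proj₂ T′) (*-monoʳ-≤ (<⇒≤ 0<ε) (≤-trans (ι-mono-≤ (ℕ.n≤1+n _))
          (≤-respˡ (*-identityˡ _) (*-monoʳ-≤ (0≤ι T) (1≤ι m)))))

        comb : (Fin c → Fin (suc T)) → (Fin c → Carrier) → Carrier
        comb a v = ∑ (λ k → ι (toℕ (a k)) * v k)

        comb-bound : ∀ a v {q} → (∀ k → ∣ v k ∣ᴿ ≤ q) → ∣ comb a v ∣ᴿ ≤ X * q
        comb-bound a v {q} v≤q = ≤-trans (abs-∑ _) (≤-trans (∑-≤-const λ k →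
          ≤-trans (≈⇒≤ (abs-* _ _)) (≤-trans (*-monoʳ-≤ (abs-nonNeg _) (≈⇒≤ (abs-of-nonNeg (0≤ι _))))
            (*-mono-≤ (abs-nonNeg _) (0≤ι T) (ι-mono-≤ (ℕ.≤-pred (Fin.toℕ<n (a k)))) (v≤q k)))) (≈⇒≤ (sym (*-assoc _ _ _))))

        module Cell i = UnitCells (X * Q i) (*-nonNeg 0≤X (≤-trans 0≤1 (1≤Q i)))

        S : (Fin c → Fin (suc T)) → Fin m → Carrier
        S a i = comb a (ℓ i)

        S≤ : ∀ a i → ∣ S a i ∣ᴿ ≤ X * Q i
        S≤ a i = comb-bound a (ℓ i) (ℓ≤Q i)

        base : (Fin c → Fin (suc T)) → Fin m → Carrier
        base a i = Cell.base i (S a i) (S≤ a i)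

        -- Measured from the corner of its cell, the last form stays bounded independently of T.
        Γ : (Fin c → Fin (suc T)) → Carrier
        Γ a = comb a φ + ∑ (λ i → β i * (S a i - base a i))

        G : Carrier
        G = X * ε + B

        Γ≤ : ∀ a → ∣ Γ a ∣ᴿ ≤ G
        Γ≤ a = ≤-trans (abs-+ _ _) (+-mono-≤ (comb-bound a φ φ≤ε) (≤-trans (abs-∑ _) (∑-mono-≤ λ i →
          ≤-trans (≈⇒≤ (abs-* _ _)) (≤-respʳ (*-identityʳ _) (*-monoˡ-≤ (abs-nonNeg _) (offset a i))))))
          where
          offset : ∀ a i → ∣ S a i - base a i ∣ᴿ ≤ 1#
          offset a i = within-1 (Cell.base≤ i _ (S≤ a i)) (Cell.≤base+1 i _ (S≤ a i)) ≤-refl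
            (≤-respˡ (+-identityʳ _) (+-mono-≤ ≤-refl 0≤1))

        module CellΓ = UnitCells G (+-nonNeg (*-nonNeg 0≤X (<⇒≤ 0<ε)) (∑-nonNeg {f = λ i → ∣ β i ∣ᴿ} λ i → abs-nonNeg (β i)))

        N : Fin c → ℕ
        N zero = CellΓ.count
        N (suc i) = Cell.count i

        cell : (Fin c → Fin (suc T)) → ∀ i → Fin (N i)
        cell a zero = CellΓ.index (Γ a) (Γ≤ a)
        cell a (suc i) = Cell.index i (S a i) (S≤ a i)

        three 3X : Carrier
        three = 1# + (1# + 1#)
        3X = three * X
        0≤three : 0# ≤ three
        0≤three = +-nonNeg 0≤1 (+-nonNeg 0≤1 0≤1)

        N≤ : ∀ i → ι (N (suc i)) ≤ 3X * Q i
        N≤ i = ≤-trans (Cell.count-≤ i) (lin (≤-trans 1≤X (x≤x*y 0≤X (1≤Q i)))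
          (solve 2 (λ X Q → ((con (+ 1) :+ (con (+ 1) :+ con (+ 1))) :* X) :* Q :+ con (+ 1) := (con (+ 1) :+ (X :* Q :+ X :* Q)) :+ X :* Q) refl X (Q i)))

        Nφ≤ : ι (N zero) ≤ 3X * ε
        Nφ≤ = ≤-trans CellΓ.count-≤ (lin large
          (solve 3 (λ X ε B → ((con (+ 1) :+ (con (+ 1) :+ con (+ 1))) :* X) :* ε :+ (con (+ 1) :+ (B :+ B)) := (con (+ 1) :+ ((X :* ε :+ B) :+ (X :* ε :+ B))) :+ X :* ε) refl X ε B))

        bound : Carrier
        bound = (three * ι c) ^ c * (∏ Q * ε)

        -- There are at most `t ^ c` cells, whereas the coefficients 0, ..., T give (T + 1)^c
        -- vectors; the extra coefficient makes the inequality strict.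
        few : bound ≤ 1# → prodℕ N ℕ.< suc T ℕ.^ c
        few small = ι-cancel-< (≤-<-trans (≈⇒≤ (ι-∏ N)) (≤-<-trans step (<-resp refl (sym (ι-^ (suc T) c)) grow)))
          where
          step : ∏ (ι ∘ N) ≤ t ^ c
          step = ≤-trans (≈⇒≤ (∏-suc (ι ∘ N))) (≤-trans (*-mono-≤ (∏-nonNeg λ i → 0≤ι _) (*-nonNeg (*-nonNeg (0≤three) 0≤X) (<⇒≤ 0<ε)) Nφ≤
                   (∏-mono-≤ (λ i → 0≤ι _) N≤))
                 (≤-trans (≈⇒≤ rearrange) (≤-respʳ (*-identityʳ _) (*-monoˡ-≤ (^-nonNeg c (0≤ι T)) small))))
            where
            rearrange : 3X * ε * ∏ (λ i → 3X * Q i) ≈ t ^ c * bound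
            rearrange = begin
              3X * ε * ∏ (λ i → 3X * Q i)         ≈⟨ *-congˡ (trans (∏-* (λ _ → 3X) Q) (*-congʳ (∏-const m 3X))) ⟩
              3X * ε * (3X ^ m * ∏ Q)             ≈⟨ solve 4 (λ a e b q → a :* e :* (b :* q) := (a :* b) :* (q :* e)) refl 3X ε (3X ^ m) (∏ Q) ⟩
              3X ^ c * (∏ Q * ε)                  ≈⟨ *-congʳ (^-congˡ c (solve 3 (λ a b t → a :* (b :* t) := t :* (a :* b)) refl (three) (ι c) t)) ⟩
              (t * (three * ι c)) ^ c * (∏ Q * ε)   ≈⟨ *-congʳ (^-distrib-* _ _ c) ⟩
              t ^ c * (three * ι c) ^ c * (∏ Q * ε) ≈⟨ *-assoc _ _ _ ⟩
              t ^ c * bound                          ∎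
              where open ≈R
          grow : t ^ c < ι (suc T) ^ c
          grow = ≰⇒> λ q → <⇒≱ (ι<ι-suc T) (^-cancel-≤ m (0≤ι T) q)

      Combination : Set
      Combination = Σ[ n ∈ (Fin (suc m) → ℤ) ] ((∃[ k ] n k ≢ 0ℤ)
        × (∀ i → ∣ ∑ (λ k → ζ (n k) * ℓ i k) ∣ᴿ ≤ 1#)
        × ∣ ∑ (λ k → ζ (n k) * (φ k + ∑ (λ i → β i * ℓ i k))) ∣ᴿ ≤ 1#)

      -- A Minkowski-type theorem with a crude constant, by counting cells. The coefficients `β` do
      -- not enter `bound`: once the forms `ℓ` are located in unit cells, their offsets contribute
      -- at most `B` to the last form, and a large `T` makes this negligible.
      pigeonholeForms : bound ≤ 1# → Combination
      pigeonholeForms small = fromCollision (pigeonholeBox (suc T) N (few small) cell)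
        where
        fromCollision : ∃[ a ] ∃[ a′ ] ((∃[ k ] a k ≢ a′ k) × (∀ i → cell a i ≡ cell a′ i)) → Combination
        fromCollision (a , a′ , (k₀ , a≢a′) , same) = n , (k₀ , nonzero) , forms , last
          where
          n : Fin c → ℤ
          n k = toℕ (a k) ℤ.⊖ toℕ (a′ k)
          nonzero : n k₀ ≢ 0ℤ
          nonzero e = a≢a′ (Fin.toℕ-injective (ℤ.+-injective (ℤ.i-j≡0⇒i≡j (+ toℕ (a k₀)) (+ toℕ (a′ k₀))
            (≡.trans (ℤ.m-n≡m⊖n (toℕ (a k₀)) (toℕ (a′ k₀))) e))))
          diff : ∀ v → ∑ (λ k → ζ (n k) * v k) ≈ comb a v - comb a′ v
          diff v = trans (∑-cong λ k → trans (*-congʳ (ζ-⊖ (toℕ (a k)) (toℕ (a′ k))))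
              (solve 3 (λ x y v → (x :- y) :* v := x :* v :- y :* v) refl (ι (toℕ (a k))) (ι (toℕ (a′ k))) (v k)))
            (∑-sub (λ k → ι (toℕ (a k)) * v k) (λ k → ι (toℕ (a′ k)) * v k))
          sameBase : ∀ i → base a i ≈ base a′ i
          sameBase i = reflexive (≡.cong (λ j → ι (toℕ j) - X * Q i) (same (suc i)))
          forms : ∀ i → ∣ ∑ (λ k → ζ (n k) * ℓ i k) ∣ᴿ ≤ 1#
          forms i = ≤-respˡ (abs-cong (sym (diff (ℓ i)))) (within-1 (Cell.base≤ i _ (S≤ a i)) (Cell.≤base+1 i _ (S≤ a i))
            (≤-respˡ (sym (sameBase i)) (Cell.base≤ i _ (S≤ a′ i))) (≤-respʳ (+-congʳ (sym (sameBase i))) (Cell.≤base+1 i _ (S≤ a′ i))))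
          comb-γ : ∀ a → comb a (λ k → φ k + ∑ (λ i → β i * ℓ i k)) ≈ comb a φ + ∑ (λ i → β i * S a i)
          comb-γ a = begin
            ∑ (λ k → w k * (φ k + ∑ (λ i → β i * ℓ i k)))                ≈⟨ ∑-cong (λ k → distribˡ (w k) _ _) ⟩
            ∑ (λ k → w k * φ k + w k * ∑ (λ i → β i * ℓ i k))            ≈⟨ ∑-+ (λ k → w k * φ k) (λ k → w k * ∑ (λ i → β i * ℓ i k)) ⟩
            comb a φ + ∑ (λ k → w k * ∑ (λ i → β i * ℓ i k))             ≈⟨ +-congˡ (∑-cong λ k → ∑-*ˡ (w k) (λ i → β i * ℓ i k)) ⟩
            comb a φ + ∑ (λ k → ∑ (λ i → w k * (β i * ℓ i k)))           ≈⟨ +-congˡ (∑-swap (λ k i → w k * (β i * ℓ i k))) ⟩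
            comb a φ + ∑ (λ i → ∑ (λ k → w k * (β i * ℓ i k)))           ≈⟨ +-congˡ (∑-cong λ i → trans (∑-cong λ k →
                solve 3 (λ w b l → w :* (b :* l) := b :* (w :* l)) refl (w k) (β i) (ℓ i k)) (sym (∑-*ˡ (β i) (λ k → w k * ℓ i k)))) ⟩
            comb a φ + ∑ (λ i → β i * S a i)                               ∎
            where
            open ≈R
            w : Fin c → Carrier
            w k = ι (toℕ (a k))
          Γ-diff : comb a (λ k → φ k + ∑ (λ i → β i * ℓ i k)) - comb a′ (λ k → φ k + ∑ (λ i → β i * ℓ i k)) ≈ Γ a - Γ a′
          Γ-diff = begin
            comb a γ - comb a′ γ                                       ≈⟨ +-cong (comb-γ a) (-‿cong (comb-γ a′)) ⟩
            (comb a φ + sβ a) - (comb a′ φ + sβ a′)                    ≈⟨ solve 5 (λ p q r s b → (p :+ q) :- (r :+ s) := (p :+ (q :- b)) :- (r :+ (s :- b))) refl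
                                                                            (comb a φ) (sβ a) (comb a′ φ) (sβ a′) (∑ (λ i → β i * base a i)) ⟩
            (comb a φ + (sβ a - ∑ (λ i → β i * base a i))) - (comb a′ φ + (sβ a′ - ∑ (λ i → β i * base a i)))
              ≈⟨ +-cong (+-congˡ (split a a (λ i → refl))) (-‿cong (+-congˡ (split a′ a sameBase))) ⟩
            Γ a - Γ a′ ∎
            where
            open ≈R
            γ : Fin c → Carrier
            γ k = φ k + ∑ (λ i → β i * ℓ i k)
            sβ : (Fin c → Fin (suc T)) → Carrier
            sβ a = ∑ (λ i → β i * S a i)
            split : ∀ a′ a → (∀ i → base a i ≈ base a′ i) → sβ a′ - ∑ (λ i → β i * base a i) ≈ ∑ (λ i → β i * (S a′ i - base a′ i))
            split a′ a e = trans (sym (∑-sub (λ i → β i * S a′ i) (λ i → β i * base a i))) (∑-cong λ i → trans (+-congˡ (-‿cong (*-congˡ (e i))))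
              (solve 3 (λ b s c → b :* s :- b :* c := b :* (s :- c)) refl (β i) (S a′ i) (base a′ i)))
          last : ∣ ∑ (λ k → ζ (n k) * (φ k + ∑ (λ i → β i * ℓ i k))) ∣ᴿ ≤ 1#
          last = ≤-respˡ (abs-cong (sym (trans (diff (λ k → φ k + ∑ (λ i → β i * ℓ i k))) Γ-diff)))
            (within-1 (CellΓ.base≤ _ (Γ≤ a)) (CellΓ.≤base+1 _ (Γ≤ a))
              (≤-respˡ (sym sameΓ) (CellΓ.base≤ _ (Γ≤ a′))) (≤-respʳ (+-congʳ (sym sameΓ)) (CellΓ.≤base+1 _ (Γ≤ a′))))
            where
            sameΓ : CellΓ.base (Γ a) (Γ≤ a) ≈ CellΓ.base (Γ a′) (Γ≤ a′)
            sameΓ = reflexive (≡.cong (λ j → ι (toℕ j) - G) (same zero))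

  -- Affine functions and their echelon systems.

  module AffineSystems where
    open OrderedField
    open FiniteSums
    open LinearFormsPigeonhole

    two : Carrier
    two = 1# + 1#

    0<two : 0# < two
    0<two = +-pos-nonNeg 0<1 0≤1

    1≤two : 1# ≤ two
    1≤two = ≤-respˡ (+-identityʳ 1#) (+-mono-≤ ≤-refl 0≤1)

    x-y≈0⇒x≈y : ∀ {x y} → x - y ≈ 0# → x ≈ y
    x-y≈0⇒x≈y {x} {y} p = trans (solve 2 (λ x y → x := (x :- y) :+ y) refl x y) (trans (+-congʳ p) (+-identityˡ y))

    /-cancel : ∀ {x} y → ¬ (x ≈ 0#) → y * x ⁻¹ * x ≈ y
    /-cancel y x≉0 = trans (*-assoc _ _ _) (trans (*-congˡ (⁻¹-inverseˡ x≉0)) (*-identityʳ y))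

    module _ {m : ℕ} (ℓ : Fin m → Fin (suc m) → Carrier) (φ : Fin (suc m) → Carrier)
      (β : Fin m → Carrier) (Q : Fin m → Carrier) (ε : Carrier) (h : Fin m → Carrier) (H : Carrier)
      (1≤Q : ∀ i → 1# ≤ Q i) (0<h : ∀ i → 0# < h i) (ℓ≤Qh : ∀ i k → ∣ ℓ i k ∣ᴿ ≤ Q i * h i)
      (0<ε : 0# < ε) (0<H : 0# < H) (φ≤εH : ∀ k → ∣ φ k ∣ᴿ ≤ ε * H) where

      private
        γ : Fin (suc m) → Carrier
        γ k = φ k + ∑ (λ i → β i * ℓ i k)

        scale≤ : ∀ {x q z} → 0# < z → ∣ x ∣ᴿ ≤ q * z → ∣ x * z ⁻¹ ∣ᴿ ≤ q
        scale≤ {x} {q} {z} 0<z p = *-cancelʳ-≤ 0<z (≤-respˡ (sym e) p)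
          where
          e : ∣ x * z ⁻¹ ∣ᴿ * z ≈ ∣ x ∣ᴿ
          e = trans (*-congˡ (sym (abs-of-nonNeg (<⇒≤ 0<z)))) (trans (sym (abs-* (x * z ⁻¹) z)) (abs-cong (/-cancel x (0<⇒≉ 0<z))))

        unscale : ∀ {z} (n : Fin (suc m) → Carrier) (v : Fin (suc m) → Carrier) → 0# < z →
                  ∣ ∑ (λ k → n k * (v k * z ⁻¹)) ∣ᴿ ≤ 1# → ∣ ∑ (λ k → n k * v k) ∣ᴿ ≤ z
        unscale {z} n v 0<z p = ≤-respʳ (*-identityˡ z) (≤-respˡ e (*-monoʳ-≤ (<⇒≤ 0<z) p))
          where
          e : ∣ ∑ (λ k → n k * (v k * z ⁻¹)) ∣ᴿ * z ≈ ∣ ∑ (λ k → n k * v k) ∣ᴿ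
          e = trans (*-congˡ (sym (abs-of-nonNeg (<⇒≤ 0<z)))) (trans (sym (abs-* (∑ (λ k → n k * (v k * z ⁻¹))) z)) (abs-cong
            (trans (∑-*ʳ (λ k → n k * (v k * z ⁻¹)) z) (∑-cong λ k → trans (*-assoc _ _ _) (*-congˡ (/-cancel (v k) (0<⇒≉ 0<z)))))))

        open PigeonholeForms (λ i k → ℓ i k * h i ⁻¹) (λ k → φ k * H ⁻¹) (λ i → β i * h i * H ⁻¹) Q ε 1≤Q
          (λ i k → scale≤ (0<h i) (ℓ≤Qh i k)) 0<ε (λ k → scale≤ 0<H (φ≤εH k))

      -- Dividing the forms by `h i` and `H` multiplies `β i` by `h i * H ⁻¹`, which is free because
      -- `β` is absent from the condition.
      pigeonhole : ((1# + (1# + 1#)) * ι (suc m)) ^ suc m * (∏ Q * ε) ≤ 1# →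
        Σ[ n ∈ (Fin (suc m) → ℤ) ] ((∃[ k ] n k ≢ 0ℤ)
          × (∀ i → ∣ ∑ (λ k → ζ (n k) * ℓ i k) ∣ᴿ ≤ h i)
          × ∣ ∑ (λ k → ζ (n k) * (φ k + ∑ (λ i → β i * ℓ i k))) ∣ᴿ ≤ H)
      pigeonhole small = rescale (pigeonholeForms small)
        where
        rescale : Combination → _
        rescale (n , nz , p , q) = n , nz , (λ i → unscale (λ k → ζ (n k)) (ℓ i) (0<h i) (p i)) ,
          unscale (λ k → ζ (n k)) γ 0<H (≤-respˡ (abs-cong (∑-cong λ k → *-congˡ (e k))) q)
          where
          e : ∀ k → φ k * H ⁻¹ + ∑ (λ i → β i * h i * H ⁻¹ * (ℓ i k * h i ⁻¹)) ≈ γ k * H ⁻¹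
          e k = trans (+-congˡ (trans (∑-cong λ i → e′ i) (sym (∑-*ʳ (λ i → β i * ℓ i k) (H ⁻¹))))) (sym (distribʳ (H ⁻¹) (φ k) _))
            where
            e′ : ∀ i → β i * h i * H ⁻¹ * (ℓ i k * h i ⁻¹) ≈ β i * ℓ i k * H ⁻¹
            e′ i = trans (solve 5 (λ b h hi H l → b :* h :* H :* (l :* hi) := b :* l :* H :* (h :* hi)) refl (β i) (h i) (h i ⁻¹) (H ⁻¹) (ℓ i k))
              (trans (*-congˡ (⁻¹-inverseʳ (h i) (0<⇒≉ (0<h i)))) (*-identityʳ _))

    countWith : ℕ → Bool → ℕ
    countWith m true  = suc m
    countWith m false = m

    countWith-suc : ∀ m f → countWith (suc m) f ≡ suc (countWith m f)
    countWith-suc m true  = ≡.refl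
    countWith-suc m false = ≡.refl

    -- Affine functions: index zero is the constant term.

    module _ {d : ℕ} where

      Aff : Set
      Aff = Vector Carrier (suc d)

      eval : Aff → Vector Carrier d → Carrier
      eval a y = a zero + ∑ (λ i → a (suc i) * y i)

      toAff : Vector ℤ (suc d) → Aff
      toAff a i = ζ (a i)

      eval-cong : ∀ {a b} y → (∀ i → a i ≈ b i) → eval a y ≈ eval b y
      eval-cong y p = +-cong (p zero) (∑-cong λ i → *-congʳ (p (suc i)))

      eval-comb : ∀ {n} (c : Fin n → Carrier) (b : Fin n → Aff) y →
                  eval (λ i → ∑ (λ k → c k * b k i)) y ≈ ∑ (λ k → c k * eval (b k) y)
      eval-comb c b y = begin
        ∑ (λ k → c k * b k zero) + ∑ (λ i → ∑ (λ k → c k * b k (suc i)) * y i)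
          ≈⟨ +-congˡ (∑-cong λ i → trans (∑-*ʳ (λ k → c k * b k (suc i)) (y i)) (∑-cong λ k → *-assoc _ _ _)) ⟩
        ∑ (λ k → c k * b k zero) + ∑ (λ i → ∑ (λ k → c k * (b k (suc i) * y i)))
          ≈⟨ +-congˡ (∑-swap (λ i k → c k * (b k (suc i) * y i))) ⟩
        ∑ (λ k → c k * b k zero) + ∑ (λ k → ∑ (λ i → c k * (b k (suc i) * y i)))
          ≈⟨ +-congˡ (∑-cong λ k → ∑-*ˡ (c k) (λ i → b k (suc i) * y i)) ⟨
        ∑ (λ k → c k * b k zero) + ∑ (λ k → c k * ∑ (λ i → b k (suc i) * y i))
          ≈⟨ ∑-+ (λ k → c k * b k zero) (λ k → c k * ∑ (λ i → b k (suc i) * y i)) ⟨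
        ∑ (λ k → c k * b k zero + c k * ∑ (λ i → b k (suc i) * y i))
          ≈⟨ ∑-cong (λ k → distribˡ (c k) _ _) ⟨
        ∑ (λ k → c k * eval (b k) y) ∎
        where open ≈R

      ∑ℤ : ∀ {n} → (Fin n → ℤ) → ℤ
      ∑ℤ = Vector.foldr ℤ._+_ 0ℤ

      ζ-∑ : ∀ {n} (f : Fin n → ℤ) → ζ (∑ℤ f) ≈ ∑ (λ k → ζ (f k))
      ζ-∑ {zero} f = trans ζ-0 (sym (∑-zero _))
      ζ-∑ {suc n} f = trans (ζ-+ (f zero) _) (trans (+-congˡ (ζ-∑ (f ∘ suc))) (sym (∑-suc _)))

      Independent : ∀ {n} → (Fin n → Vector ℤ (suc d)) → Set
      Independent {n} b = ∀ (c : Fin n → ℤ) → (∀ i → ∑ (λ k → ζ (c k) * ζ (b k i)) ≈ 0#) → ∀ k → c k ≡ 0ℤ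

      -- A basis e of a space of affine functions in reduced echelon form, up to constants
      -- if the flag is set. The pivots J are chosen so that, relative to the scale h, the
      -- coefficients of e stay bounded.
      record System (h : Fin d → Carrier) (Pos : Fin d → Set) : Set where
        field
          m       : ℕ
          J       : Fin m → Fin d
          e       : Fin m → Aff
          flag    : Bool
          pivot-1 : ∀ k → e k (suc (J k)) ≈ 1#
          pivot-0 : ∀ k k′ → k ≢ k′ → e k (suc (J k′)) ≈ 0#
          bound   : ∀ k l → ∣ e k (suc l) ∣ᴿ * h (J k) ≤ two ^ m * h l
          supp    : ∀ k l → ¬ Pos l → e k (suc l) ≈ 0#
          J-pos   : ∀ k → Pos (J k)

        size : ℕ
        size = countWith m flag

        expand : Aff → Fin (suc d) → Carrier
        expand w i = ∑ (λ k → w (suc (J k)) * e k i)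

        -- With the flag set, constants belong to the covered space, so the constant term is
        -- unconstrained.
        Covers : Aff → Set
        Covers w = (∀ l → w (suc l) ≈ expand w (suc l)) × (flag ≡ false → w zero ≈ expand w zero)

        J-injective : Injective _≡_ _≡_ J
        J-injective {k} {k′} eq with k Fin.≟ k′
        ... | yes p = p
        ... | no k≢k′ = ⊥-elim (0≉1 (trans (sym (pivot-0 k k′ k≢k′)) (trans (reflexive (≡.cong (λ j → e k (suc j)) (≡.sym eq))) (pivot-1 k))))

        expand-cong : ∀ {v w} → (∀ l → v (suc l) ≈ w (suc l)) → ∀ i → expand v i ≈ expand w i
        expand-cong p i = ∑-cong λ k → *-congʳ (p (J k))

        expand-comb : ∀ {n} (c : Fin n → Carrier) (b : Fin n → Aff) i →
                      expand (λ i → ∑ (λ k → c k * b k i)) i ≈ ∑ (λ k → c k * expand (b k) i)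
        expand-comb c b i = begin
          ∑ (λ j → ∑ (λ k → c k * b k (suc (J j))) * e j i)    ≈⟨ ∑-cong (λ j → trans (∑-*ʳ (λ k → c k * b k (suc (J j))) (e j i)) (∑-cong λ k → *-assoc _ _ _)) ⟩
          ∑ (λ j → ∑ (λ k → c k * (b k (suc (J j)) * e j i)))  ≈⟨ ∑-swap (λ j k → c k * (b k (suc (J j)) * e j i)) ⟩
          ∑ (λ k → ∑ (λ j → c k * (b k (suc (J j)) * e j i)))  ≈⟨ ∑-cong (λ k → ∑-*ˡ (c k) (λ j → b k (suc (J j)) * e j i)) ⟨
          ∑ (λ k → c k * expand (b k) i)                       ∎
          where open ≈R

        Covers-comb : ∀ {n} (c : Fin n → Carrier) (b : Fin n → Aff) {w} → (∀ k → Covers (b k)) →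
                      (∀ i → w i ≈ ∑ (λ k → c k * b k i)) → Covers w
        Covers-comb c b {w} cov w≈ = (λ l → at (suc l) (λ k → proj₁ (cov k) l)) , λ f → at zero (λ k → proj₂ (cov k) f)
          where
          at : ∀ i → (∀ k → b k i ≈ expand (b k) i) → w i ≈ expand w i
          at i p = trans (w≈ i) (trans (∑-cong λ k → *-congˡ (p k)) (trans (sym (expand-comb c b i)) (expand-cong {λ i → ∑ (λ k → c k * b k i)} {w} (λ l → sym (w≈ (suc l))) i)))

      module _ {h : Fin d → Carrier} {Pos : Fin d → Set} (0<h : ∀ l → 0# < h l) where

        open System

        empty : System h Pos
        empty = record { m = 0 ; J = λ () ; e = λ () ; flag = false ; pivot-1 = λ () ; pivot-0 = λ () ; bound = λ () ; supp = λ () ; J-pos = λ () }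

        module _ (S : System h Pos) (b : Aff) (b-supp : ∀ l → ¬ Pos l → b (suc l) ≈ 0#) where

          Extension : Set
          Extension = Σ[ S′ ∈ System h Pos ] (size S′ ≡ suc (size S) × (∀ w → Covers S w → Covers S′ w) × Covers S′ b)

          private
            r : Aff
            r i = b i - expand S b i

            r-supp : ∀ l → ¬ Pos l → r (suc l) ≈ 0#
            r-supp l ¬p = trans (+-cong (b-supp l ¬p) (trans (-‿cong (trans (∑-cong λ k → trans (*-congˡ (supp S k l ¬p)) (zeroʳ _)) (∑-0 λ _ → refl))) -0#≈0#)) (+-identityʳ 0#)

            r-pivot : ∀ k → r (suc (J S k)) ≈ 0#
            r-pivot k = trans (+-congˡ (-‿cong (trans (∑-single _ k λ j j≢k → trans (*-congˡ (pivot-0 S j k j≢k)) (zeroʳ _)) (trans (*-congˡ (pivot-1 S k)) (*-identityʳ _))))) (-‿inverseʳ _)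

          module _ (l : Fin d) (r-l≉0 : ¬ (r (suc l) ≈ 0#)) (r-max : ∀ l′ → ∣ r (suc l′) ∣ᴿ * h l ≤ ∣ r (suc l) ∣ᴿ * h l′) where
            private
              ρ : Carrier
              ρ = r (suc l)
              e* : Aff
              e* i = r i * ρ ⁻¹
              e′ : Fin (suc (m S)) → Aff
              e′ zero = e*
              e′ (suc k) i = e S k i - e S k (suc l) * e* i
              J′ : Fin (suc (m S)) → Fin d
              J′ zero = l
              J′ (suc k) = J S k
              e*-l : e* (suc l) ≈ 1#
              e*-l = ⁻¹-inverseʳ ρ r-l≉0
              e*-J : ∀ k → e* (suc (J S k)) ≈ 0#
              e*-J k = trans (*-congʳ (r-pivot k)) (zeroˡ _)
              e*-bound : ∀ l′ → ∣ e* (suc l′) ∣ᴿ * h l ≤ h l′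
              e*-bound l′ = *-cancelˡ-≤ (abs-pos r-l≉0) (≤-respˡ (sym eq) (r-max l′))
                where
                eq : ∣ ρ ∣ᴿ * (∣ e* (suc l′) ∣ᴿ * h l) ≈ ∣ r (suc l′) ∣ᴿ * h l
                eq = trans (sym (*-assoc _ _ _)) (*-congʳ (trans (sym (abs-* ρ (e* (suc l′)))) (abs-cong
                  (trans (*-comm _ _) (/-cancel (r (suc l′)) r-l≉0)))))

              -- The hypothesis says that the residue of `w` is a multiple of the new vector `e*`.
              -- The multiple is zero for functions covered before, and the residue of `b` is `ρ`
              -- times `e*`.
              cover : ∀ w i → w i - expand S w i ≈ (w (suc l) - expand S w (suc l)) * e* i →
                      w i ≈ ∑ (λ k → w (suc (J′ k)) * e′ k i)
              cover w i D = sym (begin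
                ∑ (λ k → w (suc (J′ k)) * e′ k i)   ≈⟨ ∑-suc _ ⟩
                w (suc l) * e* i + ∑ (λ k → w (suc (J S k)) * (e S k i - e S k (suc l) * e* i))
                  ≈⟨ +-congˡ (∑-cong λ k → solve 4 (λ w a b c → w :* (a :- b :* c) := w :* a :- w :* b :* c) refl (w (suc (J S k))) (e S k i) (e S k (suc l)) (e* i)) ⟩
                w (suc l) * e* i + ∑ (λ k → w (suc (J S k)) * e S k i - w (suc (J S k)) * e S k (suc l) * e* i)
                  ≈⟨ +-congˡ (trans (∑-sub _ _) (+-congˡ (-‿cong (sym (∑-*ʳ _ (e* i)))))) ⟩
                w (suc l) * e* i + (expand S w i - expand S w (suc l) * e* i)
                  ≈⟨ solve 4 (λ a e x y → a :* e :+ (x :- y :* e) := (a :- y) :* e :+ x) refl (w (suc l)) (e* i) (expand S w i) (expand S w (suc l)) ⟩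
                (w (suc l) - expand S w (suc l)) * e* i + expand S w i ≈⟨ +-congʳ D ⟨
                (w i - expand S w i) + expand S w i ≈⟨ solve 2 (λ a b → (a :- b) :+ b := a) refl (w i) (expand S w i) ⟩
                w i ∎)
                where open ≈R

              coverOld : ∀ w i → w (suc l) ≈ expand S w (suc l) → w i ≈ expand S w i → w i ≈ ∑ (λ k → w (suc (J′ k)) * e′ k i)
              coverOld w i p q = cover w i (trans (trans (+-congʳ q) (-‿inverseʳ _)) (sym (trans (*-congʳ (trans (+-congʳ p) (-‿inverseʳ _))) (zeroˡ _))))

              coverNew : ∀ i → b i ≈ ∑ (λ k → b (suc (J′ k)) * e′ k i)
              coverNew i = cover b i (trans (sym (*-identityˡ _)) (trans (*-congʳ (sym (⁻¹-inverseʳ ρ r-l≉0)))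
                (solve 3 (λ ρ ρi r → ρ :* ρi :* r := ρ :* (r :* ρi)) refl ρ (ρ ⁻¹) (r i))))

              pos-l : Pos l
              pos-l with em {Pos l}
              ... | yes p = p
              ... | no ¬p = ⊥-elim (r-l≉0 (r-supp l ¬p))

              bound′ : ∀ k l′ → ∣ e′ k (suc l′) ∣ᴿ * h (J′ k) ≤ two ^ suc (m S) * h l′
              bound′ zero l′ = ≤-trans (e*-bound l′) (≤-respˡ (*-identityˡ _) (*-monoʳ-≤ (<⇒≤ (0<h l′)) (1≤^ (suc (m S)) 1≤two)))
              -- Clearing column `l` adds a term no larger than the old bound, whence one more
              -- factor 2. The maximality of the pivot enters through `e*-bound`.
              bound′ (suc k) l′ = ≤-trans (*-monoʳ-≤ (<⇒≤ (0<h _)) (≤-trans (abs-+ _ _) (+-mono-≤ ≤-refl (≈⇒≤ (trans (abs-neg _) (abs-* _ _))))))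
                (≤-trans (≈⇒≤ (solve 4 (λ x y z h → (x :+ y :* z) :* h := x :* h :+ (y :* h) :* z) refl ∣ e S k (suc l′) ∣ᴿ ∣ e S k (suc l) ∣ᴿ ∣ e* (suc l′) ∣ᴿ (h (J S k))))
                (≤-trans (+-mono-≤ (bound S k l′) (≤-trans (*-monoʳ-≤ (abs-nonNeg _) (bound S k l))
                   (≤-trans (≈⇒≤ (solve 3 (λ c h z → (c :* h) :* z := c :* (z :* h)) refl (two ^ m S) (h l) ∣ e* (suc l′) ∣ᴿ)) (*-monoˡ-≤ (^-nonNeg (m S) (<⇒≤ 0<two)) (e*-bound l′)))))
                (≈⇒≤ (solve 2 (λ c h → c :* h :+ c :* h := ((con (+ 1) :+ con (+ 1)) :* c) :* h) refl (two ^ m S) (h l′)))))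

            extendPivot : Extension
            extendPivot = S′ , sizes , (λ w cov → (λ l′ → coverOld w (suc l′) (proj₁ cov l) (proj₁ cov l′)) , λ f → coverOld w zero (proj₁ cov l) (proj₂ cov f)) ,
              ((λ l′ → coverNew (suc l′)) , λ _ → coverNew zero)
              where
              S′ : System h Pos
              S′ = record
                { m = suc (m S) ; J = J′ ; e = e′ ; flag = flag S
                ; pivot-1 = λ { zero → e*-l ; (suc k) → trans (+-cong (pivot-1 S k) (trans (-‿cong (trans (*-congˡ (e*-J k)) (zeroʳ _))) -0#≈0#)) (+-identityʳ 1#) }
                ; pivot-0 = p0 ; bound = bound′
                ; supp = λ { zero l′ ¬p → trans (*-congʳ (r-supp l′ ¬p)) (zeroˡ _)
                           ; (suc k) l′ ¬p → trans (+-cong (supp S k l′ ¬p) (trans (-‿cong (trans (*-congˡ (trans (*-congʳ (r-supp l′ ¬p)) (zeroˡ _))) (zeroʳ _))) -0#≈0#)) (+-identityʳ 0#) }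
                ; J-pos = λ { zero → pos-l ; (suc k) → J-pos S k } }
                where
                p0 : ∀ k k′ → k ≢ k′ → e′ k (suc (J′ k′)) ≈ 0#
                p0 zero zero ne = ⊥-elim (ne ≡.refl)
                p0 zero (suc k′) _ = e*-J k′
                p0 (suc k) zero _ = trans (+-congˡ (-‿cong (trans (*-congˡ e*-l) (*-identityʳ _)))) (-‿inverseʳ _)
                p0 (suc k) (suc k′) ne = trans (+-cong (pivot-0 S k k′ (λ e → ne (≡.cong suc e))) (trans (-‿cong (trans (*-congˡ (e*-J k′)) (zeroʳ _))) -0#≈0#)) (+-identityʳ 0#)
              sizes : size S′ ≡ suc (size S)
              sizes = countWith-suc (m S) (flag S)

          -- The gradient of `b` is covered already, so `b` adds at most a constant.
          extendFlag : flag S ≡ false → (∀ l → r (suc l) ≈ 0#) →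
                       Extension
          extendFlag f r≈0 = S′ , sizes , (λ w cov → proj₁ cov , λ ()) , ((λ l → x-y≈0⇒x≈y (r≈0 l)) , λ ())
            where
            S′ : System h Pos
            S′ = record { m = m S ; J = J S ; e = e S ; flag = true ; pivot-1 = pivot-1 S ; pivot-0 = pivot-0 S ; bound = bound S ; supp = supp S ; J-pos = J-pos S }
            sizes : size S′ ≡ suc (size S)
            sizes = ≡.cong suc (≡.sym (≡.cong (countWith (m S)) f))

          extend : ¬ Covers S b → Extension
          extend ¬cov with em {∃[ l ] ¬ (r (suc l) ≈ 0#)}
          ... | yes (l₀ , r≉0) = pick l₀ r≉0 (argmaxOver l₀)
            where
            -- The pivot maximises the residue relative to `h`, not absolutely; this yields the
            -- field `bound`.
            argmaxOver : Fin d → ∃[ l ] (∀ l′ → ∣ r (suc l′) ∣ᴿ * h l′ ⁻¹ ≤ ∣ r (suc l) ∣ᴿ * h l ⁻¹)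
            argmaxOver l₀ = go {d} l₀ (λ l → ∣ r (suc l) ∣ᴿ * h l ⁻¹)
              where
              go : ∀ {n} → Fin n → (f : Fin n → Carrier) → ∃[ i ] ∀ j → f j ≤ f i
              go {suc n} _ f = argmax f
            pick : ∀ l₀ → ¬ (r (suc l₀) ≈ 0#) → ∃[ l ] (∀ l′ → ∣ r (suc l′) ∣ᴿ * h l′ ⁻¹ ≤ ∣ r (suc l) ∣ᴿ * h l ⁻¹) → Extension
            pick l₀ r≉0 (l , mx) = extendPivot l r-l≉0 r-max
              where
              r-max : ∀ l′ → ∣ r (suc l′) ∣ᴿ * h l ≤ ∣ r (suc l) ∣ᴿ * h l′
              r-max l′ = ≤-resp (e₁ (h l) ∣ r (suc l′) ∣ᴿ (0<h l′)) (e₂ ∣ r (suc l) ∣ᴿ (h l′) (0<h l)) (*-monoʳ-≤ (<⇒≤ (*-pos (0<h l) (0<h l′))) (mx l′))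
                where
                e₁ : ∀ a x {y} → 0# < y → x * y ⁻¹ * (a * y) ≈ x * a
                e₁ a x {y} 0<y = trans (solve 4 (λ a x y yi → x :* yi :* (a :* y) := x :* a :* (y :* yi)) refl a x y (y ⁻¹)) (trans (*-congˡ (⁻¹-inverseʳ y (0<⇒≉ 0<y))) (*-identityʳ _))
                e₂ : ∀ x b {a} → 0# < a → x * a ⁻¹ * (a * b) ≈ x * b
                e₂ x b {a} 0<a = trans (solve 4 (λ a x b ai → x :* ai :* (a :* b) := x :* b :* (a :* ai)) refl a x b (a ⁻¹)) (trans (*-congˡ (⁻¹-inverseʳ a (0<⇒≉ 0<a))) (*-identityʳ _))
              r-l≉0 : ¬ (r (suc l) ≈ 0#)
              r-l≉0 e = r≉0 (abs-≤0⇒≈0 (*-cancelʳ-≤ (⁻¹-pos (0<h l₀)) (≤-respʳ (trans (trans (*-congʳ (abs-0 e)) (zeroˡ _)) (sym (zeroˡ _))) (mx l₀))))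
          ... | no ¬p = byFlag (flag S) ≡.refl
            where
            r≈0 : ∀ l → r (suc l) ≈ 0#
            r≈0 l with em {r (suc l) ≈ 0#}
            ... | yes q = q
            ... | no ¬q = ⊥-elim (¬p (l , ¬q))
            byFlag : ∀ f → flag S ≡ f → Extension
            byFlag false f = extendFlag f r≈0
            byFlag true f = ⊥-elim (¬cov ((λ l → x-y≈0⇒x≈y (r≈0 l)) , λ f′ → ⊥-elim (t≢f (≡.trans (≡.sym f) f′))))
              where
              t≢f : true ≢ false
              t≢f ()

  -- Greedy covers by independent integer functions, and small combinations of them.

  module Combinations where
    open OrderedField
    open FiniteSums
    open LinearFormsPigeonhole
    open AffineSystems

    module _ {d : ℕ} {h : Fin d → Carrier} {Pos : Fin d → Set} (0<h : ∀ l → 0# < h l)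
      (𝒜 : Vector ℤ (suc d) → Set) (𝒜-supp : ∀ a → 𝒜 a → ∀ l → ¬ Pos l → ζ (a (suc l)) ≈ 0#) where

      open System

      CoverSize : ℕ → Set
      CoverSize n = Σ[ S ∈ System h Pos ] (size S ≡ n × (∀ a → 𝒜 a → Covers S (toAff a)))

      IndependentMembers : System h Pos → ℕ → Set
      IndependentMembers S n = Σ[ b ∈ (Fin n → Vector ℤ (suc d)) ] ((∀ k → 𝒜 (b k)) × Independent b × (∀ k → Covers S (toAff (b k))))

      Build : ℕ → Set
      Build n = (∃[ k ] (k ℕ.< n × CoverSize k)) ⊎ (Σ[ S ∈ System h Pos ] (size S ≡ n × IndependentMembers S n))

      -- Greedy choice: a member that is not covered extends the system and the independent family
      -- at once; if there is none, the present system covers everything.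
      build : ∀ n → Build n
      build zero = inj₂ (empty 0<h , ≡.refl , (λ ()) , (λ ()) , (λ _ _ ()) , (λ ()))
      build (suc n) = step (build n)
        where
        step : Build n → Build (suc n)
        step (inj₁ (k , k<n , cov)) = inj₁ (k , ℕ.m<n⇒m<1+n k<n , cov)
        step (inj₂ (S , size≡n , b , b∈ , ind , cov)) with em {∃[ a ] (𝒜 a × ¬ Covers S (toAff a))}
        ... | no ¬p = inj₁ (n , ℕ.n<1+n n , S , size≡n , λ a a∈ → classically (Covers S (toAff a)) id λ ¬c → ⊥-elim (¬p (a , a∈ , ¬c)))
        ... | yes (a , a∈ , ¬cov) = grow (extend 0<h S (toAff a) (𝒜-supp a a∈) ¬cov)
          where
          b′ : Fin (suc n) → Vector ℤ (suc d)
          b′ zero = a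
          b′ (suc k) = b k
          ind′ : Independent b′
          ind′ c rel = λ { zero → c₀≡0 ; (suc k) → ind (c ∘ suc) rest k }
            where
            split : ∀ i → ζ (c zero) * ζ (a i) + ∑ (λ k → ζ (c (suc k)) * ζ (b k i)) ≈ 0#
            split i = trans (sym (∑-suc (λ k → ζ (c k) * ζ (b′ k i)))) (rel i)
            c₀≡0 : c zero ≡ 0ℤ
            c₀≡0 with c zero ℤ.≟ 0ℤ
            ... | yes p = p
            -- Dividing a relation by a nonzero `c zero` would express `a` through covered
            -- functions.
            ... | no c₀≢0 = ⊥-elim (¬cov (Covers-comb S (λ k → - (c₀⁻¹ * ζ (c (suc k)))) (λ k → toAff (b k)) {toAff a} cov a≈))
              where
              c₀≉0 : ¬ (ζ (c zero) ≈ 0#)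
              c₀≉0 e = c₀≢0 (ζ-<1⇒≡0 _ (≤-<-trans (≈⇒≤ (abs-0 e)) 0<1))
              c₀⁻¹ : Carrier
              c₀⁻¹ = ζ (c zero) ⁻¹
              a≈ : ∀ i → ζ (a i) ≈ ∑ (λ k → - (c₀⁻¹ * ζ (c (suc k))) * ζ (b k i))
              a≈ i = begin
                ζ (a i) ≈⟨ solve 2 (λ a s → a := (a :+ s) :- s) refl (ζ (a i)) (c₀⁻¹ * s) ⟩
                (ζ (a i) + c₀⁻¹ * s) - c₀⁻¹ * s ≈⟨ +-congʳ (trans (+-congʳ (sym (trans (*-congʳ (⁻¹-inverseˡ c₀≉0)) (*-identityˡ _)))) (trans (+-congʳ (*-assoc _ _ _)) (trans (sym (distribˡ c₀⁻¹ _ _)) (trans (*-congˡ (split i)) (zeroʳ _))))) ⟩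
                0# - c₀⁻¹ * s ≈⟨ +-identityˡ _ ⟩
                - (c₀⁻¹ * s) ≈⟨ -‿distribˡ-* c₀⁻¹ s ⟩
                - c₀⁻¹ * s ≈⟨ ∑-*ˡ (- c₀⁻¹) (λ k → ζ (c (suc k)) * ζ (b k i)) ⟩
                ∑ (λ k → - c₀⁻¹ * (ζ (c (suc k)) * ζ (b k i))) ≈⟨ ∑-cong (λ k → solve 3 (λ x y z → :- x :* (y :* z) := :- (x :* y) :* z) refl c₀⁻¹ (ζ (c (suc k))) (ζ (b k i))) ⟩
                ∑ (λ k → - (c₀⁻¹ * ζ (c (suc k))) * ζ (b k i)) ∎
                where
                open ≈R
                s : Carrier
                s = ∑ (λ k → ζ (c (suc k)) * ζ (b k i))
            rest : ∀ i → ∑ (λ k → ζ (c (suc k)) * ζ (b k i)) ≈ 0#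
            rest i = trans (sym (+-identityˡ _)) (trans (+-congʳ (sym (trans (*-congʳ (trans (reflexive (≡.cong ζ c₀≡0)) ζ-0)) (zeroˡ _)))) (split i))
          grow : Extension 0<h S (toAff a) (𝒜-supp a a∈) → Build (suc n)
          grow (S′ , size′ , up , new) = inj₂ (S′ , ≡.trans size′ (≡.cong suc size≡n) , b′ , (λ { zero → a∈ ; (suc k) → b∈ k }) , ind′ ,
            λ { zero → new ; (suc k) → up (toAff (b k)) (cov k) })

      m≤d : (S : System h Pos) → m S ℕ.≤ d
      m≤d S = Fin.injective⇒≤ (J-injective S)

      size≤ : (S : System h Pos) → size S ℕ.≤ suc d
      size≤ S = ℕ.≤-trans (countWith≤ (flag S)) (s≤s (m≤d S))
        where
        countWith≤ : ∀ f → countWith (m S) f ℕ.≤ suc (m S)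
        countWith≤ true = ℕ.≤-refl
        countWith≤ false = ℕ.n≤1+n _

      -- A system has at most d pivots and one flag, so the greedy choice cannot succeed d + 2
      -- times.
      covered : ∃[ k ] (k ℕ.≤ suc d × CoverSize k)
      covered = choose (build (suc (suc d)))
        where
        choose : Build (suc (suc d)) → ∃[ k ] (k ℕ.≤ suc d × CoverSize k)
        choose (inj₁ (k , s≤s k≤ , cov)) = k , k≤ , cov
        choose (inj₂ (S , e , _)) = ⊥-elim (ℕ.1+n≰n (≡.subst (ℕ._≤ suc d) e (size≤ S)))

    three : Carrier
    three = 1# + (1# + 1#)

    -- The loss in recovering all coefficients from the pivots: m terms, pivot coefficients known up
    -- to a factor m, and the factor 2^m of a system. Taking d + 1 instead of d makes the resulting
    -- inequalities strict.
    κ : ℕ → Carrier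
    κ d = ι (suc d) * (ι (suc d) * two ^ d)

    -- The pigeonhole constant (3(d + 1))^(d + 1) after all d + 1 targets have been divided by
    -- `κ d`.
    Ω : ℕ → Carrier
    Ω d = (three * (ι (suc d) * κ d)) ^ suc d

    1≤κ : ∀ d → 1# ≤ κ d
    1≤κ d = ≤-trans (1≤ι d) (x≤x*y (0≤ι _) (≤-trans (1≤ι d) (x≤x*y (0≤ι _) (1≤^ d 1≤two))))

    0<κ : ∀ d → 0# < κ d
    0<κ d = <-≤-trans 0<1 (1≤κ d)

    1≤* : ∀ {x y} → 1# ≤ x → 1# ≤ y → 1# ≤ x * y
    1≤* p q = ≤-trans p (x≤x*y (≤-trans 0≤1 p) q)

    1≤three : 1# ≤ three
    1≤three = lin (+-nonNeg 0≤1 0≤1) (solve 0 ((con (+ 1) :+ (con (+ 1) :+ con (+ 1))) :+ con 0ℤ := con (+ 1) :+ (con (+ 1) :+ con (+ 1))) refl)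

    1≤Ω : ∀ d → 1# ≤ Ω d
    1≤Ω d = 1≤^ (suc d) (1≤* 1≤three (1≤* (1≤ι d) (1≤κ d)))

    module _ {d : ℕ} where

      combine : ∀ {k} → (Fin k → ℤ) → (Fin k → Vector ℤ (suc d)) → Vector ℤ (suc d)
      combine n b i = ∑ℤ {d} (λ k → n k ℤ.* b k i)

      combine-ζ : ∀ {k} (n : Fin k → ℤ) (b : Fin k → Vector ℤ (suc d)) i → ζ (combine n b i) ≈ ∑ (λ k → ζ (n k) * ζ (b k i))
      combine-ζ n b i = trans (ζ-∑ {d} (λ k → n k ℤ.* b k i)) (∑-cong λ k → ζ-* (n k) (b k i))

      combine≢0 : ∀ {k} (n : Fin k → ℤ) (b : Fin k → Vector ℤ (suc d)) → Independent b → (∃[ k ] n k ≢ 0ℤ) → ∃[ i ] combine n b i ≢ 0ℤ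
      combine≢0 n b ind (k , nk) with em {∃[ i ] combine n b i ≢ 0ℤ}
      ... | yes p = p
      ... | no ¬p = ⊥-elim (nk (ind n (λ i → trans (sym (combine-ζ n b i)) (z i)) k))
        where
        z : ∀ i → ζ (combine n b i) ≈ 0#
        z i with combine n b i ℤ.≟ 0ℤ
        ... | yes p = trans (reflexive (≡.cong ζ p)) ζ-0
        ... | no ¬q = ⊥-elim (¬p (i , ¬q))

      eval-combine : ∀ {k} (n : Fin k → ℤ) (b : Fin k → Vector ℤ (suc d)) x →
                     eval (toAff (combine n b)) x ≈ ∑ (λ k → ζ (n k) * eval (toAff (b k)) x)
      eval-combine n b x = trans (eval-cong x (combine-ζ n b)) (eval-comb (λ k → ζ (n k)) (λ k → toAff (b k)) x)

      SmallCombination : ∀ {m} (J : Fin m → Fin d) (b : Fin (suc m) → Vector ℤ (suc d)) (h : Fin d → Carrier)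
        (φ : Fin (suc m) → Carrier) (β : Fin m → Carrier) (H : Carrier) → Set
      SmallCombination {m} J b h φ β H = Σ[ n ∈ (Fin (suc m) → ℤ) ] ((∃[ i ] combine n b i ≢ 0ℤ)
          × (∀ i → ∣ ζ (combine n b (suc (J i))) ∣ᴿ ≤ κ d ⁻¹ * h (J i))
          × ∣ ∑ (λ k → ζ (n k) * (φ k + ∑ (λ i → β i * ζ (b k (suc (J i)))))) ∣ᴿ ≤ κ d ⁻¹ * H)

      -- The forms are the coefficients at the positions `J`. The last form is left open so that it
      -- can be a value or, by means of `β`, one more coefficient. Independence turns nonzero
      -- multipliers into a nonzero function.
      smallCombination : ∀ {m} → m ℕ.≤ d → (J : Fin m → Fin d) (b : Fin (suc m) → Vector ℤ (suc d)) → Independent b →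
        (h μ : Fin d → Carrier) → (∀ l → 0# < h l) → (∀ l → 1# ≤ μ l) → (∀ k l → ∣ ζ (b k (suc l)) ∣ᴿ ≤ μ l * h l) →
        (φ : Fin (suc m) → Carrier) (β : Fin m → Carrier) → ∀ {ρ H} → 0# < ρ → 0# < H → (∀ k → ∣ φ k ∣ᴿ ≤ ρ) →
        Ω d * (∏ (μ ∘ J) * ρ) ≤ H → SmallCombination J b h φ β H
      smallCombination {m} m≤d J b ind h μ 0<h 1≤μ b≤ φ β {ρ} {H} 0<ρ 0<H φ≤ cost = finish
        (pigeonhole ℓ φ β (λ i → μ (J i) * κ d) (ρ * (κ d * H ⁻¹)) (λ i → κ d ⁻¹ * h (J i)) (κ d ⁻¹ * H)
          (λ i → 1≤* (1≤μ (J i)) (1≤κ d)) (λ i → *-pos (⁻¹-pos (0<κ d)) (0<h (J i))) ℓ≤ (*-pos 0<ρ (*-pos (0<κ d) (⁻¹-pos 0<H)))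
          (*-pos (⁻¹-pos (0<κ d)) 0<H) (λ k → ≤-respʳ (sym e₁) (φ≤ k)) small)
        where
        ℓ : Fin m → Fin (suc m) → Carrier
        ℓ i k = ζ (b k (suc (J i)))
        κκ : κ d * κ d ⁻¹ ≈ 1#
        κκ = ⁻¹-inverseʳ (κ d) (0<⇒≉ (0<κ d))
        HH : H * H ⁻¹ ≈ 1#
        HH = ⁻¹-inverseʳ H (0<⇒≉ 0<H)
        ℓ≤ : ∀ i k → ∣ ℓ i k ∣ᴿ ≤ μ (J i) * κ d * (κ d ⁻¹ * h (J i))
        ℓ≤ i k = ≤-respʳ (sym (trans (solve 4 (λ m k ki h → m :* k :* (ki :* h) := (k :* ki) :* (m :* h)) refl (μ (J i)) (κ d) (κ d ⁻¹) (h (J i)))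
          (trans (*-congʳ κκ) (*-identityˡ _)))) (b≤ k (J i))
        e₁ : ρ * (κ d * H ⁻¹) * (κ d ⁻¹ * H) ≈ ρ
        e₁ = trans (solve 5 (λ r k ki h hi → r :* (k :* hi) :* (ki :* h) := r :* ((k :* ki) :* (h :* hi))) refl ρ (κ d) (κ d ⁻¹) H (H ⁻¹))
          (trans (*-congˡ (trans (*-cong κκ HH) (*-identityˡ _))) (*-identityʳ _))
        small : (three * ι (suc m)) ^ suc m * (∏ (λ i → μ (J i) * κ d) * (ρ * (κ d * H ⁻¹))) ≤ 1#
        small = ≤-trans (≈⇒≤ e₂) (≤-trans (*-monoʳ-≤ (*-nonNeg (∏-nonNeg λ i → ≤-trans 0≤1 (1≤μ (J i))) (*-nonNeg (<⇒≤ 0<ρ) (<⇒≤ (⁻¹-pos 0<H)))) (pow≤)) (≤-trans (≈⇒≤ e₃) (≤-respʳ HH (*-monoʳ-≤ (<⇒≤ (⁻¹-pos 0<H)) cost))))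
          where
          e₃ : Ω d * (∏ (μ ∘ J) * (ρ * H ⁻¹)) ≈ Ω d * (∏ (μ ∘ J) * ρ) * H ⁻¹
          e₃ = solve 4 (λ o p r h → o :* (p :* (r :* h)) := o :* (p :* r) :* h) refl (Ω d) (∏ (μ ∘ J)) ρ (H ⁻¹)
          e₂ : (three * ι (suc m)) ^ suc m * (∏ (λ i → μ (J i) * κ d) * (ρ * (κ d * H ⁻¹))) ≈ (three * (ι (suc m) * κ d)) ^ suc m * (∏ (μ ∘ J) * (ρ * H ⁻¹))
          e₂ = trans (*-congˡ (*-congʳ (trans (∏-* (μ ∘ J) (λ _ → κ d)) (*-congˡ (∏-const m (κ d))))))
            (trans (solve 6 (λ t p km r k hi → t :* ((p :* km) :* (r :* (k :* hi))) := (t :* (k :* km)) :* (p :* (r :* hi))) refl ((three * ι (suc m)) ^ suc m) (∏ (μ ∘ J)) (κ d ^ m) ρ (κ d) (H ⁻¹))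
            (*-congʳ (trans (sym (^-distrib-* (three * ι (suc m)) (κ d) (suc m))) (^-congˡ (suc m) (*-assoc _ _ _)))))
          pow≤ : (three * (ι (suc m) * κ d)) ^ suc m ≤ Ω d
          pow≤ = ≤-trans (^-monoˡ-≤ (suc m) (*-nonNeg (≤-trans 0≤1 1≤three) (*-nonNeg (0≤ι _) (<⇒≤ (0<κ d)))) (*-monoˡ-≤ (≤-trans 0≤1 1≤three) (*-monoʳ-≤ (<⇒≤ (0<κ d)) (ι-mono-≤ (s≤s m≤d)))))
            (^-monoʳ-≤ (1≤* 1≤three (1≤* (1≤ι d) (1≤κ d))) (s≤s m≤d))
        finish : Σ[ n ∈ (Fin (suc m) → ℤ) ] ((∃[ k ] n k ≢ 0ℤ)
          × (∀ i → ∣ ∑ (λ k → ζ (n k) * ℓ i k) ∣ᴿ ≤ κ d ⁻¹ * h (J i))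
          × ∣ ∑ (λ k → ζ (n k) * (φ k + ∑ (λ i → β i * ℓ i k))) ∣ᴿ ≤ κ d ⁻¹ * H) → SmallCombination J b h φ β H
        finish (n , nz , p , q) = n , combine≢0 n b ind nz , (λ i → ≤-respˡ (abs-cong (sym (combine-ζ n b (suc (J i))))) (p i)) , q

  -- Integer combinations with small coefficients and small value.

  module SmallFunctions where
    open OrderedField
    open FiniteSums
    open LinearFormsPigeonhole
    open AffineSystems
    open Combinations

    κ-dominates : ∀ {m d} → m ℕ.≤ d → ι m * (ι m * two ^ m) < κ d
    κ-dominates {m} {d} m≤d = ≤-<-trans
      (*-mono-≤ (*-nonNeg (0≤ι m) (^-nonNeg m (<⇒≤ 0<two))) (0≤ι d) (ι-mono-≤ m≤d)
        (*-mono-≤ (^-nonNeg m (<⇒≤ 0<two)) (0≤ι (suc d)) (ι-mono-≤ (ℕ.m≤n⇒m≤1+n m≤d)) (^-monoʳ-≤ 1≤two m≤d)))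
      (*-monoʳ-< (*-pos (0<ι d) (^-pos d 0<two)) (ι<ι-suc d))

    /-κ : ∀ {d x z} → x < κ d → 0# < z → x * (κ d ⁻¹ * z) < z
    /-κ {d} {x} {z} x<κ 0<z = <-resp refl (trans (sym (*-assoc _ _ _)) (trans (*-congʳ (⁻¹-inverseʳ (κ d) (0<⇒≉ (0<κ d)))) (*-identityˡ z)))
      (*-monoʳ-< (*-pos (⁻¹-pos (0<κ d)) 0<z) x<κ)

    1<κ : ∀ {d} → 1 ℕ.≤ d → 1# < κ d
    1<κ {d} 1≤d = ≤-<-trans (≤-trans (≈⇒≤ (sym ι-1)) (x≤x*y (0≤ι 1) (≤-trans (≈⇒≤ (sym ι-1)) (x≤x*y (0≤ι 1) (1≤^ 1 1≤two))))) (κ-dominates 1≤d)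

    κ⁻¹z<z : ∀ {d z} → 1 ℕ.≤ d → 0# < z → κ d ⁻¹ * z < z
    κ⁻¹z<z 1≤d 0<z = <-resp (*-identityˡ _) refl (/-κ (1<κ 1≤d) 0<z)

    abs-/ : ∀ y {x} → 0# < ∣ x ∣ᴿ → ∣ y * x ⁻¹ ∣ᴿ ≈ ∣ y ∣ᴿ * ∣ x ∣ᴿ ⁻¹
    abs-/ y {x} 0<x = trans (sym (trans (*-congˡ (⁻¹-inverseʳ ∣ x ∣ᴿ (0<⇒≉ 0<x))) (*-identityʳ _))) (trans (sym (*-assoc _ _ _))
      (*-congʳ (trans (sym (abs-* (y * x ⁻¹) x)) (abs-cong (/-cancel y x≉0)))))
      where
      x≉0 : ¬ (x ≈ 0#)
      x≉0 e = 0<⇒≉ 0<x (abs-0 e)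

    -- The number of pivots is a field of a system, so only a propositional equation m ≡ suc n is at
    -- hand; this record hides `punchIn` behind it.
    record Splitting {m n : ℕ} (i : Fin m) : Set₁ where
      field
        I         : Fin n → Fin m
        ∑-split   : ∀ (f : Fin m → Carrier) → ∑ f ≈ f i + ∑ (f ∘ I)
        ∏-split   : ∀ (f : Fin m → Carrier) → ∏ f ≈ f i * ∏ (f ∘ I)
        injective : Injective _≡_ _≡_ I
        I≢i       : ∀ j → I j ≢ i
        elim      : ∀ {P : Fin m → Set} → P i → (∀ j → P (I j)) → ∀ k → P k

    splitting : ∀ {m n} → m ≡ suc n → (i : Fin m) → Splitting {m} {n} i
    splitting ≡.refl i = record
      { I = punchIn i ; ∑-split = ∑-remove i ; ∏-split = ∏-remove i
      ; injective = Fin.punchIn-injective i _ _ ; I≢i = Fin.punchInᵢ≢i i ; elim = el }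
      where
      el : ∀ {P : Fin _ → Set} → P i → (∀ j → P (punchIn i j)) → ∀ k → P k
      el {P} p q k with i Fin.≟ k
      ... | yes ≡.refl = p
      ... | no i≢k = ≡.subst P (Fin.punchIn-punchOut i≢k) (q (Fin.punchOut i≢k))

    abs-∑-≤ : ∀ {n} {f : Fin n → Carrier} {z} → (∀ k → ∣ f k ∣ᴿ ≤ z) → ∣ ∑ f ∣ᴿ ≤ ι n * z
    abs-∑-≤ {f = f} p = ≤-trans (abs-∑ f) (∑-≤-const p)

    -- Integers below 1 in absolute value vanish, so the function is constant, and its value is an
    -- integer below 1 as well.
    trivial : ∀ {d} (a : Vector ℤ (suc d)) y → (∀ l → ∣ ζ (a (suc l)) ∣ᴿ < 1#) → ∣ eval (toAff a) y ∣ᴿ < 1# → (∃[ i ] a i ≢ 0ℤ) → ⊥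
    trivial {d} a y p q (i , ai≢0) = ai≢0 (all i)
      where
      coeff : ∀ l → a (suc l) ≡ 0ℤ
      coeff l = ζ-<1⇒≡0 _ (p l)
      eval≈ : eval (toAff a) y ≈ ζ (a zero)
      eval≈ = trans (+-congˡ (∑-0 λ l → trans (*-congʳ (trans (reflexive (≡.cong ζ (coeff l))) ζ-0)) (zeroˡ _))) (+-identityʳ _)
      all : ∀ i → a i ≡ 0ℤ
      all zero = ζ-<1⇒≡0 _ (≤-<-trans (≈⇒≤ (abs-cong (sym eval≈))) q)
      all (suc l) = coeff l

    module _ {d : ℕ} (1≤d : 1 ℕ.≤ d) {h : Fin d → Carrier} {Pos : Fin d → Set} (0<h : ∀ l → 0# < h l)
      (S : System h Pos) (x : Vector Carrier d) where

      open System S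

      Target : Carrier → Set
      Target ρ′ = Σ[ w ∈ Vector ℤ (suc d) ] ((∃[ i ] w i ≢ 0ℤ) × (∀ l → ∣ ζ (w (suc l)) ∣ᴿ < h l) × ∣ eval (toAff w) x ∣ᴿ < ρ′)

      pivots≤ : m ℕ.≤ d
      pivots≤ = Fin.injective⇒≤ J-injective

      spread : ∀ w → (∀ l → w (suc l) ≈ expand w (suc l)) → (∀ k → ∣ w (suc (J k)) ∣ᴿ ≤ ι m * (κ d ⁻¹ * h (J k))) →
               ∀ l → ∣ w (suc l) ∣ᴿ < h l
      spread w cov p l = ≤-<-trans (≤-trans (≈⇒≤ (abs-cong (cov l))) (≤-trans (abs-∑-≤ term) (≈⇒≤
          (solve 4 (λ m k t h → m :* ((m :* k) :* (t :* h)) := (m :* (m :* t)) :* (k :* h)) refl (ι m) (κ d ⁻¹) (two ^ m) (h l)))))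
        (/-κ (κ-dominates pivots≤) (0<h l))
        where
        term : ∀ k → ∣ w (suc (J k)) * e k (suc l) ∣ᴿ ≤ (ι m * κ d ⁻¹) * (two ^ m * h l)
        term k = ≤-trans (≈⇒≤ (abs-* _ _)) (≤-trans (*-monoʳ-≤ (abs-nonNeg _) (p k)) (≤-trans
          (≈⇒≤ (solve 4 (λ m k h e → m :* (k :* h) :* e := (m :* k) :* (e :* h)) refl (ι m) (κ d ⁻¹) (h (J k)) ∣ e k (suc l) ∣ᴿ))
          (*-monoˡ-≤ (*-nonNeg (0≤ι m) (<⇒≤ (⁻¹-pos (0<κ d)))) (bound k l))))

      ev : Fin m → Carrier
      ev k = eval (e k) x

      evalExpand : flag ≡ false → ∀ {w} → Covers w → eval w x ≈ ∑ (λ k → w (suc (J k)) * ev k)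
      evalExpand f {w} (c , c₀) = trans (eval-cong {a = w} {b = expand w} x (λ { zero → c₀ f ; (suc l) → c l })) (eval-comb (λ k → w (suc (J k))) e x)

      κ⁻¹h≤ : 1 ℕ.≤ m → ∀ {y z} → 0# < z → ∣ y ∣ᴿ ≤ κ d ⁻¹ * z → ∣ y ∣ᴿ ≤ ι m * (κ d ⁻¹ * z)
      κ⁻¹h≤ 1≤m {y} {z} 0<z p = ≤-trans p (≤-respˡ (trans (*-congʳ ι-1) (*-identityˡ _)) (*-monoʳ-≤ (<⇒≤ (*-pos (⁻¹-pos (0<κ d)) 0<z)) (ι-mono-≤ 1≤m)))

      -- Once the pivot coefficients vanish, a covered integer function is constant.
      flagContradiction : (b : Fin (suc m) → Vector ℤ (suc d)) → Independent b → (∀ k → Covers (toAff (b k))) →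
        (μ : Fin d → Carrier) → (∀ l → 1# ≤ μ l) → (∀ k l → ∣ ζ (b k (suc l)) ∣ᴿ ≤ μ l) →
        ∀ {ρ} → 0# < ρ → (∀ k → ∣ eval (toAff (b k)) x ∣ᴿ ≤ ρ) → Ω d * (∏ (μ ∘ J) * ρ) ≤ 1# → ⊥
      flagContradiction b ind cov μ 1≤μ b≤ 0<ρ eval≤ cost = finish (smallCombination pivots≤ J b ind (λ _ → 1#) μ (λ _ → 0<1) 1≤μ
          (λ k l → ≤-respʳ (sym (*-identityʳ _)) (b≤ k l)) (λ k → eval (toAff (b k)) x) (λ _ → 0#) 0<ρ 0<1 eval≤ cost)
        where
        finish : SmallCombination J b (λ _ → 1#) (λ k → eval (toAff (b k)) x) (λ _ → 0#) 1# → ⊥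
        finish (c , nz , p , q) = trivial (combine c b) x (λ l → ≤-<-trans (≈⇒≤ (abs-0 (w≈0 l))) 0<1)
            (≤-<-trans (≤-respˡ (abs-cong (trans (∑-cong λ k → *-congˡ (trans (+-congˡ (∑-0 λ i → zeroˡ _)) (+-identityʳ _))) (sym (eval-combine c b x)))) q) (κ⁻¹z<z 1≤d 0<1)) nz
          where
          w : Aff
          w = toAff (combine c b)
          w≈0 : ∀ l → w (suc l) ≈ 0#
          w≈0 l = trans (proj₁ (Covers-comb (λ k → ζ (c k)) (λ k → toAff (b k)) {w} cov (combine-ζ c b)) l)
            (∑-0 λ k → trans (*-congʳ (trans (reflexive (≡.cong ζ (ζ-<1⇒≡0 _ (≤-<-trans (p k) (κ⁻¹z<z 1≤d 0<1))))) ζ-0)) (zeroˡ _))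

      module _ {n : ℕ} (b : Fin (suc n) → Vector ℤ (suc d)) (ind : Independent b) (cov : ∀ k → Covers (toAff (b k)))
        (μ : Fin d → Carrier) (1≤μ : ∀ l → 1# ≤ μ l) (b≤ : ∀ k l → ∣ ζ (b k (suc l)) ∣ᴿ ≤ μ l * h l)
        {ρ ρ′ : Carrier} (0<ρ : 0# < ρ) (0<ρ′ : 0# < ρ′) (eval≤ : ∀ k → ∣ eval (toAff (b k)) x ∣ᴿ ≤ ρ) where

        private
          cov-combine : ∀ c → Covers (toAff (combine c b))
          cov-combine c = Covers-comb (λ k → ζ (c k)) (λ k → toAff (b k)) {toAff (combine c b)} cov (combine-ζ c b)

          eval-small : ∀ c (J′ : Fin n → Fin d) → ∣ ∑ (λ k → ζ (c k) * (eval (toAff (b k)) x + ∑ (λ i → 0# * ζ (b k (suc (J′ i)))))) ∣ᴿ ≤ κ d ⁻¹ * ρ′ →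
                       ∣ eval (toAff (combine c b)) x ∣ᴿ ≤ κ d ⁻¹ * ρ′
          eval-small c J′ q = ≤-respˡ (abs-cong (trans (∑-cong λ k → *-congˡ (trans (+-congˡ (∑-0 λ i → zeroˡ _)) (+-identityʳ _))) (sym (eval-combine c b x)))) q

        module _ (m≡ : m ≡ suc n) (f : flag ≡ false) (i : Fin m) where
          private
            module Sp = Splitting (splitting m≡ i)
            I : Fin n → Fin m
            I = Sp.I
            1≤m : 1 ℕ.≤ m
            1≤m = ≡.subst (1 ℕ.≤_) (≡.sym m≡) (s≤s z≤n)
            n≤d : n ℕ.≤ d
            n≤d = ℕ.≤-trans (ℕ.n≤1+n n) (≡.subst (ℕ._≤ d) m≡ pivots≤)
            evalSplit : ∀ {w} → Covers w → eval w x ≈ w (suc (J i)) * ev i + ∑ (λ j → w (suc (J (I j))) * ev (I j))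
            evalSplit {w} c = trans (evalExpand f {w} c) (Sp.∑-split (λ k → w (suc (J k)) * ev k))

          -- There are n + 1 integer unknowns but n + 2 requirements: n + 1 pivot coefficients and
          -- the value. When the contribution of pivot `i` dominates, its coefficient can be
          -- recovered from the value and the other coefficients, so this requirement is dropped.
          largeValueTarget : (∀ k → ∣ ev k ∣ᴿ * h (J k) ≤ ∣ ev i ∣ᴿ * h (J i)) → ρ′ < ∣ ev i ∣ᴿ * h (J i) →
                             Ω d * (∏ (μ ∘ J ∘ I) * ρ) ≤ ρ′ → Target ρ′
          largeValueTarget mx large cost = finish (smallCombination n≤d (J ∘ I) b ind h μ 0<h 1≤μ b≤ (λ k → eval (toAff (b k)) x) (λ _ → 0#) 0<ρ 0<ρ′ eval≤ cost)
            where
            0<ev : 0# < ∣ ev i ∣ᴿ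
            0<ev = ≰⇒> λ q → <⇒≱ (≤-<-trans (<⇒≤ 0<ρ′) large) (≤-respʳ (zeroˡ _) (*-monoʳ-≤ (<⇒≤ (0<h (J i))) q))
            finish : SmallCombination (J ∘ I) b h (λ k → eval (toAff (b k)) x) (λ _ → 0#) ρ′ → Target ρ′
            finish (c , nz , p , q) = combine c b , nz ,
              spread w (proj₁ (cov-combine c)) (Sp.elim {λ k → ∣ w (suc (J k)) ∣ᴿ ≤ ι m * (κ d ⁻¹ * h (J k))} at-i (λ j → κ⁻¹h≤ 1≤m (0<h _) (p j))) ,
              ≤-<-trans evw≤ (κ⁻¹z<z 1≤d 0<ρ′)
              where
              w : Aff
              w = toAff (combine c b)
              evw≤ : ∣ eval w x ∣ᴿ ≤ κ d ⁻¹ * ρ′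
              evw≤ = eval-small c (J ∘ I) q
              R : Carrier
              R = ∑ (λ j → w (suc (J (I j))) * ev (I j))
              Z : Carrier
              Z = κ d ⁻¹ * (∣ ev i ∣ᴿ * h (J i))
              0≤κ⁻¹ : 0# ≤ κ d ⁻¹
              0≤κ⁻¹ = <⇒≤ (⁻¹-pos (0<κ d))
              R≤ : ∣ R ∣ᴿ ≤ ι n * Z
              R≤ = abs-∑-≤ λ j → ≤-trans (≈⇒≤ (abs-* _ _)) (≤-trans (*-monoʳ-≤ (abs-nonNeg _) (p j)) (≤-trans
                (≈⇒≤ (solve 3 (λ k h e → k :* h :* e := k :* (e :* h)) refl (κ d ⁻¹) (h (J (I j))) ∣ ev (I j) ∣ᴿ)) (*-monoˡ-≤ 0≤κ⁻¹ (mx (I j)))))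
              prod≤ : ∣ w (suc (J i)) ∣ᴿ * ∣ ev i ∣ᴿ ≤ ι (suc n) * Z
              prod≤ = ≤-trans (≈⇒≤ (trans (sym (abs-* _ _)) (abs-cong (trans (solve 2 (λ a r → a := (a :+ r) :- r) refl (w (suc (J i)) * ev i) R)
                  (+-congʳ (sym (evalSplit {w} (cov-combine c)))))))) (≤-trans (abs-+ _ _) (≤-trans (+-mono-≤ (≤-trans evw≤ (*-monoˡ-≤ 0≤κ⁻¹ (<⇒≤ large))) (≤-trans (≈⇒≤ (abs-neg R)) R≤))
                  (≈⇒≤ (trans (solve 2 (λ n z → z :+ n :* z := (con (+ 1) :+ n) :* z) refl (ι n) Z) (*-congʳ (sym (ι-suc n)))))))
              at-i : ∣ w (suc (J i)) ∣ᴿ ≤ ι m * (κ d ⁻¹ * h (J i))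
              at-i = *-cancelʳ-≤ 0<ev (≤-trans prod≤ (≈⇒≤ (trans (*-congʳ (reflexive (≡.cong ι (≡.sym m≡))))
                (solve 4 (λ m k e h → m :* (k :* (e :* h)) := m :* (k :* h) :* e) refl (ι m) (κ d ⁻¹) ∣ ev i ∣ᴿ (h (J i))))))

          -- Here small pivot coefficients force a small value, so the value is the requirement to
          -- drop. The coefficient at pivot `i` is controlled through the values of the members, at
          -- the cost `ρ` over `∣ ev i ∣ᴿ` in place of the factor `μ (J i)`.
          smallValuesTarget : (∀ k → ∣ ev k ∣ᴿ * h (J k) ≤ ρ′) → 0# < ∣ ev i ∣ᴿ →
                              Ω d * (∏ (μ ∘ J ∘ I) * ρ) ≤ ∣ ev i ∣ᴿ * h (J i) → Target ρ′
          smallValuesTarget ev≤ 0<ev cost = finish (smallCombination n≤d (J ∘ I) b ind h μ 0<h 1≤μ b≤ φ β (*-pos 0<ρ (⁻¹-pos 0<ev)) (0<h (J i)) φ≤ cost′)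
            where
            ev≉0 : ¬ (ev i ≈ 0#)
            ev≉0 z = 0<⇒≉ 0<ev (abs-0 z)
            -- Solving the expansion of the value for the coefficient at pivot `i` gives `φ` plus a
            -- combination, by `β`, of the other pivot coefficients.
            φ : Fin (suc n) → Carrier
            φ k = eval (toAff (b k)) x * ev i ⁻¹
            β : Fin n → Carrier
            β j = - (ev (I j) * ev i ⁻¹)
            φ≤ : ∀ k → ∣ φ k ∣ᴿ ≤ ρ * ∣ ev i ∣ᴿ ⁻¹
            φ≤ k = ≤-respˡ (sym (abs-/ _ 0<ev)) (*-monoʳ-≤ (<⇒≤ (⁻¹-pos 0<ev)) (eval≤ k))
            cost′ : Ω d * (∏ (μ ∘ J ∘ I) * (ρ * ∣ ev i ∣ᴿ ⁻¹)) ≤ h (J i)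
            cost′ = *-cancelˡ-≤ 0<ev (≤-respˡ (sym (trans (solve 5 (λ v o p r vi → v :* (o :* (p :* (r :* vi))) := o :* (p :* r) :* (v :* vi)) refl ∣ ev i ∣ᴿ (Ω d) (∏ (μ ∘ J ∘ I)) ρ (∣ ev i ∣ᴿ ⁻¹))
              (trans (*-congˡ (⁻¹-inverseʳ ∣ ev i ∣ᴿ (0<⇒≉ 0<ev))) (*-identityʳ _)))) cost)
            γ≈ : ∀ k → φ k + ∑ (λ j → β j * ζ (b k (suc (J (I j))))) ≈ ζ (b k (suc (J i)))
            γ≈ k = begin
              φ k + ∑ (λ j → β j * ζ (b k (suc (J (I j)))))
                ≈⟨ +-congˡ (∑-cong λ j → solve 3 (λ v vi z → :- (v :* vi) :* z := (z :* v) :* :- vi) refl (ev (I j)) (ev i ⁻¹) (ζ (b k (suc (J (I j)))))) ⟩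
              φ k + ∑ (λ j → (ζ (b k (suc (J (I j)))) * ev (I j)) * - (ev i ⁻¹))
                ≈⟨ +-congˡ (∑-*ʳ (λ j → ζ (b k (suc (J (I j)))) * ev (I j)) (- (ev i ⁻¹))) ⟨
              φ k + R * - (ev i ⁻¹) ≈⟨ +-congʳ (*-congʳ (evalSplit {toAff (b k)} (cov k))) ⟩
              (ζ (b k (suc (J i))) * ev i + R) * ev i ⁻¹ + R * - (ev i ⁻¹)
                ≈⟨ solve 4 (λ z v r vi → (z :* v :+ r) :* vi :+ r :* :- vi := z :* (v :* vi)) refl (ζ (b k (suc (J i)))) (ev i) R (ev i ⁻¹) ⟩
              ζ (b k (suc (J i))) * (ev i * ev i ⁻¹) ≈⟨ trans (*-congˡ (⁻¹-inverseʳ (ev i) ev≉0)) (*-identityʳ _) ⟩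
              ζ (b k (suc (J i))) ∎
              where
              open ≈R
              R : Carrier
              R = ∑ (λ j → ζ (b k (suc (J (I j)))) * ev (I j))
            finish : SmallCombination (J ∘ I) b h φ β (h (J i)) → Target ρ′
            finish (c , nz , p , q) = combine c b , nz , spread w (proj₁ (cov-combine c)) (λ k → κ⁻¹h≤ 1≤m (0<h (J k)) (w≤ k)) ,
              ≤-<-trans (≤-trans (≈⇒≤ (abs-cong (evalExpand f {w} (cov-combine c)))) (abs-∑-≤ term)) (/-κ ιm<κ 0<ρ′)
              where
              w : Aff
              w = toAff (combine c b)
              w≤ : ∀ k → ∣ w (suc (J k)) ∣ᴿ ≤ κ d ⁻¹ * h (J k)
              w≤ = Sp.elim {λ k → ∣ w (suc (J k)) ∣ᴿ ≤ κ d ⁻¹ * h (J k)} (≤-respˡ (abs-cong (trans (∑-cong λ k → *-congˡ (γ≈ k)) (sym (combine-ζ c b (suc (J i)))))) q) p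
              term : ∀ k → ∣ w (suc (J k)) * ev k ∣ᴿ ≤ κ d ⁻¹ * ρ′
              term k = ≤-trans (≈⇒≤ (abs-* _ _)) (≤-trans (*-monoʳ-≤ (abs-nonNeg _) (w≤ k)) (≤-trans
                (≈⇒≤ (solve 3 (λ k h e → k :* h :* e := k :* (e :* h)) refl (κ d ⁻¹) (h (J k)) ∣ ev k ∣ᴿ)) (*-monoˡ-≤ (<⇒≤ (⁻¹-pos (0<κ d))) (ev≤ k))))
              ιm<κ : ι m < κ d
              ιm<κ = ≤-<-trans (x≤x*y (0≤ι m) (≤-trans (≤-trans (≈⇒≤ (sym ι-1)) (ι-mono-≤ 1≤m)) (x≤x*y (0≤ι m) (1≤^ m 1≤two)))) (κ-dominates pivots≤)

  -- Weights, exponents, and violations of the dual bound.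

  module WeightData where
    open OrderedField
    open FiniteSums
    open LinearFormsPigeonhole
    open AffineSystems
    open Combinations
    open SmallFunctions

    -- The counterpart of `lin` without subtraction: y - x equals t - s.
    linℕ : ∀ {x y s t} → s ℕ.≤ t → y ℕ.+ s ≡ x ℕ.+ t → x ℕ.≤ y
    linℕ {x} {y} {s} {t} s≤t e = ℕ.+-cancelʳ-≤ t x y (≡.subst (ℕ._≤ y ℕ.+ t) e (ℕ.+-monoʳ-≤ y s≤t))

    linℕ′ : ∀ {x y s t} r → s ℕ.≤ t → y ℕ.+ s ≡ r ℕ.+ (x ℕ.+ t) → x ℕ.≤ y
    linℕ′ {x} {y} {s} {t} r s≤t e = ℕ.m+n≤o⇒n≤o r (linℕ {r ℕ.+ x} {y} s≤t (≡.trans e (≡.sym (ℕ.+-assoc r x t))))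

    argmaxOver : ∀ {n} → Fin n → (f : Fin n → Carrier) → ∃[ i ] ∀ j → f j ≤ f i
    argmaxOver {suc n} _ f = argmax f

    ^-* : ∀ x m n → x ^ (m ℕ.* n) ≈ (x ^ m) ^ n
    ^-* x m n = sym (^-assocʳ x m n)

    module Powers (b : Carrier) (1≤b : 1# ≤ b) where
      0<b : 0# < b
      0<b = <-≤-trans 0<1 1≤b

      bi : Carrier
      bi = b ⁻¹

      0<bi : 0# < bi
      0<bi = ⁻¹-pos 0<b

      b^n*bi^n : ∀ n → b ^ n * bi ^ n ≈ 1#
      b^n*bi^n n = trans (sym (^-distrib-* b bi n)) (trans (^-congˡ n (⁻¹-inverseʳ b (0<⇒≉ 0<b))) (1^n n))

      -- This is b^(m - n); two natural exponents avoid integer powers.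
      P : ℕ → ℕ → Carrier
      P m n = b ^ m * bi ^ n

      0<P : ∀ m n → 0# < P m n
      0<P m n = *-pos (^-pos m 0<b) (^-pos n 0<bi)

      P-0 : ∀ m → P m 0 ≈ b ^ m
      P-0 m = *-identityʳ _

      P-* : ∀ m n m′ n′ → P m n * P m′ n′ ≈ P (m ℕ.+ m′) (n ℕ.+ n′)
      P-* m n m′ n′ = trans (solve 4 (λ a c a′ c′ → a :* c :* (a′ :* c′) := a :* a′ :* (c :* c′)) refl (b ^ m) (bi ^ n) (b ^ m′) (bi ^ n′))
        (*-cong (sym (^-homo-* b m m′)) (sym (^-homo-* bi n n′)))

      ^*P : ∀ k m n → b ^ k * P m n ≈ P (k ℕ.+ m) n
      ^*P k m n = trans (sym (*-assoc _ _ _)) (*-congʳ (sym (^-homo-* b k m)))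

      P-shift : ∀ m n k → P (m ℕ.+ k) (n ℕ.+ k) ≈ P m n
      P-shift m n k = trans (sym (P-* m n k k)) (trans (*-congˡ (b^n*bi^n k)) (*-identityʳ _))

      P-mono : ∀ {m n m′ n′} → m ℕ.+ n′ ℕ.≤ m′ ℕ.+ n → P m n ≤ P m′ n′
      P-mono {m} {n} {m′} {n′} p = ≤-resp (P-shift m n n′) (trans (*-congˡ (reflexive (≡.cong (bi ^_) (ℕ.+-comm n n′)))) (P-shift m′ n′ n))
        (*-monoʳ-≤ (^-nonNeg (n ℕ.+ n′) (<⇒≤ 0<bi)) (^-monoʳ-≤ 1≤b p))

      P≤1 : ∀ {m n} → m ℕ.≤ n → P m n ≤ 1#
      P≤1 {m} {n} p = ≤-respʳ (*-identityˡ 1#) (P-mono {m} {n} {0} {0} (≡.subst (ℕ._≤ n) (≡.sym (ℕ.+-identityʳ m)) p))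

      /b^ : ∀ {x n} → x * b ^ n < 1# → x < bi ^ n
      /b^ {x} {n} p = <-resp (trans (*-assoc _ _ _) (trans (*-congˡ (b^n*bi^n n)) (*-identityʳ x))) (*-identityˡ _) (*-monoʳ-< (^-pos n 0<bi) p)

    -- Λ l plays the role of b^(w l) and Pos l that of w l ≠ 0; M t is the least m with Λ top ^ t < b ^ m.
    record Weights (d : ℕ) : Set₁ where
      field
        b        : Carrier
        b-large  : Ω d * (ι (suc d) * ι (suc d)) ≤ b
        Λ        : Fin d → Carrier
        1≤Λ      : ∀ l → 1# ≤ Λ l
        ∏Λ       : ∏ Λ ≤ b
        ∏Λ-lower : b ≤ ∏ Λ
        Pos      : Fin d → Set
        Λ-null   : ∀ l → ¬ Pos l → Λ l ≈ 1#
        g        : ℕ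
        5≤g      : 5 ℕ.≤ g
        Λ-pos    : ∀ l → Pos l → b ≤ Λ l ^ g
        top      : Fin d
        Λ≤top    : ∀ l → Λ l ≤ Λ top
        M        : ℕ → ℕ
        Λ^t<b^M  : ∀ t → Λ top ^ t < b ^ M t
        b^M≤     : ∀ t → b ^ M t ≤ b * Λ top ^ t
        M≤       : ∀ t → M t ℕ.≤ suc t

      1≤b : 1# ≤ b
      1≤b = ≤-trans (1≤* (1≤Ω d) (1≤* (1≤ι d) (1≤ι d))) b-large

      1≤d : 1 ℕ.≤ d
      1≤d = ℕ.≤-trans (s≤s z≤n) (Fin.toℕ<n top)

      open Powers b 1≤b public

      M-mono : ∀ {t t₁} → t₁ ℕ.≤ t → M t₁ ℕ.≤ M t
      M-mono {t} {t₁} t₁≤t = ℕ.≮⇒≥ λ lt → <⇒≱ (*-monoˡ-< 0<b (Λ^t<b^M t)) (≤-trans (^-monoʳ-≤ {b} {suc (M t)} {M t₁} 1≤b lt)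
        (≤-trans (b^M≤ t₁) (*-monoˡ-≤ (<⇒≤ 0<b) (^-monoʳ-≤ (1≤Λ top) t₁≤t))))

      0<Λ : ∀ l → 0# < Λ l
      0<Λ l = <-≤-trans 0<1 (1≤Λ l)

      Λi : Fin d → Carrier
      Λi l = Λ l ⁻¹

      0<Λi : ∀ l → 0# < Λi l
      0<Λi l = ⁻¹-pos (0<Λ l)

      Λ^n*Λi^n : ∀ l n → Λ l ^ n * Λi l ^ n ≈ 1#
      Λ^n*Λi^n l n = trans (sym (^-distrib-* (Λ l) (Λi l) n)) (trans (^-congˡ n (⁻¹-inverseʳ (Λ l) (0<⇒≉ (0<Λ l)))) (1^n n))

      Λi≤1 : ∀ l → Λi l ≤ 1#
      Λi≤1 l = *-cancelˡ-≤ (0<Λ l) (≤-resp (sym (⁻¹-inverseʳ (Λ l) (0<⇒≉ (0<Λ l)))) (sym (*-identityʳ _)) (1≤Λ l))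

      ∏Λ^ : ∀ n → ∏ (λ l → Λ l ^ n) ≤ b ^ n
      ∏Λ^ n = ≤-respˡ (sym (∏-^ Λ n)) (^-monoˡ-≤ n (∏-nonNeg λ l → <⇒≤ (0<Λ l)) ∏Λ)

      b^z≤Λ^gz : ∀ l → Pos l → ∀ z → b ^ z ≤ Λ l ^ (g ℕ.* z)
      b^z≤Λ^gz l p z = ≤-respʳ (sym (^-* (Λ l) g z)) (^-monoˡ-≤ z (<⇒≤ 0<b) (Λ-pos l p))

      G : ℕ
      G = suc g

      -- The levels of the descent have exponents n, nG², nG⁴, …. Here kk n (suc i) = zz n i + yy n i, and
      -- yy is so much larger than zz that b^zz ≤ Λ^yy in the positive coordinates.
      kk zz yy : ℕ → ℕ → ℕ
      kk n zero    = n
      kk n (suc i) = G ℕ.* zz n i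
      zz n i = G ℕ.* kk n i
      yy n i = g ℕ.* zz n i

      kk-* : ∀ n i → kk n i ≡ n ℕ.* kk 1 i
      kk-* n zero = ≡.sym (ℕ.*-identityʳ n)
      kk-* n (suc i) = ≡.trans (≡.cong (λ k → G ℕ.* (G ℕ.* k)) (kk-* n i))
        (N.solve 3 (λ G n k → G N.:* (G N.:* (n N.:* k)) N.:= n N.:* (G N.:* (G N.:* k))) ≡.refl G n (kk 1 i))

      n≤kk : ∀ n i → n ℕ.≤ kk n i
      n≤kk n zero = ℕ.≤-refl
      n≤kk n (suc i) = ℕ.≤-trans (n≤kk n i) (ℕ.≤-trans (ℕ.m≤n*m (kk n i) G) (ℕ.m≤n*m (G ℕ.* kk n i) G))

      kk-mono : ∀ n {i j} → i ℕ.≤ j → kk n i ℕ.≤ kk n j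
      kk-mono n {zero} {j} _ = n≤kk n j
      kk-mono n (s≤s {i} {j} p) = ℕ.*-monoʳ-≤ G (ℕ.*-monoʳ-≤ G (kk-mono n p))

      -- The factor from n to `kk n (d + 2)`. With n = v / period all levels of the descent stay
      -- below v.
      period : ℕ
      period = kk 1 (suc (suc d))

      instance
        period-nonZero : ℕ.NonZero period
        period-nonZero = ℕ.>-nonZero (n≤kk 1 (suc (suc d)))

      -- Integer functions violating the dual bound at y with parameters t and s.
      Sol : ℕ → ℕ → ℕ → Vector Carrier d → Vector ℤ (suc d) → Set
      Sol V t s y a = (∃[ i ] a i ≢ 0ℤ) × (∀ l → ∣ ζ (a (suc l)) ∣ᴿ < b ^ s) × (∀ l → ∣ ζ (a (suc l)) ∣ᴿ < Λ l ^ t)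
                    × ∣ eval (toAff a) y ∣ᴿ * b ^ (t ℕ.+ V) < 1#

      Sol-supp : ∀ {V t s y} a → Sol V t s y a → ∀ l → ¬ Pos l → ζ (a (suc l)) ≈ 0#
      Sol-supp {t = t} a (_ , _ , p , _) l ¬p = trans (reflexive (≡.cong ζ (ζ-<1⇒≡0 _ (<-resp refl (trans (^-congˡ t (Λ-null l ¬p)) (1^n t)) (p l))))) ζ-0

      Sol-trivial : ∀ {V t s y} a → t ≡ 0 ⊎ s ≡ 0 → ¬ Sol V t s y a
      Sol-trivial {V} {t} {s} {y} a ts (nz , p , q , r) = trivial a y (small ts)
        (≤-<-trans (x≤x*y (abs-nonNeg _) (1≤^ (t ℕ.+ V) 1≤b)) r) nz
        where
        small : t ≡ 0 ⊎ s ≡ 0 → ∀ l → ∣ ζ (a (suc l)) ∣ᴿ < 1#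
        small (inj₁ ≡.refl) = q
        small (inj₂ ≡.refl) = p

      Members : ℕ → ℕ → ℕ → Pred (Vector Carrier d) 0ℓ → Vector ℤ (suc d) → Set
      Members V t s R a = ∃[ y ] (R y × Sol V t s y a)

      cap : ℕ → ℕ → Fin d → Carrier
      cap t s l = b ^ s ⊓ Λ l ^ t

      -- The coefficient bounds of a violation with the parameters t - yy and s - zz.
      scale : ℕ → ℕ → ℕ → ℕ → Fin d → Carrier
      scale t s n i l = (b ^ s * bi ^ zz n i) ⊓ (Λ l ^ t * Λi l ^ yy n i)

      0<scale : ∀ t s n i l → 0# < scale t s n i l
      0<scale t s n i l = ⊓-pos (0<P s (zz n i)) (*-pos (^-pos t (0<Λ l)) (^-pos (yy n i) (0<Λi l)))

      module Cover (V t s n i : ℕ) (R : Pred (Vector Carrier d) 0ℓ) where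
        supp′ : ∀ a → Members V t s R a → ∀ l → ¬ Pos l → ζ (a (suc l)) ≈ 0#
        supp′ a (y , _ , sol) = Sol-supp {V} {t} {s} {y} a sol

        Size : ℕ → Set
        Size = CoverSize {h = scale t s n i} {Pos} (0<scale t s n i) (Members V t s R) supp′

        cov : ∃[ k ] (k ℕ.≤ suc d × Size k)
        cov = covered (0<scale t s n i) (Members V t s R) supp′

        -- Minimality makes the descent work: any other cover found at the same epoch and scale
        -- bounds this size from above.
        least : ∃[ k ] (Size k × (∀ j → j ℕ.< k → ¬ Size j))
        least = leastWith Size (proj₁ cov , proj₂ (proj₂ cov))

        system : System (scale t s n i) Pos
        system = proj₁ (proj₁ (proj₂ least))

        open System system public

        gradSize : Fin m → Carrier
        gradSize k = ∣ e k (suc (proj₁ (argmaxOver top (λ l → ∣ e k (suc l) ∣ᴿ)))) ∣ᴿ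

        ≤gradSize : ∀ k l → ∣ e k (suc l) ∣ᴿ ≤ gradSize k
        ≤gradSize k = proj₂ (argmaxOver top (λ l → ∣ e k (suc l) ∣ᴿ))

        -- The zero set of e (k* k₀) is the one to be avoided.
        k* : Fin m → Fin m
        k* k₀ = proj₁ (argmaxOver k₀ (λ k → cap t s (J k) * gradSize k))

        k*-max : ∀ k₀ k → cap t s (J k) * gradSize k ≤ cap t s (J (k* k₀)) * gradSize (k* k₀)
        k*-max k₀ = proj₂ (argmaxOver k₀ (λ k → cap t s (J k) * gradSize k))

  -- The dual estimate, by descent on the dimension.

  module DualBounds where
    open OrderedField
    open FiniteSums
    open LinearFormsPigeonhole
    open AffineSystems
    open Combinations
    open SmallFunctions
    open WeightData

    eval-diff : ∀ {d} (a : Aff {d}) x y → eval a x ≈ eval a y + ∑ (λ l → a (suc l) * (x l - y l))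
    eval-diff a x y = trans (+-congˡ (trans (∑-cong λ l → solve 3 (λ a x y → a :* x := a :* y :+ a :* (x :- y)) refl (a (suc l)) (x l) (y l))
      (∑-+ (λ l → a (suc l) * y l) (λ l → a (suc l) * (x l - y l))))) (sym (+-assoc _ _ _))

    ≤*⊓ : ∀ {c L u v} → c ≤ L * u → c ≤ L * v → c ≤ L * (u ⊓ v)
    ≤*⊓ {c} {L} {u} {v} p q = [ (λ e → ≤-respʳ (*-congˡ (sym e)) p) , (λ e → ≤-respʳ (*-congˡ (sym e)) q) ]′ (⊓-sel u v)

    module OverWeights {d : ℕ} (W : Weights d) where
      open Weights W

      module Induction (V e₀ : ℕ) (period≤V : period ℕ.≤ V) (2e₀≤V : 2 ℕ.* e₀ ℕ.≤ V)
        (In : ℕ → Pred (Vector Carrier d) 0ℓ) (x : ℕ → Vector Carrier d) (x∈ : ∀ e → In e (x e))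
        (nested : ∀ {e e′} → e ℕ.≤ e′ → ∀ {y} → In e′ y → In e y)
        (close : ∀ e → e₀ ℕ.≤ e → ∀ y → In e y → ∀ l → ∣ x e l - y l ∣ᴿ * b ^ e ≤ 1#)
        (avoid : ∀ t s n i ep → s ℕ.≤ M t → n ≡ (M t ℕ.∸ s ℕ.+ V) / period → i ℕ.≤ d → ep ℕ.+ kk n (suc i) ≡ t ℕ.+ V ℕ.+ s → e₀ ℕ.≤ ep →
           ∀ k₀ y → In (ep ℕ.+ n) y →
           Cover.gradSize V t s n i (In ep) (Cover.k* V t s n i (In ep) k₀)
             ≤ ∣ eval (Cover.e V t s n i (In ep) (Cover.k* V t s n i (In ep) k₀)) y ∣ᴿ * b ^ (ep ℕ.+ n))
        where

        NoSol : ℕ → ℕ → Set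
        NoSol t s = ∀ e y → t ℕ.+ V ℕ.+ s ℕ.≤ e → In e y → ∀ a → ¬ Sol V t s y a

        module Step (t s : ℕ) (1≤s : 1 ℕ.≤ s) (s≤M : s ℕ.≤ M t)
          (IHt : ∀ t′ s′ → t′ ℕ.< t → s′ ℕ.≤ M t′ → NoSol t′ s′) (IHs : ∀ s′ → s′ ℕ.< s → NoSol t s′)
          (e : ℕ) (y₀ : Vector Carrier d) (e-large : t ℕ.+ V ℕ.+ s ℕ.≤ e) (y₀∈ : In e y₀) (a₀ : Vector ℤ (suc d)) (sol₀ : Sol V t s y₀ a₀) where

          -- Up to bounded powers of b, the volume of the box given by the coefficient bounds and
          -- the value bound b^(-t-V) is at most b^(-v). The descent may lose powers of b below v,
          -- so its unit n is a fixed fraction of v.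
          v n : ℕ
          v = M t ℕ.∸ s ℕ.+ V
          n = v / period

          v+s≡ : v ℕ.+ s ≡ M t ℕ.+ V
          v+s≡ = ≡.trans (N.solve 3 (λ m V s → (m N.:+ V) N.:+ s N.:= (m N.:+ s) N.:+ V) ≡.refl (M t ℕ.∸ s) V s) (≡.cong (ℕ._+ V) (ℕ.m∸n+n≡m s≤M))

          v≤t+V : v ℕ.≤ t ℕ.+ V
          v≤t+V = ℕ.+-monoˡ-≤ V (ℕ.≤-trans (ℕ.∸-mono (M≤ t) 1≤s) ℕ.≤-refl)

          1≤n : 1 ℕ.≤ n
          1≤n = m≥n⇒m/n>0 {v} {period} (ℕ.≤-trans period≤V (ℕ.m≤n+m V (M t ℕ.∸ s)))

          kk≤v : kk n (suc (suc d)) ℕ.≤ v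
          kk≤v = ≡.subst (ℕ._≤ v) (≡.sym (kk-* n (suc (suc d)))) (m/n*n≤m v period)

          1≤kk : ∀ i → 1 ℕ.≤ kk n i
          1≤kk i = ℕ.≤-trans 1≤n (n≤kk n i)

          -- The factor 5, from `5≤g`, is the slack spent in the exponent comparisons below.
          5k≤z : ∀ i → 5 ℕ.* kk n i ℕ.≤ zz n i
          5k≤z i = ℕ.*-monoˡ-≤ (kk n i) (ℕ.m≤n⇒m≤1+n 5≤g)

          5k≤v : ∀ i → i ℕ.≤ suc d → 5 ℕ.* kk n i ℕ.≤ v
          5k≤v i p = ℕ.≤-trans (5k≤z i) (ℕ.≤-trans (ℕ.m≤n*m (zz n i) G) (ℕ.≤-trans (kk-mono n (s≤s p)) kk≤v))

          k≤5k : ∀ i → kk n i ℕ.≤ 5 ℕ.* kk n i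
          k≤5k i = ℕ.m≤n*m (kk n i) 5

          k≤T : ∀ i → i ℕ.≤ suc d → kk n i ℕ.≤ t ℕ.+ V ℕ.+ s
          k≤T i p = ℕ.≤-trans (k≤5k i) (ℕ.≤-trans (5k≤v i p) (ℕ.≤-trans v≤t+V (ℕ.m≤m+n (t ℕ.+ V) s)))

          -- The index runs backwards in time: `ep 0` is the latest of these epochs.
          ep : ℕ → ℕ
          ep i = (t ℕ.+ V ℕ.+ s) ℕ.∸ kk n i

          ep+k : ∀ i → i ℕ.≤ suc d → ep i ℕ.+ kk n i ≡ t ℕ.+ V ℕ.+ s
          ep+k i p = ℕ.m∸n+n≡m (k≤T i p)

          e₀≤ep : ∀ i → i ℕ.≤ suc d → e₀ ℕ.≤ ep i
          e₀≤ep i p = ℕ.*-cancelˡ-≤ 2 (linℕ′ (3 ℕ.* kk n i ℕ.+ t ℕ.+ 2 ℕ.* s)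
            (ℕ.+-mono-≤ (ℕ.+-mono-≤ 2e₀≤V (5k≤v i p)) (ℕ.+-mono-≤ v≤t+V (ℕ.≤-reflexive (≡.cong (2 ℕ.*_) (≡.sym (ep+k i p))))))
            (N.solve 7 (λ ep k e t V s v → N.con 2 N.:* ep N.:+ (N.con 2 N.:* e N.:+ N.con 5 N.:* k N.:+ (v N.:+ N.con 2 N.:* (t N.:+ V N.:+ s))) N.:=
              N.con 3 N.:* k N.:+ t N.:+ N.con 2 N.:* s N.:+ (N.con 2 N.:* e N.:+ (V N.:+ v N.:+ (t N.:+ V N.:+ N.con 2 N.:* (ep N.:+ k))))) ≡.refl (ep i) (kk n i) e₀ t V s v))

          -- From the epoch ep (suc i) to the epoch ep i the least size of a covering system drops, since the
          -- pigeonhole principle would turn as many independent members into a solution for a smaller t.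
          module Stage (i : ℕ) (i≤d : i ℕ.≤ d) where

            k z yk : ℕ
            k = kk n i
            z = zz n i
            yk = yy n i

            i≤1+d : i ℕ.≤ suc d
            i≤1+d = ℕ.m≤n⇒m≤1+n i≤d

            E : ℕ
            E = ep (suc i)

            E+ : E ℕ.+ (z ℕ.+ yk) ≡ t ℕ.+ V ℕ.+ s
            E+ = ep+k (suc i) (s≤s i≤d)

            open Cover V t s n i (In E)

            h : Fin d → Carrier
            h = scale t s n i

            0<h : ∀ l → 0# < h l
            0<h = 0<scale t s n i

            c : Vector Carrier d
            c = x (ep i)

            I : Carrier
            I = ι (suc d)

            -- `ρ` bounds a member at the centre: its value at the solution point, plus d coordinate
            -- differences contributing b^s b^(-ep i) each. `ρ′` is the value bound of a violation
            -- with t - yk in place of t.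
            ρ ρ′ : Carrier
            ρ = I * P k (t ℕ.+ V)
            ρ′ = P yk (t ℕ.+ V)

            0<ρ : 0# < ρ
            0<ρ = *-pos (0<ι d) (0<P k (t ℕ.+ V))

            ΩII≤b : Ω d * (I * I) ≤ b
            ΩII≤b = b-large

            0≤Ω : 0# ≤ Ω d
            0≤Ω = ≤-trans 0≤1 (1≤Ω d)

            ΩI≤b : Ω d * I ≤ b
            ΩI≤b = ≤-trans (*-monoˡ-≤ 0≤Ω (x≤x*y (0≤ι _) (1≤ι d))) ΩII≤b

            eval≤ : ∀ a → Members V t s (In (ep i)) a → ∣ eval (toAff a) c ∣ᴿ ≤ ρ
            eval≤ a (y , y∈ , nz , p , q , r) = ≤-trans (≈⇒≤ (abs-cong (eval-diff (toAff a) c y))) (≤-trans (abs-+ _ _)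
              (≤-trans (+-mono-≤ at-y (abs-∑-≤ term)) (≈⇒≤ (trans (solve 2 (λ i p → p :+ i :* p := (con (+ 1) :+ i) :* p) refl (ι d) (P k (t ℕ.+ V))) (*-congʳ (sym (ι-suc d)))))))
              where
              at-y : ∣ eval (toAff a) y ∣ᴿ ≤ P k (t ℕ.+ V)
              at-y = ≤-trans (<⇒≤ (/b^ {n = t ℕ.+ V} r)) (≤-respˡ (*-identityˡ _) (*-monoʳ-≤ (<⇒≤ (^-pos (t ℕ.+ V) 0<bi)) (1≤^ k 1≤b)))
              term : ∀ l → ∣ ζ (a (suc l)) * (c l - y l) ∣ᴿ ≤ P k (t ℕ.+ V)
              term l = ≤-trans (≈⇒≤ (abs-* _ _)) (≤-trans (*-mono-≤ (abs-nonNeg _) (<⇒≤ (^-pos s 0<b)) (<⇒≤ (p l)) dist)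
                (P-mono {s} {ep i} {k} {t ℕ.+ V} (ℕ.≤-reflexive (≡.trans (ℕ.+-comm s (t ℕ.+ V)) (≡.trans (≡.sym (ep+k i i≤1+d)) (ℕ.+-comm (ep i) k))))))
                where
                dist : ∣ c l - y l ∣ᴿ ≤ bi ^ ep i
                dist = *-cancelʳ-≤ (^-pos (ep i) 0<b) (≤-respʳ (sym (trans (*-comm _ _) (b^n*bi^n (ep i)))) (close (ep i) (e₀≤ep i i≤1+d) y y∈ l))

            -- Such a w would solve a problem with a smaller t.
            noTarget : ¬ Target 1≤d 0<h system c ρ′
            noTarget (w , nz , w≤ , r) = byCases (ℕ.<-≤-connex yk t) (ℕ.<-≤-connex z s)
              where
              wb : ∀ l → ∣ ζ (w (suc l)) ∣ᴿ < b ^ s * bi ^ z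
              wb l = <-≤-trans (w≤ l) (x⊓y≤x _ _)
              wΛ : ∀ l → ∣ ζ (w (suc l)) ∣ᴿ < Λ l ^ t * Λi l ^ yk
              wΛ l = <-≤-trans (w≤ l) (x⊓y≤y (b ^ s * bi ^ z) _)
              yk≤t+V : yk ℕ.≤ t ℕ.+ V
              yk≤t+V = ℕ.≤-trans (ℕ.m≤n+m yk z) (ℕ.≤-trans (k≤5k (suc i)) (ℕ.≤-trans (5k≤v (suc i) (s≤s i≤d)) v≤t+V))
              const : (∀ l → ∣ ζ (w (suc l)) ∣ᴿ < 1#) → ⊥
              const p = trivial w c p (<-≤-trans r (P≤1 yk≤t+V)) nz
              byCases : yk ℕ.< t ⊎ t ℕ.≤ yk → z ℕ.< s ⊎ s ℕ.≤ z → ⊥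
              -- When t or s is used up, the scale is at most 1 and only a constant could remain.
              byCases (inj₂ t≤y) _ = const λ l → <-≤-trans (wΛ l) (≤-respʳ (Λ^n*Λi^n l t) (*-monoˡ-≤ (^-nonNeg t (<⇒≤ (0<Λ l))) (^-antiʳ-≤ (<⇒≤ (0<Λi l)) (Λi≤1 l) t≤y)))
              byCases (inj₁ _) (inj₂ s≤z) = const λ l → <-≤-trans (wb l) (P≤1 s≤z)
              byCases (inj₁ y<t) (inj₁ z<s) = choose (ℕ.≤-total s″ (M t′))
                where
                t′ s″ : ℕ
                t′ = t ℕ.∸ yk
                s″ = s ℕ.∸ z
                t′+y : t′ ℕ.+ yk ≡ t
                t′+y = ℕ.m∸n+n≡m (ℕ.<⇒≤ y<t)
                s″+z : s″ ℕ.+ z ≡ s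
                s″+z = ℕ.m∸n+n≡m (ℕ.<⇒≤ z<s)
                1≤yk : 1 ℕ.≤ yk
                1≤yk = ℕ.*-mono-≤ (ℕ.≤-trans (s≤s z≤n) 5≤g) (ℕ.≤-trans (1≤kk i) (ℕ.≤-trans (k≤5k i) (5k≤z i)))
                t′<t : t′ ℕ.< t
                t′<t = ℕ.≤-trans (≡.subst (ℕ._≤ t′ ℕ.+ yk) (ℕ.+-comm t′ 1) (ℕ.+-monoʳ-≤ t′ 1≤yk)) (ℕ.≤-reflexive t′+y)
                epoch : ∀ s′ → s′ ℕ.≤ s″ → t′ ℕ.+ V ℕ.+ s′ ℕ.≤ ep i
                epoch s′ p = ℕ.≤-trans (ℕ.+-monoʳ-≤ (t′ ℕ.+ V) p) (ℕ.+-cancelʳ-≤ (z ℕ.+ yk) _ _ (ℕ.≤-trans (ℕ.≤-reflexive eq) (≡.subst (ℕ._≤ ep i ℕ.+ (z ℕ.+ yk)) (ep+k i i≤1+d)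
                    (ℕ.+-monoʳ-≤ (ep i) (ℕ.≤-trans (k≤5k i) (ℕ.≤-trans (5k≤z i) (ℕ.m≤m+n z yk)))))))
                  where
                  eq : t′ ℕ.+ V ℕ.+ s″ ℕ.+ (z ℕ.+ yk) ≡ t ℕ.+ V ℕ.+ s
                  eq = ≡.trans (N.solve 5 (λ t y V s z → t N.:+ V N.:+ s N.:+ (z N.:+ y) N.:= (t N.:+ y) N.:+ V N.:+ (s N.:+ z)) ≡.refl t′ yk V s″ z)
                    (≡.cong₂ (λ t s → t ℕ.+ V ℕ.+ s) t′+y s″+z)
                wΛ′ : ∀ l → ∣ ζ (w (suc l)) ∣ᴿ < Λ l ^ t′
                wΛ′ l = <-resp refl (trans (*-congʳ (trans (^-congˡʳ (≡.sym t′+y)) (^-homo-* (Λ l) t′ yk))) (trans (*-assoc _ _ _) (trans (*-congˡ (Λ^n*Λi^n l yk)) (*-identityʳ _)))) (wΛ l)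
                  where
                  ^-congˡʳ : ∀ {m n} → m ≡ n → Λ l ^ m ≈ Λ l ^ n
                  ^-congˡʳ p = reflexive (≡.cong (Λ l ^_) p)
                wb′ : ∀ l → ∣ ζ (w (suc l)) ∣ᴿ < b ^ s″
                wb′ l = <-resp refl (trans (*-congʳ (trans (reflexive (≡.cong (b ^_) (≡.sym s″+z))) (^-homo-* b s″ z))) (trans (*-assoc _ _ _) (trans (*-congˡ (b^n*bi^n z)) (*-identityʳ _)))) (wb l)
                r′ : ∣ eval (toAff w) c ∣ᴿ * b ^ (t′ ℕ.+ V) < 1#
                r′ = <-resp refl (trans (*-comm _ _) (trans (^*P (t′ ℕ.+ V) yk (t ℕ.+ V)) (trans (*-congʳ (reflexive (≡.cong (b ^_)
                    (≡.trans (N.solve 3 (λ t V y → t N.:+ V N.:+ y N.:= (t N.:+ y) N.:+ V) ≡.refl t′ V yk) (≡.cong (ℕ._+ V) t′+y))))) (b^n*bi^n (t ℕ.+ V)))))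
                  (*-monoʳ-< (^-pos (t′ ℕ.+ V) 0<b) r)
                choose : s″ ℕ.≤ M t′ ⊎ M t′ ℕ.≤ s″ → ⊥
                choose (inj₁ s≤) = IHt t′ s″ t′<t s≤ (ep i) c (epoch s″ ℕ.≤-refl) (x∈ (ep i)) w (nz , wb′ , wΛ′ , r′)
                -- Beyond `M t′` the bound b^s″ says less than the one from `Λ`, so `M t′` takes its
                -- place.
                choose (inj₂ s≥) = IHt t′ (M t′) t′<t ℕ.≤-refl (ep i) c (epoch (M t′) s≥) (x∈ (ep i)) w
                  (nz , (λ l → <-≤-trans (wΛ′ l) (≤-trans (^-monoˡ-≤ t′ (<⇒≤ (0<Λ l)) (Λ≤top l)) (<⇒≤ (Λ^t<b^M t′)))) , wΛ′ , r′)

            k+2≤v : k ℕ.+ 2 ℕ.≤ v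
            k+2≤v = ℕ.≤-trans (linℕ′ (2 ℕ.* k) (ℕ.*-monoʳ-≤ 2 (1≤kk i))
              (N.solve 1 (λ k → N.con 5 N.:* k N.:+ N.con 2 N.:* N.con 1 N.:= N.con 2 N.:* k N.:+ (k N.:+ N.con 2 N.:+ N.con 2 N.:* k)) ≡.refl k)) (5k≤v i i≤1+d)

            0≤cap : ∀ l → 0# ≤ cap t s l
            0≤cap l = ⊓-glb (^-nonNeg s (<⇒≤ 0<b)) (^-nonNeg t (<⇒≤ (0<Λ l)))

            -- The bound b^s is used in the direction `top` and Λ^t in all others; the factor Λ^t
            -- that is then missing equals b^(M t) up to one factor b.
            ∏cap≤ : ∏ (cap t s) * b ^ M t ≤ b ^ (1 ℕ.+ s ℕ.+ t)
            ∏cap≤ = begin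
              ∏ (cap t s) * b ^ M t                        ≈⟨ *-congʳ (Sp.∏-split (cap t s)) ⟩
              cap t s top * ∏ (cap t s ∘ Sp.I) * b ^ M t   ≤⟨ *-monoʳ-≤ (^-nonNeg (M t) (<⇒≤ 0<b)) (*-mono-≤ (∏-nonNeg λ j → 0≤cap (Sp.I j)) (^-nonNeg s (<⇒≤ 0<b)) (x⊓y≤x _ _) (∏-mono-≤ (λ j → 0≤cap (Sp.I j)) (λ j → x⊓y≤y (b ^ s) _))) ⟩
              b ^ s * Π * b ^ M t                          ≤⟨ *-monoˡ-≤ (*-nonNeg (^-nonNeg s (<⇒≤ 0<b)) (∏-nonNeg λ j → ^-nonNeg t (<⇒≤ (0<Λ (Sp.I j))))) (b^M≤ t) ⟩
              b ^ s * Π * (b * Λ top ^ t)                  ≈⟨ solve 4 (λ bs p b l → bs :* p :* (b :* l) := (b :* bs) :* (l :* p)) refl (b ^ s) Π b (Λ top ^ t) ⟩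
              b * b ^ s * (Λ top ^ t * Π)                  ≈⟨ *-congˡ (Sp.∏-split (λ l → Λ l ^ t)) ⟨
              b * b ^ s * ∏ (λ l → Λ l ^ t)                ≤⟨ *-monoˡ-≤ (^-nonNeg (suc s) (<⇒≤ 0<b)) (∏Λ^ t) ⟩
              b * b ^ s * b ^ t                            ≈⟨ ^-homo-* b (suc s) t ⟨
              b ^ (1 ℕ.+ s ℕ.+ t)                          ∎
              where
              open ≤R
              suc-pred : ∀ {n} → 1 ℕ.≤ n → n ≡ suc (ℕ.pred n)
              suc-pred {suc n} _ = ≡.refl
              module Sp = Splitting (splitting (suc-pred 1≤d) top)
              Π : Carrier
              Π = ∏ ((λ l → Λ l ^ t) ∘ Sp.I)

            -- With the flag set there is one member more than there are pivots, so all pivot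
            -- coefficients can be annihilated. The room k + 2 ≤ v makes the remaining constant
            -- smaller than 1.
            flagged : (b′ : Fin (suc m) → Vector ℤ (suc d)) → (∀ k → Members V t s (In (ep i)) (b′ k)) → Independent b′ →
                      (∀ k → Covers (toAff (b′ k))) → ⊥
            flagged b′ b∈ ind cov = flagContradiction 1≤d 0<h system c b′ ind cov (cap t s)
              (λ l → ⊓-glb (1≤^ s 1≤b) (1≤^ t (1≤Λ l))) (λ k l → ⊓-glb (<⇒≤ (proj₁ (proj₂ (proj₂ (proj₂ (b∈ k)))) l)) (<⇒≤ (proj₁ (proj₂ (proj₂ (proj₂ (proj₂ (b∈ k))))) l)))
              0<ρ (λ k → eval≤ (b′ k) (b∈ k)) (*-cancelʳ-≤ (^-pos (M t) 0<b) (≤-trans cost (≈⇒≤ (sym (*-identityˡ _)))))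
              where
              open ≤R
              Π Q : Carrier
              Π = ∏ (cap t s ∘ J)
              Q = P k (t ℕ.+ V)
              cost : Ω d * (Π * ρ) * b ^ M t ≤ b ^ M t
              cost = begin
                Ω d * (Π * (I * Q)) * b ^ M t  ≈⟨ solve 5 (λ o p i q m → o :* (p :* (i :* q)) :* m := (o :* i) :* ((p :* m) :* q)) refl (Ω d) Π I Q (b ^ M t) ⟩
                (Ω d * I) * ((Π * b ^ M t) * Q) ≤⟨ *-mono-≤ (*-nonNeg (*-nonNeg (∏-nonNeg λ j → 0≤cap (J j)) (^-nonNeg (M t) (<⇒≤ 0<b))) (<⇒≤ (0<P k (t ℕ.+ V)))) (<⇒≤ 0<b) ΩI≤b
                    (*-monoʳ-≤ (<⇒≤ (0<P k (t ℕ.+ V))) (≤-trans (*-monoʳ-≤ (^-nonNeg (M t) (<⇒≤ 0<b)) (∏-inj-≤ J J-injective (λ l → ⊓-glb (1≤^ s 1≤b) (1≤^ t (1≤Λ l))))) ∏cap≤)) ⟩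
                b * (b ^ (1 ℕ.+ s ℕ.+ t) * Q)   ≈⟨ *-assoc _ _ _ ⟨
                b ^ (2 ℕ.+ s ℕ.+ t) * Q         ≈⟨ ^*P (2 ℕ.+ s ℕ.+ t) k (t ℕ.+ V) ⟩
                P (2 ℕ.+ s ℕ.+ t ℕ.+ k) (t ℕ.+ V) ≤⟨ P-mono {2 ℕ.+ s ℕ.+ t ℕ.+ k} {t ℕ.+ V} {M t} {0} (linℕ (ℕ.+-mono-≤ k+2≤v (ℕ.≤-reflexive v+s≡))
                  (N.solve 6 (λ m t V k v s → m N.:+ (t N.:+ V) N.:+ (k N.:+ N.con 2 N.:+ (v N.:+ s)) N.:= N.con 2 N.:+ s N.:+ t N.:+ k N.:+ N.con 0 N.:+ (v N.:+ (m N.:+ V))) ≡.refl (M t) t V k v s)) ⟩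
                P (M t) 0                       ≈⟨ P-0 (M t) ⟩
                b ^ M t ∎

            μ : Fin d → Carrier
            μ l = Λ l ^ yk

            1≤μ : ∀ l → 1# ≤ μ l
            1≤μ l = 1≤^ yk (1≤Λ l)

            b^z≤μ : ∀ l → Pos l → b ^ z ≤ μ l
            b^z≤μ l p = b^z≤Λ^gz l p z

            cap≤μh : ∀ l → Pos l → cap t s l ≤ μ l * h l
            cap≤μh l p = ≤*⊓ {L = μ l}
              (≤-trans (x⊓y≤x _ _) (≤-respˡ (trans (solve 3 (λ z s i → z :* (s :* i) := s :* (z :* i)) refl (b ^ z) (b ^ s) (bi ^ z)) (trans (*-congˡ (b^n*bi^n z)) (*-identityʳ _)))
                (*-monoʳ-≤ (<⇒≤ (0<P s z)) (b^z≤μ l p))))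
              (≤-trans (x⊓y≤y (b ^ s) _) (≈⇒≤ (sym (trans (solve 3 (λ z s i → z :* (s :* i) := s :* (z :* i)) refl (μ l) (Λ l ^ t) (Λi l ^ yk)) (trans (*-congˡ (Λ^n*Λi^n l yk)) (*-identityʳ _))))))

            member≤μh : ∀ a → Members V t s (In (ep i)) a → ∀ l → ∣ ζ (a (suc l)) ∣ᴿ ≤ μ l * h l
            member≤μh a (y , _ , sol@(_ , p , q , _)) l = classically (Pos l) (λ pos → ≤-trans (⊓-glb (<⇒≤ (p l)) (<⇒≤ (q l))) (cap≤μh l pos))
              λ ¬pos → ≤-respˡ (sym (abs-0 (Sol-supp {V} {t} {s} {y} a sol l ¬pos))) (*-nonNeg (≤-trans 0≤1 (1≤μ l)) (<⇒≤ (0<h l)))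

            -- The induction hypothesis for smaller s: members have a large coefficient.
            exact : ∀ a → Members V t s (In (ep i)) a → ∃[ l ] (P s (suc k) ≤ ∣ ζ (a (suc l)) ∣ᴿ)
            exact a (y , y∈ , nz , p , q , r) = classically (∃[ l ] (P s (suc k) ≤ ∣ ζ (a (suc l)) ∣ᴿ)) id
              (λ none → ⊥-elim (byCases (λ l → ≰⇒> λ ge → none (l , ge)) (ℕ.<-≤-connex s (suc k))))
              where
              byCases : (∀ l → ∣ ζ (a (suc l)) ∣ᴿ < P s (suc k)) → s ℕ.< suc k ⊎ suc k ℕ.≤ s → ⊥
              byCases less (inj₁ s<) = Sol-trivial {V} {t} {0} {y} a (inj₂ ≡.refl) (nz , (λ l → <-≤-trans (less l) (P≤1 (ℕ.<⇒≤ s<))) , q , r)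
              byCases less (inj₂ s≥) = IHs s′ s′<s (ep i) y (ℕ.+-cancelʳ-≤ k _ _ (ℕ.≤-trans (ℕ.≤-reflexive (ℕ.+-assoc (t ℕ.+ V) s′ k))
                    (ℕ.≤-trans (ℕ.+-monoʳ-≤ (t ℕ.+ V) (ℕ.≤-trans (ℕ.+-monoʳ-≤ s′ (ℕ.n≤1+n k)) (ℕ.≤-reflexive s′+))) (ℕ.≤-reflexive (≡.sym (ep+k i i≤1+d)))))) y∈ a
                  (nz , (λ l → <-resp refl (trans (*-congʳ (trans (reflexive (≡.cong (b ^_) (≡.sym s′+))) (^-homo-* b s′ (suc k)))) (trans (*-assoc _ _ _) (trans (*-congˡ (b^n*bi^n (suc k))) (*-identityʳ _)))) (less l)) , q , r)
                where
                s′ : ℕ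
                s′ = s ℕ.∸ suc k
                s′+ : s′ ℕ.+ suc k ≡ s
                s′+ = ℕ.m∸n+n≡m s≥
                s′<s : s′ ℕ.< s
                s′<s = ℕ.≤-trans (≡.subst (suc s′ ℕ.≤_) (≡.sym (ℕ.+-suc s′ k)) (s≤s (ℕ.m≤m+n s′ k))) (ℕ.≤-reflexive s′+)

            module _ (n′ : ℕ) (m≡ : m ≡ suc n′) (f : flag ≡ false) (b′ : Fin (suc n′) → Vector ℤ (suc d))
              (b∈ : ∀ k → Members V t s (In (ep i)) (b′ k)) (ind : Independent b′) (cov : ∀ k → Covers (toAff (b′ k))) where
              private
                k₀ : Fin m
                k₀ = ≡.subst Fin (≡.sym m≡) zero

                evc : Fin m → Carrier
                evc j = eval (e′ j) c
                  where
                  e′ : Fin m → Aff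
                  e′ = System.e system

                0<ρ′ : 0# < ρ′
                0<ρ′ = 0<P yk (t ℕ.+ V)

                module Sp (j : Fin m) = Splitting (splitting m≡ j)

                ∏rest : ∀ j → μ (J j) * ∏ (μ ∘ J ∘ Sp.I j) ≤ b ^ yk
                ∏rest j = ≤-trans (∏-inj-≤-∉ (J ∘ Sp.I j) (λ eq → Sp.injective j (J-injective eq)) 1≤μ (J j) (λ q eq → Sp.I≢i j q (J-injective eq))) (∏Λ^ yk)

                1+k≤z : suc k ℕ.≤ z
                1+k≤z = ℕ.≤-trans (linℕ′ (3 ℕ.* k) (1≤kk i) (N.solve 1 (λ k → N.con 5 N.:* k N.:+ N.con 1 N.:= N.con 3 N.:* k N.:+ (N.con 1 N.:+ k N.:+ k)) ≡.refl k)) (5k≤z i)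

              -- By `∏rest` the omitted pivot saves the factor `μ (J j)`, at least b^z. Since k + 1
              -- ≤ z, this pays for the loss b^k and for the constants.
              large : ∀ j → (∀ k → ∣ evc k ∣ᴿ * h (J k) ≤ ∣ evc j ∣ᴿ * h (J j)) → ρ′ < ∣ evc j ∣ᴿ * h (J j) → ⊥
              large j mx big = noTarget (largeValueTarget 1≤d 0<h system c b′ ind cov μ 1≤μ (λ k → member≤μh (b′ k) (b∈ k)) 0<ρ 0<ρ′ (λ k → eval≤ (b′ k) (b∈ k)) m≡ f j mx big cost)
                where
                open ≤R
                Π Q : Carrier
                Π = ∏ (μ ∘ J ∘ Sp.I j)
                Q = P k (t ℕ.+ V)
                0≤Π : 0# ≤ Π
                0≤Π = ∏-nonNeg λ q → ≤-trans 0≤1 (1≤μ (J (Sp.I j q)))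
                T : Carrier
                T = bi ^ (t ℕ.+ V)
                0≤T : 0# ≤ T
                0≤T = ^-nonNeg (t ℕ.+ V) (<⇒≤ 0<bi)
                cost : Ω d * (Π * ρ) ≤ ρ′
                cost = begin
                  Ω d * (Π * (I * (b ^ k * T)))  ≈⟨ solve 5 (λ o p i q t → o :* (p :* (i :* (q :* t))) := (o :* i) :* q :* (p :* t)) refl (Ω d) Π I (b ^ k) T ⟩
                  (Ω d * I) * b ^ k * (Π * T)    ≤⟨ *-monoʳ-≤ (*-nonNeg 0≤Π 0≤T) (≤-trans (*-monoʳ-≤ (^-nonNeg k (<⇒≤ 0<b)) ΩI≤b) (≤-trans (^-monoʳ-≤ {b} {suc k} {z} 1≤b 1+k≤z) (b^z≤μ (J j) (J-pos j)))) ⟩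
                  μ (J j) * (Π * T)              ≈⟨ *-assoc _ _ _ ⟨
                  μ (J j) * Π * T                ≤⟨ *-monoʳ-≤ 0≤T (∏rest j) ⟩
                  b ^ yk * T                     ∎

              -- Here the game is used: the zero set of the function chosen by `k*` was avoided, so
              -- its value at the centre is at least b^(-E-n) times its gradient size. By the
              -- hypothesis for smaller s, through `exactness`, that gradient size is not
              -- negligible.
              small : (∀ k → ∣ evc k ∣ᴿ * h (J k) ≤ ρ′) → ⊥
              small le = noTarget (smallValuesTarget 1≤d 0<h system c b′ ind cov μ 1≤μ (λ k → member≤μh (b′ k) (b∈ k)) 0<ρ 0<ρ′ (λ k → eval≤ (b′ k) (b∈ k)) m≡ f j le 0<evj cost)
                where
                open ≤R
                j : Fin m
                j = k* k₀
                β Π Q L Z : Carrier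
                β = b ^ (E ℕ.+ n)
                Π = ∏ (μ ∘ J ∘ Sp.I j)
                Q = P k (t ℕ.+ V)
                L = μ (J j)
                Z = gradSize j
                0≤Π : 0# ≤ Π
                0≤Π = ∏-nonNeg λ q → ≤-trans 0≤1 (1≤μ (J (Sp.I j q)))
                0<β : 0# < β
                0<β = ^-pos (E ℕ.+ n) 0<b
                n≤k : n ℕ.≤ k
                n≤k = n≤kk n i
                -- The task was posed at epoch E with time n; at `ep i` its deadline has passed.
                En≤ : E ℕ.+ n ℕ.≤ ep i
                En≤ = linℕ (ℕ.+-mono-≤ (ℕ.+-mono-≤ (ℕ.+-mono-≤ (5k≤z i) (ℕ.+-mono-≤ n≤k (ℕ.*-monoʳ-≤ 3 (z≤n {k})))) (ℕ.≤-reflexive E+)) (ℕ.+-mono-≤ (z≤n {yk}) (ℕ.≤-reflexive (≡.sym (ep+k i i≤1+d)))))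
                  (N.solve 9 (λ ei E n k z yk t V s → ei N.:+ (N.con 5 N.:* k N.:+ (n N.:+ N.con 3 N.:* N.con 0) N.:+ (E N.:+ (z N.:+ yk)) N.:+ (N.con 0 N.:+ (t N.:+ V N.:+ s)))
                     N.:= E N.:+ n N.:+ (z N.:+ (k N.:+ N.con 3 N.:* k) N.:+ (t N.:+ V N.:+ s) N.:+ (yk N.:+ (ei N.:+ k)))) ≡.refl (ep i) E n k z yk t V s)
                avoided : Z ≤ ∣ evc j ∣ᴿ * β
                avoided = avoid t s n i E s≤M ≡.refl i≤d E+ (e₀≤ep (suc i) (s≤s i≤d)) k₀ c (nested En≤ (x∈ (ep i)))
                -- Some coefficient of a member is at least b^(s-k-1), and it is a combination of pivot coefficients.
                exactness : P s (suc k) ≤ I * (cap t s (J j) * Z)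
                exactness = go (exact (b′ zero) (b∈ zero))
                  where
                  go : ∃[ l ] (P s (suc k) ≤ ∣ ζ (b′ zero (suc l)) ∣ᴿ) → P s (suc k) ≤ I * (cap t s (J j) * Z)
                  go (l , p) = ≤-trans p (≤-trans (≈⇒≤ (abs-cong (proj₁ (cov zero) l))) (≤-trans (abs-∑-≤ term)
                    (*-monoʳ-≤ (*-nonNeg (0≤cap (J j)) (abs-nonNeg _)) (ι-mono-≤ (ℕ.m≤n⇒m≤1+n (pivots≤ 1≤d 0<h system c))))))
                    where
                    term : ∀ q → ∣ ζ (b′ zero (suc (J q))) * System.e system q (suc l) ∣ᴿ ≤ cap t s (J j) * Z
                    term q = ≤-trans (≈⇒≤ (abs-* _ _)) (≤-trans (*-mono-≤ (abs-nonNeg _) (0≤cap (J q))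
                      (⊓-glb (<⇒≤ (proj₁ (proj₂ (proj₂ (proj₂ (b∈ zero)))) (J q))) (<⇒≤ (proj₁ (proj₂ (proj₂ (proj₂ (proj₂ (b∈ zero))))) (J q)))) (≤gradSize q l)) (k*-max k₀ q))
                0<Z : 0# < Z
                0<Z = ≰⇒> λ q → <⇒≱ (0<P s (suc k)) (≤-trans exactness (≤-respʳ (trans (*-congˡ (zeroʳ _)) (zeroʳ _)) (*-monoˡ-≤ (0≤ι (suc d)) (*-monoˡ-≤ (0≤cap (J j)) q))))
                0<evj : 0# < ∣ evc j ∣ᴿ
                0<evj = ≰⇒> λ q → <⇒≱ 0<Z (≤-trans avoided (≤-respʳ (zeroˡ _) (*-monoʳ-≤ (<⇒≤ 0<β) q)))
                cost : Ω d * (Π * ρ) ≤ ∣ evc j ∣ᴿ * h (J j)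
                cost = *-cancelˡ-≤ (*-pos (*-pos (<-≤-trans 0<1 (1≤μ (J j))) (0<ι d)) 0<β) (begin
                  L * I * β * (Ω d * (Π * (I * Q)))    ≈⟨ solve 6 (λ l i β o p q → l :* i :* β :* (o :* (p :* (i :* q))) := (o :* (i :* i)) :* ((l :* p) :* (β :* q))) refl L I β (Ω d) Π Q ⟩
                  (Ω d * (I * I)) * ((L * Π) * (β * Q)) ≤⟨ *-mono-≤ (*-nonNeg (*-nonNeg (≤-trans 0≤1 (1≤μ (J j))) 0≤Π) 0≤βQ) (<⇒≤ 0<b) ΩII≤b (*-monoʳ-≤ 0≤βQ (∏rest j)) ⟩
                  b * (b ^ yk * (β * Q))               ≈⟨ *-assoc _ _ _ ⟨
                  b ^ suc yk * (β * Q)                 ≈⟨ *-congˡ (^*P (E ℕ.+ n) k (t ℕ.+ V)) ⟩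
                  b ^ suc yk * P (E ℕ.+ n ℕ.+ k) (t ℕ.+ V) ≈⟨ ^*P (suc yk) (E ℕ.+ n ℕ.+ k) (t ℕ.+ V) ⟩
                  P (suc yk ℕ.+ (E ℕ.+ n ℕ.+ k)) (t ℕ.+ V) ≤⟨ P-mono {suc yk ℕ.+ (E ℕ.+ n ℕ.+ k)} {t ℕ.+ V} {s} {suc k} exponents ⟩
                  P s (suc k)                          ≤⟨ exactness ⟩
                  I * (cap t s (J j) * Z)              ≤⟨ *-monoˡ-≤ (0≤ι (suc d)) (*-mono-≤ (abs-nonNeg _) (*-nonNeg (≤-trans 0≤1 (1≤μ (J j))) (<⇒≤ (0<h (J j)))) (cap≤μh (J j) (J-pos j)) avoided) ⟩
                  I * (L * h (J j) * (∣ evc j ∣ᴿ * β)) ≈⟨ solve 5 (λ i l h v β → i :* (l :* h :* (v :* β)) := l :* i :* β :* (v :* h)) refl I L (h (J j)) ∣ evc j ∣ᴿ β ⟩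
                  L * I * β * (∣ evc j ∣ᴿ * h (J j))   ∎)
                  where
                  0≤βQ : 0# ≤ β * Q
                  0≤βQ = *-nonNeg (<⇒≤ 0<β) (<⇒≤ (0<P k (t ℕ.+ V)))
                  exponents : suc yk ℕ.+ (E ℕ.+ n ℕ.+ k) ℕ.+ suc k ℕ.≤ s ℕ.+ (t ℕ.+ V)
                  exponents = linℕ (ℕ.+-mono-≤ (ℕ.+-mono-≤ (5k≤z i) n≤k) (ℕ.+-mono-≤ (ℕ.*-monoʳ-≤ 2 (1≤kk i)) (ℕ.≤-reflexive E+)))
                    (N.solve 8 (λ E n k z yk t V s → s N.:+ (t N.:+ V) N.:+ (N.con 5 N.:* k N.:+ n N.:+ (N.con 2 N.:* N.con 1 N.:+ (E N.:+ (z N.:+ yk))))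
                       N.:= N.con 1 N.:+ yk N.:+ (E N.:+ n N.:+ k) N.:+ (N.con 1 N.:+ k) N.:+ (z N.:+ k N.:+ (N.con 2 N.:* k N.:+ (t N.:+ V N.:+ s)))) ≡.refl E n k z yk t V s)

              unflagged : ⊥
              unflagged = go (argmaxOver k₀ (λ k → ∣ evc k ∣ᴿ * h (J k)))
                where
                go : ∃[ j ] (∀ k → ∣ evc k ∣ᴿ * h (J k) ≤ ∣ evc j ∣ᴿ * h (J j)) → ⊥
                go (j , mx) = [ large j mx , (λ le → small λ k → ≤-trans (mx k) le) ]′ (<-or-≥ ρ′ (∣ evc j ∣ᴿ * h (J j)))

            noMembers : ∀ n′ → size ≡ suc n′ → (b′ : Fin (suc n′) → Vector ℤ (suc d)) → (∀ k → Members V t s (In (ep i)) (b′ k)) →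
                        Independent b′ → (∀ k → Covers (toAff (b′ k))) → ⊥
            noMembers n′ size≡ b′ b∈ ind cov = byFlag flag ≡.refl
              where
              byFlag : ∀ f → flag ≡ f → ⊥
              byFlag true f = go n′ (ℕ.suc-injective (≡.trans (≡.sym (≡.cong (countWith m) f)) size≡)) b′ b∈ ind cov
                where
                go : ∀ n′ → m ≡ n′ → (b′ : Fin (suc n′) → Vector ℤ (suc d)) → (∀ k → Members V t s (In (ep i)) (b′ k)) →
                        Independent b′ → (∀ k → Covers (toAff (b′ k))) → ⊥
                go _ ≡.refl = flagged
              byFlag false f = unflagged n′ (≡.trans (≡.sym (≡.cong (countWith m) f)) size≡) f b′ b∈ ind cov




          zeroSize : ∀ {h : Fin d → Carrier} (S : System h Pos) → System.size S ≡ 0 → System.Covers S (toAff a₀) → ⊥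
          zeroSize S size≡0 (c , c₀) = trivial a₀ y₀ (λ l → ≤-<-trans (≈⇒≤ (abs-0 (trans (c l) (no-terms (suc l))))) 0<1)
              (≤-<-trans (≈⇒≤ (abs-0 (trans (+-cong (trans (c₀ flag≡) (no-terms zero)) (∑-0 λ l → trans (*-congʳ (trans (c l) (no-terms (suc l)))) (zeroˡ _))) (+-identityʳ 0#)))) 0<1)
              (proj₁ sol₀)
            where
            counts : ∀ m f → countWith m f ≡ 0 → m ≡ 0 × f ≡ false
            counts m true ()
            counts m false e = e , ≡.refl
            m≡0 : System.m S ≡ 0
            m≡0 = proj₁ (counts (System.m S) (System.flag S) size≡0)
            flag≡ : System.flag S ≡ false
            flag≡ = proj₂ (counts (System.m S) (System.flag S) size≡0)
            no-terms : ∀ i → System.expand S (toAff a₀) i ≈ 0#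
            no-terms i = ∑-0 λ k → ⊥-elim (Fin.¬Fin0 (≡.subst Fin m≡0 k))

          a₀∈ : ∀ i → i ℕ.≤ suc d → Members V t s (In (ep i)) a₀
          a₀∈ i p = y₀ , nested (ℕ.≤-trans (ℕ.m∸n≤m (t ℕ.+ V ℕ.+ s) (kk n i)) e-large) y₀∈ , sol₀

          SizeAt : ℕ → (h : Fin d → Carrier) → (∀ l → 0# < h l) → ℕ → Set
          SizeAt i h 0<h = CoverSize {h = h} {Pos} 0<h (Members V t s (In (ep i))) λ { a (y , _ , sol) → Sol-supp {V} {t} {s} {y} a sol }

          sizeOf : ℕ → ℕ
          sizeOf i = System.size (Cover.system V t s n i (In (ep (suc i))))

          sizeOf-≤ : ∀ i {k} → Cover.Size V t s n i (In (ep (suc i))) k → sizeOf i ℕ.≤ k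
          sizeOf-≤ i {k} sz = ≡.subst (ℕ._≤ k) (≡.sym (proj₁ (proj₂ (proj₁ (proj₂ (Cover.least V t s n i (In (ep (suc i)))))))))
            (ℕ.≮⇒≥ λ k< → proj₂ (proj₂ (Cover.least V t s n i (In (ep (suc i))))) k k< sz)

          covers : ∀ i a → Members V t s (In (ep (suc i))) a → System.Covers (Cover.system V t s n i (In (ep (suc i)))) (toAff a)
          covers i = proj₂ (proj₂ (proj₁ (proj₂ (Cover.least V t s n i (In (ep (suc i)))))))

          -- Either the members at `ep i` have a cover of smaller size, or `sizeOf i` of them are
          -- independent, which `noMembers` excludes. The scale `h` is arbitrary because the next
          -- stage measures with its own.
          descend : ∀ i → i ℕ.≤ d → sizeOf i ℕ.≤ suc i → ∀ h (0<h : ∀ l → 0# < h l) → ∃[ k ] (k ℕ.≤ i × SizeAt i h 0<h k)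
          descend i i≤d size≤ h 0<h = bySize (sizeOf i) ≡.refl
            where
            Supp : ∀ a → Members V t s (In (ep i)) a → ∀ l → ¬ Pos l → ζ (a (suc l)) ≈ 0#
            Supp a (y , _ , sol) = Sol-supp {V} {t} {s} {y} a sol
            member↑ : ∀ a → Members V t s (In (ep i)) a → Members V t s (In (ep (suc i))) a
            member↑ a (y , y∈ , sol) = y , nested (ℕ.∸-monoʳ-≤ (t ℕ.+ V ℕ.+ s) (kk-mono n (ℕ.n≤1+n i))) y∈ , sol
            bySize : ∀ n′ → sizeOf i ≡ n′ → ∃[ k ] (k ℕ.≤ i × SizeAt i h 0<h k)
            bySize zero eq = ⊥-elim (zeroSize (Cover.system V t s n i (In (ep (suc i)))) eq (covers i a₀ (a₀∈ (suc i) (s≤s i≤d))))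
            bySize (suc n′) eq = choose (build 0<h (Members V t s (In (ep i))) Supp (suc n′))
              where
              choose : Build 0<h (Members V t s (In (ep i))) Supp (suc n′) → ∃[ k ] (k ℕ.≤ i × SizeAt i h 0<h k)
              choose (inj₁ (k , s≤s k≤n′ , S , sz , cov)) = k , ℕ.≤-trans k≤n′ (ℕ.≤-pred (≡.subst (ℕ._≤ suc i) eq size≤)) , S , sz , cov
              choose (inj₂ (_ , _ , b′ , b∈ , ind , _)) = ⊥-elim (Stage.noMembers i i≤d n′ eq b′ b∈ ind (λ k → covers i (b′ k) (member↑ (b′ k) (b∈ k))))

          -- The size is at most d + 1 at `ep (d + 1)` and drops d + 1 times, so it is 0 at `ep 0`,
          -- although the nonzero function `a₀` is a member at every one of these epochs.
          contradiction′ : ⊥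
          contradiction′ = go d ℕ.≤-refl (start (Cover.cov V t s n d (In (ep (suc d)))))
            where
            start : ∃[ k ] (k ℕ.≤ suc d × Cover.Size V t s n d (In (ep (suc d))) k) → sizeOf d ℕ.≤ suc d
            start (k , k≤ , sz) = ℕ.≤-trans (sizeOf-≤ d sz) k≤
            go : ∀ i → i ℕ.≤ d → sizeOf i ℕ.≤ suc i → ⊥
            go zero p q = finish (descend zero p q (λ _ → 1#) (λ _ → 0<1))
              where
              finish : ∃[ k ] (k ℕ.≤ 0 × SizeAt 0 (λ _ → 1#) (λ _ → 0<1) k) → ⊥
              finish (.0 , z≤n , S , sz , cov) = zeroSize S sz (cov a₀ (a₀∈ 0 z≤n))
            go (suc i) p q = next (descend (suc i) p q (scale t s n i) (0<scale t s n i))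
              where
              next : ∃[ k ] (k ℕ.≤ suc i × SizeAt (suc i) (scale t s n i) (0<scale t s n i) k) → ⊥
              next (k , k≤ , S , sz , cov) = go i (ℕ.≤-trans (ℕ.n≤1+n i) p) (ℕ.≤-trans (sizeOf-≤ i (S , sz , cov)) k≤)

        noSol : ∀ t s → s ℕ.≤ M t → NoSol t s
        noSol t = go (suc t) t ℕ.≤-refl
          where
          go : ∀ T t → t ℕ.< T → ∀ s → s ℕ.≤ M t → NoSol t s
          go (suc T) t (s≤s t≤T) s s≤M = go′ (suc s) s ℕ.≤-refl s≤M
            where
            go′ : ∀ S s → s ℕ.< S → s ℕ.≤ M t → NoSol t s
            go′ (suc S) zero _ _ e y _ _ a = Sol-trivial {V} {t} {0} {y} a (inj₂ ≡.refl)
            go′ (suc S) (suc s) (s≤s s<S) s≤M e y e-large y∈ a sol = Step.contradiction′ t (suc s) (s≤s z≤n) s≤M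
              (λ t′ s′ t′<t s′≤ → go T t′ (ℕ.<-≤-trans t′<t t≤T) s′ s′≤)
              (λ s′ s′< → go′ S s′ (ℕ.<-≤-trans s′< s<S) (ℕ.≤-trans (ℕ.<⇒≤ s′<) s≤M)) e y e-large y∈ a sol

  -- General position, and the potential of a list of tasks.

  module PotentialMethod where
    open OrderedField
    open FiniteSums
    open LinearFormsPigeonhole
    open AffineSystems
    open SmallFunctions
    open WeightData
    open DualBounds

    -- Read off from the back substitution in `slab-or-generalPosition`: one elimination replaces
    -- the bound R by R(1 + R) and the tolerance δ by (1 + R)δ.
    spreadConstant : ℕ → Carrier → Carrier
    spreadConstant zero R = 0#
    spreadConstant (suc k) R = 1# + (1# + ι k * R) * ((1# + R) * spreadConstant k (R * (1# + R)))

    0≤spreadConstant : ∀ k {R} → 0# ≤ R → 0# ≤ spreadConstant k R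
    0≤spreadConstant zero _ = ≤-refl
    0≤spreadConstant (suc k) p = +-nonNeg 0≤1 (*-nonNeg (+-nonNeg 0≤1 (*-nonNeg (0≤ι k) p)) (*-nonNeg (+-nonNeg 0≤1 p)
      (0≤spreadConstant k (*-nonNeg p (+-nonNeg 0≤1 p)))))

    module _ {A : Set} (X : A → Set) where

      Slab : ∀ {k} → (Fin k → A → Carrier) → Set
      Slab {k} g = Σ[ n ∈ (Fin k → Carrier) ] ((∃[ p ] n p ≈ 1#) × (∀ y → X y → ∣ ∑ (λ i → n i * g i y) ∣ᴿ ≤ 1#))

      GeneralPosition : ∀ {k} → (Fin k → A → Carrier) → Carrier → Set
      GeneralPosition {k} g K = Σ[ p ∈ (Fin k → A) ] ((∀ j → X (p j)) × (∀ (c : Fin k → Carrier) {δ} → 0# ≤ δ →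
        (∀ j → ∣ ∑ (λ i → c i * g i (p j)) ∣ᴿ ≤ δ) → ∀ i → ∣ c i ∣ᴿ ≤ K * δ))

      -- Elimination with pivots bounded from below: if the first function exceeds 1 at a point of
      -- `X`, this point is taken and the function is subtracted from the others so that they vanish
      -- there; otherwise the first function alone defines the slab.
      slab-or-generalPosition : ∀ {k} (g : Fin k → A → Carrier) {R} → 0# ≤ R → (∀ i y → X y → ∣ g i y ∣ᴿ ≤ R) →
                                Slab g ⊎ GeneralPosition g (spreadConstant k R)
      slab-or-generalPosition {zero} g 0≤R g≤ = inj₂ ((λ ()) , (λ ()) , λ _ _ _ ())
      slab-or-generalPosition {suc k} g {R} 0≤R g≤ = classically (∃[ y ] (X y × 1# < ∣ g zero y ∣ᴿ)) far
          λ ¬far → inj₁ (n₀ , (zero , refl) , λ y y∈ → ≤-respˡ (abs-cong (sym (trans (∑-suc (λ i → n₀ i * g i y)) (trans (+-cong (*-identityˡ _) (∑-0 λ i → zeroˡ _)) (+-identityʳ _)))))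
            (≮⇒≥ λ 1< → ¬far (y , y∈ , 1<)))
        where
        n₀ : Fin (suc k) → Carrier
        n₀ zero = 1#
        n₀ (suc i) = 0#
        far : ∃[ y ] (X y × 1# < ∣ g zero y ∣ᴿ) → Slab g ⊎ GeneralPosition g (spreadConstant (suc k) R)
        far (y₁ , y₁∈ , 1<g) = combineWith (slab-or-generalPosition g′ (*-nonNeg 0≤R (+-nonNeg 0≤1 0≤R)) g′≤)
          where
          g₁ : Carrier
          g₁ = g zero y₁
          g₁≉0 : ¬ (g₁ ≈ 0#)
          g₁≉0 e = <⇒≱ 1<g (≤-trans (≈⇒≤ (abs-0 e)) 0≤1)
          ν : Fin k → Carrier
          ν i = g (suc i) y₁ * g₁ ⁻¹
          ν≤ : ∀ i → ∣ ν i ∣ᴿ ≤ R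
          ν≤ i = *-cancelʳ-≤ (abs-pos g₁≉0) (≤-trans (≈⇒≤ (trans (sym (abs-* _ _)) (abs-cong (/-cancel (g (suc i) y₁) g₁≉0)))) (≤-trans (g≤ (suc i) y₁ y₁∈) (x≤x*y 0≤R (<⇒≤ 1<g))))
          g′ : Fin k → A → Carrier
          g′ i y = g (suc i) y - ν i * g zero y
          g′≤ : ∀ i y → X y → ∣ g′ i y ∣ᴿ ≤ R * (1# + R)
          g′≤ i y y∈ = ≤-trans (abs-+ _ _) (≤-trans (+-mono-≤ (g≤ (suc i) y y∈) (≤-trans (≈⇒≤ (trans (abs-neg _) (abs-* _ _))) (*-mono-≤ (abs-nonNeg _) 0≤R (ν≤ i) (g≤ zero y y∈))))
            (≈⇒≤ (solve 1 (λ r → r :+ r :* r := r :* (con (+ 1) :+ r)) refl R)))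
          g′-y₁ : ∀ i → g′ i y₁ ≈ 0#
          g′-y₁ i = trans (+-congˡ (-‿cong (/-cancel (g (suc i) y₁) g₁≉0))) (-‿inverseʳ _)
          change : ∀ (c : Fin (suc k) → Carrier) y → ∑ (λ i → c i * g i y) ≈ (c zero + ∑ (λ i → c (suc i) * ν i)) * g zero y + ∑ (λ i → c (suc i) * g′ i y)
          change c y = begin
            ∑ (λ i → c i * g i y) ≈⟨ ∑-suc (λ i → c i * g i y) ⟩
            c zero * g zero y + ∑ (λ i → c (suc i) * g (suc i) y)
              ≈⟨ +-congˡ (trans (∑-cong λ i → solve 4 (λ c g n z → c :* g := (c :* n) :* z :+ c :* (g :- n :* z)) refl (c (suc i)) (g (suc i) y) (ν i) (g zero y)) (∑-+ _ _)) ⟩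
            c zero * g zero y + (∑ (λ i → c (suc i) * ν i * g zero y) + S′)
              ≈⟨ +-congˡ (+-congʳ (sym (∑-*ʳ (λ i → c (suc i) * ν i) (g zero y)))) ⟩
            c zero * g zero y + (∑ (λ i → c (suc i) * ν i) * g zero y + S′)
              ≈⟨ solve 4 (λ c z s s′ → c :* z :+ (s :* z :+ s′) := (c :+ s) :* z :+ s′) refl (c zero) (g zero y) (∑ (λ i → c (suc i) * ν i)) S′ ⟩
            (c zero + ∑ (λ i → c (suc i) * ν i)) * g zero y + S′ ∎
            where
            open ≈R
            S′ : Carrier
            S′ = ∑ (λ i → c (suc i) * g′ i y)
          K′ : Carrier
          K′ = spreadConstant k (R * (1# + R))
          combineWith : Slab g′ ⊎ GeneralPosition g′ K′ → Slab g ⊎ GeneralPosition g (spreadConstant (suc k) R)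
          combineWith (inj₁ (n′ , (p , np) , sl)) = inj₁ (n , (suc p , np) , λ y y∈ → ≤-respˡ (abs-cong (sym (trans (change n y) (trans (+-congʳ (trans (*-congʳ (-‿inverseˡ _)) (zeroˡ _))) (+-identityˡ _))))) (sl y y∈))
            where
            n : Fin (suc k) → Carrier
            n zero = - ∑ (λ i → n′ i * ν i)
            n (suc i) = n′ i
          combineWith (inj₂ (p′ , p′∈ , gp)) = inj₂ (p , (λ { zero → y₁∈ ; (suc j) → p′∈ j }) , bound)
            where
            p : Fin (suc k) → A
            p zero = y₁
            p (suc j) = p′ j
            bound : ∀ (c : Fin (suc k) → Carrier) {δ} → 0# ≤ δ → (∀ j → ∣ ∑ (λ i → c i * g i (p j)) ∣ᴿ ≤ δ) → ∀ i → ∣ c i ∣ᴿ ≤ spreadConstant (suc k) R * δ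
            bound c {δ} 0≤δ small = λ { zero → c₀≤ ; (suc i) → ≤-trans (c≤ i) (*-monoʳ-≤ 0≤δ K″≤) }
              where
              c̃ K″ : Carrier
              c̃ = c zero + ∑ (λ i → c (suc i) * ν i)
              K″ = (1# + R) * K′
              0≤K″ : 0# ≤ K″
              0≤K″ = *-nonNeg (+-nonNeg 0≤1 0≤R) (0≤spreadConstant k (*-nonNeg 0≤R (+-nonNeg 0≤1 0≤R)))
              c̃≤ : ∣ c̃ ∣ᴿ ≤ δ
              c̃≤ = ≤-trans (x≤x*y (abs-nonNeg _) (<⇒≤ 1<g)) (≤-respˡ (trans (abs-cong (trans (change c y₁) (trans (+-congˡ (∑-0 λ i → trans (*-congˡ (g′-y₁ i)) (zeroʳ _))) (+-identityʳ _)))) (abs-* _ _)) (small zero))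
              c≤ : ∀ i → ∣ c (suc i) ∣ᴿ ≤ K″ * δ
              c≤ i = ≤-respʳ (solve 3 (λ r k d → k :* ((con (+ 1) :+ r) :* d) := (con (+ 1) :+ r) :* k :* d) refl R K′ δ) (gp (c ∘ suc) (*-nonNeg (+-nonNeg 0≤1 0≤R) 0≤δ) small′ i)
                where
                small′ : ∀ j → ∣ ∑ (λ i → c (suc i) * g′ i (p′ j)) ∣ᴿ ≤ (1# + R) * δ
                small′ j = ≤-trans (≈⇒≤ (abs-cong (trans (solve 2 (λ a s → s := (a :+ s) :- a) refl (c̃ * g zero (p′ j)) (∑ (λ i → c (suc i) * g′ i (p′ j)))) (+-congʳ (sym (change c (p′ j)))))))
                  (≤-trans (abs-+ _ _) (≤-trans (+-mono-≤ (small (suc j)) (≤-trans (≈⇒≤ (trans (abs-neg _) (abs-* _ _))) (*-mono-≤ (abs-nonNeg _) 0≤δ c̃≤ (g≤ zero (p′ j) (p′∈ j)))))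
                  (≈⇒≤ (solve 2 (λ r d → d :+ d :* r := (con (+ 1) :+ r) :* d) refl R δ))))
              K″≤ : K″ ≤ spreadConstant (suc k) R
              K″≤ = lin (+-nonNeg 0≤1 (*-nonNeg (*-nonNeg (0≤ι k) 0≤R) 0≤K″)) (solve 3 (λ i r k → (con (+ 1) :+ (con (+ 1) :+ i :* r) :* k) :+ con 0ℤ := k :+ (con (+ 1) :+ i :* r :* k)) refl (ι k) R K″)
              c₀≤ : ∣ c zero ∣ᴿ ≤ spreadConstant (suc k) R * δ
              c₀≤ = ≤-trans (≈⇒≤ (abs-cong (solve 2 (λ c s → c := (c :+ s) :- s) refl (c zero) (∑ (λ i → c (suc i) * ν i))))) (≤-trans (abs-+ _ _) (≤-trans (+-mono-≤ c̃≤ (≤-trans (≈⇒≤ (abs-neg _)) (abs-∑-≤ term)))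
                (lin (*-nonNeg 0≤K″ 0≤δ) (solve 4 (λ i r k d → (con (+ 1) :+ (con (+ 1) :+ i :* r) :* k) :* d :+ con 0ℤ := (d :+ i :* (k :* d :* r)) :+ k :* d) refl (ι k) R K″ δ))))
                where
                term : ∀ i → ∣ c (suc i) * ν i ∣ᴿ ≤ K″ * δ * R
                term i = ≤-trans (≈⇒≤ (abs-* _ _)) (*-mono-≤ (abs-nonNeg _) (*-nonNeg 0≤K″ 0≤δ) (c≤ i) (ν≤ i))

    module Potential (d : ℕ) (1≤d : 1 ℕ.≤ d) (b : Carrier) (1≤b : 1# ≤ b) (ε₀ : Carrier) (0<ε₀ : 0# < ε₀)
      (b-big : spreadConstant d (two * ε₀ ⁻¹) * (two * ι (suc d)) < ε₀ * b) where

      open Powers b 1≤b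

      Task : Set
      Task = Aff {d} × ℕ

      -- Numerically δ = d + 1, τ = 1/(2d + 4), u = 1 - τ, half = 1/2, θ = (d + 1)/(2d + 3), and uθ
      -- = ω = 1/2 - τ. If the tasks weigh at most 1/2, a centre that leaves more than θ misses
      -- tasks of weight at most τ. Then d + 1 such centres miss at most (d + 1)τ = ω altogether,
      -- less than the total, so they share a task. The rest ν = 1/2 - θ may be added at each epoch.
      δ D₃ D₄ τ ω half u θ ν : Carrier
      δ = ι (suc d)
      D₃ = δ + δ + 1#
      D₄ = δ + δ + two
      τ = D₄ ⁻¹
      ω = δ * τ
      half = (δ + 1#) * τ
      u = D₃ * τ
      θ = δ * D₃ ⁻¹
      ν = half - θ

      0<D₃ : 0# < D₃
      0<D₃ = +-pos-nonNeg (+-pos-nonNeg (0<ι d) (0≤ι (suc d))) 0≤1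

      0<D₄ : 0# < D₄
      0<D₄ = +-pos-nonNeg (+-pos-nonNeg (0<ι d) (0≤ι (suc d))) (<⇒≤ 0<two)

      0<τ : 0# < τ
      0<τ = ⁻¹-pos 0<D₄

      D₄τ : D₄ * τ ≈ 1#
      D₄τ = ⁻¹-inverseʳ D₄ (0<⇒≉ 0<D₄)

      0<u : 0# < u
      0<u = *-pos 0<D₃ 0<τ

      half+half : half + half ≈ 1#
      half+half = trans (solve 2 (λ d t → (d :+ con (+ 1)) :* t :+ (d :+ con (+ 1)) :* t := (d :+ d :+ (con (+ 1) :+ con (+ 1))) :* t) refl δ τ) D₄τ

      u+τ : u + τ ≈ 1#
      u+τ = trans (solve 2 (λ d t → (d :+ d :+ con (+ 1)) :* t :+ t := (d :+ d :+ (con (+ 1) :+ con (+ 1))) :* t) refl δ τ) D₄τ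

      uθ : u * θ ≈ ω
      uθ = trans (solve 4 (λ d3 t d d3i → d3 :* t :* (d :* d3i) := d :* t :* (d3 :* d3i)) refl D₃ τ δ (D₃ ⁻¹)) (trans (*-congˡ (⁻¹-inverseʳ D₃ (0<⇒≉ 0<D₃))) (*-identityʳ _))

      half≈ω+τ : half ≈ ω + τ
      half≈ω+τ = solve 2 (λ d t → (d :+ con (+ 1)) :* t := d :* t :+ t) refl δ τ

      0<half : 0# < half
      0<half = *-pos (+-pos-nonNeg (0<ι d) 0≤1) 0<τ

      half<1 : half < 1#
      half<1 = ≰⇒> λ q → <⇒≱ 0<half (lin (≤-respˡ (sym half+half) q) (+-identityˡ _))

      -- ν is positive because (2d+4)(d+1) < (2d+3)(d+2).
      0<ν : 0# < ν
      0<ν = ≰⇒> λ q → <⇒≱ (+-pos-nonNeg (0<ι d) 0≤1) (≤-respˡ e₂ (≤-respʳ (zeroʳ (D₄ * D₃)) (*-monoˡ-≤ (*-nonNeg (<⇒≤ 0<D₄) (<⇒≤ 0<D₃)) q)))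
        where
        e₂ : D₄ * D₃ * ν ≈ δ + 1#
        e₂ = begin
          D₄ * D₃ * ((δ + 1#) * τ - δ * D₃ ⁻¹)
            ≈⟨ solve 5 (λ d4 d3 d t ti → d4 :* d3 :* ((d :+ con (+ 1)) :* t :- d :* ti) := (d4 :* t) :* (d3 :* (d :+ con (+ 1))) :- (d3 :* ti) :* (d4 :* d)) refl D₄ D₃ δ τ (D₃ ⁻¹) ⟩
          (D₄ * τ) * (D₃ * (δ + 1#)) - (D₃ * D₃ ⁻¹) * (D₄ * δ)
            ≈⟨ +-cong (trans (*-congʳ D₄τ) (*-identityˡ _)) (-‿cong (trans (*-congʳ (⁻¹-inverseʳ D₃ (0<⇒≉ 0<D₃))) (*-identityˡ _))) ⟩
          D₃ * (δ + 1#) - D₄ * δ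
            ≈⟨ solve 1 (λ d → (d :+ d :+ con (+ 1)) :* (d :+ con (+ 1)) :- (d :+ d :+ (con (+ 1) :+ con (+ 1))) :* d := d :+ con (+ 1)) refl δ ⟩
          δ + 1# ∎
          where open ≈R

      weight : List Task → Carrier
      weight [] = 0#
      weight ((T , r) ∷ xs) = u ^ r + weight xs

      0≤weight : ∀ xs → 0# ≤ weight xs
      0≤weight [] = ≤-refl
      0≤weight ((T , r) ∷ xs) = +-nonNeg (^-nonNeg r (<⇒≤ 0<u)) (0≤weight xs)

      weight-++ : ∀ xs ys → weight (xs ++ ys) ≈ weight xs + weight ys
      weight-++ [] ys = sym (+-identityˡ _)
      weight-++ ((T , r) ∷ xs) ys = trans (+-congˡ (weight-++ xs ys)) (sym (+-assoc _ _ _))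

      weight-∈ : ∀ {T r} xs → (T , r) ∈ˡ xs → u ^ r ≤ weight xs
      weight-∈ (x ∷ xs) (here ≡.refl) = ≤-respˡ (+-identityʳ _) (+-mono-≤ ≤-refl (0≤weight xs))
      weight-∈ ((_ , r) ∷ xs) (there p) = ≤-respˡ (+-identityˡ _) (+-mono-≤ (^-nonNeg r (<⇒≤ 0<u)) (weight-∈ xs p))

      -- The threshold d + 1 catches every task that is below b^(-e) somewhere in a ball of radius
      -- b^(-e): on the way to the centre a steep function changes by at most d b^(-e).
      Hit : ℕ → Vector Carrier d → Aff {d} → Set
      Hit e y T = ∣ eval T y ∣ᴿ * b ^ e < δ

      keep : ∀ {Q : Set} → Dec Q → Task → List Task → List Task
      keep (yes _) x xs = x ∷ xs
      keep (no _) x xs = xs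

      -- The tasks that a ball with centre y at epoch e can still violate.
      remaining : ℕ → Vector Carrier d → List Task → List Task
      remaining e y [] = []
      remaining e y ((T , zero) ∷ xs) = remaining e y xs
      remaining e y ((T , suc r) ∷ xs) = keep (em {Hit e y T}) (T , r) (remaining e y xs)

      missOne : ∀ {Q : Set} → Dec Q → ℕ → Carrier
      missOne (yes _) r = 0#
      missOne (no _) r = u ^ r

      missed : ℕ → Vector Carrier d → List Task → Carrier
      missed e y [] = 0#
      missed e y ((T , r) ∷ xs) = missOne (em {Hit e y T}) r + missed e y xs

      remaining-∈ : ∀ {e y T r} xs → (T , suc r) ∈ˡ xs → Hit e y T → (T , r) ∈ˡ remaining e y xs
      remaining-∈ {e} {y} {T} {r} (_ ∷ xs) (here ≡.refl) hit = kept em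
        where
        kept : (q : Dec (Hit e y T)) → (T , r) ∈ˡ keep q (T , r) (remaining e y xs)
        kept (yes _) = here ≡.refl
        kept (no ¬q) = ⊥-elim (¬q hit)
      remaining-∈ ((_ , zero) ∷ xs) (there p) hit = remaining-∈ xs p hit
      remaining-∈ {e} {y} {T} {r} ((T′ , suc r′) ∷ xs) (there p) hit = kept em (remaining-∈ xs p hit)
        where
        kept : (q : Dec (Hit e y T′)) → (T , r) ∈ˡ remaining e y xs → (T , r) ∈ˡ keep q (T′ , r′) (remaining e y xs)
        kept (yes _) p = there p
        kept (no _) p = p

      -- A surviving task gains the factor 1/u as its time shortens. After multiplication by u,
      -- survivors and missed tasks are disjoint parts of the old list.
      remaining+missed : ∀ e y xs → u * weight (remaining e y xs) + missed e y xs ≤ weight xs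
      remaining+missed e y [] = ≈⇒≤ (trans (+-congʳ (zeroʳ u)) (+-identityʳ 0#))
      remaining+missed e y ((T , zero) ∷ xs) = ≤-trans (≈⇒≤ (solve 3 (λ a m s → a :+ (m :+ s) := m :+ (a :+ s)) refl _ _ _)) (+-mono-≤ (one em) (remaining+missed e y xs))
        where
        one : (q : Dec (Hit e y T)) → missOne q 0 ≤ 1#
        one (yes _) = 0≤1
        one (no _) = ≤-refl
      remaining+missed e y ((T , suc r) ∷ xs) = one em
        where
        A B : Carrier
        A = weight (remaining e y xs)
        B = missed e y xs
        one : (q : Dec (Hit e y T)) → u * weight (keep q (T , r) (remaining e y xs)) + (missOne q (suc r) + B) ≤ u ^ suc r + weight xs
        one (yes _) = ≤-trans (≈⇒≤ (solve 4 (λ u x a b → u :* (x :+ a) :+ (con 0ℤ :+ b) := u :* x :+ (u :* a :+ b)) refl u (u ^ r) A B)) (+-mono-≤ ≤-refl (remaining+missed e y xs))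
        one (no _) = ≤-trans (≈⇒≤ (solve 3 (λ x a b → a :+ (x :+ b) := x :+ (a :+ b)) refl (u ^ suc r) (u * A) B)) (+-mono-≤ ≤-refl (remaining+missed e y xs))

      weight≤missed : ∀ {N} e (pt : Fin N → Vector Carrier d) xs → (∀ {T r} → (T , r) ∈ˡ xs → ∃[ q ] ¬ Hit e (pt q) T) →
                      weight xs ≤ ∑ (λ q → missed e (pt q) xs)
      weight≤missed e pt [] _ = ≈⇒≤ (sym (∑-0 λ _ → refl))
      weight≤missed e pt ((T , r) ∷ xs) miss = ≤-trans (+-mono-≤ (first (miss (here ≡.refl))) (weight≤missed e pt xs (λ p → miss (there p)))) (≈⇒≤ (sym (∑-+ _ _)))
        where
        0≤missOne : ∀ {Q : Set} (q : Dec Q) → 0# ≤ missOne q r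
        0≤missOne (yes _) = ≤-refl
        0≤missOne (no _) = ^-nonNeg r (<⇒≤ 0<u)
        first : ∃[ q ] ¬ Hit e (pt q) T → u ^ r ≤ ∑ (λ q → missOne (em {Hit e (pt q) T}) r)
        first (q , ¬hit) = ≤-trans (one em) (term≤∑ (λ q → 0≤missOne (em {Hit e (pt q) T})) q)
          where
          one : (dec : Dec (Hit e (pt q) T)) → u ^ r ≤ missOne dec r
          one (yes h) = ⊥-elim (¬hit h)
          one (no _) = ≤-refl

      Steep : Aff {d} → Set
      Steep T = (∀ l → ∣ T (suc l) ∣ᴿ ≤ 1#) × (∃[ l ] 1# ≤ ∣ T (suc l) ∣ᴿ)

      AllSteep : List Task → Set
      AllSteep xs = ∀ {T r} → (T , r) ∈ˡ xs → Steep T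

      Heavy : ℕ → List Task → Vector Carrier d → Set
      Heavy e xs y = θ < weight (remaining (suc e) y xs)

      SlabAround : ℕ → (Vector Carrier d → Set) → Set
      SlabAround e X = Σ[ n ∈ Vector Carrier d ] Σ[ y₀ ∈ Vector Carrier d ]
        ((∃[ p ] n p ≈ 1#) × (∀ y → X y → ∣ ∑ (λ l → n l * (y l - y₀ l)) ∣ᴿ * b ^ e ≤ ε₀))

      -- d + 1 heavy points in general position would leave no room for their common task.
      heavySlab : ∀ e (xs : List Task) → AllSteep xs → weight xs ≤ half → ∀ c →
                  SlabAround e (λ y → Heavy e xs y × (∀ l → ∣ c l - y l ∣ᴿ * b ^ e ≤ 1#))
      heavySlab e xs steep w≤ c = classically (∃[ y ] X y) withPoint
          (λ none → (λ _ → 1#) , c , (element 1≤d , refl) , λ y y∈ → ⊥-elim (none (y , y∈)))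
        where
        X : Vector Carrier d → Set
        X y = Heavy e xs y × (∀ l → ∣ c l - y l ∣ᴿ * b ^ e ≤ 1#)
        R K : Carrier
        R = two * ε₀ ⁻¹
        K = spreadConstant d R
        0<εi : 0# < ε₀ ⁻¹
        0<εi = ⁻¹-pos 0<ε₀
        0≤R : 0# ≤ R
        0≤R = *-nonNeg (<⇒≤ 0<two) (<⇒≤ 0<εi)
        0<be : 0# < b ^ e
        0<be = ^-pos e 0<b
        withPoint : ∃[ y ] X y → SlabAround e X
        withPoint (y₀ , heavy₀ , near₀) = finish (slab-or-generalPosition X g 0≤R g≤)
          where
          g : Fin d → Vector Carrier d → Carrier
          -- Scaled so that the bound 1 for a combination of the `g l` means ε₀ b^(-e) in space.
          g l y = (y l - y₀ l) * (b ^ e * ε₀ ⁻¹)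
          g≤ : ∀ l y → X y → ∣ g l y ∣ᴿ ≤ R
          g≤ l y (_ , near) = ≤-trans (≈⇒≤ (trans (abs-* _ _) (trans (*-congˡ (abs-of-nonNeg (<⇒≤ (*-pos 0<be 0<εi)))) (sym (*-assoc _ _ _)))))
            (*-monoʳ-≤ (<⇒≤ 0<εi) (≤-trans (*-monoʳ-≤ (<⇒≤ 0<be) (abs-triangle (y l) (c l) (y₀ l))) (≤-trans (≈⇒≤ (distribʳ _ _ _))
              (+-mono-≤ (≤-trans (≈⇒≤ (*-congʳ (abs-sub _ _))) (near l)) (near₀ l)))))
          finish : Slab X g ⊎ GeneralPosition X g K → SlabAround e X
          finish (inj₁ (n , p , sl)) = n , y₀ , p , λ y y∈ → *-cancelʳ-≤ 0<εi (≤-resp (sym (eq y)) (sym (⁻¹-inverseʳ ε₀ (0<⇒≉ 0<ε₀))) (sl y y∈))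
            where
            eq : ∀ y → ∣ ∑ (λ l → n l * (y l - y₀ l)) ∣ᴿ * b ^ e * ε₀ ⁻¹ ≈ ∣ ∑ (λ l → n l * g l y) ∣ᴿ
            eq y = trans (*-assoc _ _ _) (trans (*-congˡ (sym (abs-of-nonNeg (<⇒≤ (*-pos 0<be 0<εi))))) (trans (sym (abs-* _ _)) (abs-cong
              (trans (∑-*ʳ (λ l → n l * (y l - y₀ l)) (b ^ e * ε₀ ⁻¹)) (∑-cong λ l → *-assoc _ _ _)))))
          finish (inj₂ (p , p∈ , gp)) = ⊥-elim (classically (Σ[ T ∈ Aff ] ∃[ r ] ((T , r) ∈ˡ xs × (∀ q → Hit (suc e) (pt q) T))) common
              (λ none → noCommon λ {T} {r} T∈ → classically (∃[ q ] ¬ Hit (suc e) (pt q) T) id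
                (λ allHit → ⊥-elim (none (T , r , T∈ , λ q → classically (Hit (suc e) (pt q) T) id (λ ¬h → ⊥-elim (allHit (q , ¬h))))))))
            where
            pt : Fin (suc d) → Vector Carrier d
            pt zero = y₀
            pt (suc j) = p j
            heavy : ∀ q → Heavy e xs (pt q)
            heavy zero = heavy₀
            heavy (suc j) = proj₁ (p∈ j)
            noCommon : (∀ {T r} → (T , r) ∈ˡ xs → ∃[ q ] ¬ Hit (suc e) (pt q) T) → ⊥
            noCommon miss = <⇒≱ ω<weight (≤-trans (weight≤missed (suc e) pt xs miss) (∑-≤-const {f = λ q → missed (suc e) (pt q) xs} missed≤))
              where
              ω<u : ∀ q → ω < u * weight (remaining (suc e) (pt q) xs)
              ω<u q = <-resp uθ refl (*-monoˡ-< 0<u (heavy q))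
              0≤missed : ∀ y xs → 0# ≤ missed (suc e) y xs
              0≤missed y [] = ≤-refl
              0≤missed y ((T , r) ∷ xs) = +-nonNeg (one em) (0≤missed y xs)
                where
                one : (q : Dec (Hit (suc e) y T)) → 0# ≤ missOne q r
                one (yes _) = ≤-refl
                one (no _) = ^-nonNeg r (<⇒≤ 0<u)
              ω<weight : ω < weight xs
              ω<weight = <-≤-trans (ω<u zero) (≤-trans (≤-respˡ (+-identityʳ _) (+-mono-≤ ≤-refl (0≤missed y₀ xs))) (remaining+missed (suc e) y₀ xs))
              missed≤ : ∀ q → missed (suc e) (pt q) xs ≤ τ
              missed≤ q = lin (+-mono-≤ (<⇒≤ (ω<u q)) (≤-trans (remaining+missed (suc e) (pt q) xs) (≤-trans w≤ (≈⇒≤ half≈ω+τ))))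
                (solve 4 (λ t w u m → t :+ (w :+ (u :+ m)) := m :+ (u :+ (w :+ t))) refl τ ω (u * weight (remaining (suc e) (pt q) xs)) (missed (suc e) (pt q) xs))
            common : Σ[ T ∈ Aff ] ∃[ r ] ((T , r) ∈ˡ xs × (∀ q → Hit (suc e) (pt q) T)) → ⊥
            common (T , r , T∈ , hits) = steepContradiction (proj₂ (steep T∈))
              where
              c′ : Fin d → Carrier
              c′ l = T (suc l) * ε₀
              δ′ : Carrier
              δ′ = two * δ * bi
              0≤δ′ : 0# ≤ δ′
              0≤δ′ = *-nonNeg (*-nonNeg (<⇒≤ 0<two) (0≤ι (suc d))) (<⇒≤ 0<bi)
              value : ∀ q → ∣ eval T (pt q) ∣ᴿ * b ^ e ≤ δ * bi
              value q = *-cancelʳ-≤ 0<b (≤-resp (trans (*-congˡ (*-comm _ _)) (sym (*-assoc _ _ _))) (sym (trans (*-assoc _ _ _) (trans (*-congˡ (⁻¹-inverseˡ (0<⇒≉ 0<b))) (*-identityʳ _)))) (<⇒≤ (hits q)))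
              small : ∀ j → ∣ ∑ (λ l → c′ l * g l (p j)) ∣ᴿ ≤ δ′
              small j = begin
                ∣ ∑ (λ l → c′ l * g l (p j)) ∣ᴿ             ≈⟨ abs-cong eq ⟩
                ∣ (eval T (p j) - eval T y₀) * b ^ e ∣ᴿ      ≈⟨ trans (abs-* _ _) (*-congˡ (abs-of-nonNeg (<⇒≤ 0<be))) ⟩
                ∣ eval T (p j) - eval T y₀ ∣ᴿ * b ^ e        ≤⟨ *-monoʳ-≤ (<⇒≤ 0<be) (≤-trans (abs-+ _ _) (+-mono-≤ ≤-refl (≈⇒≤ (abs-neg _)))) ⟩
                (∣ eval T (p j) ∣ᴿ + ∣ eval T y₀ ∣ᴿ) * b ^ e ≈⟨ distribʳ _ _ _ ⟩
                ∣ eval T (p j) ∣ᴿ * b ^ e + ∣ eval T y₀ ∣ᴿ * b ^ e ≤⟨ +-mono-≤ (value (suc j)) (value zero) ⟩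
                δ * bi + δ * bi ≈⟨ solve 2 (λ d b → d :* b :+ d :* b := (con (+ 1) :+ con (+ 1)) :* d :* b) refl δ bi ⟩
                δ′ ∎
                where
                open ≤R
                eq : ∑ (λ l → c′ l * g l (p j)) ≈ (eval T (p j) - eval T y₀) * b ^ e
                eq = trans (∑-cong λ l → trans (solve 5 (λ t e d b ei → t :* e :* (d :* (b :* ei)) := (e :* ei) :* (t :* d :* b)) refl (T (suc l)) ε₀ (p j l - y₀ l) (b ^ e) (ε₀ ⁻¹))
                    (trans (*-congʳ (⁻¹-inverseʳ ε₀ (0<⇒≉ 0<ε₀))) (*-identityˡ _)))
                  (trans (sym (∑-*ʳ (λ l → T (suc l) * (p j l - y₀ l)) (b ^ e))) (*-congʳ (trans (solve 2 (λ a s → s := (a :+ s) :- a) refl (eval T y₀) (∑ (λ l → T (suc l) * (p j l - y₀ l)))) (+-congʳ (sym (eval-diff T (p j) y₀))))))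
              steepContradiction : ∃[ l ] 1# ≤ ∣ T (suc l) ∣ᴿ → ⊥
              -- General position bounds the gradient of the common task by a constant over b, which
              -- is less than 1 by `b-big`.
              steepContradiction (l , 1≤T) = <⇒≱ b-big (≤-respʳ e₁ (*-monoʳ-≤ (<⇒≤ 0<b) (≤-trans (≤-respˡ (*-identityˡ _) (*-monoʳ-≤ (<⇒≤ 0<ε₀) 1≤T))
                  (≤-respˡ (trans (abs-* _ _) (*-congˡ (abs-of-nonNeg (<⇒≤ 0<ε₀)))) (gp c′ 0≤δ′ small l)))))
                where
                e₁ : K * δ′ * b ≈ K * (two * δ)
                e₁ = trans (solve 4 (λ k x bi b → k :* (x :* bi) :* b := k :* x :* (bi :* b)) refl K (two * δ) bi b) (trans (*-congˡ (⁻¹-inverseˡ (0<⇒≉ 0<b))) (*-identityʳ _))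

  -- Euclidean balls and neighbourhoods of hyperplanes.

  module BallGeometry where
    open OrderedField
    open FiniteSums
    open LinearFormsPigeonhole
    open AffineSystems
    open SmallFunctions
    open WeightData

    √-≤⇒ : ∀ {x r} → 0# ≤ x → 0# ≤ r → √ x ≤ r → x ≤ r * r
    √-≤⇒ {x} {r} 0≤x 0≤r √≤r = ≮⇒≥ λ r²<x → <⇒≱ (bigger r²<x) √≤r
      where
      bounded : Satisfiable (UpperBound (λ y → y * y ≤ x))
      bounded = 1# + x , λ y y²≤x → sq-cancel-≤ (+-nonNeg 0≤1 0≤x) (≤-trans y²≤x (lin (+-nonNeg (+-nonNeg 0≤1 0≤x) (*-nonNeg 0≤x 0≤x))
        (solve 1 (λ x → (con (+ 1) :+ x) :* (con (+ 1) :+ x) :+ con 0ℤ := x :+ (con (+ 1) :+ x :+ x :* x)) refl x)))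
      bigger : r * r < x → r < √ x
      bigger r²<x = <-≤-trans (≰⇒> λ q → <⇒≱ 0<η (lin q (solve 2 (λ r e → con 0ℤ :+ (r :+ e) := e :+ r) refl r η))) (sup-ub bounded sq≤)
        where
        Δ D η : Carrier
        Δ = x - r * r
        D = 1# + (r + r)
        0<Δ : 0# < Δ
        0<Δ = ≰⇒> λ q → <⇒≱ r²<x (lin q (solve 2 (λ x y → y :+ (x :- y) := x :+ con 0ℤ) refl x (r * r)))
        0<D : 0# < D
        0<D = +-pos-nonNeg 0<1 (+-nonNeg 0≤r 0≤r)
        -- (r + η)² = r² + η(2r + η); as η ≤ 1, the second term is at most η(1 + 2r), hence at most
        -- x - r².
        η = 1# ⊓ (Δ * D ⁻¹)
        0<η : 0# < η
        0<η = ⊓-pos 0<1 (*-pos 0<Δ (⁻¹-pos 0<D))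
        sq≤ : (r + η) * (r + η) ≤ x
        sq≤ = lin (+-mono-≤ (*-monoˡ-≤ (<⇒≤ 0<η) (x⊓y≤x 1# (Δ * D ⁻¹))) (≤-respʳ (/-cancel Δ (0<⇒≉ 0<D)) (*-monoʳ-≤ (<⇒≤ 0<D) (x⊓y≤y 1# (Δ * D ⁻¹)))))
          (solve 3 (λ x r e → x :+ (e :* e :+ e :* (con (+ 1) :+ (r :+ r))) := (r :+ e) :* (r :+ e) :+ (e :* con (+ 1) :+ (x :- r :* r))) refl x r η)

    √-≤ : ∀ {x r} → 0# ≤ x → 0# ≤ r → x ≤ r * r → √ x ≤ r
    √-≤ {x} 0≤x 0≤r x≤r² = sup-lub (0# , ≤-respˡ (sym (zeroˡ 0#)) 0≤x) λ y y²≤x → sq-cancel-≤ 0≤r (≤-trans y²≤x x≤r²)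

    module Geometry (d : ℕ) where
      open Games em ℝ d public

      S : Point → Point → Carrier
      S x y = ∑ (λ i → (x i - y i) * (x i - y i))

      S-nonNeg : ∀ x y → 0# ≤ S x y
      S-nonNeg x y = ∑-nonNeg λ i → sq-nonNeg (x i - y i)

      dist-≤⇒ : ∀ {x y r} → 0# ≤ r → dist x y ≤ r → S x y ≤ r * r
      dist-≤⇒ {x} {y} 0≤r p = ≤-respˡ (sym (∑-def (λ i → (x i - y i) * (x i - y i)))) (√-≤⇒ (≤-respʳ (∑-def (λ i → (x i - y i) * (x i - y i))) (S-nonNeg x y)) 0≤r p)

      dist-≤ : ∀ {x y r} → 0# ≤ r → S x y ≤ r * r → dist x y ≤ r
      dist-≤ {x} {y} 0≤r p = √-≤ (≤-respʳ (∑-def (λ i → (x i - y i) * (x i - y i))) (S-nonNeg x y)) 0≤r (≤-respˡ (∑-def (λ i → (x i - y i) * (x i - y i))) p)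

      S⇒coord : ∀ {x y r} → 0# ≤ r → S x y ≤ r * r → ∀ i → ∣ x i - y i ∣ᴿ ≤ r
      S⇒coord {x} {y} 0≤r p i = sq-cancel-≤ 0≤r (≤-trans (≈⇒≤ (abs-sq _)) (≤-trans (term≤∑ (λ j → sq-nonNeg (x j - y j)) i) p))

      ∈⇒S : ∀ (B : Ball) {y} → ⟦ B ⟧ y → S (centre B) y ≤ radius B * radius B
      ∈⇒S B {y} = dist-≤⇒ {centre B} {y} (<⇒≤ (0<radius B))

      S⇒∈ : ∀ (B : Ball) {y} → S (centre B) y ≤ radius B * radius B → ⟦ B ⟧ y
      S⇒∈ B {y} = dist-≤ {centre B} {y} (<⇒≤ (0<radius B))

      ∈⇒coord : ∀ (B : Ball) {y} → ⟦ B ⟧ y → ∀ i → ∣ centre B i - y i ∣ᴿ ≤ radius B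
      ∈⇒coord B {y} p = S⇒coord {centre B} {y} (<⇒≤ (0<radius B)) (∈⇒S B {y} p)

      centre∈ : ∀ (B : Ball) → ⟦ B ⟧ (centre B)
      centre∈ B = S⇒∈ B {centre B} (≤-respˡ (sym (∑-0 λ i → trans (*-congʳ (-‿inverseʳ _)) (zeroˡ _))) (*-nonNeg (<⇒≤ (0<radius B)) (<⇒≤ (0<radius B))))

      -- A triangle inequality with the displacement in the sum norm. This avoids Cauchy-Schwarz: a
      -- coordinate never exceeds the distance, so each cross term is at most ρ times one component
      -- of the displacement.
      perturb : ∀ {c c′ y : Point} {ρ} → 0# ≤ ρ → S c′ y ≤ ρ * ρ → S c y ≤ (ρ + ∑ (λ i → ∣ c i - c′ i ∣ᴿ)) * (ρ + ∑ (λ i → ∣ c i - c′ i ∣ᴿ))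
      perturb {c} {c′} {y} {ρ} 0≤ρ p = begin
        S c y ≤⟨ ∑-mono-≤ term ⟩
        ∑ (λ i → u i * u i + ((ρ + ρ) * ∣ h i ∣ᴿ + ∣ h i ∣ᴿ * H)) ≈⟨ trans (∑-+ (λ i → u i * u i) _) (+-congˡ (trans (∑-+ (λ i → (ρ + ρ) * ∣ h i ∣ᴿ) _) (+-cong (sym (∑-*ˡ (ρ + ρ) (λ i → ∣ h i ∣ᴿ))) (sym (∑-*ʳ (λ i → ∣ h i ∣ᴿ) H))))) ⟩
        S c′ y + ((ρ + ρ) * H + H * H) ≤⟨ +-mono-≤ p ≤-refl ⟩
        ρ * ρ + ((ρ + ρ) * H + H * H) ≈⟨ solve 2 (λ r h → r :* r :+ ((r :+ r) :* h :+ h :* h) := (r :+ h) :* (r :+ h)) refl ρ H ⟩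
        (ρ + H) * (ρ + H) ∎
        where
        open ≤R
        u h : Point
        u i = c′ i - y i
        h i = c i - c′ i
        H : Carrier
        H = ∑ (λ i → ∣ h i ∣ᴿ)
        term : ∀ i → (c i - y i) * (c i - y i) ≤ u i * u i + ((ρ + ρ) * ∣ h i ∣ᴿ + ∣ h i ∣ᴿ * H)
        term i = ≤-respˡ (solve 3 (λ c c′ y → (c′ :- y) :* (c′ :- y) :+ (((c′ :- y) :* (c :- c′) :+ (c′ :- y) :* (c :- c′)) :+ (c :- c′) :* (c :- c′)) := (c :- y) :* (c :- y)) refl (c i) (c′ i) (y i))
          (+-mono-≤ ≤-refl (+-mono-≤ (≤-trans (+-mono-≤ uh uh) (≈⇒≤ (sym (distribʳ _ ρ ρ)))) (≤-respˡ (abs-sq (h i)) (*-monoˡ-≤ (abs-nonNeg _) (term≤∑ (λ j → abs-nonNeg (h j)) i)))))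
          where
          uh : u i * h i ≤ ρ * ∣ h i ∣ᴿ
          uh = ≤-trans (x≤∣x∣ _) (≤-trans (≈⇒≤ (abs-* _ _)) (*-monoʳ-≤ (abs-nonNeg _) (S⇒coord {c′} {y} 0≤ρ p i)))

      ⊆-perturb : ∀ (B′ B : Ball) → radius B′ + ∑ (λ i → ∣ centre B i - centre B′ i ∣ᴿ) ≤ radius B → ⟦ B′ ⟧ ⊆ ⟦ B ⟧
      ⊆-perturb B′ B p {y} y∈ = S⇒∈ B {y} (≤-trans (perturb {centre B} {centre B′} {y} (<⇒≤ (0<radius B′)) (∈⇒S B′ {y} y∈))
        (*-mono-≤ 0≤s (<⇒≤ (0<radius B)) p p))
        where
        0≤s : 0# ≤ radius B′ + ∑ (λ i → ∣ centre B i - centre B′ i ∣ᴿ)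
        0≤s = +-nonNeg (<⇒≤ (0<radius B′)) (∑-nonNeg λ i → abs-nonNeg (centre B i - centre B′ i))

      move : Fin d → Carrier → Point → Point
      move p h x i with i Fin.≟ p
      ... | yes _ = x i + h
      ... | no _  = x i

      move-p : ∀ p h x → move p h x p ≈ x p + h
      move-p p h x with p Fin.≟ p
      ... | yes _ = refl
      ... | no ¬e = ⊥-elim (¬e ≡.refl)

      move-i : ∀ p h x i → i ≢ p → move p h x i ≈ x i
      move-i p h x i i≢p with i Fin.≟ p
      ... | yes e = ⊥-elim (i≢p e)
      ... | no _ = refl

      ∑-move : ∀ p h x (F : Fin d → Carrier → Carrier) → (∀ i {s t} → s ≈ t → F i s ≈ F i t) → (∀ i → F i 0# ≈ 0#) → ∑ (λ i → F i (move p h x i - x i)) ≈ F p h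
      ∑-move p h x F Fc F0 = trans (∑-single (λ i → F i (move p h x i - x i)) p λ i i≢p → trans (Fc i (trans (+-congʳ (move-i p h x i i≢p)) (-‿inverseʳ _))) (F0 i))
        (Fc p (trans (+-congʳ (move-p p h x)) (solve 2 (λ x h → (x :+ h) :- x := h) refl (x p) h)))

      S-move : ∀ p h x → S x (move p h x) ≈ h * h
      S-move p h x = trans (∑-cong λ i → solve 2 (λ x y → (x :- y) :* (x :- y) := (y :- x) :* (y :- x)) refl (x i) (move p h x i))
        (∑-move p h x (λ _ s → s * s) (λ _ e → *-cong e e) (λ _ → zeroˡ 0#))

      ∑-move-dot : ∀ p h x (n : Point) → ∑ (λ i → n i * move p h x i) ≈ ∑ (λ i → n i * x i) + n p * h
      ∑-move-dot p h x n = trans (∑-cong λ i → solve 3 (λ n x y → n :* y := n :* x :+ n :* (y :- x)) refl (n i) (x i) (move p h x i))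
        (trans (∑-+ (λ i → n i * x i) _) (+-congˡ (∑-move p h x (λ i s → n i * s) (λ _ → *-congˡ) (λ _ → zeroʳ _))))

      -- Tested at the two extreme points of `B′` on the axis `i`.
      ⊆⇒coord : ∀ (B′ B : Ball) → ⟦ B′ ⟧ ⊆ ⟦ B ⟧ → ∀ i → ∣ centre B i - centre B′ i ∣ᴿ + radius B′ ≤ radius B
      ⊆⇒coord B′ B sub i = [ (λ e → ≤-trans (+-mono-≤ (≈⇒≤ e) ≤-refl) (reach (- radius B′) (trans (solve 1 (λ r → :- r :* :- r := r :* r) refl (radius B′)) refl)
            (solve 3 (λ c c′ r → c :- (c′ :+ :- r) := (c :- c′) :+ r) refl (centre B i) (centre B′ i) (radius B′)) (x≤∣x∣ _)))
          , (λ e → ≤-trans (+-mono-≤ (≈⇒≤ e) ≤-refl) (reach (radius B′) refl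
            (solve 3 (λ c c′ r → c :- (c′ :+ r) := :- (:- (c :- c′) :+ r)) refl (centre B i) (centre B′ i) (radius B′)) (≤-trans (x≤∣x∣ _) (≈⇒≤ (sym (abs-neg _)))))) ]′
        (abs-sign (centre B i - centre B′ i))
        where
        reach : ∀ h → h * h ≈ radius B′ * radius B′ → ∀ {z t} → centre B i - (centre B′ i + h) ≈ z → t ≤ ∣ z ∣ᴿ → t ≤ radius B
        reach h hh {z} e t≤ = ≤-trans t≤ (≤-trans (≈⇒≤ (abs-cong (sym (trans (+-congˡ (-‿cong (move-p i h (centre B′)))) e))))
          (∈⇒coord B {move i h (centre B′)} (sub (S⇒∈ B′ {move i h (centre B′)} (≈⇒≤ (trans (S-move i h (centre B′)) hh)))) i))

      ⊆⇒radius : ∀ (B′ B : Ball) → Fin d → ⟦ B′ ⟧ ⊆ ⟦ B ⟧ → radius B′ ≤ radius B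
      ⊆⇒radius B′ B i sub = ≤-trans (≤-respˡ (+-identityˡ _) (+-mono-≤ (abs-nonNeg _) ≤-refl)) (⊆⇒coord B′ B sub i)

      nested⊆ : ∀ (B : ℕ → Ball) → (∀ n → ⟦ B (suc n) ⟧ ⊆ ⟦ B n ⟧) → ∀ {m n} → m ℕ.≤ n → ⟦ B n ⟧ ⊆ ⟦ B m ⟧
      nested⊆ B sub {m} {n} m≤n = ≡.subst (λ n → ⟦ B n ⟧ ⊆ ⟦ B m ⟧) (ℕ.m∸n+n≡m m≤n) (go (n ℕ.∸ m))
        where
        go : ∀ k → ⟦ B (k ℕ.+ m) ⟧ ⊆ ⟦ B m ⟧
        go zero p = p
        go (suc k) p = go k (sub (k ℕ.+ m) p)

      -- A point closer to H in the direction of an axis would lie in the neighbourhood.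
      ⊥⇒far : ∀ (B : Ball) H {ε} → ⟦ B ⟧ ∥ Neighbourhood ε (onHyperplane H) → ∀ p → ¬ (normal H p ≈ 0#) → ∀ {y} → ⟦ B ⟧ y →
              ε * ∣ normal H p ∣ᴿ ≤ ∣ ∑ (λ i → normal H i * y i) - offset H ∣ᴿ
      ⊥⇒far B H {ε} disjoint p np≉0 {y} y∈ = ≮⇒≥ λ close → disjoint (y∈ , y′ , on , ≤-<-trans dist≤ (h<ε close))
        where
        n : Point
        n = normal H
        v h : Carrier
        v = ∑ (λ i → n i * y i) - offset H
        h = - (v * n p ⁻¹)
        y′ : Point
        y′ = move p h y
        h<ε : ∣ v ∣ᴿ < ε * ∣ n p ∣ᴿ → ∣ h ∣ᴿ < ε
        h<ε q = ≰⇒> λ ε≤h → <⇒≱ q (≤-respʳ (trans (*-congʳ (abs-neg _)) (trans (sym (abs-* _ _)) (abs-cong (/-cancel v np≉0)))) (*-monoʳ-≤ (abs-nonNeg (n p)) ε≤h))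
        on : onHyperplane H y′
        on = trans (sym (∑-def (λ i → n i * y′ i))) (trans (∑-move-dot p h y n) (trans (+-congˡ (trans (solve 3 (λ n v ni → n :* :- (v :* ni) := :- (v :* ni :* n)) refl (n p) v (n p ⁻¹)) (-‿cong (/-cancel v np≉0))))
          (solve 2 (λ s o → s :+ :- (s :- o) := o) refl (∑ (λ i → n i * y i)) (offset H))))
        dist≤ : dist y y′ ≤ ∣ h ∣ᴿ
        dist≤ = dist-≤ {y} {y′} (abs-nonNeg h) (≈⇒≤ (trans (S-move p h y) (sym (abs-sq h))))

      module Avoid (α : Carrier) (0<α : 0# < α) (α-small : α * (1# + (ι d + ι d)) < 1#) (H : Hyperplane) (B : Ball) where
        private
          n : Point
          n = normal H
          r : Carrier
          r = radius B
          -- Along the axis of the largest component of the normal, a shift changes the form at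
          -- least as much as an equal error in any other coordinate.
          p : Fin d
          p = proj₁ (argmaxOver (proj₁ (normal≉0 H)) (λ i → ∣ n i ∣ᴿ))
          n≤ : ∀ i → ∣ n i ∣ᴿ ≤ ∣ n p ∣ᴿ
          n≤ = proj₂ (argmaxOver (proj₁ (normal≉0 H)) (λ i → ∣ n i ∣ᴿ))
          0<np : 0# < ∣ n p ∣ᴿ
          0<np = <-≤-trans (abs-pos (proj₂ (normal≉0 H))) (n≤ _)
          v : Carrier
          v = ∑ (λ i → n i * centre B i) - offset H
          a : Carrier
          a = (1# - α) * r
          α<1 : α < 1#
          α<1 = ≤-<-trans (x≤x*y (<⇒≤ 0<α) (≤-respˡ (+-identityʳ 1#) (+-mono-≤ ≤-refl (+-nonNeg (0≤ι d) (0≤ι d))))) α-small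
          0≤a : 0# ≤ a
          0≤a = *-nonNeg (x≤y⇒0≤y-x (<⇒≤ α<1)) (<⇒≤ (0<radius B))

          -- The sign moves the centre away from H.
          shift : ∃[ h ] (∣ h ∣ᴿ ≈ a × a * ∣ n p ∣ᴿ ≤ ∣ v + n p * h ∣ᴿ)
          shift = [ (λ 0≤ → a , abs-of-nonNeg 0≤a , away a (trans (abs-* _ _) (*-congˡ (abs-of-nonNeg 0≤a))) 0≤)
                  , (λ ≤0 → - a , trans (abs-neg a) (abs-of-nonNeg 0≤a) , away (- a) (trans (abs-* _ _) (*-congˡ (trans (abs-neg a) (abs-of-nonNeg 0≤a))))
                       (≤-respʳ (solve 3 (λ v n a → :- (v :* (n :* a)) := v :* (n :* :- a)) refl v (n p) a) (≤-respˡ -0#≈0# (neg-mono-≤ ≤0)))) ]′ (≤-total 0# (v * (n p * a)))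
            where
            away : ∀ h → ∣ n p * h ∣ᴿ ≈ ∣ n p ∣ᴿ * a → 0# ≤ v * (n p * h) → a * ∣ n p ∣ᴿ ≤ ∣ v + n p * h ∣ᴿ
            away h e 0≤ = sq-cancel-≤ (abs-nonNeg _) (≤-trans (≈⇒≤ (trans (*-cong e′ e′) (abs-sq (n p * h)))) (≤-trans
                (lin (+-nonNeg (+-nonNeg 0≤ 0≤) (sq-nonNeg v)) (solve 2 (λ v w → (v :+ w) :* (v :+ w) :+ con 0ℤ := w :* w :+ (v :* w :+ v :* w :+ v :* v)) refl v (n p * h)))
                (≈⇒≤ (sym (abs-sq (v + n p * h))))))
              where
              e′ : a * ∣ n p ∣ᴿ ≈ ∣ n p * h ∣ᴿ
              e′ = trans (*-comm _ _) (sym e)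

          h : Carrier
          h = proj₁ shift

        avoiding : Ball
        avoiding = record { centre = move p h (centre B) ; radius = α * r ; 0<radius = *-pos 0<α (0<radius B) }

        avoiding-⊆ : ⟦ avoiding ⟧ ⊆ ⟦ B ⟧
        avoiding-⊆ = ⊆-perturb avoiding B (≈⇒≤ (trans (+-congˡ (trans (∑-cong λ i → abs-sub _ _) (trans (∑-move p h (centre B) (λ _ s → ∣ s ∣ᴿ) (λ _ → abs-cong) (λ _ → abs-0 refl)) (proj₁ (proj₂ shift)))))
          (solve 2 (λ α r → α :* r :+ (con (+ 1) :- α) :* r := r) refl α r)))

        -- A point of `H` within ε of the new ball differs from its centre by at most 2αr in each
        -- coordinate, which changes the form by at most 2dαr times its largest component. The shift
        -- by (1 - α)r has made the form larger than that, by `α-small`.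
        avoiding-⊥ : ∀ {ε} → 0# ≤ ε → ε ≤ α * r → ⟦ avoiding ⟧ ∥ Neighbourhood ε (onHyperplane H)
        avoiding-⊥ {ε} 0≤ε ε≤ {y} (y∈ , z , on , close) = <⇒≱ strict (*-cancelʳ-≤ 0<np (≤-trans (proj₂ (proj₂ shift)) (≤-trans (≈⇒≤ (abs-cong e)) (≤-trans (abs-∑-≤ term)
            (≈⇒≤ (solve 3 (λ d n x → d :* (n :* x) := d :* x :* n) refl (ι d) ∣ n p ∣ᴿ (α * r + α * r)))))))
          where
          x′ : Point
          x′ = move p h (centre B)
          e : v + n p * h ≈ ∑ (λ i → n i * (x′ i - z i))
          e = sym (trans (∑-cong λ i → solve 3 (λ n x z → n :* (x :- z) := n :* x :- n :* z) refl (n i) (x′ i) (z i)) (trans (∑-sub (λ i → n i * x′ i) (λ i → n i * z i))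
            (trans (+-cong (∑-move-dot p h (centre B) n) (-‿cong (trans (∑-def (λ i → n i * z i)) on))) (solve 3 (λ s t o → (s :+ t) :- o := (s :- o) :+ t) refl (∑ (λ i → n i * centre B i)) (n p * h) (offset H)))))
          term : ∀ i → ∣ n i * (x′ i - z i) ∣ᴿ ≤ ∣ n p ∣ᴿ * (α * r + α * r)
          term i = ≤-trans (≈⇒≤ (abs-* _ _)) (*-mono-≤ (abs-nonNeg _) (abs-nonNeg _) (n≤ i) (≤-trans (abs-triangle (x′ i) (y i) (z i))
            (+-mono-≤ (∈⇒coord avoiding {y} y∈ i) (≤-trans (S⇒coord {y} {z} 0≤ε (dist-≤⇒ {y} {z} 0≤ε (<⇒≤ close)) i) ε≤))))
          strict : ι d * (α * r + α * r) < a
          strict = ≰⇒> λ q → <⇒≱ (*-monoʳ-< (0<radius B) α-small) (lin q (solve 3 (λ d α r → α :* (con (+ 1) :+ (d :+ d)) :* r :+ (con (+ 1) :- α) :* r := con (+ 1) :* r :+ d :* (α :* r :+ α :* r)) refl (ι d) α r))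

  -- The game seen only at the epoch balls.

  module EpochGame where
    open OrderedField
    open FiniteSums
    open LinearFormsPigeonhole
    open AffineSystems
    open SmallFunctions
    open WeightData
    open DualBounds
    open PotentialMethod
    open BallGeometry

    module Play (d : ℕ) (1≤d : 1 ℕ.≤ d) (b : Carrier) (1≤b : 1# ≤ b) (β : Carrier) (0<β : 0# < β) (1≤bβ : 1# ≤ b * β)
      (b-big : spreadConstant d (two * (β * β) ⁻¹) * (two * ι (suc d)) < β * β * b) (e₀ : ℕ) where

      open Geometry d
      open Powers b 1≤b
      -- The slab width is β² because Alice's neighbourhood has thickness β times the radius of an
      -- epoch ball, and this radius exceeds β b^(-e).
      open Potential d 1≤d b 1≤b (β * β) (*-pos 0<β 0<β) b-big

      axis : Fin d
      axis = element 1≤d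

      defaultHyperplane : Hyperplane
      defaultHyperplane = record { normal = λ _ → 1# ; offset = 0# ; normal≉0 = axis , λ e → 0≉1 (sym e) }

      -- The epoch balls of a play: the first ball with radius at most b^(-e), for e = e₀, e₀ + 1, …
      push : ∀ {Q : Set} → Dec Q → Ball → List Ball → List Ball
      push (yes _) B E = B ∷ E
      push (no _) B E = E

      Due : List Ball → Ball → Set
      Due E B = radius B * b ^ (e₀ ℕ.+ length E) ≤ 1#

      epochs : List Ball → List Ball
      epochs [] = []
      epochs (B ∷ h) = push (em {Due (epochs h) B}) B (epochs h)

      choose : ∀ {Q : Set} → Dec Q → Hyperplane → Hyperplane
      choose (yes _) H = H
      choose (no _) _ = defaultHyperplane

      epochStrategy : (List Ball → Ball → Hyperplane) → Strategy (HyperplaneMove β)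
      epochStrategy F h B = record
        { hyperplane = choose (em {Due (epochs h) B}) (F (epochs h) B) ; ε = β * radius B
        ; 0<ε = *-pos 0<β (0<radius B) ; ε≤βr = ≤-refl }

      module EpochBalls (F : List Ball → Ball → Hyperplane) (B : ℕ → Ball) (play : HyperplanePlay (epochStrategy F) B)
        (shrinking : ∀ x → 0# < x → ∃[ n ] radius (B n) ≤ x) (start : 1# < radius (B 0) * b ^ e₀) where

        L : ℕ → ℕ
        L n = length (epochs (past B n))

        Pushed : ℕ → Set
        Pushed n = Due (epochs (past B n)) (B n)

        epochs-yes : ∀ n → Pushed n → epochs (past B (suc n)) ≡ B n ∷ epochs (past B n)
        epochs-yes n p = go em
          where
          go : (q : Dec (Pushed n)) → push q (B n) (epochs (past B n)) ≡ B n ∷ epochs (past B n)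
          go (yes _) = ≡.refl
          go (no ¬p) = ⊥-elim (¬p p)

        epochs-no : ∀ n → ¬ Pushed n → epochs (past B (suc n)) ≡ epochs (past B n)
        epochs-no n ¬p = go em
          where
          go : (q : Dec (Pushed n)) → push q (B n) (epochs (past B n)) ≡ epochs (past B n)
          go (yes p) = ⊥-elim (¬p p)
          go (no _) = ≡.refl

        L-yes : ∀ n → Pushed n → L (suc n) ≡ suc (L n)
        L-yes n p = ≡.cong length (epochs-yes n p)

        L-no : ∀ n → ¬ Pushed n → L (suc n) ≡ L n
        L-no n ¬p = ≡.cong length (epochs-no n ¬p)

        L-step : ∀ n → L n ℕ.≤ L (suc n)
        L-step n = classically (Pushed n) (λ p → ℕ.≤-trans (ℕ.n≤1+n _) (ℕ.≤-reflexive (≡.sym (L-yes n p)))) (λ ¬p → ℕ.≤-reflexive (≡.sym (L-no n ¬p)))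

        L-mono : ∀ {m n} → m ℕ.≤ n → L m ℕ.≤ L n
        L-mono {m} {n} m≤n = ≡.subst (λ n → L m ℕ.≤ L n) (ℕ.m∸n+n≡m m≤n) (go (n ℕ.∸ m))
          where
          go : ∀ k → L m ℕ.≤ L (k ℕ.+ m)
          go zero = ℕ.≤-refl
          go (suc k) = ℕ.≤-trans (go k) (L-step (k ℕ.+ m))

        find : ∀ k m n → L n ≡ k → radius (B (m ℕ.+ n)) * b ^ (e₀ ℕ.+ k) ≤ 1# → ∃[ n′ ] (L n′ ≡ k × Pushed n′)
        find k zero n ≡.refl small = n , ≡.refl , small
        find k (suc m) n Ln≡ small = classically (Pushed n) (λ p → n , Ln≡ , p)
          λ ¬p → find k m (suc n) (≡.trans (L-no n ¬p) Ln≡) (≤-respˡ (*-congʳ (reflexive (≡.cong (λ n → radius (B n)) (≡.sym (ℕ.+-suc m n))))) small)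

        atLength : ∀ k n → L n ≡ k → ∃[ n′ ] (L n′ ≡ k × Pushed n′)
        atLength k n Ln≡ = go (shrinking (bi ^ (e₀ ℕ.+ k)) (^-pos (e₀ ℕ.+ k) 0<bi))
          where
          go : ∃[ m ] (radius (B m) ≤ bi ^ (e₀ ℕ.+ k)) → ∃[ n′ ] (L n′ ≡ k × Pushed n′)
          go (m , small) = find k m n Ln≡ (≤-respʳ (trans (*-comm _ _) (b^n*bi^n (e₀ ℕ.+ k))) (*-monoʳ-≤ (^-nonNeg (e₀ ℕ.+ k) (<⇒≤ 0<b))
            (≤-trans (⊆⇒radius (B (m ℕ.+ n)) (B m) axis (nested⊆ B (λ n → proj₁ (play n)) (ℕ.m≤m+n m n))) small)))

        stageOf : ∀ k → ∃[ n ] (L n ≡ k × Pushed n)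
        stageOf zero = atLength 0 0 ≡.refl
        stageOf (suc k) = next (stageOf k)
          where
          next : ∃[ n ] (L n ≡ k × Pushed n) → ∃[ n ] (L n ≡ suc k × Pushed n)
          next (n , Ln≡ , p) = atLength (suc k) (suc n) (≡.trans (L-yes n p) (≡.cong suc Ln≡))

        stage : ℕ → ℕ
        stage k = proj₁ (stageOf k)

        L-stage : ∀ k → L (stage k) ≡ k
        L-stage k = proj₁ (proj₂ (stageOf k))

        pushed : ∀ k → Pushed (stage k)
        pushed k = proj₂ (proj₂ (stageOf k))

        C : ℕ → Ball
        C k = B (stage k)

        stage-< : ∀ k → stage k ℕ.< stage (suc k)
        stage-< k = ℕ.≰⇒> λ le → ℕ.1+n≰n (ℕ.≤-trans (ℕ.≤-reflexive (≡.sym (L-stage (suc k)))) (ℕ.≤-trans (L-mono le) (ℕ.≤-reflexive (L-stage k))))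

        epochs-const : ∀ k m → L (k ℕ.+ m) ≡ L m → epochs (past B (k ℕ.+ m)) ≡ epochs (past B m)
        epochs-const zero m _ = ≡.refl
        epochs-const (suc k) m e = classically (Pushed (k ℕ.+ m))
          (λ p → ⊥-elim (ℕ.1+n≰n (ℕ.≤-trans (ℕ.≤-reflexive (≡.trans (≡.sym (L-yes (k ℕ.+ m) p)) e)) (L-mono (ℕ.m≤n+m m k)))))
          (λ ¬p → ≡.trans (epochs-no (k ℕ.+ m) ¬p) (epochs-const k m (≡.trans (≡.sym (L-no (k ℕ.+ m) ¬p)) e)))

        L-0 : ∀ n → L n ≡ 0 → epochs (past B n) ≡ []
        L-0 n e = go (epochs (past B n)) e
          where
          go : ∀ (xs : List Ball) → length xs ≡ 0 → xs ≡ []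
          go [] _ = ≡.refl

        -- Hence the rule `F` receives exactly the earlier epoch balls, as if they formed a game of
        -- their own.
        epochs-stage : ∀ k → epochs (past B (stage k)) ≡ past C k
        epochs-stage zero = L-0 (stage 0) (L-stage 0)
        epochs-stage (suc k) = ≡.trans (≡.trans (≡.cong (λ n → epochs (past B n)) (≡.sym s+)) (epochs-const (stage (suc k) ℕ.∸ suc (stage k)) (suc (stage k))
            (≡.trans (≡.cong L s+) (≡.trans (L-stage (suc k)) (≡.sym (≡.trans (L-yes (stage k) (pushed k)) (≡.cong suc (L-stage k))))))))
          (≡.trans (epochs-yes (stage k) (pushed k)) (≡.cong (B (stage k) ∷_) (epochs-stage k)))
          where
          s+ : stage (suc k) ℕ.∸ suc (stage k) ℕ.+ suc (stage k) ≡ stage (suc k)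
          s+ = ℕ.m∸n+n≡m (stage-< k)

        C-small : ∀ k → radius (C k) * b ^ (e₀ ℕ.+ k) ≤ 1#
        C-small k = ≤-respˡ (*-congˡ (reflexive (≡.cong (λ l → b ^ (e₀ ℕ.+ l)) (L-stage k)))) (pushed k)

        -- Radii shrink at most by the factor β in a move and bβ ≥ 1, so a ball that serves for one
        -- epoch is still too large for the next.
        before : ∀ n → 1# < radius (B n) * b ^ (e₀ ℕ.+ L (suc n))
        before zero = <-resp refl (*-congˡ (reflexive (≡.cong (b ^_) (≡.sym (≡.trans (≡.cong (e₀ ℕ.+_) (L-no 0 ¬p)) (ℕ.+-identityʳ e₀)))))) start
          where
          ¬p : ¬ Pushed 0
          ¬p p = <⇒≱ start (≤-respˡ (*-congˡ (reflexive (≡.cong (b ^_) (ℕ.+-identityʳ e₀)))) p)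
        before (suc n) = classically (Pushed (suc n))
          (λ p → <-resp refl (*-congˡ (reflexive (≡.cong (λ l → b ^ (e₀ ℕ.+ l)) (≡.sym (L-yes (suc n) p))))) (<-≤-trans (before n) grow))
          (λ ¬p → <-resp refl (*-congˡ (reflexive (≡.cong (λ l → b ^ (e₀ ℕ.+ l)) (≡.sym (L-no (suc n) ¬p))))) (≰⇒> ¬p))
          where
          X : Carrier
          X = b ^ (e₀ ℕ.+ L (suc n))
          grow : radius (B n) * X ≤ radius (B (suc n)) * b ^ (e₀ ℕ.+ suc (L (suc n)))
          grow = ≤-trans (x≤x*y (*-nonNeg (<⇒≤ (0<radius (B n))) (^-nonNeg (e₀ ℕ.+ L (suc n)) (<⇒≤ 0<b))) 1≤bβ)
            (≤-trans (≈⇒≤ (solve 4 (λ r x b β → r :* x :* (b :* β) := (β :* r) :* (b :* x)) refl (radius (B n)) X b β))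
            (≤-trans (*-monoʳ-≤ (*-nonNeg (<⇒≤ 0<b) (^-nonNeg (e₀ ℕ.+ L (suc n)) (<⇒≤ 0<b))) (proj₁ (proj₂ (play n))))
            (≈⇒≤ (*-congˡ (reflexive (≡.cong (b ^_) (≡.sym (ℕ.+-suc e₀ (L (suc n))))))))))

        -- The ball just before an epoch ball still had radius above b^(-e). Such a ball exists
        -- because `start` keeps the first ball from being an epoch ball.
        C-large : ∀ k → β < radius (C k) * b ^ (e₀ ℕ.+ k)
        C-large k = go (stage k) (L-stage k) (pushed k)
          where
          go : ∀ n → L n ≡ k → Pushed n → β < radius (B n) * b ^ (e₀ ℕ.+ k)
          go zero ≡.refl p = ⊥-elim (<⇒≱ start (≤-respˡ (*-congˡ (reflexive (≡.cong (b ^_) (ℕ.+-identityʳ e₀)))) p))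
          go (suc n) ≡.refl p = <-≤-trans (<-resp (*-identityʳ β) (sym (*-assoc _ _ _)) (*-monoˡ-< 0<β (before n)))
            (*-monoʳ-≤ (^-nonNeg (e₀ ℕ.+ L (suc n)) (<⇒≤ 0<b)) (proj₁ (proj₂ (play n))))

        C⊆ : ∀ k → ⟦ C (suc k) ⟧ ⊆ ⟦ B (suc (stage k)) ⟧
        C⊆ k = nested⊆ B (λ n → proj₁ (play n)) (stage-< k)

        C-nested : ∀ k → ⟦ C (suc k) ⟧ ⊆ ⟦ C k ⟧
        C-nested k {y} p = proj₁ (play (stage k)) (C⊆ k {y} p)

        C-avoids : ∀ k → ⟦ C (suc k) ⟧ ∥ Neighbourhood (β * radius (C k)) (onHyperplane (F (past C k) (C k)))
        C-avoids k {y} (y∈ , near) = proj₂ (proj₂ (play (stage k))) {y} (C⊆ k {y} y∈ , ≡.subst (λ H → Neighbourhood (β * radius (C k)) (onHyperplane H) y) (≡.sym H≡) near)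
          where
          H≡ : choose (em {Pushed (stage k)}) (F (epochs (past B (stage k))) (C k)) ≡ F (past C k) (C k)
          H≡ = go em
            where
            go : (q : Dec (Pushed (stage k))) → choose q (F (epochs (past B (stage k))) (C k)) ≡ F (past C k) (C k)
            go (yes _) = ≡.cong (λ h → F h (C k)) (epochs-stage k)
            go (no ¬p) = ⊥-elim (¬p (pushed k))

      length-past : ∀ (C : ℕ → Ball) k → length (past C k) ≡ k
      length-past C zero = ≡.refl
      length-past C (suc k) = ≡.cong suc (length-past C k)

      module Tasks (gen : ℕ → Ball → List Task) (gen-steep : ∀ k B → AllSteep (gen k B)) (gen-light : ∀ k B → weight (gen k B) ≤ ν) where

        active : List Ball → Ball → List Task
        active [] B = gen 0 B
        active (B′ ∷ h) B = remaining (e₀ ℕ.+ suc (length h)) (centre B) (active h B′) ++ gen (suc (length h)) B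

        remaining-⊆ : ∀ e y xs {T r} → (T , r) ∈ˡ remaining e y xs → ∃[ r′ ] (T , r′) ∈ˡ xs
        remaining-⊆ e y ((T , zero) ∷ xs) p = later (remaining-⊆ e y xs p)
          where
          later : ∀ {T′} → ∃[ r′ ] (T′ , r′) ∈ˡ xs → ∃[ r′ ] (T′ , r′) ∈ˡ ((T , zero) ∷ xs)
          later (r′ , q) = r′ , there q
        remaining-⊆ e y ((T , suc r) ∷ xs) p = go em p
          where
          later : ∀ {T′} → ∃[ r′ ] (T′ , r′) ∈ˡ xs → ∃[ r′ ] (T′ , r′) ∈ˡ ((T , suc r) ∷ xs)
          later (r′ , q) = r′ , there q
          go : ∀ {T′ r′} (q : Dec (Hit e y T)) → (T′ , r′) ∈ˡ keep q (T , r) (remaining e y xs) → ∃[ r′ ] (T′ , r′) ∈ˡ ((T , suc r) ∷ xs)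
          go (yes _) (here ≡.refl) = suc r , here ≡.refl
          go (yes _) (there p) = later (remaining-⊆ e y xs p)
          go (no _) p = later (remaining-⊆ e y xs p)

        active-steep : ∀ h B {T r} → (T , r) ∈ˡ active h B → Steep T
        active-steep [] B {T} {r} p = gen-steep 0 B {T} {r} p
        active-steep (B′ ∷ h) B {T} {r} p = split (∈-++⁻ (remaining e y (active h B′)) p)
          where
          e : ℕ
          e = e₀ ℕ.+ suc (length h)
          y : Point
          y = centre B
          old : ∃[ r′ ] (T , r′) ∈ˡ active h B′ → Steep T
          old (r′ , q) = active-steep h B′ {T} {r′} q
          split : (T , r) ∈ˡ remaining e y (active h B′) ⊎ (T , r) ∈ˡ gen (suc (length h)) B → Steep T
          split (inj₁ q) = old (remaining-⊆ e y (active h B′) q)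
          split (inj₂ q) = gen-steep (suc (length h)) B {T} {r} q

        SlabFor : List Ball → Ball → Set
        SlabFor h B = SlabAround (e₀ ℕ.+ length h) (λ y → Heavy (e₀ ℕ.+ length h) (active h B) y × (∀ l → ∣ centre B l - y l ∣ᴿ * b ^ (e₀ ℕ.+ length h) ≤ 1#))

        slabHyperplane : ∀ {e} {X : Point → Set} → SlabAround e X → Hyperplane
        slabHyperplane (n , y₀ , (p , np≈1) , _) = record { normal = n ; offset = ∑ (λ l → n l * y₀ l) ; normal≉0 = p , λ e → 0≉1 (trans (sym e) np≈1) }

        hyperplaneOf : ∀ h B → Dec (SlabFor h B) → Hyperplane
        hyperplaneOf h B (yes s) = slabHyperplane {e₀ ℕ.+ length h} {λ y → Heavy (e₀ ℕ.+ length h) (active h B) y × (∀ l → ∣ centre B l - y l ∣ᴿ * b ^ (e₀ ℕ.+ length h) ≤ 1#)} s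
        hyperplaneOf h B (no _) = defaultHyperplane

        F : List Ball → Ball → Hyperplane
        F h B = hyperplaneOf h B em

        taskStrategy : Strategy (HyperplaneMove β)
        taskStrategy = epochStrategy F

        module Outcome (B : ℕ → Ball) (play : HyperplanePlay taskStrategy B)
          (shrinking : ∀ x → 0# < x → ∃[ n ] radius (B n) ≤ x) (start : 1# < radius (B 0) * b ^ e₀) where

          open EpochBalls F B play shrinking start public

          act : ℕ → List Task
          act k = active (past C k) (C k)

          act-suc : ∀ k → act (suc k) ≡ remaining (suc (e₀ ℕ.+ k)) (centre (C (suc k))) (act k) ++ gen (suc k) (C (suc k))
          act-suc k = ≡.cong₂ (λ e l → remaining e (centre (C (suc k))) (act k) ++ gen l (C (suc k)))
            (≡.trans (≡.cong (λ l → e₀ ℕ.+ suc l) (length-past C k)) (ℕ.+-suc e₀ k)) (≡.cong suc (length-past C k))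

          near : ∀ k {y} → ⟦ C k ⟧ y → ∀ l → ∣ centre (C k) l - y l ∣ᴿ * b ^ (e₀ ℕ.+ k) ≤ 1#
          near k {y} y∈ l = ≤-trans (*-monoʳ-≤ (^-nonNeg (e₀ ℕ.+ k) (<⇒≤ 0<b)) (∈⇒coord (C k) {y} y∈ l)) (C-small k)

          act-steep : ∀ k → AllSteep (act k)
          act-steep k = active-steep (past C k) (C k)

          -- Heavy centres lie in the slab around the chosen hyperplane, and the next epoch ball,
          -- lying inside Bob's answer, is disjoint from the thicker neighbourhood.
          notHeavy : ∀ k → weight (act k) ≤ half → ¬ Heavy (e₀ ℕ.+ k) (act k) (centre (C (suc k)))
          notHeavy k light heavy = go em (C-avoids k)
            where
            y : Point
            y = centre (C (suc k))
            y∈ : ⟦ C (suc k) ⟧ y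
            y∈ = centre∈ (C (suc k))
            e : ℕ
            e = e₀ ℕ.+ length (past C k)
            e≡ : e ≡ e₀ ℕ.+ k
            e≡ = ≡.cong (e₀ ℕ.+_) (length-past C k)
            X : Point → Set
            X y = Heavy e (act k) y × (∀ l → ∣ centre (C k) l - y l ∣ᴿ * b ^ e ≤ 1#)
            y∈X : X y
            y∈X = ≡.subst (λ e → Heavy e (act k) y × (∀ l → ∣ centre (C k) l - y l ∣ᴿ * b ^ e ≤ 1#)) (≡.sym e≡) (heavy , near k (C-nested k {y} y∈))
            go : (q : Dec (SlabFor (past C k) (C k))) → ⟦ C (suc k) ⟧ ∥ Neighbourhood (β * radius (C k)) (onHyperplane (hyperplaneOf (past C k) (C k) q)) → ⊥
            go (no ¬s) _ = ¬s (heavySlab e (act k) (act-steep k) light (centre (C k)))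
            go (yes s@(n , y₀ , (p , np≈1) , bound)) disjoint = <⇒≱ (*-monoˡ-< 0<β (C-large k)) (≤-trans (≈⇒≤ (trans (sym (*-assoc _ _ _)) (*-congˡ (reflexive (≡.cong (b ^_) (≡.sym e≡))))))
                (≤-trans (*-monoʳ-≤ (^-nonNeg e (<⇒≤ 0<b)) (≤-resp (trans (*-congˡ (trans (abs-cong np≈1) (abs-of-nonNeg 0≤1))) (*-identityʳ _))
                  (abs-cong (trans (sym (∑-sub _ _)) (∑-cong λ l → solve 3 (λ n y z → n :* y :- n :* z := n :* (y :- z)) refl (n l) (y l) (y₀ l))))
                  (⊥⇒far (C (suc k)) (slabHyperplane {e} {X} s) disjoint p (λ e → 0≉1 (trans (sym e) np≈1)) {y} y∈))) (bound y y∈X)))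

          -- At most θ survives from the previous epoch and at most ν is new, with θ + ν = half.
          act-light : ∀ k → weight (act k) ≤ half
          act-light zero = ≤-trans (gen-light 0 (C 0)) (lin 0≤θ (solve 2 (λ h t → h :+ con 0ℤ := (h :- t) :+ t) refl half θ))
            where
            0≤θ : 0# ≤ θ
            0≤θ = *-nonNeg (0≤ι (suc d)) (<⇒≤ (⁻¹-pos 0<D₃))
          act-light (suc k) = ≤-respˡ (sym (trans (reflexive (≡.cong weight (act-suc k))) (weight-++ (remaining (suc (e₀ ℕ.+ k)) (centre (C (suc k))) (act k)) _)))
            (≤-trans (+-mono-≤ (≮⇒≥ (notHeavy k (act-light k))) (gen-light (suc k) (C (suc k)))) (≈⇒≤ (solve 2 (λ h t → t :+ (h :- t) := h) refl half θ)))

          gen⊆act : ∀ k {x} → x ∈ˡ gen k (C k) → x ∈ˡ act k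
          gen⊆act zero p = p
          gen⊆act (suc k) {x} p = ≡.subst (x ∈ˡ_) (≡.sym (act-suc k)) (∈-++⁺ʳ (remaining (suc (e₀ ℕ.+ k)) (centre (C (suc k))) (act k)) p)

          C-≤ : ∀ {m n} → m ℕ.≤ n → ⟦ C n ⟧ ⊆ ⟦ C m ⟧
          C-≤ = nested⊆ C (λ k {y} → C-nested k {y})

          -- A task violated at its deadline would have stayed active, with weight u⁰ > ½.
          avoided : ∀ k {T D} → (T , D) ∈ˡ gen k (C k) → ∀ y → ⟦ C (k ℕ.+ D) ⟧ y → 1# ≤ ∣ eval T y ∣ᴿ * b ^ (e₀ ℕ.+ (k ℕ.+ D))
          avoided k {T} {D} T∈ y y∈ = ≮⇒≥ λ bad → <⇒≱ half<1 (≤-trans (weight-∈ (act (k ℕ.+ D)) (persist bad D ≤-refl′)) (act-light (k ℕ.+ D)))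
            where
            ≤-refl′ : D ℕ.+ 0 ≡ D
            ≤-refl′ = ℕ.+-identityʳ D
            steep : Steep T
            steep = gen-steep k (C k) T∈
            persist : ∣ eval T y ∣ᴿ * b ^ (e₀ ℕ.+ (k ℕ.+ D)) < 1# → ∀ i {r} → i ℕ.+ r ≡ D → (T , r) ∈ˡ act (k ℕ.+ i)
            persist bad zero ≡.refl = ≡.subst (λ k → (T , D) ∈ˡ act k) (≡.sym (ℕ.+-identityʳ k)) (gen⊆act k T∈)
            persist bad (suc i) {r} i+r≡ = ≡.subst (λ k → (T , r) ∈ˡ act k) (≡.sym (ℕ.+-suc k i)) (≡.subst ((T , r) ∈ˡ_) (≡.sym (act-suc (k ℕ.+ i)))
                (∈-++⁺ˡ (remaining-∈ (act (k ℕ.+ i)) (persist bad i (≡.trans (ℕ.+-suc i r) i+r≡)) hit)))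
              where
              K : ℕ
              K = suc (k ℕ.+ i)
              E : ℕ
              E = suc (e₀ ℕ.+ (k ℕ.+ i))
              E≡ : e₀ ℕ.+ K ≡ E
              E≡ = ℕ.+-suc e₀ (k ℕ.+ i)
              K≤ : K ℕ.≤ k ℕ.+ D
              K≤ = ℕ.≤-trans (ℕ.≤-reflexive (≡.sym (ℕ.+-suc k i))) (ℕ.+-monoʳ-≤ k (ℕ.≤-trans (ℕ.m≤m+n (suc i) r) (ℕ.≤-reflexive i+r≡)))
              z : Point
              z = centre (C K)
              0≤bE : 0# ≤ b ^ E
              0≤bE = ^-nonNeg E (<⇒≤ 0<b)
              hit : Hit E z T
              hit = ≤-<-trans (≤-trans (*-monoʳ-≤ 0≤bE (≤-trans (≈⇒≤ (abs-cong (eval-diff T z y))) (abs-+ _ _))) (≤-trans (≈⇒≤ (distribʳ _ _ _)) (+-mono-≤ at-y across)))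
                  (<-resp (trans (+-congʳ (*-identityˡ _)) refl) (trans (+-congˡ (*-identityʳ _)) (sym (ι-suc d))) sum<)
                where
                X : Carrier
                X = ∣ eval T y ∣ᴿ * b ^ (e₀ ℕ.+ (k ℕ.+ D))
                at-y : ∣ eval T y ∣ᴿ * b ^ E ≤ X
                at-y = *-monoˡ-≤ (abs-nonNeg _) (^-monoʳ-≤ 1≤b (ℕ.≤-trans (ℕ.≤-reflexive (≡.sym E≡)) (ℕ.+-monoʳ-≤ e₀ K≤)))
                across : ∣ ∑ (λ l → T (suc l) * (z l - y l)) ∣ᴿ * b ^ E ≤ ι d * 1#
                across = ≤-respˡ (trans (abs-* _ _) (*-congˡ (abs-of-nonNeg 0≤bE))) (≤-respˡ (abs-cong (sym (∑-*ʳ (λ l → T (suc l) * (z l - y l)) (b ^ E)))) (abs-∑-≤ term))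
                  where
                  term : ∀ l → ∣ T (suc l) * (z l - y l) * b ^ E ∣ᴿ ≤ 1#
                  term l = ≤-trans (≈⇒≤ (trans (abs-* _ _) (trans (*-cong (abs-* _ _) (abs-of-nonNeg 0≤bE)) (*-assoc _ _ _)))) (≤-respʳ (*-identityˡ 1#)
                    (*-mono-≤ (*-nonNeg (abs-nonNeg _) 0≤bE) 0≤1 (proj₁ steep l) (≤-respˡ (*-congˡ (reflexive (≡.cong (b ^_) E≡))) (near K (C-≤ K≤ {y} y∈) l))))
                sum< : 1# * X + ι d * 1# < 1# + ι d * 1#
                sum< = ≰⇒> λ q → <⇒≱ bad (lin q (solve 2 (λ x y → x :+ (con (+ 1) :+ y) := con (+ 1) :+ (con (+ 1) :* x :+ y)) refl X (ι d * 1#)))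

  -- Real powers through rational exponents.

  module RealPowers where
    open OrderedField
    open FiniteSums
    open LinearFormsPigeonhole
    open AffineSystems
    open Combinations
    open WeightData

    -- This is n s^(n-1), the derivative of s^n.
    slope : ℕ → Carrier → Carrier
    slope zero s = 0#
    slope (suc n) s = s ^ n + s * slope n s

    0≤slope : ∀ n {s} → 0# ≤ s → 0# ≤ slope n s
    0≤slope zero _ = ≤-refl
    0≤slope (suc n) p = +-nonNeg (^-nonNeg n p) (*-nonNeg p (0≤slope n p))

    slope-mono : ∀ n {s s′} → 0# ≤ s → s ≤ s′ → slope n s ≤ slope n s′
    slope-mono zero _ _ = ≤-refl
    slope-mono (suc n) p q = +-mono-≤ (^-monoˡ-≤ n p q) (*-mono-≤ (0≤slope n p) (≤-trans p q) q (slope-mono n p q))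

    pow-slope : ∀ {y s η} n → 0# ≤ y → 0# ≤ η → y ≤ s → s ≤ y + η → s ^ n ≤ y ^ n + η * slope n s
    pow-slope {y} {s} {η} zero _ _ _ _ = ≈⇒≤ (sym (trans (+-congˡ (zeroʳ η)) (+-identityʳ _)))
    pow-slope {y} {s} {η} (suc n) 0≤y 0≤η y≤s s≤ = begin
      s * s ^ n                                      ≤⟨ *-monoˡ-≤ (≤-trans 0≤y y≤s) (pow-slope n 0≤y 0≤η y≤s s≤) ⟩
      s * (y ^ n + η * slope n s)                    ≈⟨ distribˡ _ _ _ ⟩
      s * y ^ n + s * (η * slope n s)                ≤⟨ +-mono-≤ (*-monoʳ-≤ (^-nonNeg n 0≤y) s≤) ≤-refl ⟩
      (y + η) * y ^ n + s * (η * slope n s)          ≈⟨ solve 5 (λ y e p s k → (y :+ e) :* p :+ s :* (e :* k) := y :* p :+ (e :* p :+ e :* (s :* k))) refl y η (y ^ n) s (slope n s) ⟩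
      y * y ^ n + (η * y ^ n + η * (s * slope n s))  ≤⟨ +-mono-≤ ≤-refl (+-mono-≤ (*-monoˡ-≤ 0≤η (^-monoˡ-≤ n 0≤y y≤s)) ≤-refl) ⟩
      y * y ^ n + (η * s ^ n + η * (s * slope n s))  ≈⟨ +-congˡ (distribˡ η _ _) ⟨
      y * y ^ n + η * (s ^ n + s * slope n s)        ∎
      where open ≤R

    larger-root : ∀ {x z} n → 0# ≤ x → x ^ n < z → ∃[ y ] (x < y × y ^ n ≤ z)
    larger-root {x} {z} n 0≤x x^n<z = x + η , ≰⇒> (λ q → <⇒≱ 0<η (lin q (solve 2 (λ x e → con 0ℤ :+ (x :+ e) := e :+ x) refl x η))) ,
        ≤-trans (pow-slope n 0≤x (<⇒≤ 0<η) x≤ ≤-refl) (lin (+-mono-≤ (*-monoˡ-≤ (<⇒≤ 0<η) (≤-trans (slope-mono n (≤-trans 0≤x x≤) (+-mono-≤ ≤-refl (x⊓y≤x 1# _))) (≤-respˡ (+-identityˡ _) (+-mono-≤ 0≤1 ≤-refl))))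
          (≤-respʳ (/-cancel (z - x ^ n) (0<⇒≉ 0<D)) (*-monoʳ-≤ (<⇒≤ 0<D) (x⊓y≤y 1# ((z - x ^ n) * D ⁻¹)))))
          (solve 5 (λ z p e k d → z :+ (e :* k :+ e :* d) := (p :+ e :* k) :+ (e :* d :+ (z :- p))) refl z (x ^ n) η (slope n (x + η)) D))
      where
      D η : Carrier
      D = 1# + slope n (x + 1#)
      η = 1# ⊓ ((z - x ^ n) * D ⁻¹)
      0<D : 0# < D
      0<D = +-pos-nonNeg 0<1 (0≤slope n (+-nonNeg 0≤x 0≤1))
      0<Δ : 0# < z - x ^ n
      0<Δ = ≰⇒> λ q → <⇒≱ x^n<z (lin q (solve 2 (λ x y → y :+ (x :- y) := x :+ con 0ℤ) refl z (x ^ n)))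
      0<η : 0# < η
      0<η = ⊓-pos 0<1 (*-pos 0<Δ (⁻¹-pos 0<D))
      x≤ : x ≤ x + η
      x≤ = ≤-respˡ (+-identityʳ x) (+-mono-≤ ≤-refl (<⇒≤ 0<η))

    -- Continuity of powers at the supremum: some element of `Q` is within η of it, and by
    -- `pow-slope` the powers differ by at most η times the slope.
    supremum-pow : ∀ {Q : Pred Carrier 0ℓ} n {z} → Satisfiable Q → Satisfiable (UpperBound Q) → (∀ y → Q y → 0# ≤ y) →
                   (∀ y → Q y → y ^ n ≤ z) → sup Q ^ n ≤ z
    supremum-pow {Q} n {z} ne@(y₀ , y₀∈) bdd nonNeg pow≤ = ≮⇒≥ λ z<s^n → contradiction′ z<s^n
      where
      s : Carrier
      s = sup Q
      0≤s : 0# ≤ s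
      0≤s = ≤-trans (nonNeg y₀ y₀∈) (sup-ub bdd y₀∈)
      K : ℕ → Carrier
      K n = slope n s
      0≤K : ∀ n → 0# ≤ K n
      0≤K n = 0≤slope n 0≤s
      contradiction′ : z < s ^ n → ⊥
      contradiction′ z<s^n = classically (∃[ y ] (Q y × s - η < y)) found (λ none → <⇒≱ 0<η (lin (sup-lub ne λ y y∈ → ≮⇒≥ λ lt → none (y , y∈ , lt))
          (solve 2 (λ s e → con 0ℤ :+ s := e :+ (s :- e)) refl s η)))
        where
        D η : Carrier
        D = 1# + K n
        η = (s ^ n - z) * D ⁻¹
        0<D : 0# < D
        0<D = +-pos-nonNeg 0<1 (0≤K n)
        0<Δ : 0# < s ^ n - z
        0<Δ = ≰⇒> λ q → <⇒≱ z<s^n (lin q (solve 2 (λ x y → y :+ (x :- y) := x :+ con 0ℤ) refl (s ^ n) z))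
        0<η : 0# < η
        0<η = *-pos 0<Δ (⁻¹-pos 0<D)
        found : ∃[ y ] (Q y × s - η < y) → ⊥
        found (y , y∈ , close) = <⇒≱ 0<η (lin (+-mono-≤ (pow-slope n (nonNeg y y∈) (<⇒≤ 0<η) (sup-ub bdd y∈) (lin (<⇒≤ close) (solve 3 (λ s e y → (y :+ e) :+ (s :- e) := s :+ y) refl s η y)))
            (+-mono-≤ (pow≤ y y∈) (≈⇒≤ (/-cancel (s ^ n - z) (0<⇒≉ 0<D)))))
          (solve 5 (λ s p z e k → con 0ℤ :+ (s :+ (p :+ e :* (con (+ 1) :+ k))) := e :+ ((p :+ e :* k) :+ (z :+ (s :- z)))) refl (s ^ n) (y ^ n) z η (K n)))

    Powerset : Carrier → Carrier → Pred Carrier 0ℓ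
    Powerset a s y = 0# ≤ y × ∃[ m ] ∃[ n ] (n ≢ 0 × (a ≤ 1# × fromℕ n * s ≤ fromℕ m ⊎ 1# ≤ a × fromℕ m ≤ fromℕ n * s) × y ^ n ≤ a ^ m)

    ^-cancel-≢0 : ∀ {x y n} → n ≢ 0 → 0# ≤ y → x ^ n ≤ y ^ n → x ≤ y
    ^-cancel-≢0 {n = zero} n≢0 = ⊥-elim (n≢0 ≡.refl)
    ^-cancel-≢0 {n = suc n} _ = ^-cancel-≤ n

    ^ᴿ-bounded : ∀ {a s} → 0# ≤ a → 0# ≤ s → Satisfiable (UpperBound (Powerset a s))
    ^ᴿ-bounded {a} {s} 0≤a 0≤s = bound (archimedean-ι s)
      where
      bound : ∃[ N ] s ≤ ι N → Satisfiable (UpperBound (Powerset a s))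
      bound (N , s≤N) = 1# + a ^ N , ub
        where
        ub : UpperBound (Powerset a s) (1# + a ^ N)
        ub y (0≤y , m , n , n≢0 , inj₁ (a≤1 , _) , p) = ≤-trans (^-cancel-≢0 n≢0 0≤1 (≤-trans p (≤-respʳ (sym (1^n n)) (^≤1 m 0≤a a≤1))))
          (≤-respˡ (+-identityʳ 1#) (+-mono-≤ ≤-refl (^-nonNeg N 0≤a)))
        ub y (0≤y , m , n , n≢0 , inj₂ (1≤a , m≤) , p) = ≤-trans (^-cancel-≢0 n≢0 (^-nonNeg N 0≤a) (≤-trans p (≤-respʳ (trans (reflexive (≡.cong (a ^_) (ℕ.*-comm n N))) (^-* a N n)) (^-monoʳ-≤ 1≤a m≤nN))))
          (≤-respˡ (+-identityˡ _) (+-mono-≤ 0≤1 ≤-refl))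
          where
          m≤nN : m ℕ.≤ n ℕ.* N
          m≤nN = ℕ.≮⇒≥ λ lt → <⇒≱ (<-≤-trans (ι<ι-suc (n ℕ.* N)) (ι-mono-≤ lt)) (≤-trans (≤-respˡ (sym (ι-def m)) m≤) (≤-respʳ (trans (*-congʳ (sym (ι-def n))) (sym (ι-* n N))) (*-monoˡ-≤ (≤-respʳ (ι-def n) (0≤ι n)) s≤N)))

    ≤^ᴿ : ∀ {a s y} → 0# ≤ a → 0# ≤ s → Powerset a s y → y ≤ a ^ᴿ s
    ≤^ᴿ 0≤a 0≤s p = sup-ub (^ᴿ-bounded 0≤a 0≤s) p

    module _ {b : Carrier} (1<b : 1# < b) {w : Carrier} (0≤w : 0# ≤ w) where
      private
        1≤b : 1# ≤ b
        1≤b = <⇒≤ 1<b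
        0≤b : 0# ≤ b
        0≤b = ≤-trans 0≤1 1≤b

      1∈Powerset : Powerset b w 1#
      1∈Powerset = 0≤1 , 0 , 1 , (λ ()) , inj₂ (1≤b , *-nonNeg (0≤-fromℕ 1) 0≤w) , ≈⇒≤ (*-identityʳ 1#)

      1≤^ᴿ : 1# ≤ b ^ᴿ w
      1≤^ᴿ = ≤^ᴿ 0≤b 0≤w 1∈Powerset

      root≤^ᴿ : ∀ n {y} → n ≢ 0 → 0# ≤ y → 1# ≤ ι n * w → y ^ n ≤ b → y ≤ b ^ᴿ w
      root≤^ᴿ n n≢0 0≤y 1≤nw p = ≤^ᴿ 0≤b 0≤w (0≤y , 1 , n , n≢0 , inj₂ (1≤b , ≤-resp (sym fromℕ-1) (*-congʳ (ι-def n)) 1≤nw) , ≤-respʳ (sym (*-identityʳ b)) p)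

      -- Everything is compared through fractions: m′/n′ ≤ w ≤ m/n gives m′n ≤ mn′, and then both
      -- sides are raised to the power n′.
      ^ᴿ-pow≤ : ∀ m n → n ≢ 0 → ι n * w ≤ ι m → (b ^ᴿ w) ^ n ≤ b ^ m
      ^ᴿ-pow≤ m n n≢0 nw≤m = supremum-pow {Powerset b w} n (1# , 1∈Powerset) (^ᴿ-bounded 0≤b 0≤w) (λ y → proj₁) pow
        where
        pow : ∀ y → Powerset b w y → y ^ n ≤ b ^ m
        pow y (0≤y , m′ , n′ , n′≢0 , inj₁ (b≤1 , _) , p) = ⊥-elim (<⇒≱ 1<b b≤1)
        pow y (0≤y , m′ , n′ , n′≢0 , inj₂ (_ , m′≤) , p) = ^-cancel-≢0 n′≢0 (^-nonNeg m 0≤b) (begin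
          (y ^ n) ^ n′      ≈⟨ trans (sym (^-* y n n′)) (trans (reflexive (≡.cong (y ^_) (ℕ.*-comm n n′))) (^-* y n′ n)) ⟩
          (y ^ n′) ^ n      ≤⟨ ^-monoˡ-≤ n (^-nonNeg n′ 0≤y) p ⟩
          (b ^ m′) ^ n      ≈⟨ ^-* b m′ n ⟨
          b ^ (m′ ℕ.* n)    ≤⟨ ^-monoʳ-≤ 1≤b m′n≤ ⟩
          b ^ (m ℕ.* n′)    ≈⟨ ^-* b m n′ ⟩
          (b ^ m) ^ n′      ∎)
          where
          open ≤R
          m′n≤ : m′ ℕ.* n ℕ.≤ m ℕ.* n′
          m′n≤ = ℕ.≮⇒≥ λ lt → <⇒≱ (<-≤-trans (ι<ι-suc (m ℕ.* n′)) (ι-mono-≤ lt)) (begin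
            ι (m′ ℕ.* n)        ≈⟨ ι-* m′ n ⟩
            ι m′ * ι n          ≤⟨ *-monoʳ-≤ (0≤ι n) (≤-resp (sym (ι-def m′)) (*-congʳ (sym (ι-def n′))) m′≤) ⟩
            ι n′ * w * ι n      ≈⟨ solve 3 (λ n′ w n → n′ :* w :* n := (n :* w) :* n′) refl (ι n′) w (ι n) ⟩
            ι n * w * ι n′      ≤⟨ *-monoʳ-≤ (0≤ι n′) nw≤m ⟩
            ι m * ι n′          ≈⟨ ι-* m n′ ⟨
            ι (m ℕ.* n′)        ∎)

      -- Otherwise a number above b^w would still have n-th power at most b^m and thus belong to the
      -- set whose supremum is b^w.
      ≤^ᴿ-pow : ∀ m n → n ≢ 0 → ι m ≤ ι n * w → b ^ m ≤ (b ^ᴿ w) ^ n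
      ≤^ᴿ-pow m n n≢0 m≤nw = ≮⇒≥ λ lt → beyond (larger-root n (≤-trans 0≤1 1≤^ᴿ) lt)
        where
        beyond : ∃[ y ] (b ^ᴿ w < y × y ^ n ≤ b ^ m) → ⊥
        beyond (y , x<y , p) = <⇒≱ x<y (≤^ᴿ 0≤b 0≤w (≤-trans (≤-trans 0≤1 1≤^ᴿ) (<⇒≤ x<y) , m , n , n≢0 , inj₂ (1≤b , ≤-resp (ι-def m) (*-congʳ (ι-def n)) m≤nw) , p))

    -- If X ≥ b^(-c) Λ^(-t) with Λ = b^w, then X^(1/w) is at least b^(-t) up to a constant.
    module _ {b : Carrier} (1<b : 1# < b) {w : Carrier} (0<w : 0# < w) (w≤1 : w ≤ 1#) (g : ℕ) (1≤gw : 1# ≤ ι g * w) (c t : ℕ) (1≤t : 1 ℕ.≤ t) where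
      open Powers b (<⇒≤ 1<b)

      inverse-power : ∀ {X} → 0# ≤ X → 1# ≤ X * b ^ c * (b ^ᴿ w) ^ t → bi ^ (t ℕ.+ 1 ℕ.+ 2 ℕ.* (c ℕ.* g)) ≤ X ^ᴿ (w ⁻¹)
      inverse-power {X} 0≤X X≥ = [ (λ X≤1 → ≤^ᴿ 0≤X 0≤wi (small X≤1 (floor-ι {ι t * w ⁻¹} (*-nonNeg (0≤ι t) 0≤wi)))) , (λ 1≤X → ≤^ᴿ 0≤X 0≤wi (large 1≤X)) ]′ (≤-total X 1#)
        where
        κ′ : ℕ
        κ′ = t ℕ.+ 1 ℕ.+ 2 ℕ.* (c ℕ.* g)
        Y Λ : Carrier
        Y = bi ^ κ′
        Λ = b ^ᴿ w
        0≤wi : 0# ≤ w ⁻¹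
        0≤wi = <⇒≤ (⁻¹-pos 0<w)
        bi≤1 : bi ≤ 1#
        bi≤1 = *-cancelˡ-≤ 0<b (≤-resp (sym (⁻¹-inverseʳ b (0<⇒≉ 0<b))) (sym (*-identityʳ b)) (<⇒≤ 1<b))
        0≤Y : 0# ≤ Y
        0≤Y = ^-nonNeg κ′ (<⇒≤ 0<bi)
        t≢0 : t ≢ 0
        t≢0 ≡.refl = ℕ.1+n≰n 1≤t
        large : 1# ≤ X → Powerset X (w ⁻¹) Y
        large 1≤X = 0≤Y , 0 , 1 , (λ ()) , inj₂ (1≤X , *-nonNeg (0≤-fromℕ 1) 0≤wi) , ≤-respˡ (sym (*-identityʳ Y)) (^≤1 κ′ (<⇒≤ 0<bi) bi≤1)
        small : X ≤ 1# → ∃[ k ] (ι k ≤ ι t * w ⁻¹ × ι t * w ⁻¹ < ι (suc k)) → Powerset X (w ⁻¹) Y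
        -- With k the integer part of t/w, the fraction (k + 1)/t lies just above 1/w. In `κ′` the
        -- part t + 1 comes from `mw≤`, and the part 2cg from m ≤ (t + 1)g ≤ 2tg.
        small X≤1 (k , k≤ , <k+1) = 0≤Y , suc k , t , t≢0 , inj₁ (X≤1 , ≤-resp (*-congʳ (ι-def t)) (ι-def (suc k)) (<⇒≤ <k+1)) , *-cancelʳ-≤ (^-pos (t ℕ.* κ′) 0<b) (begin
            Y ^ t * b ^ (t ℕ.* κ′)          ≈⟨ *-congʳ (trans (sym (^-* bi κ′ t)) (reflexive (≡.cong (bi ^_) (ℕ.*-comm κ′ t)))) ⟩
            bi ^ (t ℕ.* κ′) * b ^ (t ℕ.* κ′) ≈⟨ trans (*-comm _ _) (b^n*bi^n (t ℕ.* κ′)) ⟩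
            1#                               ≤⟨ 1≤^ m X≥ ⟩
            (X * b ^ c * Λ ^ t) ^ m          ≈⟨ trans (^-distrib-* (X * b ^ c) (Λ ^ t) m) (*-cong (^-distrib-* X (b ^ c) m) (trans (sym (^-* Λ t m)) (trans (reflexive (≡.cong (Λ ^_) (ℕ.*-comm t m))) (^-* Λ m t)))) ⟩
            X ^ m * (b ^ c) ^ m * (Λ ^ m) ^ t ≤⟨ *-mono-≤ (^-nonNeg t (^-nonNeg m (≤-trans 0≤1 (1≤^ᴿ 1<b (<⇒≤ 0<w))))) (*-nonNeg (^-nonNeg m 0≤X) (^-nonNeg (t ℕ.* (2 ℕ.* (c ℕ.* g))) (<⇒≤ 0<b)))
                  (*-monoˡ-≤ (^-nonNeg m 0≤X) (≤-respˡ (^-* b c m) (^-monoʳ-≤ (<⇒≤ 1<b) cm≤))) (^-monoˡ-≤ t (^-nonNeg m (≤-trans 0≤1 (1≤^ᴿ 1<b (<⇒≤ 0<w)))) (^ᴿ-pow≤ 1<b (<⇒≤ 0<w) (suc t) m (λ ()) mw≤)) ⟩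
            X ^ m * b ^ (t ℕ.* (2 ℕ.* (c ℕ.* g))) * (b ^ suc t) ^ t ≈⟨ trans (*-assoc _ _ _) (*-congˡ (trans (*-congˡ (sym (^-* b (suc t) t))) (trans (sym (^-homo-* b (t ℕ.* (2 ℕ.* (c ℕ.* g))) (suc t ℕ.* t))) (reflexive (≡.cong (b ^_) exponent))))) ⟩
            X ^ m * b ^ (t ℕ.* κ′) ∎)
          where
          open ≤R
          m : ℕ
          m = suc k
          exponent : t ℕ.* (2 ℕ.* (c ℕ.* g)) ℕ.+ suc t ℕ.* t ≡ t ℕ.* κ′
          exponent = N.solve 2 (λ t x → t N.:* x N.:+ (N.con 1 N.:+ t) N.:* t N.:= t N.:* (t N.:+ N.con 1 N.:+ x)) ≡.refl t (2 ℕ.* (c ℕ.* g))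
          mw≤ : ι m * w ≤ ι (suc t)
          mw≤ = begin
            ι (suc k) * w     ≈⟨ trans (*-congʳ (ι-suc k)) (distribʳ w 1# (ι k)) ⟩
            1# * w + ι k * w  ≤⟨ +-mono-≤ (≤-respˡ (sym (*-identityˡ w)) w≤1) (≤-respʳ (/-cancel (ι t) (0<⇒≉ 0<w)) (*-monoʳ-≤ (<⇒≤ 0<w) k≤)) ⟩
            1# + ι t          ≈⟨ ι-suc t ⟨
            ι (suc t)         ∎
          m≤ : m ℕ.≤ suc t ℕ.* g
          m≤ = ℕ.≮⇒≥ λ lt → <⇒≱ (<-≤-trans (ι<ι-suc (suc t ℕ.* g)) (ι-mono-≤ lt)) (begin
            ι m                ≤⟨ x≤x*y (0≤ι m) 1≤gw ⟩
            ι m * (ι g * w)    ≈⟨ solve 3 (λ m g w → m :* (g :* w) := (m :* w) :* g) refl (ι m) (ι g) w ⟩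
            ι m * w * ι g      ≤⟨ *-monoʳ-≤ (0≤ι g) mw≤ ⟩
            ι (suc t) * ι g    ≈⟨ ι-* (suc t) g ⟨
            ι (suc t ℕ.* g)    ∎)
          cm≤ : c ℕ.* m ℕ.≤ t ℕ.* (2 ℕ.* (c ℕ.* g))
          cm≤ = ℕ.≤-trans (ℕ.*-monoʳ-≤ c (ℕ.≤-trans m≤ (ℕ.*-monoˡ-≤ g (ℕ.≤-trans (ℕ.+-monoˡ-≤ t 1≤t) ℕ.≤-refl)))) (ℕ.≤-reflexive
            (N.solve 3 (λ c t g → c N.:* ((t N.:+ t) N.:* g) N.:= t N.:* (N.con 2 N.:* (c N.:* g))) ≡.refl c t g))

    sumℕ : ∀ {n} → (Fin n → ℕ) → ℕ
    sumℕ = Vector.foldr ℕ._+_ 0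

    ι-sumℕ : ∀ {n} (f : Fin n → ℕ) → ι (sumℕ f) ≈ ∑ (λ k → ι (f k))
    ι-sumℕ {zero} f = trans ι-0 (sym (∑-zero _))
    ι-sumℕ {suc n} f = trans (ι-+ (f zero) _) (trans (+-congˡ (ι-sumℕ (f ∘ suc))) (sym (∑-suc _)))

    ∏-pow : ∀ {n} b (f : Fin n → ℕ) → ∏ (λ k → b ^ f k) ≈ b ^ sumℕ f
    ∏-pow {zero} b f = ∏-zero _
    ∏-pow {suc n} b f = trans (∏-suc _) (trans (*-congˡ (∏-pow b (f ∘ suc))) (sym (^-homo-* b (f zero) _)))

    module _ {d : ℕ} (w : Vector Carrier d) (isWeight : IsWeight w) (1≤d : 1 ℕ.≤ d) (N₀ : ℕ) (N₀-large : ∀ l → ¬ (w l ≈ 0#) → 1# ≤ ι N₀ * w l)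
      (b : Carrier) (b-large : Ω d * (ι (suc d) * ι (suc d)) ≤ b) (two^N₀≤b : two ^ N₀ ≤ b) (1<b : 1# < b) where

      0≤w : ∀ l → 0# ≤ w l
      0≤w = proj₁ isWeight

      ∑w : ∑ w ≈ 1#
      ∑w = trans (∑-def w) (proj₂ isWeight)

      w≤1 : ∀ l → w l ≤ 1#
      w≤1 l = ≤-respʳ ∑w (term≤∑ 0≤w l)

      weights : Weights d
      weights = fromGrowth (archimedean-^ b 1<two)
        where
        1<two : 1# < two
        1<two = x<1+x 1#
        Λ : Fin d → Carrier
        Λ l = b ^ᴿ w l
        1≤Λ : ∀ l → 1# ≤ Λ l
        1≤Λ l = 1≤^ᴿ 1<b (0≤w l)
        0≤Λ : ∀ l → 0# ≤ Λ l
        0≤Λ l = ≤-trans 0≤1 (1≤Λ l)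
        1≤b : 1# ≤ b
        1≤b = <⇒≤ 1<b
        0<b : 0# < b
        0<b = <-≤-trans 0<1 1≤b
        Λ≤b : ∀ l → Λ l ≤ b
        Λ≤b l = ≤-resp (*-identityʳ _) (*-identityʳ b) (^ᴿ-pow≤ 1<b (0≤w l) 1 1 (λ ()) (≤-respʳ (*-identityʳ _) (*-monoˡ-≤ (0≤ι 1) (w≤1 l))))
        -- Rounding n w_l up costs at most one factor b per coordinate, independently of n.
        power≤ : ∀ n → n ≢ 0 → ∏ Λ ^ n ≤ b ^ n * b ^ d
        power≤ n n≢0 = begin
          ∏ Λ ^ n                       ≈⟨ ∏-^ Λ n ⟨
          ∏ (λ l → Λ l ^ n)             ≤⟨ ∏-mono-≤ (λ l → ^-nonNeg n (0≤Λ l)) (λ l → ^ᴿ-pow≤ 1<b (0≤w l) (suc (m l)) n n≢0 (<⇒≤ (proj₂ (proj₂ (fl l))))) ⟩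
          ∏ (λ l → b ^ suc (m l))       ≈⟨ ∏-pow b (λ l → suc (m l)) ⟩
          b ^ sumℕ (λ l → suc (m l))    ≤⟨ ^-monoʳ-≤ 1≤b sum≤ ⟩
          b ^ (n ℕ.+ d)                 ≈⟨ ^-homo-* b n d ⟩
          b ^ n * b ^ d ∎
          where
          open ≤R
          fl : ∀ l → ∃[ m ] (ι m ≤ ι n * w l × ι n * w l < ι (suc m))
          fl l = floor-ι (*-nonNeg (0≤ι n) (0≤w l))
          m : Fin d → ℕ
          m l = proj₁ (fl l)
          sum≤ : sumℕ (λ l → suc (m l)) ℕ.≤ n ℕ.+ d
          sum≤ = ℕ.≮⇒≥ λ lt → <⇒≱ (<-≤-trans (ι<ι-suc (n ℕ.+ d)) (ι-mono-≤ lt)) (begin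
            ι (sumℕ (λ l → suc (m l)))         ≈⟨ ι-sumℕ (λ l → suc (m l)) ⟩
            ∑ (λ l → ι (suc (m l)))            ≤⟨ ∑-mono-≤ (λ l → ≤-respˡ (sym (ι-suc (m l))) (+-mono-≤ ≤-refl (proj₁ (proj₂ (fl l))))) ⟩
            ∑ (λ l → 1# + ι n * w l)           ≈⟨ ∑-+ (λ _ → 1#) (λ l → ι n * w l) ⟩
            ∑ {d} (λ _ → 1#) + ∑ (λ l → ι n * w l) ≈⟨ +-cong (trans (∑-const d 1#) (*-identityʳ _)) (trans (sym (∑-*ˡ (ι n) w)) (trans (*-congˡ ∑w) (*-identityʳ _))) ⟩
            ι d + ι n                          ≈⟨ trans (+-comm _ _) (sym (ι-+ n d)) ⟩
            ι (n ℕ.+ d)                        ∎)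
        -- Taking n-th powers removes the rounding loss: the powers of a ratio above 1 would outgrow
        -- the constant factor b^d. The reverse inequality `≤∏Λ` works in the same way with rounding
        -- down.
        ∏Λ≤ : ∏ Λ ≤ b
        ∏Λ≤ = ≮⇒≥ λ b<Π → grow (ratio b<Π) (archimedean-^ (1# + b ^ d) (ratio b<Π))
          where
          q : Carrier
          q = ∏ Λ * b ⁻¹
          ratio : b < ∏ Λ → 1# < q
          ratio b<Π = <-resp (⁻¹-inverseʳ b (0<⇒≉ 0<b)) refl (*-monoʳ-< (⁻¹-pos 0<b) b<Π)
          grow : 1# < q → ∃[ n ] (1# + b ^ d ≤ q ^ n) → ⊥
          grow 1<q (n , p) = <⇒≱ (x<1+x (b ^ d)) (≤-trans p (≤-trans (^-monoʳ-≤ {q} {n} {suc n} (<⇒≤ 1<q) (ℕ.n≤1+n n)) (*-cancelˡ-≤ (^-pos (suc n) 0<b)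
            (≤-respˡ (trans (^-congˡ (suc n) (sym (trans (*-comm _ _) (/-cancel (∏ Λ) (0<⇒≉ 0<b))))) (^-distrib-* b q (suc n))) (power≤ (suc n) (λ ()))))))
        power≥ : ∀ n → n ≢ 0 → b ^ n ≤ ∏ Λ ^ n * b ^ d
        power≥ n n≢0 = begin
          b ^ n                         ≤⟨ ^-monoʳ-≤ 1≤b ≤sum ⟩
          b ^ (sumℕ m ℕ.+ d)            ≈⟨ ^-homo-* b (sumℕ m) d ⟩
          b ^ sumℕ m * b ^ d            ≈⟨ *-congʳ (∏-pow b m) ⟨
          ∏ (λ l → b ^ m l) * b ^ d     ≤⟨ *-monoʳ-≤ (^-nonNeg d (<⇒≤ 0<b)) (∏-mono-≤ (λ l → ^-nonNeg (m l) (<⇒≤ 0<b)) (λ l → ≤^ᴿ-pow 1<b (0≤w l) (m l) n n≢0 (proj₁ (proj₂ (fl l))))) ⟩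
          ∏ (λ l → Λ l ^ n) * b ^ d     ≈⟨ *-congʳ (∏-^ Λ n) ⟩
          ∏ Λ ^ n * b ^ d               ∎
          where
          open ≤R
          fl : ∀ l → ∃[ m ] (ι m ≤ ι n * w l × ι n * w l < ι (suc m))
          fl l = floor-ι (*-nonNeg (0≤ι n) (0≤w l))
          m : Fin d → ℕ
          m l = proj₁ (fl l)
          ≤sum : n ℕ.≤ sumℕ m ℕ.+ d
          ≤sum = ℕ.≮⇒≥ λ lt → <⇒≱ (<-≤-trans (ι<ι-suc (sumℕ m ℕ.+ d)) (ι-mono-≤ lt)) (begin
            ι n                                 ≈⟨ trans (trans (*-congˡ ∑w) (*-identityʳ _)) refl ⟨
            ι n * ∑ w                           ≈⟨ ∑-*ˡ (ι n) w ⟩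
            ∑ (λ l → ι n * w l)                 ≤⟨ ∑-mono-≤ (λ l → ≤-respʳ (ι-suc (m l)) (<⇒≤ (proj₂ (proj₂ (fl l))))) ⟩
            ∑ (λ l → 1# + ι (m l))              ≈⟨ ∑-+ (λ _ → 1#) (λ l → ι (m l)) ⟩
            ∑ {d} (λ _ → 1#) + ∑ (λ l → ι (m l)) ≈⟨ +-cong (trans (∑-const d 1#) (*-identityʳ _)) (sym (ι-sumℕ m)) ⟩
            ι d + ι (sumℕ m)                    ≈⟨ trans (+-comm _ _) (sym (ι-+ (sumℕ m) d)) ⟩
            ι (sumℕ m ℕ.+ d)                    ∎)
        ≤∏Λ : b ≤ ∏ Λ
        ≤∏Λ = ≮⇒≥ λ Π<b → grow (ratio Π<b) (archimedean-^ (1# + b ^ d) (ratio Π<b))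
          where
          0<Π : 0# < ∏ Λ
          0<Π = ∏-pos λ l → <-≤-trans 0<1 (1≤Λ l)
          q : Carrier
          q = b * ∏ Λ ⁻¹
          ratio : ∏ Λ < b → 1# < q
          ratio Π<b = <-resp (⁻¹-inverseʳ (∏ Λ) (0<⇒≉ 0<Π)) refl (*-monoʳ-< (⁻¹-pos 0<Π) Π<b)
          grow : 1# < q → ∃[ n ] (1# + b ^ d ≤ q ^ n) → ⊥
          grow 1<q (n , p) = <⇒≱ (x<1+x (b ^ d)) (≤-trans p (≤-trans (^-monoʳ-≤ {q} {n} {suc n} (<⇒≤ 1<q) (ℕ.n≤1+n n)) (*-cancelˡ-≤ (^-pos (suc n) 0<Π)
            (≤-respˡ (trans (^-congˡ (suc n) (sym (trans (*-comm _ _) (/-cancel b (0<⇒≉ 0<Π))))) (^-distrib-* (∏ Λ) q (suc n))) (power≥ (suc n) (λ ()))))))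
        top : ∃[ l ] ∀ l′ → Λ l′ ≤ Λ l
        top = argmaxOver (element 1≤d) Λ
        ΛT : Carrier
        ΛT = Λ (proj₁ top)
        least : ∀ t → ∃[ m ] (ΛT ^ t < b ^ m × (∀ k → k ℕ.< m → ¬ (ΛT ^ t < b ^ k)))
        least t = leastWith (λ m → ΛT ^ t < b ^ m) (suc t , upper t)
          where
          upper : ∀ t → ΛT ^ t < b ^ suc t
          upper t = ≤-<-trans (^-monoˡ-≤ t (0≤Λ _) (Λ≤b _)) (<-resp (*-identityˡ _) refl (*-monoʳ-< (^-pos t 0<b) 1<b))
        M : ℕ → ℕ
        M t = proj₁ (least t)
        b^M≤ : ∀ t m → (∀ k → k ℕ.< m → ¬ (ΛT ^ t < b ^ k)) → b ^ m ≤ b * ΛT ^ t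
        b^M≤ t zero _ = 1≤* 1≤b (1≤^ t (1≤Λ _))
        b^M≤ t (suc m) min = *-monoˡ-≤ (<⇒≤ 0<b) (≮⇒≥ (min m (ℕ.n<1+n m)))
        fromGrowth : ∃[ n ] b ≤ two ^ n → Weights d
        fromGrowth (g₀ , b≤) = record
          { b = b ; b-large = b-large ; Λ = Λ ; 1≤Λ = 1≤Λ ; ∏Λ = ∏Λ≤ ; ∏Λ-lower = ≤∏Λ ; Pos = λ l → ¬ (w l ≈ 0#)
          ; Λ-null = λ l ¬¬0 → classically (w l ≈ 0#) (λ w≈0 → ≤-antisym (≤-respˡ (*-identityʳ _) (^ᴿ-pow≤ 1<b (0≤w l) 0 1 (λ ()) (≈⇒≤ (trans (*-congˡ w≈0) (trans (zeroʳ _) (sym ι-0)))))) (1≤Λ l)) (λ ne → ⊥-elim (¬¬0 ne))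
          -- In coordinates of positive weight Λ ≥ 2, and b ≤ 2^g₀, so b ≤ Λ^g; the summand 5
          -- provides `5≤g`.
          ; g = g₀ ℕ.+ 5 ; 5≤g = ℕ.m≤n+m 5 g₀
          ; Λ-pos = λ l pos → ≤-trans b≤ (≤-trans (^-monoʳ-≤ 1≤two (ℕ.m≤m+n g₀ 5)) (^-monoˡ-≤ (g₀ ℕ.+ 5) (<⇒≤ 0<two) (two≤ l pos)))
          ; top = proj₁ top ; Λ≤top = proj₂ top ; M = M ; Λ^t<b^M = λ t → proj₁ (proj₂ (least t))
          ; b^M≤ = λ t → b^M≤ t (M t) (proj₂ (proj₂ (least t)))
          ; M≤ = λ t → ℕ.≮⇒≥ λ lt → proj₂ (proj₂ (least t)) (suc t) lt (≤-<-trans (^-monoˡ-≤ t (0≤Λ _) (Λ≤b _)) (<-resp (*-identityˡ _) refl (*-monoʳ-< (^-pos t 0<b) 1<b))) }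
          where
          two≤ : ∀ l → ¬ (w l ≈ 0#) → two ≤ Λ l
          two≤ l pos = root≤^ᴿ 1<b (0≤w l) N₀ (N₀≢0 N₀ (N₀-large l pos)) (<⇒≤ 0<two) (N₀-large l pos) two^N₀≤b
            where
            N₀≢0 : ∀ N → 1# ≤ ι N * w l → N ≢ 0
            N₀≢0 .0 p ≡.refl = <⇒≱ 0<1 (≤-respʳ (trans (*-congʳ ι-0) (zeroˡ _)) p)

  -- Transference from the dual bound to simultaneous approximation.

  module Transfer where
    open OrderedField
    open FiniteSums
    open LinearFormsPigeonhole
    open AffineSystems
    open SmallFunctions
    open WeightData

    decode : ∀ {m} (N : Fin m → ℕ) → Fin (prodℕ N) → ∀ i → Fin (N i)
    decode N x zero    = proj₁ (Fin.remQuot {N zero} (prodℕ (N ∘ suc)) x)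
    decode N x (suc i) = decode (N ∘ suc) (proj₂ (Fin.remQuot {N zero} (prodℕ (N ∘ suc)) x)) i

    decode-injective : ∀ {m} (N : Fin m → ℕ) x y → (∀ i → decode N x i ≡ decode N y i) → x ≡ y
    decode-injective {zero} N zero zero _ = ≡.refl
    decode-injective {suc m} N x y p = ≡.trans (≡.sym (Fin.combine-remQuot {N zero} (prodℕ (N ∘ suc)) x))
      (≡.trans (≡.cong₂ Fin.combine (p zero) (decode-injective (N ∘ suc) _ _ (p ∘ suc))) (Fin.combine-remQuot {N zero} (prodℕ (N ∘ suc)) y))

    -- For nonzero q the hypothesis says that the function vanishes at p/q; its value at y is then
    -- governed by the errors q y - p.
    ∑-neg-eval : ∀ {d} (a p : Fin d → Carrier) (q : Carrier) (y : Fin d → Carrier) {a₀} → q * a₀ ≈ - ∑ (λ l → a l * p l) →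
                 q * (a₀ + ∑ (λ l → a l * y l)) ≈ ∑ (λ l → a l * (q * y l - p l))
    ∑-neg-eval a p q y {a₀} e = begin
      q * (a₀ + ∑ (λ l → a l * y l))       ≈⟨ distribˡ q a₀ _ ⟩
      q * a₀ + q * ∑ (λ l → a l * y l)     ≈⟨ +-cong e (trans (∑-*ˡ q (λ l → a l * y l)) (∑-cong λ l → solve 3 (λ q a y → q :* (a :* y) := a :* (q :* y)) refl q (a l) (y l))) ⟩
      - ∑ (λ l → a l * p l) + ∑ (λ l → a l * (q * y l)) ≈⟨ +-comm _ _ ⟩
      ∑ (λ l → a l * (q * y l)) - ∑ (λ l → a l * p l)   ≈⟨ ∑-sub (λ l → a l * (q * y l)) (λ l → a l * p l) ⟨
      ∑ (λ l → a l * (q * y l) - a l * p l)             ≈⟨ ∑-cong (λ l → solve 3 (λ a q p → a :* q :- a :* p := a :* (q :- p)) refl (a l) (q * y l) (p l)) ⟩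
      ∑ (λ l → a l * (q * y l - p l))      ∎
      where open ≈R

    module TransferenceOver {d : ℕ} (W : Weights d) where
      open Weights W

      module Transference (V : ℕ) (d<b : ι d < b) (y : Vector Carrier d) (t : ℕ)
        (dual : ∀ t₁ → t₁ ℕ.≤ t → ∀ a → (∃[ i ] a i ≢ 0ℤ) → (∀ l → ∣ ζ (a (suc l)) ∣ᴿ < Λ l ^ t₁) → ¬ (∣ eval (toAff a) y ∣ᴿ * b ^ (t₁ ℕ.+ V) < 1#)) where

        -- There are more integer vectors a in the box |a_l| < Λ_l^t₁ than residues of a·p modulo Q.
        module _ (Q : ℤ) (p : Fin d → ℤ) (Q≢0 : Q ≢ 0ℤ) (Q< : ι ℤ.∣ Q ∣ < b ^ t)
          (near : ∀ l → Pos l → ∣ ζ Q * y l - ζ (p l) ∣ᴿ * Λ l ^ t * b ^ (V ℕ.+ 2) ≤ 1#) where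
          private
            instance
              Q-nonZero : ℤ.NonZero Q
              Q-nonZero = ℤ.≢-nonZero Q≢0

            q : ℕ
            q = ℤ.∣ Q ∣

            1≤q : 1 ℕ.≤ q
            1≤q = ℕ.≮⇒≥ λ lt → Q≢0 (ℤ.∣i∣≡0⇒i≡0 (ℕ.n<1⇒n≡0 lt))

            -- `t₁` is the least exponent with |Q| < b^t₁: the box then has more points than there
            -- are residues, while b^(t₁ - 1) ≤ |Q| keeps the resulting function small at y.
            level : ∃[ t₀ ] (suc t₀ ℕ.≤ t × b ^ t₀ ≤ ι q × ι q < b ^ suc t₀)
            level = pred (leastWith (λ n → ι q < b ^ n) (t , Q<))
              where
              pred : ∃[ m ] (ι q < b ^ m × (∀ k → k ℕ.< m → ¬ (ι q < b ^ k))) → ∃[ t₀ ] (suc t₀ ℕ.≤ t × b ^ t₀ ≤ ι q × ι q < b ^ suc t₀)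
              pred (zero , lt , _) = ⊥-elim (<⇒≱ lt (≤-respˡ ι-1 (ι-mono-≤ 1≤q)))
              pred (suc m , lt , min) = m , ℕ.≮⇒≥ (λ t<m → min t t<m Q<) , ≮⇒≥ (min m (ℕ.n<1+n m)) , lt

            t₀ t₁ : ℕ
            t₀ = proj₁ level
            t₁ = suc t₀

            counts : ∀ l → ∃[ m ] (ι m < Λ l ^ t₁ × Λ l ^ t₁ ≤ ι (suc m))
            counts l = pred (leastWith (λ n → Λ l ^ t₁ ≤ ι n) (archimedean-ι (Λ l ^ t₁)))
              where
              pred : ∃[ m ] (Λ l ^ t₁ ≤ ι m × (∀ k → k ℕ.< m → ¬ (Λ l ^ t₁ ≤ ι k))) → ∃[ m ] (ι m < Λ l ^ t₁ × Λ l ^ t₁ ≤ ι (suc m))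
              pred (zero , le , _) = ⊥-elim (<⇒≱ 0<1 (≤-trans (1≤^ t₁ (1≤Λ l)) (≤-respʳ ι-0 le)))
              pred (suc m , le , min) = m , ≰⇒> (min m (ℕ.n<1+n m)) , le

            N : Fin d → ℕ
            N l = suc (proj₁ (counts l))

            q<∏N : q ℕ.< prodℕ N
            q<∏N = ι-cancel-< (<-≤-trans (proj₂ (proj₂ (proj₂ level))) (≤-trans (^-monoˡ-≤ t₁ (<⇒≤ 0<b) ∏Λ-lower) (≤-respˡ (∏-^ Λ t₁)
              (≤-respʳ (sym (ι-∏ N)) (∏-mono-≤ (λ l → ^-nonNeg t₁ (<⇒≤ (0<Λ l))) (λ l → proj₂ (proj₂ (counts l))))))))

            s : Fin (prodℕ N) → ℤ
            s x = ∑ℤ {d} (λ l → + Fin.toℕ (decode N x l) ℤ.* p l)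

            ζ-s : ∀ x → ζ (s x) ≈ ∑ (λ l → ι (Fin.toℕ (decode N x l)) * ζ (p l))
            ζ-s x = trans (ζ-∑ {d} _) (∑-cong λ l → trans (ζ-* (+ Fin.toℕ (decode N x l)) (p l)) (*-congʳ (ζ-pos _)))

            residue : Fin (prodℕ N) → Fin q
            residue x = Fin.fromℕ< (remainder< (s x) Q)

            ζ-division : ∀ x → ζ (s x) ≈ ι (s x %ℤ Q) + ζ (s x /ℤ Q) * ζ Q
            ζ-division x = trans (reflexive (≡.cong ζ (division (s x) Q))) (trans (ζ-+ (+ (s x %ℤ Q)) _) (+-cong (ζ-pos _) (ζ-* (s x /ℤ Q) Q)))

            collide : ∃[ x ] ∃[ x′ ] (x Fin.< x′ × residue x ≡ residue x′) → ⊥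
            collide (x , x′ , x<x′ , same) = dual t₁ (proj₁ (proj₂ level)) A A≢0 A< small
              where
              u u′ : Fin d → ℕ
              u l = Fin.toℕ (decode N x l)
              u′ l = Fin.toℕ (decode N x′ l)
              A : Vector ℤ (suc d)
              -- As the residues agree, this difference of quotients makes the function vanish at
              -- p/Q.
              A zero = s x′ /ℤ Q ℤ.- s x /ℤ Q
              A (suc l) = + u l ℤ.- + u′ l
              ζA : ∀ l → ζ (A (suc l)) ≈ ι (u l) - ι (u′ l)
              ζA l = trans (ζ-sub (+ u l) (+ u′ l)) (+-cong (ζ-pos _) (-‿cong (ζ-pos _)))
              A≢0 : ∃[ i ] A i ≢ 0ℤ
              A≢0 = classically (∃[ i ] A i ≢ 0ℤ) id λ none → ⊥-elim (Fin.<⇒≢ x<x′ (decode-injective N x x′ λ l →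
                Fin.toℕ-injective (ℤ.+-injective (ℤ.i-j≡0⇒i≡j (+ u l) (+ u′ l) (classically (A (suc l) ≡ 0ℤ) id λ ne → ⊥-elim (none (suc l , ne)))))))
              A< : ∀ l → ∣ ζ (A (suc l)) ∣ᴿ < Λ l ^ t₁
              A< l = ≤-<-trans (≤-respˡ (abs-cong (sym (ζA l))) (abs-lub
                  (lin (+-mono-≤ (u≤ x) (0≤ι (u′ l))) (solve 3 (λ m u v → m :+ (u :+ con 0ℤ) := (u :- v) :+ (m :+ v)) refl (ι m) (ι (u l)) (ι (u′ l))))
                  (lin (+-mono-≤ (u≤ x′) (0≤ι (u l))) (solve 3 (λ m u v → m :+ (v :+ con 0ℤ) := (:- (u :- v)) :+ (m :+ u)) refl (ι m) (ι (u l)) (ι (u′ l))))))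
                (proj₁ (proj₂ (counts l)))
                where
                m : ℕ
                m = proj₁ (counts l)
                u≤ : ∀ x → ι (Fin.toℕ (decode N x l)) ≤ ι m
                u≤ x = ι-mono-≤ (ℕ.≤-pred (Fin.toℕ<n (decode N x l)))
              relation : ζ Q * ζ (A zero) ≈ - ∑ (λ l → ζ (A (suc l)) * ζ (p l))
              relation = sym (begin
                - ∑ (λ l → ζ (A (suc l)) * ζ (p l)) ≈⟨ -‿cong (trans (∑-cong λ l → trans (*-congʳ (ζA l)) (solve 3 (λ a b p → (a :- b) :* p := a :* p :- b :* p) refl (ι (u l)) (ι (u′ l)) (ζ (p l)))) (∑-sub _ _)) ⟩
                - (∑ (λ l → ι (u l) * ζ (p l)) - ∑ (λ l → ι (u′ l) * ζ (p l))) ≈⟨ -‿cong (+-cong (trans (sym (ζ-s x)) (ζ-division x)) (-‿cong (trans (sym (ζ-s x′)) (ζ-division x′)))) ⟩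
                - ((ι (s x %ℤ Q) + ζ (s x /ℤ Q) * ζ Q) - (ι (s x′ %ℤ Q) + ζ (s x′ /ℤ Q) * ζ Q))
                  ≈⟨ -‿cong (+-congʳ (+-congʳ (reflexive (≡.cong ι rem≡)))) ⟩
                - ((ι (s x′ %ℤ Q) + ζ (s x /ℤ Q) * ζ Q) - (ι (s x′ %ℤ Q) + ζ (s x′ /ℤ Q) * ζ Q))
                  ≈⟨ solve 4 (λ r k k′ q → :- ((r :+ k :* q) :- (r :+ k′ :* q)) := q :* (k′ :- k)) refl (ι (s x′ %ℤ Q)) (ζ (s x /ℤ Q)) (ζ (s x′ /ℤ Q)) (ζ Q) ⟩
                ζ Q * (ζ (s x′ /ℤ Q) - ζ (s x /ℤ Q)) ≈⟨ *-congˡ (ζ-sub (s x′ /ℤ Q) (s x /ℤ Q)) ⟨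
                ζ Q * ζ (A zero) ∎)
                where
                open ≈R
                rem≡ : s x %ℤ Q ≡ s x′ %ℤ Q
                rem≡ = ≡.trans (≡.sym (Fin.toℕ-fromℕ< (remainder< (s x) Q))) (≡.trans (≡.cong Fin.toℕ same) (Fin.toℕ-fromℕ< (remainder< (s x′) Q)))
              val : Carrier
              val = ∣ eval (toAff A) y ∣ᴿ
              q·val≤ : ι q * val ≤ ι d * bi ^ (V ℕ.+ 2)
              q·val≤ = ≤-respˡ (trans (abs-cong (sym (∑-neg-eval (λ l → ζ (A (suc l))) (λ l → ζ (p l)) (ζ Q) y relation))) (trans (abs-* _ _) (*-congʳ (abs-ζ Q)))) (abs-∑-≤ term)
                where
                term : ∀ l → ∣ ζ (A (suc l)) * (ζ Q * y l - ζ (p l)) ∣ᴿ ≤ bi ^ (V ℕ.+ 2)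
                term l = classically (Pos l) pos λ ¬pos → ≤-respˡ (sym (abs-0 (trans (*-congʳ (null ¬pos)) (zeroˡ _)))) (^-nonNeg (V ℕ.+ 2) (<⇒≤ 0<bi))
                  where
                  null : ¬ Pos l → ζ (A (suc l)) ≈ 0#
                  null ¬pos = trans (reflexive (≡.cong ζ (ζ-<1⇒≡0 _ (<-resp refl (trans (^-congˡ t₁ (Λ-null l ¬pos)) (1^n t₁)) (A< l))))) ζ-0
                  pos : Pos l → ∣ ζ (A (suc l)) * (ζ Q * y l - ζ (p l)) ∣ᴿ ≤ bi ^ (V ℕ.+ 2)
                  pos pl = *-cancelʳ-≤ (^-pos (V ℕ.+ 2) 0<b) (≤-trans (*-monoʳ-≤ (^-nonNeg (V ℕ.+ 2) (<⇒≤ 0<b)) (≤-trans (≈⇒≤ (trans (abs-* _ _) (*-comm _ _)))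
                      (*-monoˡ-≤ (abs-nonNeg _) (≤-trans (<⇒≤ (A< l)) (^-monoʳ-≤ (1≤Λ l) (proj₁ (proj₂ level)))))))
                    (≤-respʳ (sym (trans (*-comm _ _) (b^n*bi^n (V ℕ.+ 2)))) (near l pl)))
              small : val * b ^ (t₁ ℕ.+ V) < 1#
              -- The value is at most d b^(-V-2)/|Q|, and b^(t₁ + V) ≤ |Q| b^(V + 1); what remains
              -- is d/b < 1.
              small = ≤-<-trans (begin
                val * b ^ (suc t₀ ℕ.+ V)                    ≈⟨ *-congˡ (trans (reflexive (≡.cong (b ^_) (≡.sym (ℕ.+-suc t₀ V)))) (^-homo-* b t₀ (suc V))) ⟩
                val * (b ^ t₀ * b ^ suc V)                  ≤⟨ *-monoˡ-≤ (abs-nonNeg _) (*-monoʳ-≤ (^-nonNeg (suc V) (<⇒≤ 0<b)) (proj₁ (proj₂ (proj₂ level)))) ⟩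
                val * (ι q * b ^ suc V)                     ≈⟨ solve 3 (λ e q b → e :* (q :* b) := q :* e :* b) refl val (ι q) (b ^ suc V) ⟩
                ι q * val * b ^ suc V                       ≤⟨ *-monoʳ-≤ (^-nonNeg (suc V) (<⇒≤ 0<b)) q·val≤ ⟩
                ι d * bi ^ (V ℕ.+ 2) * b ^ suc V           ≈⟨ trans (*-assoc _ _ _) (*-congˡ (trans (*-comm _ _) (trans (*-congˡ (reflexive (≡.cong (bi ^_) (ℕ.+-comm V 2)))) (P-shift 0 1 (suc V))))) ⟩
                ι d * P 0 1                                ≈⟨ *-congˡ (trans (*-identityˡ _) (*-identityʳ bi)) ⟩
                ι d * bi                                   ∎)
                (<-resp refl (⁻¹-inverseʳ b (0<⇒≉ 0<b)) (*-monoʳ-< 0<bi d<b))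
                where open ≤R

          transfer : ⊥
          transfer = collide (Fin.pigeonhole q<∏N residue)

  -- Inhomogeneous approximations near one epoch ball.

  module Approximations where
    open OrderedField
    open FiniteSums
    open LinearFormsPigeonhole
    open AffineSystems
    open WeightData
    open Transfer

    -- 1 + 1 + 2 + 2: the two candidate errors and the two shifts in `difference`, all multiplied by
    -- `X l * b`.
    six : Carrier
    six = 1# + 1# + (two + two)

    module CandidatesOver {d : ℕ} (W : Weights d) where
      open Weights W

      module Candidates (V D : ℕ) (8≤b : two + six ≤ b) (d<b : ι d < b)
        (θ : Fin d → Carrier → Carrier) (L : Carrier) (0≤L : 0# ≤ L) (L≤b : L ≤ b)
        (lipschitz : ∀ l x y → ∣ θ l x - θ l y ∣ᴿ ≤ L * ∣ x - y ∣ᴿ) (t : ℕ) (4≤t : 4 ℕ.≤ t) where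

        -- V + 2 is the quality that transference demands, and D is the time given to the task. Of
        -- the 5, one pays for `b^M≤`, two for |q| > b^(t-2), and two give the strict inequality 4 <
        -- b² in `together`. The epoch is late enough for the dual bounds and for |q′| times the
        -- coordinate differences to be at most 2/b in the units of `X`.
        c₂ epoch : ℕ
        c₂ = V ℕ.+ 2 ℕ.+ (D ℕ.+ 5)
        epoch = t ℕ.+ (M t ℕ.+ (V ℕ.+ 2))

        -- At time t only q with b^(t-2) < |q| ≤ b^(t-1) are considered.
        Candidate : Vector Carrier d → ℤ → (Fin d → ℤ) → Set
        Candidate y q p = b ^ t < ι ℤ.∣ q ∣ * (b * b) × ι ℤ.∣ q ∣ * b ≤ b ^ t
                        × (∀ l → Pos l → ∣ ζ q * y l - θ l (y l) - ζ (p l) ∣ᴿ * Λ l ^ t * b ^ c₂ ≤ 1#)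

        0≤b : 0# ≤ b
        0≤b = <⇒≤ 0<b

        1≤six : 1# ≤ six
        1≤six = lin (+-nonNeg 0≤1 (+-nonNeg (<⇒≤ 0<two) (<⇒≤ 0<two))) (solve 1 (λ t → con (+ 1) :+ con (+ 1) :+ t :+ con 0ℤ := con (+ 1) :+ (con (+ 1) :+ t)) refl (two + two))

        two<b : two < b
        two<b = <-≤-trans (≰⇒> λ q → <⇒≱ (<-≤-trans 0<1 1≤six) (lin q (solve 2 (λ t s → con 0ℤ :+ (t :+ s) := s :+ t) refl two six))) 8≤b

        six≤b : six ≤ b
        six≤b = ≤-trans (≤-respˡ (+-identityˡ six) (+-mono-≤ (<⇒≤ 0<two) ≤-refl)) 8≤b

        pos-top : Pos top
        pos-top = classically (Pos top) id λ ¬pos → ⊥-elim (<⇒≱ (≤-<-trans 1≤two two<b) (≤-trans ∏Λ-lower (≤-respʳ (trans (∏-const d 1#) (1^n d))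
          (∏-mono-≤ (λ l → <⇒≤ (0<Λ l)) (λ l → ≤-trans (Λ≤top l) (≈⇒≤ (Λ-null top ¬pos)))))))

        epoch-late : ∀ {t₁} → t₁ ℕ.≤ t → t₁ ℕ.+ V ℕ.+ M t₁ ℕ.≤ epoch
        epoch-late {t₁} p = ℕ.≤-trans (ℕ.+-mono-≤ (ℕ.+-monoˡ-≤ V p) (M-mono p)) (ℕ.≤-trans (ℕ.m≤m+n _ 2) (ℕ.≤-reflexive
          (N.solve 3 (λ t V m → t N.:+ V N.:+ m N.:+ N.con 2 N.:= t N.:+ (m N.:+ (V N.:+ N.con 2))) ≡.refl t V (M t))))

        Λ^t≤ : ∀ l → Λ l ^ t ≤ b ^ M t
        Λ^t≤ l = ≤-trans (^-monoˡ-≤ t (<⇒≤ (0<Λ l)) (Λ≤top l)) (<⇒≤ (Λ^t<b^M t))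

        0≤Λ^ : ∀ l → 0# ≤ Λ l ^ t
        0≤Λ^ l = ^-nonNeg t (<⇒≤ (0<Λ l))

        X : Fin d → Carrier
        X l = Λ l ^ t * b ^ (V ℕ.+ 2)

        0≤X : ∀ l → 0# ≤ X l
        0≤X l = *-nonNeg (0≤Λ^ l) (^-nonNeg (V ℕ.+ 2) 0≤b)

        small-value : ∀ {l a} → ∣ a ∣ᴿ * Λ l ^ t * b ^ c₂ ≤ 1# → ∣ a ∣ᴿ * X l * b ≤ 1#
        small-value {l} {a} p = ≤-trans (≤-trans (*-monoˡ-≤ (*-nonNeg (abs-nonNeg a) (0≤X l)) b≤) (≈⇒≤ (trans (solve 4 (λ a x y z → a :* (x :* y) :* z := a :* x :* (y :* z)) refl ∣ a ∣ᴿ (Λ l ^ t) (b ^ (V ℕ.+ 2)) (b ^ (D ℕ.+ 5)))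
          (*-congˡ (sym (^-homo-* b (V ℕ.+ 2) (D ℕ.+ 5))))))) p
          where
          b≤ : b ≤ b ^ (D ℕ.+ 5)
          b≤ = ≤-respˡ (*-identityʳ b) (^-monoʳ-≤ {b} {1} {D ℕ.+ 5} 1≤b (ℕ.≤-trans (s≤s z≤n) (ℕ.m≤n+m 5 D)))

        small-shift : ∀ {l c x} → 0# ≤ c → c * b ≤ b ^ t → ∣ x ∣ᴿ * b ^ epoch ≤ two → c * ∣ x ∣ᴿ * X l * b ≤ two
        small-shift {l} {c} {x} 0≤c cb≤ x≤ = ≤-trans (≈⇒≤ (solve 4 (λ c x X b → c :* x :* X :* b := (c :* b) :* (x :* X)) refl c ∣ x ∣ᴿ (X l) b))
          (≤-trans (*-mono-≤ (*-nonNeg (abs-nonNeg x) (0≤X l)) (^-nonNeg t 0≤b) cb≤ (*-monoˡ-≤ (abs-nonNeg x) (≤-trans (*-monoʳ-≤ (^-nonNeg (V ℕ.+ 2) 0≤b) (Λ^t≤ l)) (≈⇒≤ (sym (^-homo-* b (M t) (V ℕ.+ 2)))))))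
          (≤-trans (≈⇒≤ (trans (solve 3 (λ t x e → t :* (x :* e) := x :* (t :* e)) refl (b ^ t) ∣ x ∣ᴿ (b ^ (M t ℕ.+ (V ℕ.+ 2)))) (*-congˡ (sym (^-homo-* b t (M t ℕ.+ (V ℕ.+ 2))))))) x≤))

        Lb≤ : L * b ≤ b ^ t
        Lb≤ = ≤-trans (*-monoʳ-≤ 0≤b L≤b) (≤-respˡ (*-congˡ (*-identityʳ b)) (^-monoʳ-≤ {b} {2} {t} 1≤b (ℕ.≤-trans (s≤s (s≤s z≤n)) 4≤t)))

        module _ {y y′ : Vector Carrier d} {q q′ : ℤ} {p p′ : Fin d → ℤ}
          (dual : ∀ t₁ → t₁ ℕ.≤ t → ∀ a → (∃[ i ] a i ≢ 0ℤ) → (∀ l → ∣ ζ (a (suc l)) ∣ᴿ < Λ l ^ t₁) → ¬ (∣ eval (toAff a) y ∣ᴿ * b ^ (t₁ ℕ.+ V) < 1#))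
          (close : ∀ l → ∣ y l - y′ l ∣ᴿ * b ^ epoch ≤ two) (cand : Candidate y q p) (cand′ : Candidate y′ q′ p′) where

          private
            r r′ : Fin d → Carrier
            r l = ζ q * y l - θ l (y l) - ζ (p l)
            r′ l = ζ q′ * y′ l - θ l (y′ l) - ζ (p′ l)

          -- Subtracting two inhomogeneous approximations leaves a homogeneous one with multiplier q
          -- - q′; the Lipschitz condition controls what is left of θ.
          difference : ∀ l → Pos l → ∣ ζ (q ℤ.- q′) * y l - ζ (p l ℤ.- p′ l) ∣ᴿ * Λ l ^ t * b ^ (V ℕ.+ 2) ≤ 1#
          difference l pl = *-cancelʳ-≤ 0<b (≤-trans (≤-trans (*-monoʳ-≤ 0≤b (≤-trans (≈⇒≤ (*-assoc _ _ _)) (*-monoʳ-≤ (0≤X l) bound))) (≤-trans (≈⇒≤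
              (solve 6 (λ x y z w X b → (x :+ y :+ (z :+ w)) :* X :* b := x :* X :* b :+ y :* X :* b :+ (z :* X :* b :+ w :* X :* b)) refl ∣ r l ∣ᴿ ∣ r′ l ∣ᴿ (ι ℤ.∣ q′ ∣ * ∣ y l - y′ l ∣ᴿ) (L * ∣ y l - y′ l ∣ᴿ) (X l) b))
              (+-mono-≤ (+-mono-≤ (small-value {l} {r l} (proj₂ (proj₂ cand) l pl)) (small-value {l} {r′ l} (proj₂ (proj₂ cand′) l pl)))
                (+-mono-≤ (small-shift {l} (0≤ι ℤ.∣ q′ ∣) (proj₁ (proj₂ cand′)) (close l)) (small-shift {l} 0≤L Lb≤ (close l))))))
            (≤-respʳ (sym (*-identityˡ b)) six≤b))
            where
            bound : ∣ ζ (q ℤ.- q′) * y l - ζ (p l ℤ.- p′ l) ∣ᴿ ≤ ∣ r l ∣ᴿ + ∣ r′ l ∣ᴿ + (ι ℤ.∣ q′ ∣ * ∣ y l - y′ l ∣ᴿ + L * ∣ y l - y′ l ∣ᴿ)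
            bound = ≤-trans (≈⇒≤ (abs-cong (trans (+-cong (*-congʳ (ζ-sub q q′)) (-‿cong (ζ-sub (p l) (p′ l))))
                (solve 8 (λ q q′ y y′ th th′ p p′ → (q :- q′) :* y :- (p :- p′) := ((q :* y :- th :- p) :- (q′ :* y′ :- th′ :- p′)) :+ (:- (q′ :* (y :- y′)) :+ (th :- th′))) refl
                  (ζ q) (ζ q′) (y l) (y′ l) (θ l (y l)) (θ l (y′ l)) (ζ (p l)) (ζ (p′ l))))))
              (≤-trans (abs-+ _ _) (+-mono-≤ (≤-trans (abs-+ _ _) (+-mono-≤ ≤-refl (≈⇒≤ (abs-neg _))))
                (≤-trans (abs-+ _ _) (+-mono-≤ (≈⇒≤ (trans (abs-neg _) (trans (abs-* _ _) (*-congʳ (abs-ζ q′))))) (lipschitz l (y l) (y′ l))))))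

          -- |q - q′| ≤ 2b^(t-1) < b^t, so a nonzero difference would contradict transference.
          same-q : q ≡ q′
          same-q = classically (q ≡ q′) id λ q≢q′ → ⊥-elim (TransferenceOver.Transference.transfer W V d<b y t dual (q ℤ.- q′) (λ l → p l ℤ.- p′ l)
              (λ e → q≢q′ (ℤ.i-j≡0⇒i≡j q q′ e)) D< difference)
            where
            D< : ι ℤ.∣ q ℤ.- q′ ∣ < b ^ t
            D< = ≰⇒> λ le → <⇒≱ (*-monoʳ-< (^-pos t 0<b) two<b) (≤-trans (≤-respˡ (*-comm _ _) (*-monoʳ-≤ 0≤b le)) (≤-trans (*-monoʳ-≤ 0≤b sum≤)
              (≤-trans (≈⇒≤ (distribʳ b _ _)) (≤-trans (+-mono-≤ (proj₁ (proj₂ cand)) (proj₁ (proj₂ cand′))) (≈⇒≤ (solve 1 (λ x → x :+ x := (con (+ 1) :+ con (+ 1)) :* x) refl (b ^ t)))))))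
              where
              sum≤ : ι ℤ.∣ q ℤ.- q′ ∣ ≤ ι ℤ.∣ q ∣ + ι ℤ.∣ q′ ∣
              sum≤ = ≤-resp (abs-ζ (q ℤ.- q′)) (+-cong (abs-ζ q) (abs-ζ q′)) (≤-trans (≈⇒≤ (abs-cong (ζ-sub q q′))) (≤-trans (abs-+ _ _) (+-mono-≤ ≤-refl (≈⇒≤ (abs-neg _)))))

          q-q′≈0 : ζ (q ℤ.- q′) ≈ 0#
          q-q′≈0 = trans (reflexive (≡.cong ζ (ℤ.i≡j⇒i-j≡0 {q} {q′} same-q))) ζ-0

          same-p : ∀ l → Pos l → p l ≡ p′ l
          same-p l pl = ℤ.i-j≡0⇒i≡j (p l) (p′ l) (ζ-<1⇒≡0 _ (≰⇒> λ ge → <⇒≱ 1<b² (large ge)))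
            where
            b≤b² : b ≤ b * b
            b≤b² = x≤x*y 0≤b 1≤b
            1<b² : 1# < b * b
            1<b² = <-≤-trans (≤-<-trans 1≤two two<b) b≤b²
            b²≤ : b * b ≤ b ^ (V ℕ.+ 2)
            b²≤ = ≤-respˡ (*-congˡ (*-identityʳ b)) (^-monoʳ-≤ {b} {2} {V ℕ.+ 2} 1≤b (ℕ.m≤n+m 2 V))
            pdiff : Carrier
            pdiff = ∣ ζ (p l ℤ.- p′ l) ∣ᴿ
            bound : pdiff * X l ≤ 1#
            bound = ≤-respˡ (trans (*-assoc _ _ _) (*-congʳ (trans (abs-cong (trans (+-congʳ (trans (*-congʳ q-q′≈0) (zeroˡ _))) (+-identityˡ _))) (abs-neg _)))) (difference l pl)
            large : 1# ≤ pdiff → b * b ≤ 1#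
            large ge = ≤-trans b²≤ (≤-trans (≤-respˡ (*-identityˡ _) (*-monoʳ-≤ (^-nonNeg (V ℕ.+ 2) 0≤b) (1≤^ t (1≤Λ l))))
              (≤-trans (≤-respˡ (*-identityˡ _) (*-monoʳ-≤ (0≤X l) ge)) bound))

          -- Two candidates for the same t agree up to a distance that a task at their epoch excludes.
          together : ∣ y top - y′ top ∣ᴿ * b ^ (epoch ℕ.+ D) < 1#
          together = ≰⇒> λ ge → <⇒≱ 4<b² (≤-trans (≤-respˡ (*-identityˡ _) (*-monoʳ-≤ (*-nonNeg 0≤b 0≤b) ge)) final)
            where
            open ≤R
            Δ R Y K : Carrier
            Δ = ∣ y top - y′ top ∣ᴿ
            Y = b ^ (epoch ℕ.+ D)
            R = ∣ r top ∣ᴿ + ∣ r′ top ∣ᴿ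
            K = b ^ (V ℕ.+ 2) * b ^ D
            0≤Δ : 0# ≤ Δ
            0≤Δ = abs-nonNeg _
            0≤R : 0# ≤ R
            0≤R = +-nonNeg (abs-nonNeg _) (abs-nonNeg _)
            0≤K : 0# ≤ K
            0≤K = *-nonNeg (^-nonNeg (V ℕ.+ 2) 0≤b) (^-nonNeg D 0≤b)
            4<b² : two * two < b * b
            4<b² = ≤-<-trans (*-monoˡ-≤ (<⇒≤ 0<two) (<⇒≤ two<b)) (*-monoʳ-< 0<b two<b)
            qΔ : ι ℤ.∣ q ∣ * Δ ≤ R + L * Δ
            qΔ = ≤-trans (≈⇒≤ (trans (*-congʳ (sym (abs-ζ q))) (trans (sym (abs-* _ _)) (abs-cong (trans
                (solve 6 (λ q y y′ th th′ p → q :* (y :- y′) := ((q :* y :- th :- p) :- (q :* y′ :- th′ :- p)) :+ (th :- th′)) refl (ζ q) (y top) (y′ top) (θ top (y top)) (θ top (y′ top)) (ζ (p top)))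
                (+-congʳ (+-congˡ (-‿cong (+-cong (+-congʳ (*-congʳ (reflexive (≡.cong ζ same-q)))) (-‿cong (reflexive (≡.cong ζ (same-p top pos-top)))))))))))))
              (≤-trans (abs-+ _ _) (+-mono-≤ (≤-trans (abs-+ _ _) (+-mono-≤ ≤-refl (≈⇒≤ (abs-neg _)))) (lipschitz top (y top) (y′ top))))
            btΔ : b ^ t * Δ ≤ two * (b * b * R)
            -- From b^t Δ ≤ b²|q|Δ ≤ b²(R + LΔ): the term with L is absorbed because 2Lb² ≤ b⁴ ≤
            -- b^t, which needs t ≥ 4.
            btΔ = lin (+-mono-≤ (+-mono-≤ (≤-trans (*-monoʳ-≤ 0≤Δ (<⇒≤ (proj₁ cand))) (≈⇒≤ (solve 3 (λ q b x → q :* b :* x := b :* (q :* x)) refl (ι ℤ.∣ q ∣) (b * b) Δ)))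
                  (≤-trans (*-monoʳ-≤ 0≤Δ (<⇒≤ (proj₁ cand))) (≈⇒≤ (solve 3 (λ q b x → q :* b :* x := b :* (q :* x)) refl (ι ℤ.∣ q ∣) (b * b) Δ))))
                (+-mono-≤ (*-monoˡ-≤ (*-nonNeg (<⇒≤ 0<two) (*-nonNeg 0≤b 0≤b)) qΔ) (≤-trans (≤-trans (≈⇒≤ (solve 3 (λ b l x → (con (+ 1) :+ con (+ 1)) :* (b :* b) :* (l :* x) := ((con (+ 1) :+ con (+ 1)) :* l) :* (b :* b) :* x) refl b L Δ)) (*-monoʳ-≤ 0≤Δ two-L)) ≤-refl)))
              (solve 6 (λ bt x q b l r → (con (+ 1) :+ con (+ 1)) :* (b :* b :* r) :+ (bt :* x :+ bt :* x :+ ((con (+ 1) :+ con (+ 1)) :* (b :* b) :* (q :* x) :+ (con (+ 1) :+ con (+ 1)) :* (b :* b) :* (l :* x)))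
                 := bt :* x :+ (b :* b :* (q :* x) :+ b :* b :* (q :* x) :+ ((con (+ 1) :+ con (+ 1)) :* (b :* b) :* (r :+ l :* x) :+ bt :* x))) refl (b ^ t) Δ (ι ℤ.∣ q ∣) b L R)
              where
              two-L : two * L * (b * b) ≤ b ^ t
              two-L = ≤-trans (*-monoʳ-≤ (*-nonNeg 0≤b 0≤b) (*-mono-≤ 0≤L 0≤b (<⇒≤ two<b) L≤b)) (≤-respˡ (solve 1 (λ b → b :* (b :* (b :* (b :* con (+ 1)))) := (b :* b) :* (b :* b)) refl b) (^-monoʳ-≤ {b} {4} {t} 1≤b 4≤t))
            RK : R * (b ^ M t * K) * (b * b * (b * b)) ≤ two
            RK = begin
              R * (b ^ M t * K) * (b * b * (b * b))           ≤⟨ *-monoʳ-≤ (*-nonNeg (*-nonNeg 0≤b 0≤b) (*-nonNeg 0≤b 0≤b)) (*-monoˡ-≤ 0≤R (*-monoʳ-≤ 0≤K (b^M≤ t))) ⟩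
              R * (b * Λ top ^ t * K) * (b * b * (b * b))     ≈⟨ solve 5 (λ r b l v d → r :* (b :* l :* (v :* d)) :* (b :* b :* (b :* b)) := r :* l :* (v :* (d :* (b :* (b :* (b :* (b :* (b :* con (+ 1))))))))) refl R b (Λ top ^ t) (b ^ (V ℕ.+ 2)) (b ^ D) ⟩
              R * Λ top ^ t * (b ^ (V ℕ.+ 2) * (b ^ D * b ^ 5)) ≈⟨ *-congˡ (trans (*-congˡ (sym (^-homo-* b D 5))) (sym (^-homo-* b (V ℕ.+ 2) (D ℕ.+ 5)))) ⟩
              R * Λ top ^ t * b ^ c₂                          ≈⟨ solve 4 (λ x y l b → (x :+ y) :* l :* b := x :* l :* b :+ y :* l :* b) refl ∣ r top ∣ᴿ ∣ r′ top ∣ᴿ (Λ top ^ t) (b ^ c₂) ⟩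
              ∣ r top ∣ᴿ * Λ top ^ t * b ^ c₂ + ∣ r′ top ∣ᴿ * Λ top ^ t * b ^ c₂ ≤⟨ +-mono-≤ (proj₂ (proj₂ cand) top pos-top) (proj₂ (proj₂ cand′) top pos-top) ⟩
              two ∎
            final : Δ * Y * (b * b) ≤ two * two
            final = begin
              Δ * b ^ (epoch ℕ.+ D) * (b * b)              ≈⟨ *-congʳ (*-congˡ (trans (^-homo-* b epoch D) (*-congʳ (trans (^-homo-* b t (M t ℕ.+ (V ℕ.+ 2))) (*-congˡ (^-homo-* b (M t) (V ℕ.+ 2))))))) ⟩
              Δ * (b ^ t * (b ^ M t * b ^ (V ℕ.+ 2)) * b ^ D) * (b * b)
                ≈⟨ solve 6 (λ x t m v d b → x :* (t :* (m :* v) :* d) :* (b :* b) := t :* x :* (m :* (v :* d) :* (b :* b))) refl Δ (b ^ t) (b ^ M t) (b ^ (V ℕ.+ 2)) (b ^ D) b ⟩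
              b ^ t * Δ * (b ^ M t * K * (b * b))          ≤⟨ *-monoʳ-≤ (*-nonNeg (*-nonNeg (^-nonNeg (M t) 0≤b) 0≤K) (*-nonNeg 0≤b 0≤b)) btΔ ⟩
              two * (b * b * R) * (b ^ M t * K * (b * b))  ≈⟨ solve 5 (λ t b r m k → t :* (b :* b :* r) :* (m :* k :* (b :* b)) := t :* (r :* (m :* k) :* (b :* b :* (b :* b)))) refl two b R (b ^ M t) K ⟩
              two * (R * (b ^ M t * K) * (b * b * (b * b))) ≤⟨ *-monoˡ-≤ (<⇒≤ 0<two) RK ⟩
              two * two ∎

  -- The task lists: their weight and what they exclude.

  module TaskLists where
    open OrderedField
    open FiniteSums
    open LinearFormsPigeonhole
    open AffineSystems
    open WeightData
    open DualBounds
    open PotentialMethod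
    open BallGeometry
    open EpochGame
    open Approximations

    -- The task list takes its witness of a pivot from excluded middle, whereas `avoid` is given
    -- one; both must lead to the same `k*`.
    argmaxOver-irrelevant : ∀ {n} (i j : Fin n) (f : Fin n → Carrier) → argmaxOver i f ≡ argmaxOver j f
    argmaxOver-irrelevant {suc n} i j f = ≡.refl

    tabulateUpTo : ∀ {A : Set} → ℕ → (ℕ → List A) → List A
    tabulateUpTo zero f = []
    tabulateUpTo (suc N) f = f N ++ tabulateUpTo N f

    ∈-tabulateUpTo : ∀ {A : Set} {x : A} N f i → i ℕ.< N → x ∈ˡ f i → x ∈ˡ tabulateUpTo N f
    ∈-tabulateUpTo {x = x} (suc N) f i (s≤s i≤N) p = go (ℕ.m≤n⇒m<n∨m≡n i≤N)
      where
      go : i ℕ.< N ⊎ i ≡ N → x ∈ˡ f N ++ tabulateUpTo N f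
      go (inj₁ i<N) = ∈-++⁺ʳ (f N) (∈-tabulateUpTo N f i i<N p)
      go (inj₂ ≡.refl) = ∈-++⁺ˡ p

    ∈-tabulateUpTo⁻ : ∀ {A : Set} {x : A} N f → x ∈ˡ tabulateUpTo N f → ∃[ i ] x ∈ˡ f i
    ∈-tabulateUpTo⁻ {x = x} (suc N) f p = go (∈-++⁻ (f N) p)
      where
      go : x ∈ˡ f N ⊎ x ∈ˡ tabulateUpTo N f → ∃[ i ] x ∈ˡ f i
      go (inj₁ q) = N , q
      go (inj₂ q) = ∈-tabulateUpTo⁻ N f q

    module GeneratorOver {d : ℕ} (W : Weights d) where
      open Weights W

      module Generator (β : Carrier) (0<β : 0# < β) (1≤bβ : 1# ≤ b * β)
        (b-big : spreadConstant d (two * (β * β) ⁻¹) * (two * ι (suc d)) < β * β * b)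
        (8≤b : two + six ≤ b) (d<b : ι d < b) (θ′ : Fin d → Carrier → Carrier) (L : Carrier) (0≤L : 0# ≤ L) (L≤b : L ≤ b)
        (lipschitz : ∀ l x y → ∣ θ′ l x - θ′ l y ∣ᴿ ≤ L * ∣ x - y ∣ᴿ) (V₁ D e₀ : ℕ) where

        open Geometry d
        open Potential d 1≤d b 1≤b (β * β) (*-pos 0<β 0<β) b-big public
        open Play d 1≤d b 1≤b β 0<β 1≤bβ b-big e₀ public

        -- A multiple of `period`, so that n = v / period is at least V₁.
        V : ℕ
        V = V₁ ℕ.* period

        Region : Set₁
        Region = Pred (Vector Carrier d) 0ℓ

        normalised : Aff {d} → Carrier → Aff {d}
        normalised a g i = a i * g ⁻¹

        coverTask : ∀ t s n i (R : Region) → Dec (Fin (Cover.m V t s n i R)) → List Task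
        coverTask t s n i R (yes k₀) = (normalised (Cover.e V t s n i R (Cover.k* V t s n i R k₀)) (Cover.gradSize V t s n i R (Cover.k* V t s n i R k₀)) , n) ∷ []
        coverTask t s n i R (no _) = []

        -- Enumerating by n, r and i rather than by (t, s) makes the count of tasks with deadline n
        -- visible.
        Index : ℕ → ℕ → ℕ → ℕ → Set
        Index e n r i = ∃[ t ] ∃[ s ] (s ℕ.≤ M t × M t ℕ.∸ s ℕ.+ V ≡ r ℕ.+ n ℕ.* period × e ℕ.+ kk n (suc i) ≡ t ℕ.+ V ℕ.+ s)

        indexTask : ∀ e n r i (R : Region) → Dec (Index e n r i) → List Task
        indexTask e n r i R (yes (t , s , _)) = coverTask t s n i R em
        indexTask e n r i R (no _) = []

        block : ℕ → Region → ℕ → List Task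
        block e R n = tabulateUpTo period λ r → tabulateUpTo (suc d) λ i → indexTask e n r i R em

        -- The cutoff makes the list finite and loses nothing, since n is at most 2 + 2e at epoch e.
        dualTasks : ℕ → Region → List Task
        dualTasks e R = tabulateUpTo (3 ℕ.+ 2 ℕ.* e) λ i → block e R (V₁ ℕ.+ i)

        module Cd (t : ℕ) (4≤t : 4 ℕ.≤ t) = CandidatesOver.Candidates W V D 8≤b d<b θ′ L 0≤L L≤b lipschitz t 4≤t

        CandidateAt : ℕ → Region → Set
        CandidateAt e R = ∃[ t ] Σ[ 4≤t ∈ 4 ℕ.≤ t ] (Cd.epoch t 4≤t ≡ e × ∃[ y ] (R y × ∃[ q ] ∃[ p ] Cd.Candidate t 4≤t y q p))

        coordinate : Fin d → Carrier → Aff {d}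
        coordinate l c zero = - c
        coordinate l c (suc i) with i Fin.≟ l
        ... | yes _ = 1#
        ... | no _ = 0#

        -- One task suffices: by `together`, all candidate points for this time in the ball have a
        -- `top` coordinate within b^(-epoch-D) of the one that was found.
        candidateTask : ∀ e R → Dec (CandidateAt e R) → List Task
        candidateTask e R (yes (t , _ , _ , y , _)) = (coordinate top (y top) , D) ∷ []
        candidateTask e R (no _) = []

        gen : ℕ → Ball → List Task
        gen k B = dualTasks (e₀ ℕ.+ k) ⟦ B ⟧ ++ candidateTask (e₀ ℕ.+ k) ⟦ B ⟧ em

        coordinate-l : ∀ l c → coordinate l c (suc l) ≈ 1#
        coordinate-l l c with l Fin.≟ l
        ... | yes _ = refl
        ... | no ¬e = ⊥-elim (¬e ≡.refl)

        coordinate-i : ∀ l c i → i ≢ l → coordinate l c (suc i) ≈ 0#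
        coordinate-i l c i i≢l with i Fin.≟ l
        ... | yes e = ⊥-elim (i≢l e)
        ... | no _ = refl

        eval-coordinate : ∀ l c y → eval (coordinate l c) y ≈ y l - c
        eval-coordinate l c y = trans (+-congˡ (trans (∑-single _ l λ i i≢l → trans (*-congʳ (coordinate-i l c i i≢l)) (zeroˡ _)) (trans (*-congʳ (coordinate-l l c)) (*-identityˡ _)))) (+-comm _ _)

        steep-coordinate : ∀ l c → Steep (coordinate l c)
        steep-coordinate l c = ≤1 , l , ≈⇒≤ (sym (trans (abs-cong (coordinate-l l c)) (abs-of-nonNeg 0≤1)))
          where
          ≤1 : ∀ i → ∣ coordinate l c (suc i) ∣ᴿ ≤ 1#
          ≤1 i = classically (i ≡ l) (λ { ≡.refl → ≈⇒≤ (trans (abs-cong (coordinate-l l c)) (abs-of-nonNeg 0≤1)) }) (λ ne → ≤-respˡ (sym (abs-0 (coordinate-i l c i ne))) 0≤1)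

        0<gradSize : ∀ t s n i R k → 0# < Cover.gradSize V t s n i R k
        0<gradSize t s n i R k = <-≤-trans 0<1 (≤-trans (≈⇒≤ (sym (trans (abs-cong (Cover.pivot-1 V t s n i R k)) (abs-of-nonNeg 0≤1)))) (Cover.≤gradSize V t s n i R k (Cover.J V t s n i R k)))

        steep-cover : ∀ t s n i R k → Steep (normalised (Cover.e V t s n i R k) (Cover.gradSize V t s n i R k))
        steep-cover t s n i R k = (λ l → *-cancelʳ-≤ 0<γ (≤-resp (sym (value l)) (sym (*-identityˡ γ)) (Cover.≤gradSize V t s n i R k l))) ,
            l* , *-cancelʳ-≤ 0<γ (≤-resp (sym (*-identityˡ γ)) (sym (value l*)) ≤-refl)
          where
          γ : Carrier
          γ = Cover.gradSize V t s n i R k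
          a : Aff {d}
          a = Cover.e V t s n i R k
          l* : Fin d
          l* = proj₁ (argmaxOver top (λ l → ∣ a (suc l) ∣ᴿ))
          0<γ : 0# < γ
          0<γ = 0<gradSize t s n i R k
          value : ∀ l → ∣ a (suc l) * γ ⁻¹ ∣ᴿ * γ ≈ ∣ a (suc l) ∣ᴿ
          value l = trans (*-congˡ (sym (abs-of-nonNeg (<⇒≤ 0<γ)))) (trans (sym (abs-* _ _)) (abs-cong (/-cancel (a (suc l)) (0<⇒≉ 0<γ))))

        coverTask-steep : ∀ t s n i R q {T r} → (T , r) ∈ˡ coverTask t s n i R q → Steep T
        coverTask-steep t s n i R (yes k₀) (here ≡.refl) = steep-cover t s n i R (Cover.k* V t s n i R k₀)

        indexTask-steep : ∀ e n r i R q {T D} → (T , D) ∈ˡ indexTask e n r i R q → Steep T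
        indexTask-steep e n r i R (yes (t , s , _)) {T} {D} p = coverTask-steep t s n i R em {T} {D} p

        candidateTask-steep : ∀ e R q {T r} → (T , r) ∈ˡ candidateTask e R q → Steep T
        candidateTask-steep e R (yes (t , _ , _ , y , _)) (here ≡.refl) = steep-coordinate top (y top)

        gen-steep : ∀ k B → AllSteep (gen k B)
        gen-steep k B {T} {r} p = split (∈-++⁻ (dualTasks e R) p)
          where
          e : ℕ
          e = e₀ ℕ.+ k
          R : Region
          R = ⟦ B ⟧
          inner : ∀ n j → ∃[ i ] ((T , r) ∈ˡ indexTask e n j i R em) → Steep T
          inner n j (i , q) = indexTask-steep e n j i R em {T} {r} q
          middle : ∀ n → ∃[ j ] ((T , r) ∈ˡ tabulateUpTo (suc d) (λ i → indexTask e n j i R em)) → Steep T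
          middle n (j , q) = inner n j (∈-tabulateUpTo⁻ (suc d) (λ i → indexTask e n j i R em) q)
          outer : ∃[ i ] ((T , r) ∈ˡ block e R (V₁ ℕ.+ i)) → Steep T
          outer (i , q) = middle (V₁ ℕ.+ i) (∈-tabulateUpTo⁻ period (λ j → tabulateUpTo (suc d) (λ i′ → indexTask e (V₁ ℕ.+ i) j i′ R em)) q)
          split : (T , r) ∈ˡ dualTasks e R ⊎ (T , r) ∈ˡ candidateTask e R em → Steep T
          split (inj₁ q) = outer (∈-tabulateUpTo⁻ (3 ℕ.+ 2 ℕ.* e) (λ i → block e R (V₁ ℕ.+ i)) q)
          split (inj₂ q) = candidateTask-steep e R em {T} {r} q

        weight-tab : ∀ N f {c} → (∀ i → weight (f i) ≤ c) → weight (tabulateUpTo N f) ≤ ι N * c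
        weight-tab zero f p = ≈⇒≤ (sym (trans (*-congʳ ι-0) (zeroˡ _)))
        weight-tab (suc N) f {c} p = ≤-respˡ (sym (weight-++ (f N) _)) (≤-respʳ (sym (trans (*-congʳ (ι-suc N)) (trans (distribʳ c 1# (ι N)) (+-congʳ (*-identityˡ c))))) (+-mono-≤ (p N) (weight-tab N f p)))

        -- The geometric series, with τ = 1 - u.
        weight-geometric : ∀ N f {c} → 0# ≤ c → (∀ i → weight (f i) ≤ u ^ i * c) → τ * weight (tabulateUpTo N f) + u ^ N * c ≤ c
        weight-geometric zero f {c} _ p = ≈⇒≤ (trans (+-cong (zeroʳ τ) (*-identityˡ c)) (+-identityˡ c))
        weight-geometric (suc N) f {c} 0≤c p = ≤-trans (≤-respˡ (+-congʳ (*-congˡ (sym (weight-++ (f N) _)))) (+-mono-≤ (*-monoˡ-≤ (<⇒≤ 0<τ) (+-mono-≤ (p N) ≤-refl)) ≤-refl))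
          (≤-trans (≈⇒≤ (trans (solve 5 (λ t u x c w → t :* (x :* c :+ w) :+ u :* x :* c := t :* w :+ (u :+ t) :* (x :* c)) refl τ u (u ^ N) c (weight (tabulateUpTo N f)))
            (+-congˡ (trans (*-congʳ u+τ) (*-identityˡ _))))) (weight-geometric N f 0≤c p))

        0≤u^ : ∀ n → 0# ≤ u ^ n
        0≤u^ n = ^-nonNeg n (<⇒≤ 0<u)

        coverTask-light : ∀ t s n i R q → weight (coverTask t s n i R q) ≤ u ^ n
        coverTask-light t s n i R (yes _) = ≈⇒≤ (+-identityʳ _)
        coverTask-light t s n i R (no _) = 0≤u^ n

        indexTask-light : ∀ e n r i R q → weight (indexTask e n r i R q) ≤ u ^ n
        indexTask-light e n r i R (yes (t , s , _)) = coverTask-light t s n i R em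
        indexTask-light e n r i R (no _) = 0≤u^ n

        candidateTask-light : ∀ e R q → weight (candidateTask e R q) ≤ u ^ D
        candidateTask-light e R (yes _) = ≈⇒≤ (+-identityʳ _)
        candidateTask-light e R (no _) = 0≤u^ D

        blockConstant : Carrier
        blockConstant = ι period * (ι (suc d) * u ^ V₁)

        dualTasks-light : ∀ e R → τ * weight (dualTasks e R) ≤ blockConstant
        dualTasks-light e R = ≤-trans (≤-respˡ (+-identityʳ _) (+-mono-≤ ≤-refl (*-nonNeg (0≤u^ (3 ℕ.+ 2 ℕ.* e)) 0≤c))) (weight-geometric (3 ℕ.+ 2 ℕ.* e) (λ i → block e R (V₁ ℕ.+ i)) 0≤c light)
          where
          0≤c : 0# ≤ blockConstant
          0≤c = *-nonNeg (0≤ι period) (*-nonNeg (0≤ι (suc d)) (0≤u^ V₁))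
          light : ∀ i → weight (block e R (V₁ ℕ.+ i)) ≤ u ^ i * blockConstant
          light i = ≤-trans (weight-tab period (λ r → tabulateUpTo (suc d) λ j → indexTask e (V₁ ℕ.+ i) r j R em) λ r → weight-tab (suc d) (λ j → indexTask e (V₁ ℕ.+ i) r j R em) λ j → indexTask-light e (V₁ ℕ.+ i) r j R em)
            (≈⇒≤ (trans (*-congˡ (*-congˡ (^-homo-* u V₁ i))) (solve 4 (λ p d v i → p :* (d :* (v :* i)) := i :* (p :* (d :* v))) refl (ι period) (ι (suc d)) (u ^ V₁) (u ^ i))))

        Light : Set
        Light = Σ[ hν ∈ Carrier ] (hν + hν ≤ ν × blockConstant ≤ τ * hν × u ^ D ≤ hν)

        gen-light : Light → ∀ k B → weight (gen k B) ≤ ν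
        gen-light (hν , hh , p , q) k B = ≤-respˡ (sym (weight-++ (dualTasks (e₀ ℕ.+ k) ⟦ B ⟧) _)) (≤-trans (+-mono-≤ (*-cancelˡ-≤ 0<τ (≤-trans (dualTasks-light (e₀ ℕ.+ k) ⟦ B ⟧) p))
          (≤-trans (candidateTask-light (e₀ ℕ.+ k) ⟦ B ⟧ em) q)) hh)

        module Winning (light : Light) (1≤V₁ : 1 ℕ.≤ V₁) (2e₀≤V₁ : 2 ℕ.* e₀ ℕ.≤ V₁) where

          open Tasks gen gen-steep (gen-light light)

          winningStrategy : Strategy (HyperplaneMove β)
          winningStrategy = taskStrategy

          V₁≤V : V₁ ℕ.≤ V
          V₁≤V = ℕ.m≤m*n V₁ period

          period≤V : period ℕ.≤ V
          period≤V = ℕ.m≤n*m period V₁ ⦃ ℕ.>-nonZero 1≤V₁ ⦄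

          2e₀≤V : 2 ℕ.* e₀ ℕ.≤ V
          2e₀≤V = ℕ.≤-trans 2e₀≤V₁ V₁≤V

          e₀≤V : e₀ ℕ.≤ V
          e₀≤V = ℕ.≤-trans (ℕ.m≤n*m e₀ 2) 2e₀≤V

          t+M-injective : ∀ {t t′} → t ℕ.+ M t ≡ t′ ℕ.+ M t′ → t ≡ t′
          t+M-injective {t} {t′} eq = go (ℕ.<-cmp t t′)
            where
            apart : ∀ {t t′} → t ℕ.< t′ → t ℕ.+ M t ≢ t′ ℕ.+ M t′
            apart t<t′ e = ℕ.<⇒≢ (ℕ.+-mono-<-≤ t<t′ (M-mono (ℕ.<⇒≤ t<t′))) e
            go : Tri (t ℕ.< t′) (t ≡ t′) (t′ ℕ.< t) → t ≡ t′
            go (tri< lt _ _) = ⊥-elim (apart lt eq)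
            go (tri≈ _ e _) = e
            go (tri> _ _ gt) = ⊥-elim (apart gt (≡.sym eq))

          -- The two equations add up to a formula for t + M t, which is strictly increasing in t.
          index-unique : ∀ {e n r i t s t′ s′} → s ℕ.≤ M t → M t ℕ.∸ s ℕ.+ V ≡ r ℕ.+ n ℕ.* period → e ℕ.+ kk n (suc i) ≡ t ℕ.+ V ℕ.+ s →
                         s′ ℕ.≤ M t′ → M t′ ℕ.∸ s′ ℕ.+ V ≡ r ℕ.+ n ℕ.* period → e ℕ.+ kk n (suc i) ≡ t′ ℕ.+ V ℕ.+ s′ → t ≡ t′ × s ≡ s′
          index-unique {e} {n} {r} {i} {t} {s} {t′} {s′} p q o p′ q′ o′ = t≡ , s≡ t≡
            where
            total : ∀ t s → s ℕ.≤ M t → M t ℕ.∸ s ℕ.+ V ≡ r ℕ.+ n ℕ.* period → e ℕ.+ kk n (suc i) ≡ t ℕ.+ V ℕ.+ s →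
                    t ℕ.+ M t ℕ.+ (V ℕ.+ V) ≡ (e ℕ.+ kk n (suc i)) ℕ.+ (r ℕ.+ n ℕ.* period)
            total t s p q o = ≡.trans (≡.trans (≡.cong (λ m → t ℕ.+ m ℕ.+ (V ℕ.+ V)) (≡.sym (ℕ.m∸n+n≡m p)))
              (N.solve 4 (λ t m s V → t N.:+ (m N.:+ s) N.:+ (V N.:+ V) N.:= (t N.:+ V N.:+ s) N.:+ (m N.:+ V)) ≡.refl t (M t ℕ.∸ s) s V)) (≡.sym (≡.cong₂ ℕ._+_ o (≡.sym q)))
            t≡ : t ≡ t′
            t≡ = t+M-injective (ℕ.+-cancelʳ-≡ (V ℕ.+ V) _ _ (≡.trans (total t s p q o) (≡.sym (total t′ s′ p′ q′ o′))))
            s≡ : t ≡ t′ → s ≡ s′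
            s≡ ≡.refl = ℕ.+-cancelˡ-≡ (t ℕ.+ V) s s′ (≡.trans (≡.sym o) o′)

          module Won (B : ℕ → Ball) (play : HyperplanePlay winningStrategy B)
            (shrinking : ∀ x → 0# < x → ∃[ n ] radius (B n) ≤ x) (start : 1# < radius (B 0) * b ^ e₀) where

            open Outcome B play shrinking start public

            In : ℕ → Pred (Vector Carrier d) 0ℓ
            In e = ⟦ C (e ℕ.∸ e₀) ⟧

            x : ℕ → Vector Carrier d
            x e = centre (C (e ℕ.∸ e₀))

            nested : ∀ {e e′} → e ℕ.≤ e′ → ∀ {y} → In e′ y → In e y
            nested p {y} = C-≤ (ℕ.∸-monoˡ-≤ e₀ p) {y}

            e₀+ : ∀ {e} → e₀ ℕ.≤ e → e₀ ℕ.+ (e ℕ.∸ e₀) ≡ e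
            e₀+ p = ℕ.m+[n∸m]≡n p

            close : ∀ e → e₀ ℕ.≤ e → ∀ y → In e y → ∀ l → ∣ x e l - y l ∣ᴿ * b ^ e ≤ 1#
            close e p y y∈ l = ≤-respˡ (*-congˡ (reflexive (≡.cong (b ^_) (e₀+ p)))) (near (e ℕ.∸ e₀) {y} y∈ l)

            generated : ∀ t s n i ep → s ℕ.≤ M t → n ≡ (M t ℕ.∸ s ℕ.+ V) / period → i ℕ.≤ d → ep ℕ.+ kk n (suc i) ≡ t ℕ.+ V ℕ.+ s →
              ∀ R k₀ → (normalised (Cover.e V t s n i R (Cover.k* V t s n i R k₀)) (Cover.gradSize V t s n i R (Cover.k* V t s n i R k₀)) , n) ∈ˡ dualTasks ep R
            generated t s n i ep s≤M n≡ i≤d ep≡ R k₀ = ∈-tabulateUpTo (3 ℕ.+ 2 ℕ.* ep) (λ i → block ep R (V₁ ℕ.+ i)) (n ℕ.∸ V₁) n∸V₁<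
                (≡.subst (λ n′ → task ∈ˡ block ep R n′) (≡.sym (ℕ.m+[n∸m]≡n V₁≤n))
                  (∈-tabulateUpTo period (λ r → tabulateUpTo (suc d) λ i → indexTask ep n r i R em) r (m%n<n v period)
                    (∈-tabulateUpTo (suc d) (λ i → indexTask ep n r i R em) i (s≤s i≤d) (member em))))
              where
              task : Task
              task = normalised (Cover.e V t s n i R (Cover.k* V t s n i R k₀)) (Cover.gradSize V t s n i R (Cover.k* V t s n i R k₀)) , n
              v r : ℕ
              v = M t ℕ.∸ s ℕ.+ V
              r = v % period
              v≡ : v ≡ r ℕ.+ n ℕ.* period
              v≡ = ≡.subst (λ n → v ≡ r ℕ.+ n ℕ.* period) (≡.sym n≡) (m≡m%n+[m/n]*n v period)
              V₁≤n : V₁ ℕ.≤ n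
              V₁≤n = ≡.subst₂ ℕ._≤_ (m*n/n≡m V₁ period) (≡.sym n≡) (/-monoˡ-≤ period (ℕ.m≤n+m V (M t ℕ.∸ s)))
              n*period≤v : n ℕ.* period ℕ.≤ v
              n*period≤v = ≡.subst (λ n → n ℕ.* period ℕ.≤ v) (≡.sym n≡) (m/n*n≤m v period)
              5kk≤v : 5 ℕ.* kk n (suc i) ℕ.≤ v
              5kk≤v = ℕ.≤-trans (ℕ.*-monoˡ-≤ (kk n (suc i)) (ℕ.m≤n⇒m≤1+n 5≤g)) (ℕ.≤-trans (ℕ.m≤n*m (zz n (suc i)) G) (ℕ.≤-trans (kk-mono n (s≤s (s≤s i≤d)))
                (ℕ.≤-trans (ℕ.≤-reflexive (kk-* n (suc (suc d)))) n*period≤v)))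
              v≤ : v ℕ.≤ suc (ep ℕ.+ kk n (suc i))
              v≤ = ℕ.≤-trans (ℕ.+-monoˡ-≤ V (ℕ.≤-trans (ℕ.m∸n≤m (M t) s) (M≤ t))) (s≤s (ℕ.≤-trans (ℕ.m≤m+n (t ℕ.+ V) s) (ℕ.≤-reflexive (≡.sym ep≡))))
              -- From 5 kk ≤ v and v ≤ 1 + ep + kk by eliminating kk.
              v≤2+2e : v ℕ.≤ 2 ℕ.+ 2 ℕ.* ep
              v≤2+2e = ℕ.*-cancelˡ-≤ 4 (linℕ′ (3 ℕ.+ 3 ℕ.* ep) (ℕ.+-mono-≤ 5kk≤v (ℕ.*-monoʳ-≤ 5 v≤))
                (N.solve 3 (λ v k e → N.con 4 N.:* (N.con 2 N.:+ N.con 2 N.:* e) N.:+ (N.con 5 N.:* k N.:+ N.con 5 N.:* v)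
                  N.:= N.con 3 N.:+ N.con 3 N.:* e N.:+ (N.con 4 N.:* v N.:+ (v N.:+ N.con 5 N.:* (N.con 1 N.:+ (e N.:+ k))))) ≡.refl v (kk n (suc i)) ep))
              n∸V₁< : n ℕ.∸ V₁ ℕ.< 3 ℕ.+ 2 ℕ.* ep
              n∸V₁< = s≤s (ℕ.≤-trans (ℕ.m∸n≤m n V₁) (ℕ.≤-trans (ℕ.m≤m*n n period) (ℕ.≤-trans n*period≤v v≤2+2e)))
              member : (q : Dec (Index ep n r i)) → task ∈ˡ indexTask ep n r i R q
              member (no ¬p) = ⊥-elim (¬p (t , s , s≤M , v≡ , ep≡))
              member (yes (t′ , s′ , p′ , q′ , o′)) = same (index-unique {ep} {n} {r} {i} s≤M v≡ ep≡ p′ q′ o′)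
                where
                cover : (q : Dec (Fin (Cover.m V t s n i R))) → task ∈ˡ coverTask t s n i R q
                cover (no ¬k) = ⊥-elim (¬k k₀)
                cover (yes k₁) = here (≡.cong (λ k → normalised (Cover.e V t s n i R k) (Cover.gradSize V t s n i R k) , n)
                  (≡.cong proj₁ (argmaxOver-irrelevant k₀ k₁ (λ k → cap t s (Cover.J V t s n i R k) * Cover.gradSize V t s n i R k))))
                same : ∀ {t′ s′} → t ≡ t′ × s ≡ s′ → task ∈ˡ coverTask t′ s′ n i R em
                same (≡.refl , ≡.refl) = cover em

            eval-normalised : ∀ a c y → eval (normalised a c) y ≈ eval a y * c ⁻¹
            eval-normalised a c y = trans (+-congˡ (trans (∑-cong λ l → solve 3 (λ a c y → a :* c :* y := a :* y :* c) refl (a (suc l)) (c ⁻¹) (y l)) (sym (∑-*ʳ (λ l → a (suc l) * y l) (c ⁻¹)))))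
              (sym (distribʳ (c ⁻¹) _ _))

            avoid : ∀ t s n i ep → s ℕ.≤ M t → n ≡ (M t ℕ.∸ s ℕ.+ V) / period → i ℕ.≤ d → ep ℕ.+ kk n (suc i) ≡ t ℕ.+ V ℕ.+ s → e₀ ℕ.≤ ep →
               ∀ k₀ y → In (ep ℕ.+ n) y →
               Cover.gradSize V t s n i (In ep) (Cover.k* V t s n i (In ep) k₀)
                 ≤ ∣ eval (Cover.e V t s n i (In ep) (Cover.k* V t s n i (In ep) k₀)) y ∣ᴿ * b ^ (ep ℕ.+ n)
            avoid t s n i ep s≤M n≡ i≤d ep≡ e₀≤ep k₀ y y∈ = conclude (avoided k {normalised a γ} {n} (∈-++⁺ˡ (≡.subst (λ e → (normalised a γ , n) ∈ˡ dualTasks e (In ep)) (≡.sym (e₀+ e₀≤ep))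
                (generated t s n i ep s≤M n≡ i≤d ep≡ (In ep) k₀))) y (≡.subst (λ j → ⟦ C j ⟧ y) (ℕ.+-∸-comm n e₀≤ep) y∈))
              where
              k : ℕ
              k = ep ℕ.∸ e₀
              k* : Fin (Cover.m V t s n i (In ep))
              k* = Cover.k* V t s n i (In ep) k₀
              a : Aff {d}
              a = Cover.e V t s n i (In ep) k*
              γ : Carrier
              γ = Cover.gradSize V t s n i (In ep) k*
              0<γ : 0# < γ
              0<γ = 0<gradSize t s n i (In ep) k*
              conclude : 1# ≤ ∣ eval (normalised a γ) y ∣ᴿ * b ^ (e₀ ℕ.+ (k ℕ.+ n)) → γ ≤ ∣ eval a y ∣ᴿ * b ^ (ep ℕ.+ n)
              conclude p = ≤-resp (*-identityˡ γ) (begin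
                  ∣ eval (normalised a γ) y ∣ᴿ * b ^ (e₀ ℕ.+ (k ℕ.+ n)) * γ ≈⟨ solve 3 (λ x y z → x :* y :* z := x :* z :* y) refl ∣ eval (normalised a γ) y ∣ᴿ (b ^ (e₀ ℕ.+ (k ℕ.+ n))) γ ⟩
                  ∣ eval (normalised a γ) y ∣ᴿ * γ * b ^ (e₀ ℕ.+ (k ℕ.+ n)) ≈⟨ *-cong (trans (*-congˡ (sym (abs-of-nonNeg (<⇒≤ 0<γ)))) (trans (sym (abs-* _ _)) (abs-cong (trans (*-congʳ (eval-normalised a γ y)) (/-cancel (eval a y) (0<⇒≉ 0<γ))))))
                      (reflexive (≡.cong (b ^_) (≡.trans (≡.sym (ℕ.+-assoc e₀ k n)) (≡.cong (ℕ._+ n) (e₀+ e₀≤ep))))) ⟩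
                  ∣ eval a y ∣ᴿ * b ^ (ep ℕ.+ n) ∎) (*-monoʳ-≤ (<⇒≤ 0<γ) p)
                where open ≈R

            open OverWeights.Induction W V e₀ period≤V 2e₀≤V In x (λ e → centre∈ (C (e ℕ.∸ e₀))) nested close avoid

            -- The choice s = M t₁ makes the bound b^s a consequence of the bound Λ^t₁, so A(t₁, s)
            -- applies to all functions in the weighted box.
            dual : ∀ t e y → (∀ {t₁} → t₁ ℕ.≤ t → t₁ ℕ.+ V ℕ.+ M t₁ ℕ.≤ e) → In e y → ∀ t₁ → t₁ ℕ.≤ t → ∀ a → (∃[ i ] a i ≢ 0ℤ) →
                   (∀ l → ∣ ζ (a (suc l)) ∣ᴿ < Λ l ^ t₁) → ¬ (∣ eval (toAff a) y ∣ᴿ * b ^ (t₁ ℕ.+ V) < 1#)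
            dual t e y late y∈ t₁ t₁≤t a nz a< ev< = noSol t₁ (M t₁) ℕ.≤-refl e y (late t₁≤t) y∈ a
              (nz , (λ l → <-≤-trans (a< l) (≤-trans (^-monoˡ-≤ t₁ (<⇒≤ (0<Λ l)) (Λ≤top l)) (<⇒≤ (Λ^t<b^M t₁)))) , a< , ev<)

            -- The task was built from some candidate for some time t′, possibly another one. The
            -- epoch determines t′ = t, and then `together` puts z closer to the point of the task
            -- than the task permits.
            noCandidate : ∀ t 4≤t z → (∀ k → ⟦ C k ⟧ z) → ∀ q p → ¬ Cd.Candidate t 4≤t z q p
            noCandidate t 4≤t z z∈ q p cand = go em (λ {T} T∈ → avoided k {T} {D} (∈-++⁺ʳ (dualTasks (e₀ ℕ.+ k) ⟦ C k ⟧) T∈) z (z∈ (k ℕ.+ D)))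
              where
              E k : ℕ
              E = Cd.epoch t 4≤t
              k = E ℕ.∸ e₀
              e₀≤E : e₀ ℕ.≤ E
              e₀≤E = ℕ.≤-trans e₀≤V (ℕ.≤-trans (ℕ.m≤m+n V 2) (ℕ.≤-trans (ℕ.m≤n+m (V ℕ.+ 2) (M t)) (ℕ.m≤n+m _ t)))
              go : (dec : Dec (CandidateAt (e₀ ℕ.+ k) ⟦ C k ⟧)) → (∀ {T} → (T , D) ∈ˡ candidateTask (e₀ ℕ.+ k) ⟦ C k ⟧ dec → 1# ≤ ∣ eval T z ∣ᴿ * b ^ (e₀ ℕ.+ (k ℕ.+ D))) → ⊥
              go (no ¬c) _ = ¬c (t , 4≤t , ≡.sym (e₀+ e₀≤E) , z , z∈ k , q , p , cand)
              go (yes (t′ , 4≤t′ , E′≡ , y , y∈ , q′ , p′ , cand′)) avoids = sameT {t′} {4≤t′} (t+M-injective t+M≡) cand′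
                where
                t+M≡ : t′ ℕ.+ M t′ ≡ t ℕ.+ M t
                t+M≡ = ℕ.+-cancelʳ-≡ (V ℕ.+ 2) _ _ (≡.trans (ℕ.+-assoc t′ (M t′) (V ℕ.+ 2)) (≡.trans E′≡ (≡.trans (e₀+ e₀≤E) (≡.sym (ℕ.+-assoc t (M t) (V ℕ.+ 2))))))
                sameT : ∀ {t′ 4≤t′} → t′ ≡ t → Cd.Candidate t′ 4≤t′ y q′ p′ → ⊥
                sameT {_} {4≤t′} ≡.refl cand′ = <⇒≱ (Cd.together t 4≤t {y} {z} {q′} {q} {p′} {p} (dual t E y (Cd.epoch-late t 4≤t) y∈) near2 cand′ cand)
                  (≤-respʳ (*-cong (trans (abs-cong (eval-coordinate top (y top) z)) (abs-sub (z top) (y top)))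
                    (reflexive (≡.cong (b ^_) (≡.trans (≡.sym (ℕ.+-assoc e₀ k D)) (≡.cong (ℕ._+ D) (e₀+ e₀≤E)))))) (avoids (here ≡.refl)))
                  where
                  near2 : ∀ l → ∣ y l - z l ∣ᴿ * b ^ E ≤ two
                  near2 l = ≤-trans (*-monoʳ-≤ (^-nonNeg E (<⇒≤ 0<b)) (abs-triangle (y l) (x E l) (z l))) (≤-trans (≈⇒≤ (distribʳ _ _ _))
                    (+-mono-≤ (≤-trans (≈⇒≤ (*-congʳ (abs-sub _ _))) (close E e₀≤E y y∈ l)) (close E e₀≤E z (z∈ k) l)))

  -- Limit points of shrinking plays, and membership in the set of badly approximable points.

  module LimitPoints where
    open OrderedField
    open FiniteSums
    open LinearFormsPigeonhole
    open AffineSystems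
    open Combinations
    open WeightData
    open BallGeometry
    open RealPowers

    max-≥ : ∀ {d} (f : Vector Carrier d) i → f i ≤ max f
    max-≥ {suc d} f zero = x≤x⊔y (f zero) _
    max-≥ {suc d} f (suc i) = ≤-trans (max-≥ (f ∘ suc) i) (x≤y⊔x (f zero) (max (f ∘ suc)))

    ℤ^1/-≥ : ∀ {x w y} → ¬ (w ≈ 0#) → y ≤ ∣ x ∣ℤ ^ᴿ (w ⁻¹) → y ≤ ∣ x ∣ℤ^1/ w
    ℤ^1/-≥ {x} {w} w≉0 p with em {w ≈ 0#}
    ... | yes e = ⊥-elim (w≉0 e)
    ... | no _ = p

    ≤∣∣ℤ : ∀ {x y} → (∀ n → y ≤ ∣ x - ζ n ∣ᴿ) → y ≤ ∣ x ∣ℤ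
    ≤∣∣ℤ {x} {y} p = ≤-respˡ (-‿involutive y) (neg-mono-≤ (sup-lub (- ∣ x - fromℤ 0ℤ ∣ᴿ , 0ℤ , -‿involutive _)
      λ v (n , v≈) → ≤-respˡ (-‿involutive v) (neg-mono-≤ (≤-respʳ (sym v≈) (≤-respʳ (abs-cong (+-congˡ (-‿cong (ζ-def n)))) (p n))))))

    module _ {d : ℕ} (w : Vector Carrier d) (isWeight : IsWeight w) (1≤d : 1 ℕ.≤ d) (N₀ : ℕ) (N₀-large : ∀ l → ¬ (w l ≈ 0#) → 1# ≤ ι N₀ * w l)
      (b : Carrier) (b-large : Ω d * (ι (suc d) * ι (suc d)) ≤ b) (two^N₀≤b : two ^ N₀ ≤ b) (1<b : 1# < b)
      (θ : Fin d → Carrier → Carrier) (z : Vector Carrier d) (c₂ : ℕ)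
      (noCandidate : ∀ t → 4 ℕ.≤ t → ∀ q (p : Fin d → ℤ) → b ^ t < ι ℤ.∣ q ∣ * (b * b) → ι ℤ.∣ q ∣ * b ≤ b ^ t →
         ¬ (∀ l → ¬ (w l ≈ 0#) → ∣ ζ q * z l - θ l (z l) - ζ (p l) ∣ᴿ * (b ^ᴿ w l) ^ t * b ^ c₂ ≤ 1#)) where
      open Powers b (<⇒≤ 1<b)

      noCandidate⇒Bad : Bad θ w z
      noCandidate⇒Bad = from (archimedean-ι (1# + b ^ 3))
        where
        f : ℤ → Carrier
        f q = max (λ i → ∣ fromℤ q * z i - θ i (z i) ∣ℤ^1/ w i) * fromℤ (+ ℤ.∣ q ∣)
        K : ℕ
        -- `inverse-power` gives b^(-t-1-2c₂N₀) and |q| exceeds b^(t-2); t cancels in the product.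
        K = 3 ℕ.+ 2 ℕ.* (c₂ ℕ.* N₀)
        bound : ∀ t q → 4 ℕ.≤ t → b ^ t < ι ℤ.∣ q ∣ * (b * b) → ι ℤ.∣ q ∣ * b ≤ b ^ t → bi ^ K ≤ f q
        bound t q 4≤t low up = classically (∃[ l ] (¬ (w l ≈ 0#) × (∀ n → 1# ≤ ∣ ζ q * z l - θ l (z l) - ζ n ∣ᴿ * (b ^ᴿ w l) ^ t * b ^ c₂))) far
            (λ none → ⊥-elim (noCandidate t 4≤t q (λ l → proj₁ (approx none l)) low up (λ l → proj₂ (approx none l))))
          where
          approx : ¬ (∃[ l ] (¬ (w l ≈ 0#) × (∀ n → 1# ≤ ∣ ζ q * z l - θ l (z l) - ζ n ∣ᴿ * (b ^ᴿ w l) ^ t * b ^ c₂))) →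
                   ∀ l → ∃[ n ] (¬ (w l ≈ 0#) → ∣ ζ q * z l - θ l (z l) - ζ n ∣ᴿ * (b ^ᴿ w l) ^ t * b ^ c₂ ≤ 1#)
          approx none l = classically (∃[ n ] (∣ ζ q * z l - θ l (z l) - ζ n ∣ᴿ * (b ^ᴿ w l) ^ t * b ^ c₂ ≤ 1#)) (λ (n , p) → n , λ _ → p)
            -- A default for coordinates without a close integer; by `none` these have weight zero.
            λ ¬n → 0ℤ , λ w≉0 → ⊥-elim (none (l , w≉0 , λ n → <⇒≤ (≰⇒> λ p → ¬n (n , p))))
          far : ∃[ l ] (¬ (w l ≈ 0#) × (∀ n → 1# ≤ ∣ ζ q * z l - θ l (z l) - ζ n ∣ᴿ * (b ^ᴿ w l) ^ t * b ^ c₂)) → bi ^ K ≤ f q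
          far (l , w≉0 , p) = ≤-trans (≤-trans shrink (*-monoˡ-≤ (^-nonNeg κ′ (<⇒≤ 0<bi)) (<⇒≤ low′))) (≤-respʳ (*-congˡ fq) (*-monoʳ-≤ (0≤ι ℤ.∣ q ∣) comp))
            where
            κ′ : ℕ
            κ′ = t ℕ.+ 1 ℕ.+ 2 ℕ.* (c₂ ℕ.* N₀)
            w≥0 : 0# ≤ w l
            w≥0 = proj₁ isWeight l
            0<w : 0# < w l
            0<w = w≥0 , λ e → w≉0 (sym e)
            x Λ Y : Carrier
            x = fromℤ q * z l - θ l (z l)
            Λ = b ^ᴿ w l
            Y = (Λ ^ t * b ^ c₂) ⁻¹
            0<Λb : 0# < Λ ^ t * b ^ c₂
            0<Λb = *-pos (^-pos t (<-≤-trans 0<1 (1≤^ᴿ 1<b w≥0))) (^-pos c₂ 0<b)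
            Y≤ : Y ≤ ∣ x ∣ℤ
            Y≤ = ≤∣∣ℤ {x} {Y} λ n → *-cancelʳ-≤ 0<Λb (≤-resp (sym (⁻¹-inverseˡ (0<⇒≉ 0<Λb))) (trans (*-assoc _ _ _) (*-congʳ (abs-cong (+-congʳ (+-congʳ (*-congʳ (ζ-def q))))))) (p n))
            comp : bi ^ κ′ ≤ max (λ i → ∣ fromℤ q * z i - θ i (z i) ∣ℤ^1/ w i)
            comp = ≤-trans (ℤ^1/-≥ {x} {w l} w≉0 (inverse-power 1<b 0<w (w≤1 w isWeight 1≤d N₀ N₀-large b b-large two^N₀≤b 1<b l) N₀ (N₀-large l w≉0) c₂ t (ℕ.≤-trans (s≤s z≤n) 4≤t) (≤-trans (<⇒≤ (⁻¹-pos 0<Λb)) Y≤)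
                (≤-resp (⁻¹-inverseˡ (0<⇒≉ 0<Λb)) (trans (*-congˡ (*-comm _ _)) (sym (*-assoc _ _ _))) (*-monoʳ-≤ (<⇒≤ 0<Λb) Y≤))))
              (max-≥ (λ i → ∣ fromℤ q * z i - θ i (z i) ∣ℤ^1/ w i) l)
            fq : ι ℤ.∣ q ∣ ≈ fromℤ (+ ℤ.∣ q ∣)
            fq = ι-def ℤ.∣ q ∣
            low′ : b ^ t * bi ^ 2 < ι ℤ.∣ q ∣
            low′ = <-resp refl (trans (solve 3 (λ q b i → q :* (b :* b) :* (i :* (i :* con (+ 1))) := q :* ((b :* (b :* con (+ 1))) :* (i :* (i :* con (+ 1))))) refl (ι ℤ.∣ q ∣) b bi) (trans (*-congˡ (b^n*bi^n 2)) (*-identityʳ _)))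
              (*-monoʳ-< (^-pos 2 0<bi) low)
            shrink : bi ^ K ≤ bi ^ κ′ * (b ^ t * bi ^ 2)
            shrink = ≈⇒≤ (sym (trans (trans (solve 3 (λ x b i → x :* (b :* i) := b :* (x :* i)) refl (bi ^ κ′) (b ^ t) (bi ^ 2)) (*-congˡ (sym (^-homo-* bi κ′ 2))))
              (trans (trans (*-congˡ (reflexive (≡.cong (bi ^_) (N.solve 2 (λ t m → t N.:+ N.con 1 N.:+ m N.:+ N.con 2 N.:= N.con 3 N.:+ m N.:+ t) ≡.refl t (2 ℕ.* (c₂ ℕ.* N₀)))))) (P-shift 0 K t)) (*-identityˡ _))))
        from : ∃[ N ] (1# + b ^ 3 ≤ ι N) → Bad θ w z
        from (N , large) = bi ^ K , N , ^-pos K 0<bi , λ q q≢0 N≤ → level q N≤ (leastWith (λ T → ι ℤ.∣ q ∣ ≤ b ^ T) (archimedean-^ (ι ℤ.∣ q ∣) 1<b))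
          where
          level : ∀ q → N ℕ.≤ ℤ.∣ q ∣ → ∃[ T ] (ι ℤ.∣ q ∣ ≤ b ^ T × (∀ k → k ℕ.< T → ¬ (ι ℤ.∣ q ∣ ≤ b ^ k))) → bi ^ K ≤ f q
          level q N≤ (T , up , min) = go T up min T>3
            where
            b³<q : b ^ 3 < ι ℤ.∣ q ∣
            b³<q = <-≤-trans (x<1+x (b ^ 3)) (≤-trans large (ι-mono-≤ N≤))
            T>3 : 3 ℕ.< T
            T>3 = ℕ.≰⇒> λ T≤3 → <⇒≱ b³<q (≤-trans up (^-monoʳ-≤ (<⇒≤ 1<b) T≤3))
            go : ∀ T → ι ℤ.∣ q ∣ ≤ b ^ T → (∀ k → k ℕ.< T → ¬ (ι ℤ.∣ q ∣ ≤ b ^ k)) → 3 ℕ.< T → bi ^ K ≤ f q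
            -- `suc (suc T)` is the t with b^(t-2) < |q| ≤ b^(t-1).
            go (suc T) up min lt = bound (suc (suc T)) q (ℕ.m≤n⇒m≤1+n lt)
              (<-resp (trans (*-comm (b ^ T) _) (*-assoc b b (b ^ T))) refl (*-monoʳ-< (*-pos 0<b 0<b) (≰⇒> (min T (ℕ.n<1+n T)))))
              (≤-trans (*-monoʳ-≤ (<⇒≤ 0<b) up) (≈⇒≤ (*-comm _ _)))

    module Plays (d : ℕ) (1≤d : 1 ℕ.≤ d) where
      open Geometry d

      module Limit (B : ℕ → Ball) (sub : ∀ n → ⟦ B (suc n) ⟧ ⊆ ⟦ B n ⟧) (shrinking : ∀ x → 0# < x → ∃[ n ] radius (B n) ≤ x) where

        coord : ∀ {m n} → m ℕ.≤ n → ∀ l → ∣ centre (B m) l - centre (B n) l ∣ᴿ ≤ radius (B m)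
        coord {m} {n} p l = ∈⇒coord (B m) {centre (B n)} (nested⊆ B sub p {centre (B n)} (centre∈ (B n))) l

        Lower : Fin d → Pred Carrier 0ℓ
        Lower l x = ∃[ n ] x ≈ centre (B n) l - radius (B n)

        cross : ∀ l m n → centre (B n) l - radius (B n) ≤ centre (B m) l + radius (B m)
        cross l m n = go (ℕ.≤-total m n)
          where
          0≤r : ∀ n → 0# ≤ radius (B n)
          0≤r n = <⇒≤ (0<radius (B n))
          go : m ℕ.≤ n ⊎ n ℕ.≤ m → centre (B n) l - radius (B n) ≤ centre (B m) l + radius (B m)
          go (inj₁ p) = lin (+-mono-≤ (≤-trans (-x≤∣x∣ _) (coord p l)) (0≤r n)) (solve 4 (λ cm rm cn rn → (cm :+ rm) :+ (:- (cm :- cn) :+ con 0ℤ) := (cn :- rn) :+ (rm :+ rn)) refl (centre (B m) l) (radius (B m)) (centre (B n) l) (radius (B n)))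
          go (inj₂ p) = lin (+-mono-≤ (≤-trans (x≤∣x∣ _) (coord p l)) (0≤r m)) (solve 4 (λ cm rm cn rn → (cm :+ rm) :+ ((cn :- cm) :+ con 0ℤ) := (cn :- rn) :+ (rn :+ rm)) refl (centre (B m) l) (radius (B m)) (centre (B n) l) (radius (B n)))

        limit : Point
        limit l = sup (Lower l)

        limit-near : ∀ m l → ∣ limit l - centre (B m) l ∣ᴿ ≤ radius (B m)
        limit-near m l = abs-lub (lin (sup-lub {Lower l} (_ , 0 , refl) λ x (n , x≈) → ≤-respˡ (sym x≈) (cross l m n))
            (solve 3 (λ z c r → r :+ z := (z :- c) :+ (c :+ r)) refl (limit l) (centre (B m) l) (radius (B m))))
          (lin (sup-ub {Lower l} (_ , λ x (n , x≈) → ≤-respˡ (sym x≈) (cross l m n)) (m , refl))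
            (solve 3 (λ z c r → r :+ (c :- r) := :- (z :- c) :+ z) refl (limit l) (centre (B m) l) (radius (B m))))

        -- If the distance exceeded r, `perturb` would be violated at the centre of a ball so small
        -- that d times its radius is less than the excess.
        limit∈ : ∀ n → ⟦ B n ⟧ limit
        limit∈ n = ≮⇒≥ λ r<D → contradict r<D (shrinking _ (0<ε r<D))
          where
          r D : Carrier
          r = radius (B n)
          D = dist (centre (B n)) limit
          0<ι′ : 0# < ι (suc d)
          0<ι′ = 0<ι d
          ε : Carrier
          ε = (D - r) * ι (suc d) ⁻¹
          0<Δ : r < D → 0# < D - r
          0<Δ r<D = ≰⇒> λ q → <⇒≱ r<D (lin q (solve 2 (λ D r → r :+ (D :- r) := D :+ con 0ℤ) refl D r))
          0<ε : r < D → 0# < ε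
          0<ε r<D = *-pos (0<Δ r<D) (⁻¹-pos 0<ι′)
          contradict : r < D → ∃[ m ] radius (B m) ≤ ε → ⊥
          contradict r<D (m , rm≤) = <⇒≱ (<-resp (+-identityʳ _) (trans (+-congˡ (trans (*-comm _ _) (/-cancel (D - r) (0<⇒≉ 0<ι′)))) (solve 2 (λ r D → r :+ (D :- r) := D) refl r D)) strict<) far
            where
            k : ℕ
            k = m ℕ.⊔ n
            rk≤ : radius (B k) ≤ ε
            rk≤ = ≤-trans (⊆⇒radius (B k) (B m) (element 1≤d) (nested⊆ B sub (ℕ.m≤m⊔n m n))) rm≤
            c n′ : Point
            c = centre (B k)
            n′ = centre (B n)
            0≤r : 0# ≤ r
            0≤r = <⇒≤ (0<radius (B n))
            S-sym : ∀ x y → S x y ≈ S y x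
            S-sym x y = ∑-cong λ i → solve 2 (λ x y → (x :- y) :* (x :- y) := (y :- x) :* (y :- x)) refl (x i) (y i)
            total : Carrier
            total = ∑ (λ i → ∣ limit i - c i ∣ᴿ)
            total≤ : total ≤ ι d * ε
            total≤ = ∑-≤-const λ i → ≤-trans (limit-near k i) rk≤
            far : D ≤ r + total
            far = dist-≤ {n′} {limit} (+-nonNeg 0≤r (∑-nonNeg λ i → abs-nonNeg (limit i - c i))) (≤-respˡ (S-sym limit n′) (perturb {limit} {c} {n′} 0≤r
              (≤-respˡ (S-sym n′ c) (∈⇒S (B n) {c} (nested⊆ B sub (ℕ.m≤n⊔m m n) {c} (centre∈ (B k)))))))
            strict< : r + total + 0# < r + ι (suc d) * ε
            strict< = ≰⇒> λ q → <⇒≱ (0<ε r<D) (lin (+-mono-≤ q (+-mono-≤ total≤ (≈⇒≤ (*-congʳ (sym (ι-suc d))))))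
              (solve 5 (λ r s i t e → con 0ℤ :+ (r :+ s :* e :+ (t :+ (con (+ 1) :+ i) :* e)) := e :+ (r :+ t :+ con 0ℤ :+ (i :* e :+ s :* e))) refl r (ι (suc d)) (ι d) total ε))

  -- Plays that do not shrink, and both games from one strategy.

  module WinningStrategies where
    open OrderedField
    open FiniteSums
    open AffineSystems
    open WeightData
    open PotentialMethod
    open BallGeometry
    open LimitPoints

    small-power : ∀ {x y} → 0# < x → x < 1# → 0# < y → ∃[ n ] (x ^ n ≤ y)
    small-power {x} {y} 0<x x<1 0<y = invert (archimedean-^ (y ⁻¹) 1<xi)
      where
      xi : Carrier
      xi = x ⁻¹
      0<xi : 0# < xi
      0<xi = ⁻¹-pos 0<x
      1<xi : 1# < xi
      1<xi = <-resp (⁻¹-inverseˡ (0<⇒≉ 0<x)) (*-identityʳ xi) (*-monoˡ-< 0<xi x<1)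
      invert : ∃[ n ] (y ⁻¹ ≤ xi ^ n) → ∃[ n ] (x ^ n ≤ y)
      invert (n , p) = n , *-cancelʳ-≤ (⁻¹-pos 0<y) (≤-trans (*-monoˡ-≤ (^-nonNeg n (<⇒≤ 0<x)) p) (≈⇒≤ (trans (sym (^-distrib-* x xi n))
        (trans (trans (^-congˡ n (⁻¹-inverseʳ x (0<⇒≉ 0<x))) (1^n n)) (sym (⁻¹-inverseʳ y (0<⇒≉ 0<y)))))))

    module Strategies (d : ℕ) (1≤d : 1 ℕ.≤ d) (Q : Pred (Vector Carrier d) 0ℓ) where
      open Geometry d
      open Plays d 1≤d

      Shrinking : (ℕ → Ball) → Set
      Shrinking B = ∀ x → 0# < x → ∃[ n ] radius (B n) ≤ x

      Meets : (ℕ → Ball) → Set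
      Meets B = Satisfiable (⋂ ℕ (λ n → ⟦ B n ⟧) ∩ Q)

      margin : Carrier
      margin = 1# + (ι d + ι d)

      abstract
        avoidance : ∀ α → 0# < α → α * margin < 1# → ∀ H B → Σ[ B′ ∈ Ball ]
          (radius B′ ≈ α * radius B × ⟦ B′ ⟧ ⊆ ⟦ B ⟧ × (∀ {ε} → 0# ≤ ε → ε ≤ α * radius B → ⟦ B′ ⟧ ∥ Neighbourhood ε (onHyperplane H)))
        avoidance α 0<α α-small H B = avoiding , refl , (λ {y} → avoiding-⊆ {y}) , λ p q {y} → avoiding-⊥ p q {y}
          where open Avoid α 0<α α-small H B

      module _ (β : Carrier) (0<β : 0# < β) (β-small : β * margin < 1#) (σ : Strategy (HyperplaneMove β))
        (wins : ∀ B → HyperplanePlay σ B → Shrinking B → Meets B) where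

        β<1 : β < 1#
        β<1 = ≤-<-trans (x≤x*y (<⇒≤ 0<β) (≤-respˡ (+-identityʳ 1#) (+-mono-≤ ≤-refl (+-nonNeg (0≤ι d) (0≤ι d))))) β-small

        -- If the radii of a play do not tend to 0, then its balls have a ball in common, and this ball
        -- contains a point of Q because a fictitious shrinking play inside it does.
        module Fictitious (B₀ : Ball) where

          Legal : List Ball → Ball → Ball → Set
          Legal h B B′ = ⟦ B′ ⟧ ⊆ ⟦ B ⟧ × β * radius B ≤ radius B′ × ⟦ B′ ⟧ ∥ Neighbourhood (HyperplaneMove.ε (σ h B)) (onHyperplane (HyperplaneMove.hyperplane (σ h B)))

          avoided : ∀ h B → _
          avoided h B = avoidance β 0<β β-small (HyperplaneMove.hyperplane (σ h B)) B

          next : List Ball → Ball → Ball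
          next h B = proj₁ (avoided h B)

          next-legal : ∀ h B → Legal h B (next h B)
          next-legal h B = proj₁ (proj₂ (proj₂ (avoided h B))) , ≈⇒≤ (sym (proj₁ (proj₂ (avoided h B)))) ,
            proj₂ (proj₂ (proj₂ (avoided h B))) (<⇒≤ (HyperplaneMove.0<ε (σ h B))) (HyperplaneMove.ε≤βr (σ h B))

          state : ℕ → List Ball × Ball
          state zero = [] , B₀
          state (suc n) = proj₂ (state n) ∷ proj₁ (state n) , next (proj₁ (state n)) (proj₂ (state n))

          F : ℕ → Ball
          F n = proj₂ (state n)

          past≡ : ∀ n → past F n ≡ proj₁ (state n)
          past≡ zero = ≡.refl
          past≡ (suc n) = ≡.cong (F n ∷_) (past≡ n)

          F-suc : ∀ n → F (suc n) ≡ next (past F n) (F n)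
          F-suc n = ≡.cong (λ h → next h (F n)) (≡.sym (past≡ n))

          play : HyperplanePlay σ F
          play n = ≡.subst (Legal (past F n) (F n)) (≡.sym (F-suc n)) (next-legal (past F n) (F n))

          F-radius : ∀ n → radius (F n) ≈ β ^ n * radius B₀
          F-radius zero = sym (*-identityˡ _)
          F-radius (suc n) = trans (proj₁ (proj₂ (avoided (proj₁ (state n)) (F n)))) (trans (*-congˡ (F-radius n)) (sym (*-assoc _ _ _)))

          F-shrinking : Shrinking F
          F-shrinking x 0<x = go (small-power 0<β β<1 (*-pos 0<x (⁻¹-pos (0<radius B₀))))
            where
            go : ∃[ n ] (β ^ n ≤ x * radius B₀ ⁻¹) → ∃[ n ] radius (F n) ≤ x
            go (n , p) = n , ≤-resp (sym (F-radius n)) (/-cancel x (0<⇒≉ (0<radius B₀))) (*-monoʳ-≤ (<⇒≤ (0<radius B₀)) p)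

        dense : ∀ B₀ → ∃[ z ] (⟦ B₀ ⟧ z × Q z)
        dense B₀ = extract (wins F play F-shrinking)
          where
          open Fictitious B₀
          extract : Meets F → ∃[ z ] (⟦ B₀ ⟧ z × Q z)
          extract (z , z∈ , q) = z , z∈ 0 , q

        module Common (B : ℕ → Ball) (sub : ∀ n → ⟦ B (suc n) ⟧ ⊆ ⟦ B n ⟧) (ρ : Carrier) (0<ρ : 0# < ρ) (ρ≤ : ∀ n → ρ ≤ radius (B n)) where

          Negated : Pred Carrier 0ℓ
          Negated x = ∃[ n ] x ≈ - radius (B n)

          bounded : Satisfiable (UpperBound Negated)
          bounded = 0# , λ x (n , e) → ≤-respˡ (sym e) (≤-respʳ -0#≈0# (neg-mono-≤ (<⇒≤ (0<radius (B n)))))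

          halfρ δ : Carrier
          halfρ = ρ * two ⁻¹
          δ = halfρ * ι (suc d) ⁻¹

          0<halfρ : 0# < halfρ
          0<halfρ = *-pos 0<ρ (⁻¹-pos 0<two)

          0<δ : 0# < δ
          0<δ = *-pos 0<halfρ (⁻¹-pos (0<ι d))

          stable : ∃[ N ] ∀ n → radius (B N) - radius (B n) ≤ δ
          stable = classically (∃[ N ] (sup Negated - δ < - radius (B N))) found
              λ none → ⊥-elim (<⇒≱ 0<δ (lin (sup-lub {Negated} (_ , 0 , refl) λ x (n , e) → ≤-respˡ (sym e) (≮⇒≥ λ lt → none (n , lt)))
                (solve 2 (λ s d → con 0ℤ :+ s := d :+ (s :- d)) refl (sup Negated) δ)))
            where
            found : ∃[ N ] (sup Negated - δ < - radius (B N)) → ∃[ N ] ∀ n → radius (B N) - radius (B n) ≤ δ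
            found (N , lt) = N , λ n → lin (+-mono-≤ (<⇒≤ lt) (sup-ub {Negated} bounded (n , refl)))
              (solve 4 (λ s d N n → d :+ ((s :- d) :+ :- n) := (N :- n) :+ (:- N :+ s)) refl (sup Negated) δ (radius (B N)) (radius (B n)))

          N : ℕ
          N = proj₁ stable

          common : Ball
          common = record { centre = centre (B N) ; radius = halfρ ; 0<radius = 0<halfρ }

          -- After `N` the radii lose at most δ, and `⊆⇒coord` turns this into a bound for the drift
          -- of each coordinate of the centre. The total drift dδ is at most ρ/2.
          common-late : ∀ {n} → N ℕ.≤ n → ⟦ common ⟧ ⊆ ⟦ B n ⟧
          common-late {n} N≤n = ⊆-perturb common (B n) (≤-trans (+-mono-≤ ≤-refl (≤-trans (∑-≤-const λ i → ≤-trans (≈⇒≤ (abs-sub _ _)) (shift i)) dδ≤)) (≤-trans (≈⇒≤ halves) (ρ≤ n)))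
            where
            shift : ∀ i → ∣ centre (B N) i - centre (B n) i ∣ᴿ ≤ δ
            shift i = ≤-trans (lin (⊆⇒coord (B n) (B N) (nested⊆ B sub N≤n) i) (solve 3 (λ a r R → (R :- r) :+ (a :+ r) := a :+ R) refl _ (radius (B n)) (radius (B N)))) (proj₂ stable n)
            dδ≤ : ι d * δ ≤ halfρ
            dδ≤ = ≤-respʳ (trans (*-comm _ _) (/-cancel halfρ (0<⇒≉ (0<ι d)))) (*-monoʳ-≤ (<⇒≤ 0<δ) (ι-mono-≤ (ℕ.n≤1+n d)))
            halves : halfρ + halfρ ≈ ρ
            halves = trans (solve 2 (λ r t → r :* t :+ r :* t := r :* t :* (con (+ 1) :+ con (+ 1))) refl ρ (two ⁻¹)) (/-cancel ρ (0<⇒≉ 0<two))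

          common⊆ : ∀ n → ⟦ common ⟧ ⊆ ⟦ B n ⟧
          common⊆ n {y} p = go (ℕ.≤-total N n)
            where
            go : N ℕ.≤ n ⊎ n ℕ.≤ N → ⟦ B n ⟧ y
            go (inj₁ N≤n) = common-late N≤n {y} p
            go (inj₂ n≤N) = nested⊆ B sub n≤N {y} (common-late ℕ.≤-refl {y} p)

        wins-always : ∀ B → HyperplanePlay σ B → Meets B
        wins-always B play = classically (∃[ ρ ] (0# < ρ × (∀ n → ρ ≤ radius (B n)))) bounded-below
            λ none → wins B play λ x 0<x → classically (∃[ n ] radius (B n) ≤ x) id λ big → ⊥-elim (none (x , 0<x , λ n → <⇒≤ (≰⇒> λ le → big (n , le))))
          where
          bounded-below : ∃[ ρ ] (0# < ρ × (∀ n → ρ ≤ radius (B n))) → Meets B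
          bounded-below (ρ , 0<ρ , ρ≤) = meet (dense common)
            where
            open Common B (λ n → proj₁ (play n)) ρ 0<ρ ρ≤
            meet : ∃[ z ] (⟦ common ⟧ z × Q z) → Meets B
            meet (z , z∈ , q) = z , (λ n → common⊆ n {z} z∈) , q

      module _ {β b : Carrier} (1<b : 1# < b) (core : ∀ e₀ → Σ[ σ ∈ Strategy (HyperplaneMove β) ]
          (∀ B → HyperplanePlay σ B → Shrinking B → 1# < radius (B 0) * b ^ e₀ → Meets B)) where

        startOf : ∀ (B : Ball) → ∃[ e₀ ] 1# < radius B * b ^ e₀
        startOf B = go (archimedean-^ (1# + radius B ⁻¹) 1<b)
          where
          go : ∃[ n ] (1# + radius B ⁻¹ ≤ b ^ n) → ∃[ e₀ ] 1# < radius B * b ^ e₀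
          go (n , p) = n , <-resp (⁻¹-inverseʳ (radius B) (0<⇒≉ (0<radius B))) refl (*-monoˡ-< (0<radius B) (<-≤-trans (x<1+x _) p))

        first : List Ball → Ball → Ball
        first [] B = B
        first (B′ ∷ h) B = first h B′

        first-past : ∀ B n → first (past B n) (B n) ≡ B 0
        first-past B zero = ≡.refl
        first-past B (suc n) = first-past B n

        strategyFrom : Ball → Strategy (HyperplaneMove β)
        strategyFrom B₀ = proj₁ (core (proj₁ (startOf B₀)))

        -- `e₀` depends on Bob's first ball, which Alice reads off from the history. It is the same
        -- throughout a play, so each play is one against a fixed strategy of `core`.
        merged : Σ[ σ ∈ Strategy (HyperplaneMove β) ] (∀ B → HyperplanePlay σ B → Shrinking B → Meets B)
        merged = (λ h B → strategyFrom (first h B) h B) , λ B play shrinking → proj₂ (core (proj₁ (startOf (B 0)))) B (restrict B play) shrinking (proj₂ (startOf (B 0)))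
          where
          Step : (ℕ → Ball) → ℕ → Ball → Set
          Step B n B₀ = let open HyperplaneMove (strategyFrom B₀ (past B n) (B n)) in
            ⟦ B (suc n) ⟧ ⊆ ⟦ B n ⟧ × β * radius (B n) ≤ radius (B (suc n)) × ⟦ B (suc n) ⟧ ∥ Neighbourhood ε (onHyperplane hyperplane)
          restrict : ∀ B → HyperplanePlay (λ h B → strategyFrom (first h B) h B) B → HyperplanePlay (strategyFrom (B 0)) B
          restrict B play n = ≡.subst (Step B n) (first-past B n) (play n)

      WinsFor : Carrier → Set
      WinsFor β = Σ[ σ ∈ Strategy (HyperplaneMove β) ] (∀ B → HyperplanePlay σ B → Meets B)

      0<margin : 0# < margin
      0<margin = +-pos-nonNeg 0<1 (+-nonNeg (0≤ι d) (0≤ι d))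

      α : Carrier
      α = (1# + margin) ⁻¹

      0<1+margin : 0# < 1# + margin
      0<1+margin = +-pos-nonNeg 0<1 (<⇒≤ 0<margin)

      0<α : 0# < α
      0<α = ⁻¹-pos 0<1+margin

      α-small : α * margin < 1#
      α-small = <-resp refl (⁻¹-inverseˡ (0<⇒≉ 0<1+margin)) (*-monoˡ-< 0<α (x<1+x margin))

      α<1 : α < 1#
      α<1 = <-resp (*-identityʳ α) (⁻¹-inverseˡ (0<⇒≉ 0<1+margin)) (*-monoˡ-< 0<α (≰⇒> λ q → <⇒≱ 0<margin (lin q (solve 1 (λ m → con 0ℤ :+ (con (+ 1) :+ m) := m :+ con (+ 1)) refl margin))))

      module _ (winsFor : ∀ β → 0# < β → β * margin < 1# → WinsFor β) where

        -- A strategy for the smaller parameter min(β, α) serves for β: its neighbourhoods are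
        -- legal, and a ball that Bob may choose for β he may also choose for the smaller parameter.
        absoluteWinning : HyperplaneAbsoluteWinning Q
        absoluteWinning β 0<β _ = relax (winsFor β₀ (⊓-pos 0<β 0<α) (≤-<-trans (*-monoʳ-≤ (<⇒≤ 0<margin) (x⊓y≤y β α)) α-small))
          where
          β₀ : Carrier
          β₀ = β ⊓ α
          relax : WinsFor β₀ → Σ[ σ ∈ Strategy (HyperplaneMove β) ] (∀ B → HyperplanePlay σ B → Meets B)
          relax (σ , wins) = (λ h B → record
              { hyperplane = HyperplaneMove.hyperplane (σ h B) ; ε = HyperplaneMove.ε (σ h B) ; 0<ε = HyperplaneMove.0<ε (σ h B)
              ; ε≤βr = ≤-trans (HyperplaneMove.ε≤βr (σ h B)) (*-monoʳ-≤ (<⇒≤ (0<radius B)) (x⊓y≤x β α)) })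
            , λ B play → wins B λ n → proj₁ (play n) , ≤-trans (*-monoʳ-≤ (<⇒≤ (0<radius (B n))) (x⊓y≤x β α)) (proj₁ (proj₂ (play n))) , proj₂ (proj₂ (play n))

        -- Alice answers with a ball of ratio α outside the neighbourhood that the hyperplane
        -- strategy names; Bob's balls then form a hyperplane play with parameter αβ.
        schmidtWinning : SchmidtWinning Q
        schmidtWinning = α , 0<α , α<1 , λ β 0<β β<1 → against β 0<β β<1 (winsFor (α * β) (*-pos 0<α 0<β) (αβ-small β 0<β β<1))
          where
          αβ≤α : ∀ β → β < 1# → α * β ≤ α
          αβ≤α β β<1 = ≤-respʳ (*-identityʳ α) (*-monoˡ-≤ (<⇒≤ 0<α) (<⇒≤ β<1))
          αβ-small : ∀ β → 0# < β → β < 1# → α * β * margin < 1#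
          αβ-small β 0<β β<1 = ≤-<-trans (*-monoʳ-≤ (<⇒≤ 0<margin) (αβ≤α β β<1)) α-small
          against : ∀ β → 0# < β → β < 1# → WinsFor (α * β) → Σ[ σ ∈ Strategy (SchmidtMove α) ] (∀ B → SchmidtPlay β σ B → Meets B)
          against β 0<β β<1 (σ , wins) = τ , λ B play → wins B (hyperplanePlay B play)
            where
            avoided : ∀ h B → _
            avoided h B = avoidance α 0<α α-small (HyperplaneMove.hyperplane (σ h B)) B
            τ : Strategy (SchmidtMove α)
            τ h B = record { ball = proj₁ (avoided h B) ; radius≈ = proj₁ (proj₂ (avoided h B)) ; ball⊆B = proj₁ (proj₂ (proj₂ (avoided h B))) }
            hyperplanePlay : ∀ B → SchmidtPlay β τ B → HyperplanePlay σ B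
            hyperplanePlay B play n = (λ {y} p → proj₁ (proj₂ (proj₂ (avoided (past B n) (B n)))) {y} (proj₂ (play n) {y} p)) ,
                ≈⇒≤ (trans (solve 3 (λ a b r → a :* b :* r := b :* (a :* r)) refl α β (radius (B n))) (sym (trans (proj₁ (play n)) (*-congˡ (proj₁ (proj₂ (avoided (past B n) (B n)))))))) ,
                λ {y} (p , near) → proj₂ (proj₂ (proj₂ (avoided (past B n) (B n)))) (<⇒≤ (HyperplaneMove.0<ε m)) (≤-trans (HyperplaneMove.ε≤βr m) (*-monoʳ-≤ (<⇒≤ (0<radius (B n))) (αβ≤α β β<1))) {y} (proj₂ (play n) {y} p , near)
              where
              m : HyperplaneMove (α * β) (B n)
              m = response σ B n

  -- Choice of the constants, and the conclusion.

  module Conclusion where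
    open OrderedField
    open FiniteSums
    open LinearFormsPigeonhole
    open AffineSystems
    open Combinations
    open WeightData
    open PotentialMethod
    open BallGeometry
    open EpochGame
    open RealPowers
    open Approximations
    open TaskLists
    open LimitPoints
    open WinningStrategies

    x≤x+y : ∀ {x y} → 0# ≤ y → x ≤ x + y
    x≤x+y p = ≤-respˡ (+-identityʳ _) (+-mono-≤ ≤-refl p)

    y≤x+y : ∀ {x y} → 0# ≤ x → y ≤ x + y
    y≤x+y p = ≤-respˡ (+-identityˡ _) (+-mono-≤ p ≤-refl)

    module Main (d : ℕ) (1≤d : 1 ℕ.≤ d) (w : Vector Carrier d) (isWeight : IsWeight w)
      (θ : Fin d → Carrier → Carrier) (lipschitz : ∀ l → Lipschitz (θ l)) where

      open Geometry d
      open Plays d 1≤d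
      open Strategies d 1≤d (Bad θ w)

      exponent : ∃[ N ] ∀ l → ¬ (w l ≈ 0#) → 1# ≤ ι N * w l
      exponent = commonBound (λ l n → ¬ (w l ≈ 0#) → 1# ≤ ι n * w l) (λ l k≤n p w≉0 → ≤-trans (p w≉0) (*-monoʳ-≤ (proj₁ isWeight l) (ι-mono-≤ k≤n)))
        λ l → classically (w l ≈ 0#) (λ e → 0 , λ w≉0 → ⊥-elim (w≉0 e)) λ w≉0 → later l (archimedean-ι* 1# (proj₁ isWeight l , λ e → w≉0 (sym e)))
        where
        later : ∀ l → ∃[ n ] (1# ≤ ι n * w l) → ∃[ n ] (¬ (w l ≈ 0#) → 1# ≤ ι n * w l)
        later l (n , p) = n , λ _ → p

      slopeBound : ∃[ N ] ∀ l x y → ∣ θ l x - θ l y ∣ᴿ ≤ ι N * ∣ x - y ∣ᴿ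
      slopeBound = commonBound (λ l n → ∀ x y → ∣ θ l x - θ l y ∣ᴿ ≤ ι n * ∣ x - y ∣ᴿ) (λ l k≤n p x y → ≤-trans (p x y) (*-monoʳ-≤ (abs-nonNeg _) (ι-mono-≤ k≤n)))
        λ l → later l (archimedean-ι (proj₁ (lipschitz l)))
        where
        later : ∀ l → ∃[ n ] (proj₁ (lipschitz l) ≤ ι n) → ∃[ n ] (∀ x y → ∣ θ l x - θ l y ∣ᴿ ≤ ι n * ∣ x - y ∣ᴿ)
        later l (n , p) = n , λ x y → ≤-trans (proj₂ (lipschitz l) x y) (*-monoʳ-≤ (abs-nonNeg _) p)

      N₀ : ℕ
      N₀ = proj₁ exponent

      L : Carrier
      L = ι (proj₁ slopeBound)

      module Base (β : Carrier) (0<β : 0# < β) (β-small : β * margin < 1#) where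

        I K : Carrier
        I = ι (suc d)
        K = spreadConstant d (two * (β * β) ⁻¹) * (two * I)

        0<ββ : 0# < β * β
        0<ββ = *-pos 0<β 0<β

        0≤K : 0# ≤ K
        0≤K = *-nonNeg (0≤spreadConstant d (*-nonNeg (<⇒≤ 0<two) (<⇒≤ (⁻¹-pos 0<ββ)))) (*-nonNeg (<⇒≤ 0<two) (0≤ι (suc d)))

        -- Lower bounds for b, which is their sum: b₁ for the pigeonhole constants, b₂ to make Λ ≥ 2
        -- in positive coordinates, b₃ = 8 for comparing candidates, b₄ for the Lipschitz constant,
        -- b₅ so that no move skips an epoch, b₆ for the general position argument.
        b₁ b₂ b₃ b₄ b₅ b₆ : Carrier
        b₁ = Ω d * (I * I)
        b₂ = two ^ N₀
        b₃ = two + six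
        b₄ = L
        b₅ = β ⁻¹
        b₆ = K * (β * β) ⁻¹ + 1#

        0≤b₁ : 0# ≤ b₁
        0≤b₁ = *-nonNeg (≤-trans 0≤1 (1≤Ω d)) (*-nonNeg (0≤ι (suc d)) (0≤ι (suc d)))

        0≤b₂ : 0# ≤ b₂
        0≤b₂ = ^-nonNeg N₀ (<⇒≤ 0<two)

        0≤six : 0# ≤ six
        0≤six = +-nonNeg (+-nonNeg 0≤1 0≤1) (+-nonNeg (<⇒≤ 0<two) (<⇒≤ 0<two))

        0≤b₃ : 0# ≤ b₃
        0≤b₃ = +-nonNeg (<⇒≤ 0<two) 0≤six

        0≤b₅ : 0# ≤ b₅
        0≤b₅ = <⇒≤ (⁻¹-pos 0<β)

        0≤b₆ : 0# ≤ b₆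
        0≤b₆ = +-nonNeg (*-nonNeg 0≤K (<⇒≤ (⁻¹-pos 0<ββ))) 0≤1

        b : Carrier
        b = b₁ + (b₂ + (b₃ + (b₄ + (b₅ + b₆))))

        r₅ : 0# ≤ b₅ + b₆
        r₅ = +-nonNeg 0≤b₅ 0≤b₆

        r₄ : 0# ≤ b₄ + (b₅ + b₆)
        r₄ = +-nonNeg (0≤ι (proj₁ slopeBound)) r₅

        r₃ : 0# ≤ b₃ + (b₄ + (b₅ + b₆))
        r₃ = +-nonNeg 0≤b₃ r₄

        tail₂ : b₂ + (b₃ + (b₄ + (b₅ + b₆))) ≤ b
        tail₂ = y≤x+y 0≤b₁

        tail₃ : b₃ + (b₄ + (b₅ + b₆)) ≤ b
        tail₃ = ≤-trans (y≤x+y 0≤b₂) tail₂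

        tail₄ : b₄ + (b₅ + b₆) ≤ b
        tail₄ = ≤-trans (y≤x+y 0≤b₃) tail₃

        tail₅ : b₅ + b₆ ≤ b
        tail₅ = ≤-trans (y≤x+y (0≤ι (proj₁ slopeBound))) tail₄

        b-large : Ω d * (ι (suc d) * ι (suc d)) ≤ b
        b-large = x≤x+y (+-nonNeg 0≤b₂ r₃)

        two^N₀≤b : two ^ N₀ ≤ b
        two^N₀≤b = ≤-trans (x≤x+y r₃) tail₂

        8≤b : two + six ≤ b
        8≤b = ≤-trans (x≤x+y r₄) tail₃

        L≤b : L ≤ b
        L≤b = ≤-trans (x≤x+y r₅) tail₄

        1<b : 1# < b
        1<b = <-≤-trans (x<1+x 1#) (≤-trans (x≤x+y 0≤six) 8≤b)

        d<b : ι d < b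
        d<b = <-≤-trans (ι<ι-suc d) (≤-trans (≤-trans (x≤x*y (0≤ι (suc d)) (1≤* (1≤Ω d) (1≤ι d)))
          (≈⇒≤ (solve 2 (λ i o → i :* (o :* i) := o :* (i :* i)) refl I (Ω d)))) b-large)

        1≤bβ : 1# ≤ b * β
        1≤bβ = ≤-respˡ (⁻¹-inverseˡ (0<⇒≉ 0<β)) (*-monoʳ-≤ (<⇒≤ 0<β) (≤-trans (x≤x+y 0≤b₆) tail₅))

        b-big : K < β * β * b
        b-big = <-≤-trans (≰⇒> λ q → <⇒≱ 0<ββ (lin q e)) (*-monoˡ-≤ (<⇒≤ 0<ββ) (≤-trans (y≤x+y 0≤b₅) tail₅))
          where
          e : 0# + β * β * b₆ ≈ β * β + K
          e = trans (+-identityˡ _) (trans (distribˡ _ _ _) (trans (+-cong (trans (*-comm _ _) (/-cancel K (0<⇒≉ 0<ββ))) (*-identityʳ _)) (+-comm _ _)))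

        W : Weights d
        W = weights w isWeight 1≤d N₀ (proj₂ exponent) b b-large two^N₀≤b 1<b

        module Gen (V₁ D e₀ : ℕ) = GeneratorOver.Generator W β 0<β 1≤bβ b-big 8≤b d<b θ L (0≤ι (proj₁ slopeBound)) L≤b (proj₂ slopeBound) V₁ D e₀

        module Pot = Potential d 1≤d b (<⇒≤ 1<b) (β * β) 0<ββ b-big

        hν : Carrier
        hν = Pot.ν * two ⁻¹

        0<hν : 0# < hν
        0<hν = *-pos Pot.0<ν (⁻¹-pos 0<two)

        u<1 : Pot.u < 1#
        u<1 = ≰⇒> λ q → <⇒≱ Pot.0<τ (lin q (trans (+-identityˡ 1#) (trans (sym Pot.u+τ) (+-comm _ _))))

        deadline : ∃[ D ] (Pot.u ^ D ≤ hν)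
        deadline = small-power Pot.0<u u<1 0<hν

        periodW : ℕ
        periodW = Weights.period W

        0<pI : 0# < ι periodW * I
        0<pI = *-pos (<-≤-trans 0<1 (≤-trans (≈⇒≤ (sym ι-1)) (ι-mono-≤ (Weights.n≤kk W 1 (suc (suc d)))))) (0<ι d)

        startLevel : ∃[ n ] (Pot.u ^ n ≤ Pot.τ * hν * (ι periodW * I) ⁻¹)
        startLevel = small-power Pot.0<u u<1 (*-pos (*-pos Pot.0<τ 0<hν) (⁻¹-pos 0<pI))

        core : ∀ e₀ → Σ[ σ ∈ Strategy (HyperplaneMove β) ] (∀ B → HyperplanePlay σ B → Shrinking B → 1# < radius (B 0) * b ^ e₀ → Meets B)
        core e₀ = Wn.winningStrategy , wins
          where
          D V₁ : ℕ
          D = proj₁ deadline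
          -- The first summand makes the tasks light, 1 makes `V₁` positive, and 2e₀ keeps all
          -- epochs of the descent at or after e₀.
          V₁ = proj₁ startLevel ℕ.+ (1 ℕ.+ 2 ℕ.* e₀)
          open Gen V₁ D e₀ using (Light; blockConstant; module Winning; V; module Cd)
          light : Light
          light = hν , ≈⇒≤ (trans (solve 2 (λ n t → n :* t :+ n :* t := n :* t :* (con (+ 1) :+ con (+ 1))) refl Pot.ν (two ⁻¹)) (/-cancel Pot.ν (0<⇒≉ 0<two)))
            , ≤-trans (≈⇒≤ (sym (*-assoc (ι periodW) I (Pot.u ^ V₁)))) (≤-trans (*-monoˡ-≤ (<⇒≤ 0<pI) (≤-trans (^-antiʳ-≤ (<⇒≤ Pot.0<u) (<⇒≤ u<1) (ℕ.m≤m+n (proj₁ startLevel) (1 ℕ.+ 2 ℕ.* e₀))) (proj₂ startLevel)))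
                (≈⇒≤ (trans (*-comm _ _) (/-cancel (Pot.τ * hν) (0<⇒≉ 0<pI)))))
            , proj₂ deadline
          module Wn = Winning light (ℕ.≤-trans (s≤s z≤n) (ℕ.m≤n+m (1 ℕ.+ 2 ℕ.* e₀) (proj₁ startLevel))) (ℕ.≤-trans (ℕ.n≤1+n _) (ℕ.m≤n+m (1 ℕ.+ 2 ℕ.* e₀) (proj₁ startLevel)))
          wins : ∀ B → HyperplanePlay Wn.winningStrategy B → Shrinking B → 1# < radius (B 0) * b ^ e₀ → Meets B
          wins B play shrinking start = limit , limit∈ ,
              noCandidate⇒Bad w isWeight 1≤d N₀ (proj₂ exponent) b b-large two^N₀≤b 1<b θ limit (V ℕ.+ 2 ℕ.+ (D ℕ.+ 5))
                λ t 4≤t q p low up near → noCandidate t 4≤t limit (λ k → limit∈ (stage k)) q p (low , up , near)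
            where
            open Limit B (λ n {y} → proj₁ (play n) {y}) shrinking
            open Wn.Won B play shrinking start using (noCandidate; stage)

        winsFor : WinsFor β
        winsFor = proj₁ strategy , wins-always β 0<β β-small (proj₁ strategy) (proj₂ strategy)
          where
          strategy : Σ[ σ ∈ Strategy (HyperplaneMove β) ] (∀ B → HyperplanePlay σ B → Shrinking B → Meets B)
          strategy = merged 1<b core

      winning : HyperplaneAbsoluteWinning (Bad θ w) × SchmidtWinning (Bad θ w)
      winning = absoluteWinning Base.winsFor , schmidtWinning Base.winsFor

theorem1 : (em : ExcludedMiddle 0ℓ) (ℝ : Reals) →
    let open Classical em ℝ in
    (d : ℕ) → 1 ℕ.≤ d →
    let open Games em ℝ d in
    (w : Vector Carrier d) → IsWeight w →
    (θ : Fin d → Carrier → Carrier) → (∀ i → Lipschitz (θ i)) →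
    HyperplaneAbsoluteWinning (Bad θ w) × SchmidtWinning (Bad θ w)
theorem1 em ℝ d 1≤d w isWeight θ lipschitz = Proof.Conclusion.Main.winning em ℝ d 1≤d w isWeight θ lipschitz
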